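{- Let $k\ge 3$ and let $F$ be a $k$-graph satisfying: ($\clubsuit$) $F$ has no vanishing ordering of $V(F)$; ($\spadesuit$) for each pair $i<j$ in $[k]$, the edge set of $F$ can be partitioned into two spanning subhypergraphs $F^1_{i,j}$ and $F^2_{i,j}$ such that there exists an ordering of $V(F)$ which is vanishing both for $F^1_{i,j}$ and for $F^2_{i,j}$, and such that for any two edges $e_1\in E(F^1_{i,j})$ and $e_2\in E(F^2_{i,j})$ with $|e_1\cap e_2|=k-1$, the set $e_1\cap e_2$ is $i$-type with respect to $F^1_{i,j}$ and $j$-type with respect to $F^2_{i,j}$ (under that ordering). Then $\pi_{k-2}(F)=k^{ -k}$.
   Context: A $k$-graph is a pair $H=(V,E)$ with $E$ a set of $k$-element subsets of $V$; $H$ is $F$-free if it has no subhypergraph isomorphic to $F$. For $0\le j<k$ and a $j$-graph $G$ on $V$, $\mathcal K_k(G)$ is the set of $k$-subsets of $V$ all of whose $j$-subsets are edges of $G$. A $k$-graph $H=(V,E)$ on $n$ vertices is $(d,\mu,j)$-dense if $|\mathcal K_k(G)\cap E|\ge d|\mathcal K_k(G)|-\mu n^k$ for every $j$-graph $G$ on $V$; $\pi_j(F)$ is the supremum of all $d\in[0,1]$ such that for every $\mu>0$ and $n_0$ there is an $F$-free $(d,\mu,j)$-dense $k$-graph with at least $n_0$ vertices. The shadow of a $k$-graph $F$ is $\partial F=\{S:|S|=k-1,\ S\subset e\text{ for some }e\in E(F)\}$. An ordering $(v_1,\dots,v_f)$ of $V(F)$ is vanishing (for $F$) if $\partial F$ can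 be partitioned into $k$ disjoint sets $\mathcal C_1,\dots,\mathcal C_k$ such that for every edge $e=\{v_{i(1)},\dots,v_{i(k)}\}$ of $F$ with $i(1)<\dots<i(k)$ we have $e\setminus\{v_{i(\ell)}\}\in\mathcal C_\ell$ for every $\ell\in[k]$. Given a vanishing ordering and a $(k-1)$-set $S\subset V(F)$, $S$ is $\ell$-type with respect to $F$ if there is a vertex $v$ with $S\cup\{v\}\in E(F)$ such that $v$ is in the $\ell$-th position of $S\cup\{v\}$ under the ordering. A spanning subhypergraph has vertex set $V(F)$. -}

module Defs where

open import Data.Nat as ℕ using (ℕ; zero; suc; _^_; _∸_; _≡ᵇ_; _<ᵇ_)
open import Data.Nat.Properties using (m^n≢0)
open import Data.Bool using (Bool; true; false; T; _∧_; _∨_; not; if_then_else_)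
open import Data.Fin using (Fin; toℕ; _<_)
open import Data.Fin.Properties using (_≟_)
open import Data.Fin.Subset using (Subset; ∣_∣; _∩_; _∪_; _-_; ⁅_⁆)
open import Data.Fin.Permutation using (Permutation′; _⟨$⟩ʳ_)
open import Data.Vec using (Vec; []; _∷_; lookup; tabulate)
open import Data.List using (List; []; _∷_; _++_; map; allFin)
open import Data.Nat.ListAction using (sum)
open import Data.Bool.ListAction using (all; any)
open import Data.Integer using (+_)
open import Data.Rational using (ℚ; _/_; 0ℚ; 1ℚ) renaming (_≤_ to _≤ℚ_; _<_ to _<ℚ_; _*_ to _*ℚ_; _-_ to _-ℚ_)
open import Data.Product using (Σ; Σ-syntax; _×_)
open import Relation.Nullary using (¬_; ⌊_⌋)
open import Relation.Binary.PropositionalEquality using (_≡_)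
open import Function.Definitions using (Injective)

allSubsets : (n : ℕ) → List (Subset n)
allSubsets zero = [] ∷ []
allSubsets (suc n) = map (true ∷_) (allSubsets n) ++ map (false ∷_) (allSubsets n)

_⊆ᵇ_ : ∀ {n} → Subset n → Subset n → Bool
[] ⊆ᵇ [] = true
(x ∷ xs) ⊆ᵇ (y ∷ ys) = (not x ∨ y) ∧ (xs ⊆ᵇ ys)

count : ∀ {n} → (Subset n → Bool) → ℕ
count {n} p = sum (map (λ S → if p S then 1 else 0) (allSubsets n))

ℕtoℚ : ℕ → ℚ
ℕtoℚ m = + m / 1

record KGraph (k n : ℕ) : Set where
  field
    edge    : Subset n → Bool
    uniform : ∀ S → T (edge S) → ∣ S ∣ ≡ k
open KGraph public

-- 𝒦_k(G) for a j-graph G (given as a set of vertex subsets; only its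
-- j-element members matter): k-sets all of whose j-subsets lie in G
inK : ∀ {n} (k j : ℕ) → (Subset n → Bool) → Subset n → Bool
inK {n} k j G S =
  (∣ S ∣ ≡ᵇ k) ∧ all (λ U → not ((U ⊆ᵇ S) ∧ (∣ U ∣ ≡ᵇ j)) ∨ G U) (allSubsets n)

Dense : ∀ {k n} (j : ℕ) (d μ : ℚ) → KGraph k n → Set
Dense {k} {n} j d μ H = ∀ (G : Subset n → Bool) →
  ((d *ℚ ℕtoℚ (count (inK k j G))) -ℚ (μ *ℚ ℕtoℚ (n ^ k)))
    ≤ℚ ℕtoℚ (count (λ S → inK k j G S ∧ edge H S))

image : ∀ {f n} → (Fin f → Fin n) → Subset f → Subset n
image {f} φ e = tabulate (λ w → any (λ u → lookup e u ∧ ⌊ φ u ≟ w ⌋) (allFin f))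

Contains : ∀ {k f n} → KGraph k f → KGraph k n → Set
Contains {k} {f} {n} F H =
  Σ[ φ ∈ (Fin f → Fin n) ] (Injective _≡_ _≡_ φ ×
     (∀ e → T (edge F e) → T (edge H (image φ e))))

Free : ∀ {k f n} → KGraph k f → KGraph k n → Set
Free F H = ¬ Contains F H

Achievable : ∀ {k f} → ℕ → KGraph k f → ℚ → Set
Achievable {k} j F d = ∀ (μ : ℚ) → 0ℚ <ℚ μ → ∀ (n₀ : ℕ) →
  Σ[ n ∈ ℕ ] (n₀ ℕ.≤ n × Σ[ H ∈ KGraph k n ] (Free F H × Dense j d μ H))

IsPi : ∀ {k f} → ℕ → KGraph k f → ℚ → Set
IsPi j F α =
  (∀ d → 0ℚ ≤ℚ d → d ≤ℚ 1ℚ → Achievable j F d → d ≤ℚ α) ×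
  (∀ β → β <ℚ α → Σ[ d ∈ ℚ ] (0ℚ ≤ℚ d × d ≤ℚ 1ℚ × Achievable j F d × β <ℚ d))

invPow : ℕ → ℚ
invPow zero = 1ℚ
invPow (suc m) = _/_ (+ 1) (suc m ^ suc m) {{m^n≢0 (suc m) (suc m)}}

-- Orderings. An ordering of V(F) = Fin f is a permutation σ; the vertex v
-- sits at position σ v (0-based). rank σ e v = number of vertices of e
-- strictly before v, i.e. the (0-based) position of v within e.

rank : ∀ {f} → Permutation′ f → Subset f → Fin f → ℕ
rank σ e v = ∣ e ∩ tabulate (λ u → toℕ (σ ⟨$⟩ʳ u) <ᵇ toℕ (σ ⟨$⟩ʳ v)) ∣

-- σ is vanishing for the k-graph with edge set E: the shadow is partitioned
-- into classes 𝒞_0,…,𝒞_{k-1} (class of S is c S) so that for every edge e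
-- and vertex v ∈ e at (0-based) position ℓ within e, e ∖ {v} ∈ 𝒞_ℓ.
Vanishing : ∀ {f} (k : ℕ) → (Subset f → Bool) → Permutation′ f → Set
Vanishing {f} k E σ =
  Σ[ c ∈ (Subset f → Fin k) ]
    (∀ e → T (E e) → ∀ v → lookup e v ≡ true → toℕ (c (e - v)) ≡ rank σ e v)

LType : ∀ {f} {k : ℕ} → (Subset f → Bool) → Permutation′ f → Fin k → Subset f → Set
LType {f} E σ ℓ S =
  Σ[ v ∈ Fin f ] (T (E (S ∪ ⁅ v ⁆)) × rank σ (S ∪ ⁅ v ⁆) v ≡ toℕ ℓ)

Club : ∀ {k f} → KGraph k f → Set
Club {k} {f} F = ¬ (Σ[ σ ∈ Permutation′ f ] Vanishing k (edge F) σ)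

Partition : ∀ {f} → (Subset f → Bool) → (Subset f → Bool) → (Subset f → Bool) → Set
Partition E E₁ E₂ = ∀ S → (E S ≡ (E₁ S ∨ E₂ S)) × ¬ (T (E₁ S) × T (E₂ S))

Spade : ∀ {k f} → KGraph k f → Set
Spade {k} {f} F = ∀ (i j : Fin k) → i < j →
  Σ[ E₁ ∈ (Subset f → Bool) ] Σ[ E₂ ∈ (Subset f → Bool) ] Σ[ σ ∈ Permutation′ f ]
    (Partition (edge F) E₁ E₂ × Vanishing k E₁ σ × Vanishing k E₂ σ ×
     (∀ e₁ e₂ → T (E₁ e₁) → T (E₂ e₂) → ∣ e₁ ∩ e₂ ∣ ≡ k ∸ 1 →
        LType E₁ σ i (e₁ ∩ e₂) × LType E₂ σ j (e₁ ∩ e₂)))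

{-# OPTIONS --safe #-}
module Submission where

-- Upper bound. Let H be (d, μ, k−2)-dense with d > k^{-k}. Regularise it by colourings of the (k−1)- and (k−2)-tuples and restrict to M vertices in a typical cell. Every (k−1)-subset of [M] then carries a probability vector on the colours, every k-subset a set of colour k-tuples of measure > k^{-k}. By AM–GM the measures of its k projections add up to more than 1, so two of them, to positions i < j, overlap. By Ramsey's theorem i, j are the same throughout, and every (k−1)-set has a common colour of role i in one assignment and of role j in another. By (♠) for (i, j) these two assignments are compatible along F, and counting inside the cell yields a copy of F.
--
-- Lower bound. Colour the (k−1)-subsets of an ordered vertex set at random by [k]; the edges are the k-sets e for which e minus its ℓ-th vertex has colour ℓ for every ℓ. A copy of F would pull back to a vanishing ordering, and a first-moment bound on the box norms of the colour classes gives density.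

open import Defs
open import Data.Nat as ℕ using (ℕ; zero; suc; z≤n; s≤s)
import Data.Nat.Properties as ℕₚ
open import Data.Integer as ℤ using (-[1+_])
import Data.Integer.Properties as ℤₚ
open import Data.Rational as ℚ using (ℚ; mkℚ; 0ℚ; 1ℚ; _+_; _*_; _-_; -_; _≤_; _<_; 1/_; *≤*; toℚᵘ)
open import Data.Rational.Properties as ℚₚ using (≤-refl; ≤-trans; ≤-reflexive; <⇒≤; ≤-<-trans; <-≤-trans; +-mono-≤; *-identityˡ; *-identityʳ; *-zeroˡ; *-zeroʳ; *-assoc; *-comm; +-identityˡ; +-identityʳ; neg-antimono-≤; +-inverseʳ)
import Data.Rational.Unnormalised as ℚᵘ
import Data.Rational.Unnormalised.Properties as ℚᵘₚ
open import Data.Bool using (Bool; true; false; T; _∧_; _∨_; not; if_then_else_)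
import Data.Bool.Properties as Boolₚ
open import Data.Product using (Σ; Σ-syntax; _×_; _,_; proj₁; proj₂)
open import Data.Sum using (_⊎_; inj₁; inj₂; [_,_]′)
open import Data.Empty using (⊥; ⊥-elim)
open import Data.Unit using (⊤; tt)
open import Data.Maybe using (Maybe; just; nothing)
open import Data.Fin as Fin using (Fin; zero; suc; toℕ)
import Data.Fin.Properties as Finₚ
open import Data.Fin.Subset using (Subset; ∣_∣; ⁅_⁆; _∩_; _∪_) renaming (_-_ to _∖_)
open import Data.Fin.Permutation using (Permutation′; permutation; _⟨$⟩ʳ_; _⟨$⟩ˡ_; inverseˡ; inverseʳ)
import Data.Fin.Subset
import Data.Fin.Permutation
import Data.Bool.ListAction as BoolL
import Data.Nat.ListAction as ℕL
open import Data.Vec as Vec using (Vec; []; _∷_; lookup; tabulate)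
open import Data.Vec.Properties as Vecₚ using (lookup∘tabulate)
open import Data.List as List using (List; []; _∷_; _++_; length)
import Data.List.Properties as Listₚ
open import Data.List.Relation.Unary.Any using (here; there)
open import Data.List.Membership.Propositional using (_∈_)
open import Data.List.Membership.Propositional.Properties using (∈-map⁺; ∈-map⁻; ∈-++⁺ˡ; ∈-++⁺ʳ; ∈-filter⁺; ∈-filter⁻; ∈-allFin; ∈-cartesianProduct⁺; ∈-cartesianProduct⁻)
open import Data.List.Relation.Unary.AllPairs using ([]; _∷_)
open import Data.List.Relation.Unary.Unique.Propositional using (Unique)
import Data.List.Relation.Unary.Unique.Propositional.Properties as Uniqueₚ
open import Data.List.Relation.Unary.All as All using ([]; _∷_)
open import Relation.Nullary using (¬_; yes; no; Dec; ⌊_⌋)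
open import Relation.Binary.PropositionalEquality using (_≡_; _≢_; refl; sym; trans; cong; cong₂; subst; subst₂; module ≡-Reasoning)
open import Tactic.RingSolver.Core.AlmostCommutativeRing using (AlmostCommutativeRing; fromCommutativeRing)
open import Tactic.RingSolver using (solve-∀)
open import Function using (_∘_; id; case_of_)

-- AM-GM speaks of the `k` faces of one `k`-set, whereas an overlap concerns `k` different `k`-sets
-- through one (k-1)-set, which has another role in each of them. Therefore the measure attached to
-- each role is first made almost constant by Ramsey's theorem, and only then can the bound be moved
-- from one `k`-set to the other situation. The regularity lemma has to be the strong one: the error
-- allowed for the edges must be small against the number of colours of the (k-1)-tuples, the error
-- for those against the number of colours of the (k-2)-tuples, and neither number is known in
-- advance. Density is assumed only on families 𝒦_k(G) with one unordered graph G, while a cell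
-- imposes different tests at different positions. For k ≥ 4 random labels tell the positions apart.
-- For k = 3 the graph G is a set of vertices and cannot force labels to differ, so a separate
-- argument with weights and one more use of Ramsey's theorem is needed. The upper bound ends in a
-- contradiction with freeness, so its classical case distinctions can be made under double
-- negation.

ℛ : AlmostCommutativeRing _ _
ℛ = fromCommutativeRing ℚₚ.+-*-commutativeRing zero?
  where
  zero? : (x : ℚ) → Maybe (0ℚ ≡ x)
  zero? x with 0ℚ ℚₚ.≟ x
  ... | yes p = just p
  ... | no _ = nothing

-- Ordered-field arithmetic in the rationals.

infixl 6 _⊕_
infixl 7 _⊗_

_⊕_ : ∀ {a b} → 0ℚ ≤ a → 0ℚ ≤ b → 0ℚ ≤ a + b
p ⊕ q = +-mono-≤ p q

_⊗_ : ∀ {a b} → 0ℚ ≤ a → 0ℚ ≤ b → 0ℚ ≤ a * b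
_⊗_ {a} {b} p q = ℚₚ.nonNegative⁻¹ (a * b) {{ℚₚ.nonNeg*nonNeg⇒nonNeg a {{ℚ.nonNegative p}} b {{ℚ.nonNegative q}}}}

Δ : ∀ {a b} → a ≤ b → 0ℚ ≤ b - a
Δ {a} {b} p = subst (_≤ b - a) (+-inverseʳ a) (ℚₚ.+-monoˡ-≤ (- a) p)

undiff : ∀ a b → (b - a) + a ≡ b
undiff = solve-∀ ℛ

-- Proof by certificate: the ring solver checks the identity for the difference, and `c` is
-- non-negative by `⊕`, `⊗` and `Δ`. Most of the nonlinear estimates below have this form.
≤-by : ∀ {a b c} → b - a ≡ c → 0ℚ ≤ c → a ≤ b
≤-by {a} {b} refl p = subst₂ _≤_ (+-identityˡ a) (undiff a b) (ℚₚ.+-monoˡ-≤ a p)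

<-by : ∀ {a b c} → b - a ≡ c → 0ℚ < c → a < b
<-by {a} {b} refl p = subst₂ _<_ (+-identityˡ a) (undiff a b) (ℚₚ.+-monoˡ-< a p)

Δ< : ∀ {a b} → a < b → 0ℚ < b - a
Δ< {a} {b} p = subst (_< b - a) (+-inverseʳ a) (ℚₚ.+-monoˡ-< (- a) p)

*-monoʳ : ∀ {a b} c → 0ℚ ≤ c → a ≤ b → c * a ≤ c * b
*-monoʳ c p q = ℚₚ.*-monoˡ-≤-nonNeg c {{ℚ.nonNegative p}} q

*-monoˡ : ∀ {a b} c → 0ℚ ≤ c → a ≤ b → a * c ≤ b * c
*-monoˡ c p q = ℚₚ.*-monoʳ-≤-nonNeg c {{ℚ.nonNegative p}} q

*-mono : ∀ {a b c d} → 0ℚ ≤ a → 0ℚ ≤ d → a ≤ b → c ≤ d → a * c ≤ b * d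
*-mono {a} {b} {c} {d} p q r s = ≤-trans (*-monoʳ a p s) (*-monoˡ d q r)

*-pos : ∀ {a b} → 0ℚ < a → 0ℚ < b → 0ℚ < a * b
*-pos {a} {b} p q = ℚₚ.positive⁻¹ (a * b) {{ℚₚ.pos*pos⇒pos a {{ℚ.positive p}} b {{ℚ.positive q}}}}

+-pos : ∀ {a b} → 0ℚ < a → 0ℚ ≤ b → 0ℚ < a + b
+-pos {a} {b} p q = subst (_< a + b) (+-identityˡ 0ℚ) (ℚₚ.+-mono-<-≤ p q)

sq≥0 : ∀ a → 0ℚ ≤ a * a
sq≥0 a with ℚₚ.≤-total 0ℚ a
... | inj₁ p = p ⊗ p
... | inj₂ p = subst (0ℚ ≤_) (l a) (neg-antimono-≤ p ⊗ neg-antimono-≤ p)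
  where l : ∀ a → (- a) * (- a) ≡ a * a
        l = solve-∀ ℛ

0≤1 : 0ℚ ≤ 1ℚ
0≤1 = *≤* (ℤ.+≤+ z≤n)

0<1 : 0ℚ < 1ℚ
0<1 = ℚₚ.positive⁻¹ 1ℚ

half : ℚ
half = ℚ.½

0<half : 0ℚ < half
0<half = ℚₚ.positive⁻¹ half

*-cancel-pos : ∀ {a b} c → 0ℚ < c → c * a ≤ c * b → a ≤ b
*-cancel-pos c p = ℚₚ.*-cancelˡ-≤-pos c {{ℚ.positive p}}

contra : ∀ {a b} {X : Set} → a < b → b ≤ a → X
contra p q = ⊥-elim (ℚₚ.<-irrefl refl (<-≤-trans p q))

<-or-≤ : ∀ a b → (a < b) ⊎ (b ≤ a)
<-or-≤ a b with b ℚₚ.≤? a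
... | yes p = inj₂ p
... | no p = inj₁ (ℚₚ.≰⇒> p)

opaque
  -- Total, with value 0 at 0: a conditional density on a null cell is then 0 and needs no side
  -- condition.
  inv : ℚ → ℚ
  inv c with 0ℚ ℚₚ.≟ c
  ... | yes _ = 0ℚ
  ... | no p = (1/ c) {{ℚ.≢-nonZero (p ∘ sym)}}

  inv-r : ∀ c → 0ℚ < c → c * inv c ≡ 1ℚ
  inv-r c p with 0ℚ ℚₚ.≟ c
  ... | yes q = ⊥-elim (ℚₚ.<-irrefl q p)
  ... | no q = ℚₚ.*-inverseʳ c {{ℚ.≢-nonZero (q ∘ sym)}}

  inv-pos : ∀ c → 0ℚ < c → 0ℚ < inv c
  inv-pos c p with <-or-≤ 0ℚ (inv c)
  ... | inj₁ q = q
  ... | inj₂ q = contra 0<1 (subst₂ _≤_ (inv-r c p) (*-zeroʳ c) (*-monoʳ c (<⇒≤ p) q))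

nonneg-cases : ∀ {c} → 0ℚ ≤ c → (0ℚ < c) ⊎ (0ℚ ≡ c)
nonneg-cases {c} p with 0ℚ ℚₚ.≟ c
... | yes q = inj₂ q
... | no q = inj₁ (ℚₚ.≰⇒> (λ r → q (ℚₚ.≤-antisym p r)))

≤-div : ∀ {a b} c → 0ℚ < c → c * a ≤ b → a ≤ b * inv c
≤-div {a} {b} c p q = *-cancel-pos c p (subst (c * a ≤_) l q)
  where
  r : ∀ c b i → c * (b * i) ≡ (c * i) * b
  r = solve-∀ ℛ
  l : b ≡ c * (b * inv c)
  l = sym (trans (r c b (inv c)) (trans (cong (_* b) (inv-r c p)) (*-identityˡ b)))

⟦_⟧ : Bool → ℚ
⟦ true ⟧ = 1ℚ
⟦ false ⟧ = 0ℚ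

⟦⟧≥0 : ∀ b → 0ℚ ≤ ⟦ b ⟧
⟦⟧≥0 true = 0≤1
⟦⟧≥0 false = ≤-refl

⟦⟧≤1 : ∀ b → ⟦ b ⟧ ≤ 1ℚ
⟦⟧≤1 true = ≤-refl
⟦⟧≤1 false = 0≤1

⟦∧⟧ : ∀ a b → ⟦ a ∧ b ⟧ ≡ ⟦ a ⟧ * ⟦ b ⟧
⟦∧⟧ true b = sym (*-identityˡ ⟦ b ⟧)
⟦∧⟧ false b = sym (*-zeroˡ ⟦ b ⟧)

⟦⟧-mono : ∀ {a b} → (a ≡ true → b ≡ true) → ⟦ a ⟧ ≤ ⟦ b ⟧
⟦⟧-mono {false} {b} p = ⟦⟧≥0 b
⟦⟧-mono {true} {b} p rewrite p refl = ≤-refl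

⟦⟧-idem : ∀ b → ⟦ b ⟧ * ⟦ b ⟧ ≡ ⟦ b ⟧
⟦⟧-idem true = refl
⟦⟧-idem false = refl

-- Recursive, so that `ν (suc m)` unfolds to `1ℚ + ν m` for the ring solver; `ℕtoℚ≡ν` connects it
-- with the cast in the statement.
ν : ℕ → ℚ
ν zero = 0ℚ
ν (suc m) = 1ℚ + ν m

ℕtoℚ≡ν : ∀ m → ℕtoℚ m ≡ ν m
ℕtoℚ≡ν zero = refl
ℕtoℚ≡ν (suc m) = trans (ℚₚ.toℚᵘ-injective (ℚᵘₚ.≃-trans (tof (suc m)) (ℚᵘₚ.≃-sym (ℚᵘₚ.≃-trans (ℚₚ.toℚᵘ-homo-+ 1ℚ (ℕtoℚ m)) (ℚᵘₚ.≃-trans (ℚᵘₚ.+-congʳ (toℚᵘ 1ℚ) (tof m)) e))))) (cong (1ℚ +_) (ℕtoℚ≡ν m))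
  where
  tof : ∀ m → toℚᵘ (ℕtoℚ m) ℚᵘ.≃ (ℤ.+ m ℚᵘ./ 1)
  tof m = ℚₚ.toℚᵘ-fromℚᵘ (ℤ.+ m ℚᵘ./ 1)
  e : toℚᵘ 1ℚ ℚᵘ.+ (ℤ.+ m ℚᵘ./ 1) ℚᵘ.≃ (ℤ.+ suc m ℚᵘ./ 1)
  e = ℚᵘ.*≡* (cong (λ z → (ℤ.+ 1 ℤ.+ z) ℤ.* ℤ.+ 1) (ℤₚ.*-identityʳ (ℤ.+ m)))

ν≥0 : ∀ m → 0ℚ ≤ ν m
ν≥0 zero = ≤-refl
ν≥0 (suc m) = 0≤1 ⊕ ν≥0 m

ν-+ : ∀ m n → ν (m ℕ.+ n) ≡ ν m + ν n
ν-+ zero n = sym (+-identityˡ (ν n))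
ν-+ (suc m) n = trans (cong (1ℚ +_) (ν-+ m n)) (sym (ℚₚ.+-assoc 1ℚ (ν m) (ν n)))

ν-* : ∀ m n → ν (m ℕ.* n) ≡ ν m * ν n
ν-* zero n = sym (*-zeroˡ (ν n))
ν-* (suc m) n = trans (ν-+ n (m ℕ.* n)) (trans (cong (ν n +_) (ν-* m n)) (l (ν m) (ν n)))
  where l : ∀ m n → n + m * n ≡ (1ℚ + m) * n
        l = solve-∀ ℛ

ν-mono : ∀ {m n} → m ℕ.≤ n → ν m ≤ ν n
ν-mono {n = n} z≤n = ν≥0 n
ν-mono (s≤s p) = +-mono-≤ (≤-refl {1ℚ}) (ν-mono p)

ν-pos : ∀ m → 0ℚ < ν (suc m)
ν-pos m = +-pos 0<1 (ν≥0 m)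

opaque
  -- The denominator is at least 1, so a non-negative rational is at most its numerator.
  archimedean : ∀ (a : ℚ) → Σ[ N ∈ ℕ ] (a ≤ ν N)
  archimedean a@(mkℚ (ℤ.+ p) q-1 _) = p , subst (a ≤_) (ℕtoℚ≡ν p) (ℚₚ.toℚᵘ-cancel-≤ (ℚᵘₚ.≤-respʳ-≃ (ℚᵘₚ.≃-sym (ℚₚ.toℚᵘ-fromℚᵘ (ℤ.+ p ℚᵘ./ 1))) (ℚᵘ.*≤* le)))
    where
    le : (ℤ.+ p) ℤ.* (ℤ.+ 1) ℤ.≤ (ℤ.+ p) ℤ.* (ℤ.+ suc q-1)
    le = ℤₚ.*-monoˡ-≤-nonNeg (ℤ.+ p) (ℤ.+≤+ (s≤s z≤n))
  archimedean a@(mkℚ (-[1+ p ]) q-1 _) = 0 , ℚₚ.<⇒≤ (ℚₚ.negative⁻¹ a)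

archimedean⁻¹ : ∀ ε → 0ℚ < ε → Σ[ N ∈ ℕ ] (1ℚ ≤ ν N * ε)
archimedean⁻¹ ε p with archimedean (inv ε)
... | N , q = N , subst (_≤ ν N * ε) (trans (*-comm (inv ε) ε) (inv-r ε p)) (*-monoˡ ε (<⇒≤ p) q)

infixr 8 _^ℚ_
_^ℚ_ : ℚ → ℕ → ℚ
a ^ℚ zero = 1ℚ
a ^ℚ suc n = a * a ^ℚ n

^ℚ≥0 : ∀ {a} n → 0ℚ ≤ a → 0ℚ ≤ a ^ℚ n
^ℚ≥0 zero p = 0≤1
^ℚ≥0 (suc n) p = p ⊗ ^ℚ≥0 n p

^ℚ-pos : ∀ {a} n → 0ℚ < a → 0ℚ < a ^ℚ n
^ℚ-pos zero p = 0<1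
^ℚ-pos (suc n) p = *-pos p (^ℚ-pos n p)

^ℚ-mono : ∀ {a b} n → 0ℚ ≤ a → a ≤ b → a ^ℚ n ≤ b ^ℚ n
^ℚ-mono zero p q = ≤-refl
^ℚ-mono (suc n) p q = *-mono p (^ℚ≥0 n (≤-trans p q)) q (^ℚ-mono n p q)

^ℚ≤1 : ∀ {a} n → 0ℚ ≤ a → a ≤ 1ℚ → a ^ℚ n ≤ 1ℚ
^ℚ≤1 zero p q = ≤-refl
^ℚ≤1 (suc n) p q = *-mono {d = 1ℚ} p 0≤1 q (^ℚ≤1 n p q)

ν-^ : ∀ m n → ν (m ℕ.^ n) ≡ ν m ^ℚ n
ν-^ m zero = +-identityʳ 1ℚ
ν-^ m (suc n) = trans (ν-* m (m ℕ.^ n)) (cong (ν m *_) (ν-^ m n))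

-- Positive linear functionals

record Lin (A : Set) : Set where
  field
    ∫ : (A → ℚ) → ℚ
    ∫+ : ∀ f g → ∫ (λ a → f a + g a) ≡ ∫ f + ∫ g
    ∫* : ∀ c f → ∫ (λ a → c * f a) ≡ c * ∫ f
    ∫≤ : ∀ {f g} → (∀ a → f a ≤ g a) → ∫ f ≤ ∫ g

  ∫≡ : ∀ {f g} → (∀ a → f a ≡ g a) → ∫ f ≡ ∫ g
  ∫≡ p = ℚₚ.≤-antisym (∫≤ (≤-reflexive ∘ p)) (∫≤ (≤-reflexive ∘ sym ∘ p))

  ∫*ʳ : ∀ c f → ∫ (λ a → f a * c) ≡ ∫ f * c
  ∫*ʳ c f = trans (∫≡ (λ a → *-comm (f a) c)) (trans (∫* c f) (*-comm c (∫ f)))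

  ∫0 : ∫ (λ _ → 0ℚ) ≡ 0ℚ
  ∫0 = trans (∫* 0ℚ (λ _ → 0ℚ)) (*-zeroˡ (∫ (λ _ → 0ℚ)))

  ∫≥0 : ∀ {f} → (∀ a → 0ℚ ≤ f a) → 0ℚ ≤ ∫ f
  ∫≥0 {f} p = subst (_≤ ∫ f) ∫0 (∫≤ p)

  ∫- : ∀ f g → ∫ (λ a → f a - g a) ≡ ∫ f - ∫ g
  ∫- f g = trans (∫+ f (λ a → - g a)) (cong (∫ f +_) neg)
    where
    neg : ∫ (λ a → - g a) ≡ - ∫ g
    neg = trans (∫≡ (λ a → neg1 (g a))) (trans (∫* (- 1ℚ) g) (sym (neg1 (∫ g))))
      where neg1 : ∀ x → - x ≡ (- 1ℚ) * x
            neg1 = solve-∀ ℛ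

  ∫const : ∀ c → ∫ (λ _ → c) ≡ c * ∫ (λ _ → 1ℚ)
  ∫const c = trans (∫≡ (λ _ → sym (*-identityʳ c))) (∫* c (λ _ → 1ℚ))

open Lin public

Mean : ∀ {A} → Lin A → Set
Mean L = ∫ L (λ _ → 1ℚ) ≡ 1ℚ

mean-const : ∀ {A} (L : Lin A) → Mean L → ∀ c → ∫ L (λ _ → c) ≡ c
mean-const L m c = trans (∫const L c) (trans (cong (c *_) m) (*-identityʳ c))

mean-≤ : ∀ {A} (L : Lin A) → Mean L → ∀ {f c} → (∀ a → f a ≤ c) → ∫ L f ≤ c
mean-≤ L m {f} {c} p = subst (∫ L f ≤_) (mean-const L m c) (∫≤ L p)

-- The first-moment method: some point does no worse than the mean.
Low : ∀ {A} → Lin A → Set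
Low {A} L = ∀ f → Σ[ a ∈ A ] f a ≤ ∫ L f

-- Fubini against every functional at once. Finite sums have it, and the quantification over `L` is
-- what lets it pass to products.
Swap : ∀ {B} → Lin B → Set₁
Swap {B} K = ∀ {A} (L : Lin A) (f : A → B → ℚ) → ∫ L (λ a → ∫ K (f a)) ≡ ∫ K (λ b → ∫ L (λ a → f a b))

+-middle : ∀ a b c d → (a + b) + (c + d) ≡ (a + c) + (b + d)
+-middle = solve-∀ ℛ

sumFin : ∀ n → Lin (Fin n)
∫ (sumFin zero) f = 0ℚ
∫ (sumFin (suc n)) f = f zero + ∫ (sumFin n) (f ∘ suc)
∫+ (sumFin zero) f g = refl
∫+ (sumFin (suc n)) f g = trans (cong (f zero + g zero +_) (∫+ (sumFin n) (f ∘ suc) (g ∘ suc))) (+-middle (f zero) (g zero) (∫ (sumFin n) (f ∘ suc)) (∫ (sumFin n) (g ∘ suc)))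
∫* (sumFin zero) c f = sym (*-zeroʳ c)
∫* (sumFin (suc n)) c f = trans (cong (c * f zero +_) (∫* (sumFin n) c (f ∘ suc))) (sym (ℚₚ.*-distribˡ-+ c (f zero) (∫ (sumFin n) (f ∘ suc))))
∫≤ (sumFin zero) p = ≤-refl
∫≤ (sumFin (suc n)) p = +-mono-≤ (p zero) (∫≤ (sumFin n) (p ∘ suc))

sumFin-swap : ∀ n → Swap (sumFin n)
sumFin-swap zero L f = ∫0 L
sumFin-swap (suc n) L f = trans (∫+ L (λ a → f a zero) (λ a → ∫ (sumFin n) (f a ∘ suc))) (cong (∫ L (λ a → f a zero) +_) (sumFin-swap n L (λ a → f a ∘ suc)))

sumFin-1 : ∀ n → ∫ (sumFin n) (λ _ → 1ℚ) ≡ ν n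
sumFin-1 zero = refl
sumFin-1 (suc n) = cong (1ℚ +_) (sumFin-1 n)

scale : ∀ {A} c → 0ℚ ≤ c → Lin A → Lin A
∫ (scale c p L) f = c * ∫ L f
∫+ (scale c p L) f g = trans (cong (c *_) (∫+ L f g)) (ℚₚ.*-distribˡ-+ c (∫ L f) (∫ L g))
∫* (scale c p L) d f = trans (cong (c *_) (∫* L d f)) (l c d (∫ L f))
  where l : ∀ c d x → c * (d * x) ≡ d * (c * x)
        l = solve-∀ ℛ
∫≤ (scale c p L) q = *-monoʳ c p (∫≤ L q)

scale-swap : ∀ {A} c p (L : Lin A) → Swap L → Swap (scale c p L)
scale-swap c p L s K f = trans (∫* K c (λ a → ∫ L (f a))) (cong (c *_) (s K f))

avg : ∀ n → Lin (Fin (suc n))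
avg n = scale (inv (ν (suc n))) (<⇒≤ (inv-pos (ν (suc n)) (ν-pos n))) (sumFin (suc n))

avg-mean : ∀ n → Mean (avg n)
avg-mean n = trans (cong (inv (ν (suc n)) *_) (sumFin-1 (suc n))) (trans (*-comm (inv (ν (suc n))) (ν (suc n))) (inv-r (ν (suc n)) (ν-pos n)))

avg-swap : ∀ n → Swap (avg n)
avg-swap n = scale-swap (inv (ν (suc n))) (<⇒≤ (inv-pos (ν (suc n)) (ν-pos n))) (sumFin (suc n)) (sumFin-swap (suc n))

avg-low : ∀ n → Low (avg n)
avg-low n f with Finₚ.any? (λ i → f i ℚₚ.≤? ∫ (avg n) f)
... | yes p = p
... | no p = ⊥-elim (ℚₚ.<-irrefl (sym e) lt)
  where
  A = ∫ (avg n) f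
  gt : ∀ i → A < f i
  gt i = ℚₚ.≰⇒> (λ q → p (i , q))
  sumgt : ∀ m (g : Fin (suc m) → ℚ) → (∀ i → A < g i) → ∫ (sumFin (suc m)) (λ _ → A) < ∫ (sumFin (suc m)) g
  sumgt zero g q = ℚₚ.+-monoˡ-< 0ℚ (q zero)
  sumgt (suc m) g q = ℚₚ.+-mono-< (q zero) (sumgt m (g ∘ suc) (q ∘ suc))
  lt : ∫ (avg n) (λ _ → A) < ∫ (avg n) f
  lt = ℚₚ.*-monoʳ-<-pos (inv (ν (suc n))) {{ℚ.positive (inv-pos (ν (suc n)) (ν-pos n))}} (sumgt n f gt)
  e : ∫ (avg n) f ≡ ∫ (avg n) (λ _ → A)
  e = sym (mean-const (avg n) (avg-mean n) A)

lin× : ∀ {A B} → Lin A → Lin B → Lin (A × B)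
∫ (lin× L K) f = ∫ L (λ a → ∫ K (λ b → f (a , b)))
∫+ (lin× L K) f g = trans (∫≡ L (λ a → ∫+ K (λ b → f (a , b)) (λ b → g (a , b)))) (∫+ L (λ a → ∫ K (λ b → f (a , b))) (λ a → ∫ K (λ b → g (a , b))))
∫* (lin× L K) c f = trans (∫≡ L (λ a → ∫* K c (λ b → f (a , b)))) (∫* L c (λ a → ∫ K (λ b → f (a , b))))
∫≤ (lin× L K) p = ∫≤ L (λ a → ∫≤ K (λ b → p (a , b)))

lin⊤ : Lin ⊤
∫ lin⊤ f = f tt
∫+ lin⊤ f g = refl
∫* lin⊤ c f = refl
∫≤ lin⊤ p = p tt

sumBool : Lin Bool
∫ sumBool f = f true + f false
∫+ sumBool f g = +-middle (f true) (g true) (f false) (g false)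
∫* sumBool c f = sym (ℚₚ.*-distribˡ-+ c (f true) (f false))
∫≤ sumBool p = +-mono-≤ (p true) (p false)

linVec : ∀ {A} → Lin A → ∀ m → Lin (Vec A m)
∫ (linVec L zero) f = f []
∫ (linVec L (suc m)) f = ∫ L (λ a → ∫ (linVec L m) (λ x → f (a ∷ x)))
∫+ (linVec L zero) f g = refl
∫+ (linVec L (suc m)) f g = trans (∫≡ L (λ a → ∫+ (linVec L m) (λ x → f (a ∷ x)) (λ x → g (a ∷ x)))) (∫+ L (λ a → ∫ (linVec L m) (λ x → f (a ∷ x))) (λ a → ∫ (linVec L m) (λ x → g (a ∷ x))))
∫* (linVec L zero) c f = refl
∫* (linVec L (suc m)) c f = trans (∫≡ L (λ a → ∫* (linVec L m) c (λ x → f (a ∷ x)))) (∫* L c (λ a → ∫ (linVec L m) (λ x → f (a ∷ x))))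
∫≤ (linVec L zero) p = p []
∫≤ (linVec L (suc m)) p = ∫≤ L (λ a → ∫≤ (linVec L m) (λ x → p (a ∷ x)))

linVec-swap : ∀ {A} (L : Lin A) → Swap L → ∀ m → Swap (linVec L m)
linVec-swap L s zero K f = refl
linVec-swap L s (suc m) K f = trans (s K (λ a v → ∫ (linVec L m) (λ x → f a (v ∷ x)))) (∫≡ L (λ v → linVec-swap L s m K (λ a x → f a (v ∷ x))))

linVec-mean : ∀ {A} (L : Lin A) → Mean L → ∀ m → Mean (linVec L m)
linVec-mean L e zero = refl
linVec-mean L e (suc m) = trans (∫≡ L (λ _ → linVec-mean L e m)) e

-- No enumeration is kept. `∑-δ` identifies `∑` as the counting sum, and it is the form in which
-- finiteness is applied: an integral is split according to the value of a function into `A`.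
record Finite (A : Set) : Set where
  infix 4 _==_
  field
    ∑ : Lin A
    _==_ : A → A → Bool
    ==⇒≡ : ∀ {a b} → (a == b) ≡ true → a ≡ b
    ==-refl : ∀ a → (a == a) ≡ true
    ∑-δ : ∀ (φ : A → ℚ) b → ∫ ∑ (λ a → ⟦ a == b ⟧ * φ a) ≡ φ b

open Finite public

∧-true : ∀ {a b} → a ∧ b ≡ true → a ≡ true × b ≡ true
∧-true {true} {true} _ = refl , refl

∧ˡ : ∀ a b → a ∧ b ≡ true → a ≡ true
∧ˡ true b _ = refl

∧ʳ : ∀ a b → a ∧ b ≡ true → b ≡ true
∧ʳ true b p = p

∧-intro : ∀ {a b} → a ≡ true → b ≡ true → a ∧ b ≡ true
∧-intro refl refl = refl

finite⊤ : Finite ⊤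
∑ finite⊤ = lin⊤
_==_ finite⊤ _ _ = true
==⇒≡ finite⊤ _ = refl
==-refl finite⊤ _ = refl
∑-δ finite⊤ φ b = *-identityˡ (φ tt)

eqBool : Bool → Bool → Bool
eqBool true b = b
eqBool false b = not b

finiteBool : Finite Bool
∑ finiteBool = sumBool
_==_ finiteBool = eqBool
==⇒≡ finiteBool {true} {true} _ = refl
==⇒≡ finiteBool {false} {false} _ = refl
==-refl finiteBool true = refl
==-refl finiteBool false = refl
∑-δ finiteBool φ true = l (φ true) (φ false)
  where l : ∀ a b → 1ℚ * a + 0ℚ * b ≡ a
        l = solve-∀ ℛ
∑-δ finiteBool φ false = l (φ true) (φ false)
  where l : ∀ a b → 0ℚ * a + 1ℚ * b ≡ b
        l = solve-∀ ℛ

eqFin : ∀ {n} → Fin n → Fin n → Bool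
eqFin zero zero = true
eqFin zero (suc j) = false
eqFin (suc i) zero = false
eqFin (suc i) (suc j) = eqFin i j

finiteFin : ∀ n → Finite (Fin n)
∑ (finiteFin n) = sumFin n
_==_ (finiteFin n) = eqFin
==⇒≡ (finiteFin (suc n)) {zero} {zero} _ = refl
==⇒≡ (finiteFin (suc n)) {suc a} {suc b} p = cong suc (==⇒≡ (finiteFin n) p)
==-refl (finiteFin (suc n)) zero = refl
==-refl (finiteFin (suc n)) (suc i) = ==-refl (finiteFin n) i
∑-δ (finiteFin (suc n)) φ zero = trans (cong₂ _+_ (*-identityˡ (φ zero)) (trans (∫≡ (sumFin n) (λ a → *-zeroˡ (φ (suc a)))) (∫0 (sumFin n)))) (+-identityʳ (φ zero))
∑-δ (finiteFin (suc n)) φ (suc b) = trans (cong₂ _+_ (*-zeroˡ (φ zero)) (∑-δ (finiteFin n) (φ ∘ suc) b)) (+-identityˡ (φ (suc b)))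

*-assoc-∫ : ∀ {A} (L : Lin A) c (f g : A → ℚ) → ∫ L (λ b → (c * f b) * g b) ≡ c * ∫ L (λ b → f b * g b)
*-assoc-∫ L c f g = trans (∫≡ L (λ b → *-assoc c (f b) (g b))) (∫* L c (λ b → f b * g b))

finite× : ∀ {A B} → Finite A → Finite B → Finite (A × B)
∑ (finite× P Q) = lin× (∑ P) (∑ Q)
_==_ (finite× P Q) (a , b) (c , d) = _==_ P a c ∧ _==_ Q b d
==⇒≡ (finite× P Q) p with ∧-true p
... | q , r = cong₂ _,_ (==⇒≡ P q) (==⇒≡ Q r)
==-refl (finite× P Q) (a , b) = ∧-intro (==-refl P a) (==-refl Q b)
∑-δ (finite× P Q) φ (c , d) = trans (∫≡ (∑ P) (λ a → trans (∫≡ (∑ Q) (λ b → cong (_* φ (a , b)) (⟦∧⟧ (_==_ P a c) (_==_ Q b d)))) (trans (*-assoc-∫ (∑ Q) ⟦ _==_ P a c ⟧ (λ b → ⟦ _==_ Q b d ⟧) (λ b → φ (a , b))) (cong (⟦ _==_ P a c ⟧ *_) (∑-δ Q (λ b → φ (a , b)) d))))) (∑-δ P (λ a → φ (a , d)) c)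

eqVec : ∀ {A} → Finite A → ∀ {m} → Vec A m → Vec A m → Bool
eqVec P [] [] = true
eqVec P (a ∷ x) (b ∷ y) = _==_ P a b ∧ eqVec P x y

finiteVec : ∀ {A} → Finite A → ∀ m → Finite (Vec A m)
∑ (finiteVec P m) = linVec (∑ P) m
_==_ (finiteVec P m) = eqVec P
==⇒≡ (finiteVec P zero) {[]} {[]} _ = refl
==⇒≡ (finiteVec P (suc m)) {a ∷ x} {b ∷ y} p with ∧-true p
... | q , r = cong₂ _∷_ (==⇒≡ P q) (==⇒≡ (finiteVec P m) r)
==-refl (finiteVec P zero) [] = refl
==-refl (finiteVec P (suc m)) (a ∷ x) = ∧-intro (==-refl P a) (==-refl (finiteVec P m) x)
∑-δ (finiteVec P zero) φ [] = *-identityˡ (φ [])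
∑-δ (finiteVec P (suc m)) φ (c ∷ d) = trans (∫≡ (∑ P) (λ a → trans (∫≡ (linVec (∑ P) m) (λ b → cong (_* φ (a ∷ b)) (⟦∧⟧ (_==_ P a c) (eqVec P b d)))) (trans (*-assoc-∫ (linVec (∑ P) m) ⟦ _==_ P a c ⟧ (λ b → ⟦ eqVec P b d ⟧) (λ b → φ (a ∷ b))) (cong (⟦ _==_ P a c ⟧ *_) (∑-δ (finiteVec P m) (λ b → φ (a ∷ b)) d))))) (∑-δ P (λ a → φ (a ∷ d)) c)

==-false : ∀ {A} (P : Finite A) {a b} → a ≢ b → _==_ P a b ≡ false
==-false P {a} {b} n with _==_ P a b in e
... | true = ⊥-elim (n (==⇒≡ P e))
... | false = refl

==-sym : ∀ {A} (P : Finite A) a b → _==_ P a b ≡ _==_ P b a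
==-sym P a b with _==_ P a b in e | _==_ P b a in e'
... | true | true = refl
... | false | false = refl
... | true | false = case trans (sym (subst (λ z → _==_ P b z ≡ true) (sym (==⇒≡ P e)) (==-refl P b))) e' of λ ()
... | false | true = case trans (sym (subst (λ z → _==_ P a z ≡ true) (sym (==⇒≡ P e')) (==-refl P a))) e of λ ()

∣_∣f : ∀ {A} → Finite A → ℚ
∣ P ∣f = ∫ (∑ P) (λ _ → 1ℚ)

-- Thinnings: the order-preserving injections of [k] into [m], which index the k-subsets of [m]

infix 4 _⊑_
data _⊑_ : ℕ → ℕ → Set where
  done : 0 ⊑ 0
  skip : ∀ {k m} → k ⊑ m → k ⊑ suc m
  keep : ∀ {k m} → k ⊑ m → suc k ⊑ suc m

infixr 6 _⨟_
_⨟_ : ∀ {k m n} → k ⊑ m → m ⊑ n → k ⊑ n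
e ⨟ skip I = skip (e ⨟ I)
skip e ⨟ keep I = skip (e ⨟ I)
keep e ⨟ keep I = keep (e ⨟ I)
done ⨟ done = done

idT : ∀ {m} → m ⊑ m
idT {zero} = done
idT {suc m} = keep idT

none : ∀ {m} → 0 ⊑ m
none {zero} = done
none {suc m} = skip none

none-unique : ∀ {m} (e : 0 ⊑ m) → e ≡ none
none-unique done = refl
none-unique (skip e) = cong skip (none-unique e)

⊑⇒≤ : ∀ {k m} → k ⊑ m → k ℕ.≤ m
⊑⇒≤ done = z≤n
⊑⇒≤ (skip e) = ℕₚ.m≤n⇒m≤1+n (⊑⇒≤ e)
⊑⇒≤ (keep e) = s≤s (⊑⇒≤ e)

id-unique : ∀ {m} (e : m ⊑ m) → e ≡ idT
id-unique done = refl
id-unique (skip e) = ⊥-elim (ℕₚ.1+n≰n (⊑⇒≤ e))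
id-unique (keep e) = cong keep (id-unique e)

⨟-idˡ : ∀ {k m} (e : k ⊑ m) → idT ⨟ e ≡ e
⨟-idˡ done = refl
⨟-idˡ (skip e) = cong skip (⨟-idˡ e)
⨟-idˡ (keep e) = cong keep (⨟-idˡ e)

⨟-assoc : ∀ {a b c d} (p : a ⊑ b) (q : b ⊑ c) (r : c ⊑ d) → (p ⨟ q) ⨟ r ≡ p ⨟ (q ⨟ r)
⨟-assoc p q (skip r) = cong skip (⨟-assoc p q r)
⨟-assoc p (skip q) (keep r) = cong skip (⨟-assoc p q r)
⨟-assoc (skip p) (keep q) (keep r) = cong skip (⨟-assoc p q r)
⨟-assoc (keep p) (keep q) (keep r) = cong keep (⨟-assoc p q r)
⨟-assoc done done done = refl

skip-injective : ∀ {k m} {e e' : k ⊑ m} → skip e ≡ skip e' → e ≡ e'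
skip-injective refl = refl

keep-injective : ∀ {k m} {e e' : k ⊑ m} → keep e ≡ keep e' → e ≡ e'
keep-injective refl = refl

⨟-injective : ∀ {k m n} {e e' : k ⊑ m} (I : m ⊑ n) → e ⨟ I ≡ e' ⨟ I → e ≡ e'
⨟-injective (skip I) p = ⨟-injective I (skip-injective p)
⨟-injective {e = skip e} {skip e'} (keep I) p = cong skip (⨟-injective I (skip-injective p))
⨟-injective {e = keep e} {keep e'} (keep I) p = cong keep (⨟-injective I (keep-injective p))
⨟-injective {e = skip e} {keep e'} (keep I) ()
⨟-injective {e = keep e} {skip e'} (keep I) ()
⨟-injective {e = done} {done} done p = refl

-- d t omits t
d : ∀ {j} → Fin (suc j) → j ⊑ suc j
d zero = skip idT
d {suc j} (suc t) = keep (d t)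

miss : ∀ {j} → j ⊑ suc j → Fin (suc j)
miss (skip e) = zero
miss {suc j} (keep e) = suc (miss e)

d-miss : ∀ {j} (e : j ⊑ suc j) → d (miss e) ≡ e
d-miss (skip e) = cong skip (sym (id-unique e))
d-miss {suc j} (keep e) = cong keep (d-miss e)

ix : ∀ {k m} → k ⊑ m → Fin k → Fin m
ix (skip e) t = suc (ix e t)
ix (keep e) zero = zero
ix (keep e) (suc t) = suc (ix e t)

select : ∀ {A : Set} {k m} → k ⊑ m → Vec A m → Vec A k
select done x = []
select (skip e) (a ∷ x) = select e x
select (keep e) (a ∷ x) = a ∷ select e x

put : ∀ {A : Set} {k m} → k ⊑ m → Vec A k → Vec A m → Vec A m
put done z x = x
put (skip e) z (a ∷ x) = a ∷ put e z x
put (keep e) (b ∷ z) (a ∷ x) = b ∷ put e z x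

select-put : ∀ {A : Set} {k m} (e : k ⊑ m) (z : Vec A k) x → select e (put e z x) ≡ z
select-put done [] x = refl
select-put (skip e) z (a ∷ x) = select-put e z x
select-put (keep e) (b ∷ z) (a ∷ x) = cong (b ∷_) (select-put e z x)

select-⨟ : ∀ {A : Set} {k m n} (e : k ⊑ m) (I : m ⊑ n) (x : Vec A n) → select (e ⨟ I) x ≡ select e (select I x)
select-⨟ e (skip I) (a ∷ x) = select-⨟ e I x
select-⨟ (skip e) (keep I) (a ∷ x) = select-⨟ e I x
select-⨟ (keep e) (keep I) (a ∷ x) = cong (a ∷_) (select-⨟ e I x)
select-⨟ done done [] = refl

lookup-select : ∀ {A : Set} {k m} (e : k ⊑ m) (x : Vec A m) t → lookup (select e x) t ≡ lookup x (ix e t)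
lookup-select (skip e) (a ∷ x) t = lookup-select e x t
lookup-select (keep e) (a ∷ x) zero = refl
lookup-select (keep e) (a ∷ x) (suc t) = lookup-select e x t

-- Cov e T τ : the positions of e that lie in T are among those chosen by τ
data Cov : ∀ {k b m j} → k ⊑ m → b ⊑ m → j ⊑ k → Set where
  done : Cov done done done
  ss : ∀ {k b m j} {e : k ⊑ m} {T : b ⊑ m} {τ : j ⊑ k} → Cov e T τ → Cov (skip e) (skip T) τ
  sk : ∀ {k b m j} {e : k ⊑ m} {T : b ⊑ m} {τ : j ⊑ k} → Cov e T τ → Cov (skip e) (keep T) τ
  ks : ∀ {k b m j} {e : k ⊑ m} {T : b ⊑ m} {τ : j ⊑ k} → Cov e T τ → Cov (keep e) (skip T) (skip τ)
  ksk : ∀ {k b m j} {e : k ⊑ m} {T : b ⊑ m} {τ : j ⊑ k} → Cov e T τ → Cov (keep e) (skip T) (keep τ)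
  kk : ∀ {k b m j} {e : k ⊑ m} {T : b ⊑ m} {τ : j ⊑ k} → Cov e T τ → Cov (keep e) (keep T) (keep τ)

-- The purpose of `Cov`: once the coordinates outside `e` are frozen at `x`, any function of the
-- `T`-part becomes a function of the `τ`-part of `z`.
cov-dep : ∀ {A : Set} {k b m j} {e : k ⊑ m} {T : b ⊑ m} {τ : j ⊑ k} → Cov e T τ → ∀ {z z' : Vec A k} x → select τ z ≡ select τ z' → select T (put e z x) ≡ select T (put e z' x)
cov-dep done x p = refl
cov-dep (ss c) (a ∷ x) p = cov-dep c x p
cov-dep (sk c) (a ∷ x) p = cong (a ∷_) (cov-dep c x p)
cov-dep (ks c) {b ∷ z} {b' ∷ z'} (a ∷ x) p = cov-dep c x p
cov-dep (ksk c) {b ∷ z} {b' ∷ z'} (a ∷ x) p = cov-dep c x (cong Vec.tail p)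
cov-dep (kk c) {b ∷ z} {b' ∷ z'} (a ∷ x) p = cong₂ _∷_ (cong Vec.head p) (cov-dep c x (cong Vec.tail p))

cov-id : ∀ {k b m} (e : k ⊑ m) (T : b ⊑ m) → Cov e T idT
cov-id done done = done
cov-id (skip e) (skip T) = ss (cov-id e T)
cov-id (skip e) (keep T) = sk (cov-id e T)
cov-id (keep e) (skip T) = ksk (cov-id e T)
cov-id (keep e) (keep T) = kk (cov-id e T)

-- `e` meets `T` in at most `b` positions, and these can be padded to `j` positions of `e`.
cov-small : ∀ {k b m j} (e : k ⊑ m) (T : b ⊑ m) → b ℕ.≤ j → j ℕ.≤ k → Σ[ τ ∈ j ⊑ k ] Cov e T τ
cov-small {j = zero} done done p q = done , done
cov-small (skip e) (skip T) p q with cov-small e T p q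
... | τ , c = τ , ss c
cov-small (skip e) (keep T) p q with cov-small e T (ℕₚ.≤-trans (ℕₚ.n≤1+n _) p) q
... | τ , c = τ , sk c
cov-small (keep e) (keep T) (s≤s p) (s≤s q) with cov-small e T p q
... | τ , c = keep τ , kk c
cov-small {suc k} {j = j} (keep e) (skip T) p q with j ℕ.≤? k
... | yes r = let τ , c = cov-small e T p r in skip τ , ks c
... | no r with ℕₚ.≤-antisym q (ℕₚ.≰⇒> r)
... | refl = idT , cov-id (keep e) (skip T)

-- If `e` is not inside `T`, one of its positions lies outside `T` and the other `j` cover the
-- intersection. So a condition on one set is a legitimate test for every other set of the same
-- size.
cov-diff : ∀ {j b m} (e : suc j ⊑ m) (T : b ⊑ m) → (Σ[ δ ∈ suc j ⊑ b ] e ≡ δ ⨟ T) ⊎ (Σ[ τ ∈ j ⊑ suc j ] Cov e T τ)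
cov-diff (skip e) (skip T) with cov-diff e T
... | inj₁ (δ , p) = inj₁ (δ , cong skip p)
... | inj₂ (τ , c) = inj₂ (τ , ss c)
cov-diff (skip e) (keep T) with cov-diff e T
... | inj₁ (δ , p) = inj₁ (skip δ , cong skip p)
... | inj₂ (τ , c) = inj₂ (τ , sk c)
cov-diff (keep e) (skip T) = inj₂ (skip idT , ks (cov-id e T))
cov-diff {zero} (keep e) (keep T) = inj₁ (keep none , cong keep (trans (none-unique e) (sym (none-unique (none ⨟ T)))))
cov-diff {suc j} (keep e) (keep T) with cov-diff e T
... | inj₁ (δ , p) = inj₁ (keep δ , cong keep p)
... | inj₂ (τ , c) = inj₂ (keep τ , kk c)

thins : ∀ j k → List (j ⊑ k)
thins zero zero = done ∷ []
thins (suc j) zero = []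
thins zero (suc k) = List.map skip (thins zero k)
thins (suc j) (suc k) = List.map keep (thins j k) ++ List.map skip (thins (suc j) k)

thins-complete : ∀ {j k} (e : j ⊑ k) → e ∈ thins j k
thins-complete done = here refl
thins-complete {zero} (skip e) = ∈-map⁺ skip (thins-complete e)
thins-complete {suc j} (skip e) = ∈-++⁺ʳ (List.map keep (thins j _)) (∈-map⁺ skip (thins-complete e))
thins-complete (keep e) = ∈-++⁺ˡ (∈-map⁺ keep (thins-complete e))

thins-unique : ∀ j k → Unique (thins j k)
thins-unique zero zero = [] ∷ []
thins-unique (suc j) zero = []
thins-unique zero (suc k) = Uniqueₚ.map⁺ skip-injective (thins-unique zero k)
thins-unique (suc j) (suc k) = Uniqueₚ.++⁺ (Uniqueₚ.map⁺ keep-injective (thins-unique j k)) (Uniqueₚ.map⁺ skip-injective (thins-unique (suc j) k)) disjoint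
  where
  disjoint : ∀ {e} → ¬ (e ∈ List.map keep (thins j k) × e ∈ List.map skip (thins (suc j) k))
  disjoint (p , q) with ∈-map⁻ keep p | ∈-map⁻ skip q
  ... | _ , _ , refl | _ , _ , ()

allF : ∀ n → (Fin n → Bool) → Bool
allF zero p = true
allF (suc n) p = p zero ∧ allF n (p ∘ suc)

bool-ext : ∀ {a b} → (a ≡ true → b ≡ true) → (b ≡ true → a ≡ true) → a ≡ b
bool-ext {true} {b} p q = sym (p refl)
bool-ext {false} {true} p q = q refl
bool-ext {false} {false} p q = refl

allF-elim : ∀ n (p : Fin n → Bool) → allF n p ≡ true → ∀ i → p i ≡ true
allF-elim (suc n) p q zero = ∧ˡ (p zero) (allF n (p ∘ suc)) q
allF-elim (suc n) p q (suc i) = allF-elim n (p ∘ suc) (∧ʳ (p zero) (allF n (p ∘ suc)) q) i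

allF-intro : ∀ n (p : Fin n → Bool) → (∀ i → p i ≡ true) → allF n p ≡ true
allF-intro zero p q = refl
allF-intro (suc n) p q = ∧-intro (q zero) (allF-intro n (p ∘ suc) (q ∘ suc))

allF-∧ : ∀ n (p q : Fin n → Bool) → allF n p ∧ allF n q ≡ allF n (λ i → p i ∧ q i)
allF-∧ n p q = bool-ext
  (λ h → allF-intro n _ (λ t → ∧-intro (allF-elim n p (∧ˡ (allF n p) (allF n q) h) t) (allF-elim n q (∧ʳ (allF n p) (allF n q) h) t)))
  (λ h → ∧-intro (allF-intro n p (λ t → ∧ˡ (p t) (q t) (allF-elim n _ h t))) (allF-intro n q (λ t → ∧ʳ (p t) (q t) (allF-elim n _ h t))))

allL : ∀ {A : Set} → (A → Bool) → List A → Bool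
allL p [] = true
allL p (a ∷ l) = p a ∧ allL p l

allL-elim : ∀ {A : Set} (p : A → Bool) l → allL p l ≡ true → ∀ {a} → a ∈ l → p a ≡ true
allL-elim p (b ∷ l) q (here refl) = ∧ˡ (p b) (allL p l) q
allL-elim p (b ∷ l) q (there m) = allL-elim p l (∧ʳ (p b) (allL p l) q) m

allL-intro : ∀ {A : Set} (p : A → Bool) l → (∀ {a} → a ∈ l → p a ≡ true) → allL p l ≡ true
allL-intro p [] q = refl
allL-intro p (a ∷ l) q = ∧-intro (q (here refl)) (allL-intro p l (q ∘ there))

sumL : ∀ {A : Set} → (A → ℚ) → List A → ℚ
sumL f [] = 0ℚ
sumL f (a ∷ l) = f a + sumL f l

prodL : ∀ {A : Set} → (A → ℚ) → List A → ℚ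
prodL f [] = 1ℚ
prodL f (a ∷ l) = f a * prodL f l

sumL-≥ : ∀ {A : Set} {f : A → ℚ} → (∀ a → 0ℚ ≤ f a) → ∀ {l a} → a ∈ l → f a ≤ sumL f l
sumL≥0 : ∀ {A : Set} {f : A → ℚ} → (∀ a → 0ℚ ≤ f a) → ∀ l → 0ℚ ≤ sumL f l
sumL≥0 p [] = ≤-refl
sumL≥0 p (a ∷ l) = p a ⊕ sumL≥0 p l
sumL-≥ {f = f} p {a ∷ l} (here refl) = subst (_≤ f a + sumL f l) (+-identityʳ (f a)) (+-mono-≤ (≤-refl {f a}) (sumL≥0 p l))
sumL-≥ {f = f} p {b ∷ l} {a} (there q) = subst (_≤ f b + sumL f l) (+-identityˡ (f a)) (+-mono-≤ (p b) (sumL-≥ p q))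

sumL-≤ : ∀ {A : Set} {f : A → ℚ} {c} → (∀ a → f a ≤ c) → ∀ l → sumL f l ≤ ν (length l) * c
sumL-≤ {c = c} p [] = ≤-reflexive (sym (*-zeroˡ c))
sumL-≤ {c = c} p (a ∷ l) = ≤-trans (+-mono-≤ (p a) (sumL-≤ p l)) (≤-reflexive (r c (ν (length l))))
  where r : ∀ c m → c + m * c ≡ (1ℚ + m) * c
        r = solve-∀ ℛ

∫sumL : ∀ {A B : Set} (L : Lin B) (f : A → B → ℚ) l → ∫ L (λ b → sumL (λ a → f a b) l) ≡ sumL (λ a → ∫ L (f a)) l
∫sumL L f [] = ∫0 L
∫sumL L f (a ∷ l) = trans (∫+ L (f a) (λ b → sumL (λ a → f a b) l)) (cong (∫ L (f a) +_) (∫sumL L f l))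

module _ {A : Set} (L : Lin A) (mean : Mean L) (swap : Swap L) where

  -- The old coordinates in `e` integrate out because `L` has mean one. Freezing the remaining
  -- coordinates then reduces a statement about `m` vertices to one about `k`.
  resample : ∀ {k m} (e : k ⊑ m) (Φ : Vec A m → ℚ) → ∫ (linVec L m) Φ ≡ ∫ (linVec L m) (λ x → ∫ (linVec L k) (λ z → Φ (put e z x)))
  resample done Φ = refl
  resample (skip e) Φ = ∫≡ L (λ a → resample e (λ x → Φ (a ∷ x)))
  resample {suc k} {suc m} (keep e) Φ = begin
    ∫ L (λ a → ∫ (linVec L m) (λ x → Φ (a ∷ x)))
      ≡⟨ ∫≡ L (λ a → resample e (λ x → Φ (a ∷ x))) ⟩
    ∫ L (λ a → ∫ (linVec L m) (λ x → ∫ (linVec L k) (λ z → Φ (a ∷ put e z x))))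
      ≡⟨ linVec-swap L swap m L (λ a x → ∫ (linVec L k) (λ z → Φ (a ∷ put e z x))) ⟩
    ∫ (linVec L m) (λ x → ∫ L (λ a → ∫ (linVec L k) (λ z → Φ (a ∷ put e z x))))
      ≡⟨ sym (mean-const L mean (∫ (linVec L m) (λ x → ∫ L (λ a → ∫ (linVec L k) (λ z → Φ (a ∷ put e z x)))))) ⟩
    ∫ L (λ _ → ∫ (linVec L m) (λ x → ∫ L (λ a → ∫ (linVec L k) (λ z → Φ (a ∷ put e z x))))) ∎
    where open ≡-Reasoning

  marginal : ∀ {k m} (e : k ⊑ m) (Φ : Vec A k → ℚ) → ∫ (linVec L m) (λ x → Φ (select e x)) ≡ ∫ (linVec L k) Φ
  marginal {k} {m} e Φ = trans (resample e (Φ ∘ select e)) (trans (∫≡ (linVec L m) (λ x → ∫≡ (linVec L k) (λ z → cong Φ (select-put e z x)))) (mean-const (linVec L m) (linVec-mean L mean m) (∫ (linVec L k) Φ)))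

-- Discrepancy against functions of all but one of the coordinates

Abs : ℚ → ℚ → Set
Abs a ε = (a ≤ ε) × (- ε ≤ a)

module Disc (n : ℕ) where
  V : Set
  V = Fin (suc n)

  𝔼 : ∀ m → Lin (Vec V m)
  𝔼 = linVec (avg n)

  𝔼-mean : ∀ m → Mean (𝔼 m)
  𝔼-mean = linVec-mean (avg n) (avg-mean n)

  𝔼-abs : ∀ m {f ε} → (∀ x → Abs (f x) ε) → Abs (∫ (𝔼 m) f) ε
  𝔼-abs m {f} {ε} p = mean-≤ (𝔼 m) (𝔼-mean m) (proj₁ ∘ p) , subst (_≤ ∫ (𝔼 m) f) (mean-const (𝔼 m) (𝔼-mean m) (- ε)) (∫≤ (𝔼 m) (proj₂ ∘ p))

  -- One set of `j`-tuples for each omitted coordinate; `evalT` is the indicator of their cylinder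
  -- intersection. `CutReg` is thus smallness in the cut norm under which (j+1)-graphs can be
  -- counted.
  Test : ℕ → Set
  Test j = Fin (suc j) → Vec V j → Bool

  evalT : ∀ {j} → Test j → Vec V (suc j) → Bool
  evalT {j} w z = allF (suc j) (λ t → w t (select (d t) z))

  CutReg : ∀ j → (Vec V (suc j) → ℚ) → ℚ → Set
  CutReg j F ε = ∀ w → Abs (∫ (𝔼 (suc j)) (λ z → F z * ⟦ evalT w z ⟧)) ε

  -- However the coordinates outside `e` are fixed, `X` is a cylinder intersection in those of `e`.
  -- Against such events a cut-regular function of the `e`-part integrates to almost nothing, which
  -- is `cut-lift`.
  Adm : ∀ {j m} → suc j ⊑ m → (Vec V m → Bool) → Set
  Adm {j} {m} e X = ∀ x → Σ[ w ∈ Test j ] (∀ z → X (put e z x) ≡ evalT w z)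

  cut-lift : ∀ {j m F ε} {X : Vec V m → Bool} (e : suc j ⊑ m) → CutReg j F ε → Adm e X → Abs (∫ (𝔼 m) (λ x → F (select e x) * ⟦ X x ⟧)) ε
  cut-lift {j} {m} {F} {ε} {X} e reg adm = subst (λ a → Abs a ε) (sym (resample (avg n) (avg-mean n) (avg-swap n) e (λ x → F (select e x) * ⟦ X x ⟧)))
    (𝔼-abs m (λ x → subst (λ a → Abs a ε) (∫≡ (𝔼 (suc j)) (λ z → sym (cong₂ (λ a b → F a * ⟦ b ⟧) (select-put e z x) (proj₂ (adm x) z)))) (reg (proj₁ (adm x)))))

  adm-true : ∀ {j m} (e : suc j ⊑ m) → Adm e (λ _ → true)
  adm-true {j} e x = (λ _ _ → true) , λ z → sym (allF-intro (suc j) (λ _ → true) (λ _ → refl))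

  adm-∧ : ∀ {j m} (e : suc j ⊑ m) (X Y : Vec V m → Bool) → Adm e X → Adm e Y → Adm e (λ x → X x ∧ Y x)
  adm-∧ {j} e X Y p q x with p x | q x
  ... | w , a | w' , b = (λ t y → w t y ∧ w' t y) , λ z → trans (cong₂ _∧_ (a z) (b z)) (allF-∧ (suc j) (λ t → w t (select (d t) z)) (λ t → w' t (select (d t) z)))

  adm-ext : ∀ {j m} {e : suc j ⊑ m} {X Y : Vec V m → Bool} → (∀ x → X x ≡ Y x) → Adm e X → Adm e Y
  adm-ext {e = e} p q x = proj₁ (q x) , λ z → trans (sym (p (put e z x))) (proj₂ (q x) z)

  adm-all : ∀ {j m} {B : Set} (e : suc j ⊑ m) (X : B → Vec V m → Bool) l → (∀ {b} → b ∈ l → Adm e (X b)) → Adm e (λ x → allL (λ b → X b x) l)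
  adm-all e X [] p = adm-true e
  adm-all e X (b ∷ l) p = adm-∧ e (X b) (λ x → allL (λ b → X b x) l) (p (here refl)) (adm-all e X l (p ∘ there))

  -- A function that ignores one coordinate of `e` is a test with a single non-trivial factor, at
  -- the ignored coordinate `miss τ`; `z₀` fills the place of that coordinate.
  adm-dep : ∀ {j m b} {e : suc j ⊑ m} {T : b ⊑ m} {τ : j ⊑ suc j} → Cov e T τ → (φ : Vec V b → Bool) → Adm e (λ x → φ (select T x))
  adm-dep {j} {e = e} {T} {τ} c φ x = w , pf
    where
    z₀ : Vec V (suc j)
    z₀ = Vec.replicate (suc j) zero
    w : Test j
    w t y = if eqFin t (miss τ) then φ (select T (put e (put τ y z₀) x)) else true
    here' : ∀ z → w (miss τ) (select (d (miss τ)) z) ≡ φ (select T (put e z x))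
    here' z rewrite ==-refl (finiteFin (suc j)) (miss τ) | d-miss τ = cong φ (cov-dep c x (select-put τ (select τ z) z₀))
    pf : ∀ z → φ (select T (put e z x)) ≡ evalT w z
    pf z = bool-ext
      (λ h → allF-intro (suc j) (λ t → w t (select (d t) z)) (λ t → at t h))
      (λ h → trans (sym (here' z)) (allF-elim (suc j) (λ t → w t (select (d t) z)) h (miss τ)))
      where
      at : ∀ t → φ (select T (put e z x)) ≡ true → w t (select (d t) z) ≡ true
      at t h with eqFin t (miss τ) in q
      ... | false = refl
      ... | true = subst (λ s → φ (select T (put e (put τ (select (d s) z) z₀) x)) ≡ true) (sym (==⇒≡ (finiteFin (suc j)) {t} {miss τ} q))
        (trans (cong φ (cov-dep c x (trans (select-put τ (select (d (miss τ)) z) z₀) (cong (λ δ → select δ z) (d-miss τ))))) h)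

prodF : ∀ n → (Fin n → ℚ) → ℚ
prodF zero x = 1ℚ
prodF (suc n) x = x zero * prodF n (x ∘ suc)

prodF≥0 : ∀ n {x : Fin n → ℚ} → (∀ i → 0ℚ ≤ x i) → 0ℚ ≤ prodF n x
prodF≥0 zero p = 0≤1
prodF≥0 (suc n) p = p zero ⊗ prodF≥0 n (p ∘ suc)

prodF-mono : ∀ n {x y : Fin n → ℚ} → (∀ i → 0ℚ ≤ x i) → (∀ i → x i ≤ y i) → prodF n x ≤ prodF n y
prodF-mono zero p q = ≤-refl
prodF-mono (suc n) p q = *-mono (p zero) (prodF≥0 n (λ i → ≤-trans (p (suc i)) (q (suc i)))) (q zero) (prodF-mono n (p ∘ suc) (q ∘ suc))

-- `q` may be negative. The induction multiplies by `p + q` and discards a non-negative multiple of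
-- `q * q`.
bernoulli : ∀ m p q → 0ℚ ≤ p → 0ℚ ≤ p + q → p ^ℚ suc m + ν (suc m) * (p ^ℚ m * q) ≤ (p + q) ^ℚ suc m
bernoulli zero p q h h' = ≤-reflexive (l p q)
  where l : ∀ p q → p * 1ℚ + (1ℚ + 0ℚ) * (1ℚ * q) ≡ (p + q) * 1ℚ
        l = solve-∀ ℛ
bernoulli (suc m) p q h h' = ≤-trans
  (≤-by (l p q (p ^ℚ m) (ν m)) ((ν≥0 (suc m) ⊗ ^ℚ≥0 m h) ⊗ sq≥0 q))
  (*-monoʳ (p + q) h' (bernoulli m p q h h'))
  where l : ∀ p q P n → (p + q) * (p * P + (1ℚ + n) * (P * q)) - (p * (p * P) + (1ℚ + (1ℚ + n)) * (p * P * q)) ≡ (1ℚ + n) * P * (q * q)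
        l = solve-∀ ℛ

*-^ℚ : ∀ a b n → (a * b) ^ℚ n ≡ a ^ℚ n * b ^ℚ n
*-^ℚ a b zero = refl
*-^ℚ a b (suc n) = trans (cong ((a * b) *_) (*-^ℚ a b n)) (l a b (a ^ℚ n) (b ^ℚ n))
  where l : ∀ a b x y → (a * b) * (x * y) ≡ (a * x) * (b * y)
        l = solve-∀ ℛ

-- Bernoulli's inequality at `c * a` and `y - a`, where `a` is the mean of the `N` earlier numbers:
-- these two add up to the new total `y + S`.
am-gm-step : ∀ n N c y S P → c ≡ 1ℚ + N → 0ℚ < N → 0ℚ ≤ y → 0ℚ ≤ S → P * N ^ℚ n ≤ S ^ℚ n → ν (suc n) ≡ c → (y * P) * (c * c ^ℚ n) ≤ (y + S) ^ℚ suc n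
am-gm-step n N c y S P refl N>0 y≥0 S≥0 h h' = begin
    (y * P) * (c * C)               ≡⟨ l₁ y P c C ⟩
    (y * (c * C)) * P               ≤⟨ *-monoʳ (y * (c * C)) (y≥0 ⊗ (c≥0 ⊗ ^ℚ≥0 n c≥0)) P≤A ⟩
    (y * (c * C)) * a ^ℚ n          ≡⟨ l₂ y c C (a ^ℚ n) ⟩
    (C * a ^ℚ n) * (c * y)          ≡⟨ cong (_* (c * y)) (sym (*-^ℚ c a n)) ⟩
    (c * a) ^ℚ n * (c * y)          ≡⟨ l₃ c a ((c * a) ^ℚ n) y ⟩
    c * a * (c * a) ^ℚ n + c * ((c * a) ^ℚ n * (y - a))
      ≡⟨ cong (λ z → c * a * (c * a) ^ℚ n + z * ((c * a) ^ℚ n * (y - a))) (sym h') ⟩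
    c * a * (c * a) ^ℚ n + ν (suc n) * ((c * a) ^ℚ n * (y - a))
      ≤⟨ bernoulli n (c * a) (y - a) (c≥0 ⊗ a≥0) (subst (0ℚ ≤_) (sym e) (y≥0 ⊕ S≥0)) ⟩
    (c * a + (y - a)) ^ℚ suc n      ≡⟨ cong (_^ℚ suc n) e ⟩
    (y + S) ^ℚ suc n                ∎
  where
  open ℚₚ.≤-Reasoning
  C = c ^ℚ n
  a = S * inv N
  c≥0 : 0ℚ ≤ c
  c≥0 = 0≤1 ⊕ <⇒≤ N>0
  a≥0 : 0ℚ ≤ a
  a≥0 = S≥0 ⊗ <⇒≤ (inv-pos N N>0)
  na : N * a ≡ S
  na = trans (r N S (inv N)) (trans (cong (_* S) (inv-r N N>0)) (*-identityˡ S))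
    where r : ∀ n S i → n * (S * i) ≡ (n * i) * S
          r = solve-∀ ℛ
  e : c * a + (y - a) ≡ y + S
  e = trans (r N a y) (cong (y +_) na)
    where r : ∀ n a y → (1ℚ + n) * a + (y - a) ≡ y + n * a
          r = solve-∀ ℛ
  P≤A : P ≤ a ^ℚ n
  P≤A = *-cancel-pos (N ^ℚ n) (^ℚ-pos n N>0) (≤-trans (≤-reflexive (*-comm (N ^ℚ n) P)) (≤-trans h (≤-reflexive (trans (cong (_^ℚ n) (sym na)) (*-^ℚ N a n)))))
  l₁ : ∀ y P c C → y * P * (c * C) ≡ (y * (c * C)) * P
  l₁ = solve-∀ ℛ
  l₂ : ∀ y c C A → (y * (c * C)) * A ≡ (C * A) * (c * y)
  l₂ = solve-∀ ℛ
  l₃ : ∀ c a B y → B * (c * y) ≡ c * a * B + c * (B * (y - a))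
  l₃ = solve-∀ ℛ

am-gm : ∀ n (x : Fin n → ℚ) → (∀ i → 0ℚ ≤ x i) → prodF n x * ν n ^ℚ n ≤ ∫ (sumFin n) x ^ℚ n
am-gm zero x p = ≤-refl
am-gm (suc zero) x p = ≤-reflexive (l (x zero))
  where l : ∀ a → a * 1ℚ * ((1ℚ + 0ℚ) * 1ℚ) ≡ (a + 0ℚ) * 1ℚ
        l = solve-∀ ℛ
am-gm (suc (suc m)) x p = am-gm-step (suc m) (ν (suc m)) (ν (suc (suc m))) (x zero) (∫ (sumFin (suc m)) (x ∘ suc)) (prodF (suc m) (x ∘ suc)) refl (ν-pos m) (p zero) (∫≥0 (sumFin (suc m)) (p ∘ suc)) (am-gm (suc m) (x ∘ suc) (p ∘ suc)) refl

pow-near-1 : ∀ k y → 1ℚ < y → Σ[ ξ ∈ ℚ ] (0ℚ < ξ × (1ℚ + ξ) ^ℚ k < y)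
pow-near-1 k y p = ξ , ξ>0 , ≤-<-trans (bound k) (<-by (l y (cc k) ξ t) (subst (0ℚ <_) (sym tξ) (*-pos ξ>0 (+-pos t>0 0≤1))))
  where
  -- `cc k` is 2^k - 1, so that (1 + ξ)^k is at most 1 + `cc k * ξ` whenever `ξ` is at most 1.
  cc : ℕ → ℚ
  cc zero = 0ℚ
  cc (suc k) = 1ℚ + (cc k + cc k)
  cc≥0 : ∀ k → 0ℚ ≤ cc k
  cc≥0 zero = ≤-refl
  cc≥0 (suc k) = 0≤1 ⊕ (cc≥0 k ⊕ cc≥0 k)
  t = y - 1ℚ
  t>0 : 0ℚ < t
  t>0 = Δ< p
  D = t + (cc k + 1ℚ)
  D>0 : 0ℚ < D
  D>0 = +-pos t>0 (cc≥0 k ⊕ 0≤1)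
  -- This denominator makes `ξ` at most 1 and `cc k * ξ` strictly smaller than `t`.
  ξ = t * inv D
  ξ>0 : 0ℚ < ξ
  ξ>0 = *-pos t>0 (inv-pos D D>0)
  Dξ : D * ξ ≡ t
  Dξ = trans (r D t (inv D)) (trans (cong (_* t) (inv-r D D>0)) (*-identityˡ t))
    where r : ∀ D t i → D * (t * i) ≡ (D * i) * t
          r = solve-∀ ℛ
  tξ : t - cc k * ξ ≡ ξ * (t + 1ℚ)
  tξ = trans (cong (_- cc k * ξ) (sym Dξ)) (r t (cc k) ξ)
    where r : ∀ t c ξ → (t + (c + 1ℚ)) * ξ - c * ξ ≡ ξ * (t + 1ℚ)
          r = solve-∀ ℛ
  ξ≤1 : ξ ≤ 1ℚ
  ξ≤1 = *-cancel-pos D D>0 (≤-trans (≤-reflexive Dξ) (≤-by (r t (cc k)) (cc≥0 k ⊕ 0≤1)))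
    where r : ∀ t c → (t + (c + 1ℚ)) * 1ℚ - t ≡ c + 1ℚ
          r = solve-∀ ℛ
  bound : ∀ k → (1ℚ + ξ) ^ℚ k ≤ 1ℚ + cc k * ξ
  bound zero = ≤-reflexive (sym (trans (cong (1ℚ +_) (*-zeroˡ ξ)) (+-identityʳ 1ℚ)))
  bound (suc k) = ≤-trans (*-monoʳ (1ℚ + ξ) (0≤1 ⊕ <⇒≤ ξ>0) (bound k)) (≤-by (r ξ (cc k)) ((cc≥0 k ⊗ <⇒≤ ξ>0) ⊗ Δ ξ≤1))
    where r : ∀ ξ c → 1ℚ + (1ℚ + (c + c)) * ξ - (1ℚ + ξ) * (1ℚ + c * ξ) ≡ c * ξ * (1ℚ - ξ)
          r = solve-∀ ℛ
  l : ∀ y c ξ t → y - (1ℚ + c * ξ) ≡ (y - 1ℚ) - c * ξ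
  l = solve-∀ ℛ

opaque
  -- AM-GM with room to spare: since c times k^k exceeds 1 strictly, the sum exceeds 1 by a `ξ` that
  -- depends on `k` and `c` alone. This surplus later pays for rounding and for small overlaps.
  sum-gap : ∀ k c → 1ℚ < c * ν k ^ℚ k → Σ[ ξ ∈ ℚ ] (0ℚ < ξ × (∀ (x : Fin k → ℚ) → (∀ i → 0ℚ ≤ x i) → c ≤ prodF k x → 1ℚ + ξ ≤ ∫ (sumFin k) x))
  sum-gap k c p = main (pow-near-1 k (c * ν k ^ℚ k) p)
    where
    main : Σ[ ξ ∈ ℚ ] (0ℚ < ξ × (1ℚ + ξ) ^ℚ k < c * ν k ^ℚ k) → Σ[ ξ ∈ ℚ ] (0ℚ < ξ × (∀ (x : Fin k → ℚ) → (∀ i → 0ℚ ≤ x i) → c ≤ prodF k x → 1ℚ + ξ ≤ ∫ (sumFin k) x))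
    main (ξ , ξ>0 , q) = ξ , ξ>0 , bound
      where
      bound : ∀ (x : Fin k → ℚ) → (∀ i → 0ℚ ≤ x i) → c ≤ prodF k x → 1ℚ + ξ ≤ ∫ (sumFin k) x
      bound x x≥0 h = [ (λ r → contra q (≤-trans (*-monoˡ (ν k ^ℚ k) (^ℚ≥0 k (ν≥0 k)) h) (≤-trans (am-gm k x x≥0) (^ℚ-mono k (∫≥0 (sumFin k) x≥0) (<⇒≤ r))))) , id ]′ (<-or-≤ (∫ (sumFin k) x) (1ℚ + ξ))

-- Double negation and Ramsey's theorem.

DN : Set → Set
DN A = ¬ ¬ A

pure : ∀ {A} → A → DN A
pure a k = k a

infixl 1 _>>=_
_>>=_ : ∀ {A B} → DN A → (A → DN B) → DN B
(m >>= f) k = m (λ a → f a k)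

lem : ∀ A → DN (A ⊎ ¬ A)
lem A k = k (inj₂ (λ a → k (inj₁ a)))

Decides : ∀ {B : Set} → (B → Bool) → (B → Set) → Set
Decides {B} b P = ∀ e → (b e ≡ true → P e) × (b e ≡ false → ¬ P e)

-- Double negation commutes with finite conjunctions; the recursion runs over the shape of the
-- thinnings and applies `lem` at each leaf.
decide : ∀ {k m} (P : k ⊑ m → Set) → DN (Σ[ b ∈ (k ⊑ m → Bool) ] Decides b P)
decide {zero} {zero} P = lem (P done) >>= λ where
  (inj₁ p) → pure ((λ _ → true) , λ { done → (λ _ → p) , λ () })
  (inj₂ p) → pure ((λ _ → false) , λ { done → (λ ()) , λ _ → p })
decide {suc k} {zero} P = pure ((λ _ → true) , λ ())
decide {zero} {suc m} P = decide (P ∘ skip) >>= λ where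
  (b , h) → pure ((λ { (skip e) → b e }) , λ { (skip e) → h e })
decide {suc k} {suc m} P = decide (P ∘ skip) >>= λ (b , h) → decide (P ∘ keep) >>= λ (b' , h') →
  pure ((λ { (skip e) → b e ; (keep e) → b' e }) , λ { (skip e) → h e ; (keep e) → h' e })

⊑-+ˡ : ∀ a b → a ⊑ a ℕ.+ b
⊑-+ˡ zero b = none
⊑-+ˡ (suc a) b = keep (⊑-+ˡ a b)

⊑-+ʳ : ∀ a b → b ⊑ a ℕ.+ b
⊑-+ʳ zero b = idT
⊑-+ʳ (suc a) b = skip (⊑-+ʳ a b)

Mono : ∀ {k M} → (k ⊑ M → Bool) → Bool → ℕ → Set
Mono {k} {M} P b a = Σ[ I ∈ a ⊑ M ] (∀ e → P (e ⨟ I) ≡ b)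

Arrows : ℕ → ℕ → ℕ → ℕ → Set
Arrows k a b M = (P : k ⊑ M → Bool) → Mono P true a ⊎ Mono P false b

-- The Erdős-Szekeres recursion. The first vertex colours the `k`-sets of the rest by `P ∘ keep`; on
-- a set homogeneous for this link it suffices to find one point fewer in the colour of the link,
-- because the first vertex can be added.
ramsey-step : ∀ {k a b p q M} → Arrows k p q M → Arrows (suc k) a (suc b) p → Arrows (suc k) (suc a) b q → Arrows (suc k) (suc a) (suc b) (suc M)
ramsey-step {k} {a} {b} {p} {q} {M} hk hp hq P = [ left , right ]′ (hk (P ∘ keep))
  where
  drop : ∀ {c m e'} {J : c ⊑ m} {I : m ⊑ M} (e : suc k ⊑ c) → P (skip ((e ⨟ J) ⨟ I)) ≡ e' → P (skip (e ⨟ (J ⨟ I))) ≡ e'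
  drop {J = J} {I} e h = trans (cong (P ∘ skip) (sym (⨟-assoc e J I))) h
  both : ∀ {c m e'} {J : c ⊑ m} {I : m ⊑ M} → (∀ e → P (keep (e ⨟ I)) ≡ e') → (∀ e → P (skip ((e ⨟ J) ⨟ I)) ≡ e') → ∀ e → P (e ⨟ keep (J ⨟ I)) ≡ e'
  both {J = J} {I} h g (skip e) = drop e (g e)
  both {J = J} {I} h g (keep e) = trans (cong (P ∘ keep) (sym (⨟-assoc e J I))) (h (e ⨟ J))
  left : Mono (P ∘ keep) true p → _
  left (I , h) = [ (λ (J , g) → inj₁ (keep (J ⨟ I) , both h g)) , (λ (J , g) → inj₂ (skip (J ⨟ I) , λ e → drop e (g e))) ]′ (hp (λ e → P (skip (e ⨟ I))))
  right : Mono (P ∘ keep) false q → _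
  right (I , h) = [ (λ (J , g) → inj₁ (skip (J ⨟ I) , λ e → drop e (g e))) , (λ (J , g) → inj₂ (keep (J ⨟ I) , both h g)) ]′ (hq (λ e → P (skip (e ⨟ I))))

opaque
  ramsey : ∀ k a b → Σ ℕ (Arrows k a b)
  ramsey zero a b = a ℕ.+ b , λ P → point {P} (P none) refl
    where
    all-none : ∀ {c M} (P : 0 ⊑ M → Bool) {v} → P none ≡ v → (I : c ⊑ M) → ∀ e → P (e ⨟ I) ≡ v
    all-none P h I e = trans (cong P (none-unique (e ⨟ I))) h
    point : ∀ {P : 0 ⊑ a ℕ.+ b → Bool} v → P none ≡ v → Mono P true a ⊎ Mono P false b
    point {P} true h = inj₁ (⊑-+ˡ a b , all-none P h (⊑-+ˡ a b))
    point {P} false h = inj₂ (⊑-+ʳ a b , all-none P h (⊑-+ʳ a b))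
  ramsey (suc k) zero b = 0 , λ P → inj₁ (done , λ ())
  ramsey (suc k) (suc a) zero = 0 , λ P → inj₂ (done , λ ())
  ramsey (suc k) (suc a) (suc b) = _ , ramsey-step (proj₂ (ramsey k _ _)) (proj₂ (ramsey (suc k) a (suc b))) (proj₂ (ramsey (suc k) (suc a) b))

ramseyℕ : ℕ → ℕ → ℕ → ℕ
ramseyℕ k a b = proj₁ (ramsey k a b)

ramseyDN : ∀ k a b (P : k ⊑ ramseyℕ k a b → Set) → DN ((Σ[ I ∈ a ⊑ ramseyℕ k a b ] (∀ e → P (e ⨟ I))) ⊎ (Σ[ I ∈ b ⊑ ramseyℕ k a b ] (∀ e → ¬ P (e ⨟ I))))
ramseyDN k a b P = decide P >>= λ (c , h) → pure ([ (λ (I , g) → inj₁ (I , λ e → proj₁ (h (e ⨟ I)) (g e))) , (λ (I , g) → inj₂ (I , λ e → proj₂ (h (e ⨟ I)) (g e))) ]′ (proj₂ (ramsey k a b) c))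

-- Blow-ups: n marked points with a block of free points before each of them and after the last

skips : ∀ b {k m} → k ⊑ m → k ⊑ b ℕ.+ m
skips zero e = e
skips (suc b) e = skip (skips b e)

pts : ∀ {b k m} → Fin b → k ⊑ m → suc k ⊑ b ℕ.+ m
pts {suc b} zero e = keep (skips b e)
pts (suc t) e = skip (pts t e)

rest : ℕ → ℕ → ℕ
rest zero N = 0
rest (suc n) N = suc (N ℕ.+ rest n N)

marked : ∀ n N → n ⊑ rest n N
marked zero N = done
marked (suc n) N = keep (skips N (marked n N))

-- the marked points and one free point in block ℓ: the point t₁ of the first block, or the point t of a later one
free : ∀ n b N → Fin (suc n) → Fin b → Fin N → suc n ⊑ b ℕ.+ rest n N
free n b N zero t₁ t = pts t₁ (marked n N)
free (suc n) b N (suc ℓ) t₁ t = skips b (keep (free n N N ℓ t t))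

d-skips : ∀ {j k m} b (e : j ⊑ k) (I : k ⊑ m) → e ⨟ skips b I ≡ skips b (e ⨟ I)
d-skips zero e I = refl
d-skips (suc b) e I = cong skip (d-skips b e I)

d-pts : ∀ {b k m} (t : Fin b) (e : k ⊑ m) → d zero ⨟ pts t e ≡ skips b e
d-pts {suc b} zero e = cong skip (⨟-idˡ (skips b e))
d-pts (suc t) e = cong skip (d-pts t e)

-- A point of block `ℓ` comes at position `ℓ` of its edge: the blocks are arranged so that the
-- marked set can acquire a further vertex in every role.
d-free : ∀ n b N ℓ t₁ t → d ℓ ⨟ free n b N ℓ t₁ t ≡ skips b (marked n N)
d-free n b N zero t₁ t = d-pts t₁ (marked n N)
d-free (suc n) b N (suc ℓ) t₁ t = trans (d-skips b (d (suc ℓ)) (keep (free n N N ℓ t t))) (cong (skips b ∘ keep) (d-free n N N ℓ t t))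

infixr 5 _⊞_
_⊞_ : ∀ {a b c e} → a ⊑ b → c ⊑ e → a ℕ.+ c ⊑ b ℕ.+ e
done ⊞ q = q
skip p ⊞ q = skip (p ⊞ q)
keep p ⊞ q = keep (p ⊞ q)

blow : ∀ n {N N'} → N ⊑ N' → rest n N ⊑ rest n N'
blow zero J = done
blow (suc n) J = keep (J ⊞ blow n J)

skips-⊞ : ∀ {b B j k m} (J : b ⊑ B) (e : j ⊑ k) (q : k ⊑ m) → skips b e ⨟ (J ⊞ q) ≡ skips B (e ⨟ q)
skips-⊞ done e q = refl
skips-⊞ (skip J) e q = cong skip (skips-⊞ J e q)
skips-⊞ (keep J) e q = cong skip (skips-⊞ J e q)

pts-⊞ : ∀ {b B j k m} (J : b ⊑ B) (t : Fin b) (e : j ⊑ k) (q : k ⊑ m) → pts t e ⨟ (J ⊞ q) ≡ pts (ix J t) (e ⨟ q)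
pts-⊞ (skip J) t e q = cong skip (pts-⊞ J t e q)
pts-⊞ (keep J) zero e q = cong keep (skips-⊞ J e q)
pts-⊞ (keep J) (suc t) e q = cong skip (pts-⊞ J t e q)

marked-blow : ∀ n {N N'} (J : N ⊑ N') → marked n N ⨟ blow n J ≡ marked n N'
marked-blow zero J = refl
marked-blow (suc n) J = cong keep (trans (skips-⊞ J (marked n _) (blow n J)) (cong (skips _) (marked-blow n J)))

free-blow : ∀ n {b B N N'} (J₁ : b ⊑ B) (J : N ⊑ N') ℓ t₁ t → free n b N ℓ t₁ t ⨟ (J₁ ⊞ blow n J) ≡ free n B N' ℓ (ix J₁ t₁) (ix J t)
free-blow n J₁ J zero t₁ t = trans (pts-⊞ J₁ t₁ (marked n _) (blow n J)) (cong (pts (ix J₁ t₁)) (marked-blow n J))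
free-blow (suc n) {N = N} J₁ J (suc ℓ) t₁ t = trans (skips-⊞ J₁ (keep (free n N N ℓ t t)) (blow (suc n) J)) (cong (skips _ ∘ keep) (free-blow n J J ℓ t t))

-- Sends `S` to the marked points and the other points of [m] into the blocks between them; every
-- block has room for `m` points. A set that extends `S` by one vertex becomes the marked points
-- with one free point, in the same role (`place-free`).
place : ∀ {n m} (S : n ⊑ m) b N → m ℕ.≤ b → m ℕ.≤ N → m ⊑ b ℕ.+ rest n N
place done b N p q = skips b done
place (skip S) (suc b) N (s≤s p) q = keep (place S b N p (ℕₚ.≤-trans (ℕₚ.n≤1+n _) q))
place (keep S) b N p q = skips b (keep (place S N N (ℕₚ.≤-trans (ℕₚ.n≤1+n _) q) (ℕₚ.≤-trans (ℕₚ.n≤1+n _) q)))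

place-marked : ∀ {n m} (S : n ⊑ m) b N p q → S ⨟ place S b N p q ≡ skips b (marked n N)
place-marked done b N p q = d-skips b done done
place-marked (skip S) (suc b) N (s≤s p) q = cong skip (place-marked S b N p _)
place-marked (keep S) b N p q = trans (d-skips b (keep S) (keep (place S N N _ _))) (cong (skips b ∘ keep) (place-marked S N N _ _))

0<Fin : ∀ {N m} → suc m ℕ.≤ N → Fin N
0<Fin (s≤s _) = zero

free-merge : ∀ n N ℓ t₁ t → Σ[ s ∈ Fin N ] free n N N ℓ t₁ t ≡ free n N N ℓ s s
free-merge n N zero t₁ t = t₁ , refl
free-merge (suc n) N (suc ℓ) t₁ t = t , refl

place-free : ∀ {n m} (S : n ⊑ m) b N p q (ℓ : Fin (suc n)) (e : suc n ⊑ m) → d ℓ ⨟ e ≡ S → Σ[ t₁ ∈ Fin b ] Σ[ t ∈ Fin N ] e ⨟ place S b N p q ≡ free n b N ℓ t₁ t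
place-free (skip S) (suc b) N (s≤s p) q zero (keep e) h = zero , 0<Fin q , cong keep (trans (cong (_⨟ place S b N p _) (trans (sym (⨟-idˡ e)) (skip-injective h))) (place-marked S b N p _))
place-free (skip S) (suc b) N (s≤s p) q ℓ (skip e) h with place-free S b N p (ℕₚ.≤-trans (ℕₚ.n≤1+n _) q) ℓ e (skip-injective h)
place-free (skip S) (suc b) N (s≤s p) q zero (skip e) h | t₁ , t , g = suc t₁ , t , cong skip g
place-free (skip {suc n} S) (suc b) N (s≤s p) q (suc ℓ) (skip e) h | t₁ , t , g = suc t₁ , t , cong skip g
place-free (keep S) b N p q (suc ℓ) (keep e) h with place-free S N N (ℕₚ.≤-trans (ℕₚ.n≤1+n _) q) (ℕₚ.≤-trans (ℕₚ.n≤1+n _) q) ℓ e (keep-injective h)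
... | t₁ , t , g with free-merge _ N ℓ t₁ t
... | s , g' = 0<Fin p , s , trans (d-skips b (keep e) (keep (place S N N _ _))) (cong (skips b ∘ keep) (trans g g'))
place-free {suc n} (skip S) b N p q (suc ℓ) (keep e) ()
place-free (keep S) b N p q ℓ (skip e) ()
place-free done b N p q ℓ () h

-- One free point in every block: an `n`-set, the centre, with one extension by a vertex in each of
-- the n + 1 roles. Overlaps are measured on such configurations.
conf : ℕ → ℕ
conf n = 1 ℕ.+ rest n 1

centre : ∀ n → n ⊑ conf n
centre n = skips 1 (marked n 1)

petal : ∀ n → Fin (suc n) → suc n ⊑ conf n
petal n ℓ = free n 1 1 ℓ zero zero

pt : ∀ {N} → Fin N → 1 ⊑ N
pt zero = keep none
pt (suc t) = skip (pt t)

ix-pt : ∀ {N} (t : Fin N) → ix (pt t) zero ≡ t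
ix-pt zero = refl
ix-pt (suc t) = cong suc (ix-pt t)

conf-at : ∀ n {N} → Fin N → conf n ⊑ N ℕ.+ rest n N
conf-at n t = pt t ⊞ blow n (pt t)

centre-at : ∀ n {N} (t : Fin N) → centre n ⨟ conf-at n t ≡ skips N (marked n N)
centre-at n t = trans (skips-⊞ (pt t) (marked n 1) (blow n (pt t))) (cong (skips _) (marked-blow n (pt t)))

petal-at : ∀ n {N} (t : Fin N) ℓ → petal n ℓ ⨟ conf-at n t ≡ free n N N ℓ t t
petal-at n {N} t ℓ = trans (free-blow n (pt t) (pt t) ℓ zero zero) (cong (λ s → free n N N ℓ s s) (ix-pt t))

-- Reduced hypergraphs: a probability vector on the colours A for every n-subset S of [M]

wt : ∀ {A} → Finite A → (β : A → ℚ) → (∀ a → 0ℚ ≤ β a) → Lin A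
∫ (wt P β p) f = ∫ (∑ P) (λ a → β a * f a)
∫+ (wt P β p) f g = trans (∫≡ (∑ P) (λ a → ℚₚ.*-distribˡ-+ (β a) (f a) (g a))) (∫+ (∑ P) (λ a → β a * f a) (λ a → β a * g a))
∫* (wt P β p) c f = trans (∫≡ (∑ P) (λ a → l (β a) c (f a))) (∫* (∑ P) c (λ a → β a * f a))
  where l : ∀ b c x → b * (c * x) ≡ c * (b * x)
        l = solve-∀ ℛ
∫≤ (wt P β p) q = ∫≤ (∑ P) (λ a → *-monoʳ (β a) (p a) (q a))

record Str {A : Set} (P : Finite A) (n M : ℕ) : Set where
  field
    β : n ⊑ M → A → ℚ
    β≥0 : ∀ S a → 0ℚ ≤ β S a
    β1 : ∀ S → ∫ (∑ P) (β S) ≡ 1ℚ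

open Str public

μ : ∀ {A} {P : Finite A} {n M} → Str P n M → n ⊑ M → Lin A
μ {P = P} s S = wt P (β s S) (β≥0 s S)

μ-mean : ∀ {A} {P : Finite A} {n M} (s : Str P n M) S → Mean (μ s S)
μ-mean {P = P} s S = trans (∫≡ (∑ P) (λ a → *-identityʳ (β s S a))) (β1 s S)

res : ∀ {A} {P : Finite A} {n m M} → m ⊑ M → Str P n M → Str P n m
β (res K s) S = β s (S ⨟ K)
β≥0 (res K s) S = β≥0 s (S ⨟ K)
β1 (res K s) S = β1 s (S ⨟ K)

trues : ∀ {N} (p : Fin N → Bool) → Σ[ c ∈ ℕ ] Σ[ J ∈ c ⊑ N ] ((∀ t → p (ix J t) ≡ true) × ν c ≡ ∫ (sumFin N) (λ t → ⟦ p t ⟧))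
trues {zero} p = 0 , done , (λ ()) , refl
trues {suc N} p = add (p zero) refl (trues (p ∘ suc))
  where
  add : ∀ b → p zero ≡ b → Σ[ c ∈ ℕ ] Σ[ J ∈ c ⊑ N ] ((∀ t → p (suc (ix J t)) ≡ true) × ν c ≡ ∫ (sumFin N) (λ t → ⟦ p (suc t) ⟧)) → Σ[ c ∈ ℕ ] Σ[ J ∈ c ⊑ suc N ] ((∀ t → p (ix J t) ≡ true) × ν c ≡ ∫ (sumFin (suc N)) (λ t → ⟦ p t ⟧))
  add true e (c , J , h , g) = suc c , keep J , (λ { zero → e ; (suc t) → h t }) , cong₂ (λ b x → ⟦ b ⟧ + x) (sym e) g
  add false e (c , J , h , g) = c , skip J , h , trans (sym (+-identityˡ (ν c))) (cong₂ (λ b x → ⟦ b ⟧ + x) (sym e) g)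

≤⇒⊑ : ∀ {m c} → m ℕ.≤ c → m ⊑ c
≤⇒⊑ z≤n = none
≤⇒⊑ (s≤s p) = keep (≤⇒⊑ p)

ix-⨟ : ∀ {k m n} (e : k ⊑ m) (I : m ⊑ n) t → ix (e ⨟ I) t ≡ ix I (ix e t)
ix-⨟ e (skip I) t = cong suc (ix-⨟ e I t)
ix-⨟ (skip e) (keep I) t = cong suc (ix-⨟ e I t)
ix-⨟ (keep e) (keep I) zero = refl
ix-⨟ done done ()
ix-⨟ (keep e) (keep I) (suc t) = cong suc (ix-⨟ e I t)

-- Double counting: if no point lay in `m` of the events, their measures would add up to at most m -
-- 1, but the total is at least `ν N * δ`.
common-point : ∀ {A : Set} (L : Lin A) → Mean L → ∀ {N} m δ (Y : Fin N → A → Bool) → ν m ≤ ν N * δ → (∀ t → δ ≤ ∫ L (λ a → ⟦ Y t a ⟧)) → DN (Σ[ α ∈ A ] Σ[ J ∈ m ⊑ N ] (∀ t → Y (ix J t) α ≡ true))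
common-point {A} L mean {N} m δ Y h δ≤ = λ k → contra (lt (ν m)) (≤-trans h (≤-trans (≤-reflexive total) (≤-trans (∫≤ (sumFin N) δ≤) (≤-trans (≤-reflexive (sym (sumFin-swap N L (λ a t → ⟦ Y t a ⟧)))) (mean-≤ L mean (λ a → few k a))))))
  where
  lt : ∀ x → x - 1ℚ < x
  lt x = <-by (l x) 0<1
    where l : ∀ x → x - (x - 1ℚ) ≡ 1ℚ
          l = solve-∀ ℛ
  total : ν N * δ ≡ ∫ (sumFin N) (λ _ → δ)
  total = trans (*-comm (ν N) δ) (trans (cong (δ *_) (sym (sumFin-1 N))) (sym (∫const (sumFin N) δ)))
  few : ¬ (Σ[ α ∈ A ] Σ[ J ∈ m ⊑ N ] (∀ t → Y (ix J t) α ≡ true)) → ∀ a → ∫ (sumFin N) (λ t → ⟦ Y t a ⟧) ≤ ν m - 1ℚ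
  few k a = go (trues (λ t → Y t a))
    where
    go : Σ[ c ∈ ℕ ] Σ[ J ∈ c ⊑ N ] ((∀ t → Y (ix J t) a ≡ true) × ν c ≡ ∫ (sumFin N) (λ t → ⟦ Y t a ⟧)) → ∫ (sumFin N) (λ t → ⟦ Y t a ⟧) ≤ ν m - 1ℚ
    go (c , J , g , e) with m ℕ.≤? c
    ... | yes p = ⊥-elim (k (a , ≤⇒⊑ p ⨟ J , λ t → trans (cong (λ i → Y i a) (ix-⨟ (≤⇒⊑ p) J t)) (g (ix (≤⇒⊑ p) t))))
    ... | no p = subst (_≤ ν m - 1ℚ) e (≤-by (r (ν m) (ν c)) (Δ (ν-mono (ℕₚ.≰⇒> p))))
      where r : ∀ m c → (m - 1ℚ) - c ≡ m - (1ℚ + c)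
            r = solve-∀ ℛ

module _ {n : ℕ} where

  -- `X ℓ e` collects the colours that are allowed on the face of `e` without its `ℓ`-th vertex.
  Family : Set → ℕ → Set
  Family A M = Fin (suc n) → suc n ⊑ M → A → Bool

  resX : ∀ {A m M} → m ⊑ M → Family A M → Family A m
  resX K X ℓ e = X ℓ (e ⨟ K)

  -- A single colour of the centre has to serve all roles at once, each role being tested on its own
  -- petal.
  Rich : ∀ {A} {P : Finite A} {M} → Str P n M → Family A M → ℚ → Set
  Rich {M = M} s X δ = ∀ (C : conf n ⊑ M) → δ ≤ ∫ (μ s (centre n ⨟ C)) (λ a → ⟦ allF (suc n) (λ ℓ → X ℓ (petal n ℓ ⨟ C) a) ⟧)

  Good : ∀ {A m M} → Family A M → m ⊑ M → n ⊑ m → Set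
  Good {A} {m} X U S = Σ[ α ∈ A ] (∀ ℓ e → d ℓ ⨟ e ≡ S → X ℓ (e ⨟ U) α ≡ true)

  rich-res : ∀ {A} {P : Finite A} {m M} {s : Str P n M} {X δ} (K : m ⊑ M) → (∀ (C : conf n ⊑ m) → δ ≤ ∫ (μ s (centre n ⨟ (C ⨟ K))) (λ a → ⟦ allF (suc n) (λ ℓ → X ℓ (petal n ℓ ⨟ (C ⨟ K)) a) ⟧)) → Rich (res K s) (resX K X) δ
  rich-res {s = s} {X} {δ} K h C = subst (δ ≤_) e (h C)
    where
    e : ∫ (μ s (centre n ⨟ (C ⨟ K))) (λ a → ⟦ allF (suc n) (λ ℓ → X ℓ (petal n ℓ ⨟ (C ⨟ K)) a) ⟧) ≡ ∫ (μ (res K s) (centre n ⨟ C)) (λ a → ⟦ allF (suc n) (λ ℓ → X ℓ ((petal n ℓ ⨟ C) ⨟ K) a) ⟧)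
    e = trans (cong (λ S → ∫ (μ s S) (λ a → ⟦ allF (suc n) (λ ℓ → X ℓ (petal n ℓ ⨟ (C ⨟ K)) a) ⟧)) (sym (⨟-assoc (centre n) C K)))
      (∫≡ (μ s ((centre n ⨟ C) ⨟ K)) (λ a → cong ⟦_⟧ (allF-cong (suc n) (λ ℓ → cong (λ e → X ℓ e a) (sym (⨟-assoc (petal n ℓ) C K))))))
      where
      allF-cong : ∀ m {p q : Fin m → Bool} → (∀ i → p i ≡ q i) → allF m p ≡ allF m q
      allF-cong zero h = refl
      allF-cong (suc m) h = cong₂ _∧_ (h zero) (allF-cong m (h ∘ suc))

  Chooses : ℚ → (∀ {A M} → Family A M → Set) → ℕ → Set₁
  Chooses δ Concl M = ∀ {A} {P : Finite A} (s : Str P n M) (X : Family A M) → Rich s X δ → DN (Concl X)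

  -- By Ramsey's theorem either all `m`-subsets are good for the position `S`, or a whole blow-up of
  -- `S` contains none that is. In the second case `common-point` finds a colour of the marked set
  -- that is shared by `m` indices, and the free points with these indices make a good subset after
  -- all. Goodness of every `U` survives passing to subsets, so the positions can be treated one
  -- after another.
  choose-one : ∀ {m} (S : n ⊑ m) δ → 0ℚ < δ → ∀ m₂ → Σ ℕ (Chooses δ (λ {A} {M} X → Σ[ K ∈ m₂ ⊑ M ] (∀ (U : m ⊑ m₂) → Good X (U ⨟ K) S)))
  choose-one {m} S δ δ>0 m₂ = go (archimedean (ν m * inv δ))
    where
    go : Σ[ N ∈ ℕ ] (ν m * inv δ ≤ ν N) → Σ ℕ (Chooses δ (λ {A} {M} X → Σ[ K ∈ m₂ ⊑ M ] (∀ (U : m ⊑ m₂) → Good X (U ⨟ K) S)))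
    go (N , hN) = ramseyℕ m m₂ (N ℕ.+ rest n N) , λ s X rich → ramseyDN m m₂ (N ℕ.+ rest n N) (λ U → Good X U S) >>= λ where
        (inj₁ p) → pure p
        (inj₂ (K , h)) → ⊥-elim (common-point (μ s (skips N (marked n N) ⨟ K)) (μ-mean s (skips N (marked n N) ⨟ K)) m δ
          (λ t a → allF (suc n) (λ ℓ → X ℓ (free n N N ℓ t t ⨟ K) a)) hδ (meas s X rich K) (λ (α , J , g) → h (U J) (α , good X K J α g)))
      where
      hδ : ν m ≤ ν N * δ
      hδ = ≤-trans (≤-reflexive (sym (trans (*-assoc (ν m) (inv δ) δ) (trans (cong (ν m *_) (trans (*-comm (inv δ) δ) (inv-r δ δ>0))) (*-identityʳ (ν m)))))) (*-monoˡ δ (<⇒≤ δ>0) hN)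
      U : m ⊑ N → m ⊑ N ℕ.+ rest n N
      U J = place S m m ℕₚ.≤-refl ℕₚ.≤-refl ⨟ (J ⊞ blow n J)
      meas : ∀ {A} {P : Finite A} {M} (s : Str P n M) (X : Family A M) → Rich s X δ → (K : N ℕ.+ rest n N ⊑ M) → ∀ t → δ ≤ ∫ (μ s (skips N (marked n N) ⨟ K)) (λ a → ⟦ allF (suc n) (λ ℓ → X ℓ (free n N N ℓ t t ⨟ K) a) ⟧)
      meas s X rich K t = ≤-trans (rich-res {s = s} {X = X} K (λ C → rich (C ⨟ K)) (conf-at n t)) (≤-trans (≤-reflexive (cong (λ S → ∫ (μ s (S ⨟ K)) (λ a → ⟦ allF (suc n) (λ ℓ → X ℓ ((petal n ℓ ⨟ conf-at n t) ⨟ K) a) ⟧)) (centre-at n t)))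
        (∫≤ (μ s (skips N (marked n N) ⨟ K)) (λ a → ⟦⟧-mono (λ h → allF-intro (suc n) (λ ℓ → X ℓ (free n N N ℓ t t ⨟ K) a) (λ ℓ → subst (λ e → X ℓ (e ⨟ K) a ≡ true) (petal-at n t ℓ) (allF-elim (suc n) (λ ℓ → X ℓ ((petal n ℓ ⨟ conf-at n t) ⨟ K) a) h ℓ))))))
      good : ∀ {A M} (X : Family A M) (K : N ℕ.+ rest n N ⊑ M) J α → (∀ t → allF (suc n) (λ ℓ → X ℓ (free n N N ℓ (ix J t) (ix J t) ⨟ K) α) ≡ true) → ∀ ℓ e → d ℓ ⨟ e ≡ S → X ℓ (e ⨟ (U J ⨟ K)) α ≡ true
      good X K J α g ℓ e h = at (place-free S m m ℕₚ.≤-refl ℕₚ.≤-refl ℓ e h)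
        where
        at : Σ[ t₁ ∈ Fin m ] Σ[ t ∈ Fin m ] e ⨟ place S m m ℕₚ.≤-refl ℕₚ.≤-refl ≡ free n m m ℓ t₁ t → X ℓ (e ⨟ (U J ⨟ K)) α ≡ true
        at (t₁ , t , p) = at' (free-merge n m ℓ t₁ t)
          where
          at' : Σ[ r ∈ Fin m ] free n m m ℓ t₁ t ≡ free n m m ℓ r r → X ℓ (e ⨟ (U J ⨟ K)) α ≡ true
          at' (r , q) = subst (λ e → X ℓ e α ≡ true) (sym eq) (allF-elim (suc n) (λ ℓ → X ℓ (free n N N ℓ (ix J r) (ix J r) ⨟ K) α) (g r) ℓ)
            where
            eq : e ⨟ (U J ⨟ K) ≡ free n N N ℓ (ix J r) (ix J r) ⨟ K
            eq = trans (sym (⨟-assoc e (U J) K)) (cong (_⨟ K) (trans (sym (⨟-assoc e (place S m m ℕₚ.≤-refl ℕₚ.≤-refl) (J ⊞ blow n J))) (trans (cong (_⨟ (J ⊞ blow n J)) (trans p q)) (free-blow n J J ℓ r r))))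

  choose-list : ∀ {m} (l : List (n ⊑ m)) δ → 0ℚ < δ → Σ ℕ (Chooses δ (λ {A} {M} X → Σ[ K ∈ m ⊑ M ] (∀ {S} → S ∈ l → Good X K S)))
  choose-list {m} [] δ δ>0 = m , λ s X rich → pure (idT , λ ())
  choose-list {m} (S₀ ∷ l) δ δ>0 = go (choose-list l δ δ>0)
    where
    go : Σ ℕ (Chooses δ (λ {A} {M} X → Σ[ K ∈ m ⊑ M ] (∀ {S} → S ∈ l → Good X K S))) → Σ ℕ (Chooses δ (λ {A} {M} X → Σ[ K ∈ m ⊑ M ] (∀ {S} → S ∈ (S₀ ∷ l) → Good X K S)))
    go (M' , h) = proj₁ (choose-one S₀ δ δ>0 M') , λ s X rich → proj₂ (choose-one S₀ δ δ>0 M') s X rich >>= λ (K , g) → h (res K s) (resX K X) (rich-res {s = s} {X = X} K (λ C → rich (C ⨟ K))) >>= λ (K' , g') →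
      pure (K' ⨟ K , λ where
        (here refl) → g K'
        (there p) → let α , q = g' p in α , λ ℓ e r → subst (λ e → X ℓ e α ≡ true) (⨟-assoc e K' K) (q ℓ e r))

  opaque
    choose : ∀ m δ → 0ℚ < δ → Σ ℕ (Chooses δ (λ {A} {M} X → Σ[ K ∈ m ⊑ M ] Σ[ α ∈ (n ⊑ m → A) ] (∀ ℓ e → X ℓ (e ⨟ K) (α (d ℓ ⨟ e)) ≡ true)))
    choose m δ δ>0 = proj₁ c , λ s X rich → proj₂ c s X rich >>= λ (K , g) → pure (K , (λ S → proj₁ (g (thins-complete S))) , λ ℓ e → proj₂ (g (thins-complete (d ℓ ⨟ e))) ℓ e refl)
      where
      c : Σ ℕ (Chooses δ (λ {A} {M} X → Σ[ K ∈ m ⊑ M ] (∀ {S} → S ∈ thins n m → Good X K S)))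
      c = choose-list (thins n m) δ δ>0

-- Independent colours on the faces of one `k`-set.

hlin : ∀ {A L} → Vec (Lin A) L → Lin (Vec A L)
∫ (hlin []) f = f []
∫ (hlin (K ∷ Ks)) f = ∫ K (λ a → ∫ (hlin Ks) (λ v → f (a ∷ v)))
∫+ (hlin []) f g = refl
∫+ (hlin (K ∷ Ks)) f g = trans (∫≡ K (λ a → ∫+ (hlin Ks) (λ v → f (a ∷ v)) (λ v → g (a ∷ v)))) (∫+ K (λ a → ∫ (hlin Ks) (λ v → f (a ∷ v))) (λ a → ∫ (hlin Ks) (λ v → g (a ∷ v))))
∫* (hlin []) c f = refl
∫* (hlin (K ∷ Ks)) c f = trans (∫≡ K (λ a → ∫* (hlin Ks) c (λ v → f (a ∷ v)))) (∫* K c (λ a → ∫ (hlin Ks) (λ v → f (a ∷ v))))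
∫≤ (hlin []) p = p []
∫≤ (hlin (K ∷ Ks)) p = ∫≤ K (λ a → ∫≤ (hlin Ks) (λ v → p (a ∷ v)))

hlin-mean : ∀ {A L} (Ks : Vec (Lin A) L) → (∀ i → Mean (lookup Ks i)) → Mean (hlin Ks)
hlin-mean [] p = refl
hlin-mean (K ∷ Ks) p = trans (∫≡ K (λ _ → hlin-mean Ks (p ∘ suc))) (p zero)

-- Bringing one chosen factor to the outside lets an event be bounded colour by colour in that role.
hlin-extract : ∀ {A L} (Ks : Vec (Lin A) (suc L)) → (∀ i → Swap (lookup Ks i)) → ∀ i f → ∫ (hlin Ks) f ≡ ∫ (lookup Ks i) (λ a → ∫ (hlin (Vec.removeAt Ks i)) (λ v → f (Vec.insertAt v i a)))
hlin-extract (K ∷ Ks) sw zero f = refl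
hlin-extract {L = suc L} (K ∷ Ks@(_ ∷ _)) sw (suc i) f = trans (∫≡ K (λ b → hlin-extract Ks (sw ∘ suc) i (λ v → f (b ∷ v)))) (sw (suc i) K (λ b a → ∫ (hlin (Vec.removeAt Ks i)) (λ v → f (b ∷ Vec.insertAt v i a))))

hlin-prod : ∀ {A L} (Ks : Vec (Lin A) L) (X : Fin L → A → Bool) → ∫ (hlin Ks) (λ v → ⟦ allF L (λ i → X i (lookup v i)) ⟧) ≡ prodF L (λ i → ∫ (lookup Ks i) (λ a → ⟦ X i a ⟧))
hlin-prod [] X = refl
hlin-prod {L = suc L} (K ∷ Ks) X = trans (∫≡ K (λ a → trans (∫≡ (hlin Ks) (λ v → ⟦∧⟧ (X zero a) (allF L (λ i → X (suc i) (lookup v i))))) (trans (∫* (hlin Ks) ⟦ X zero a ⟧ (λ v → ⟦ allF L (λ i → X (suc i) (lookup v i)) ⟧)) (cong (⟦ X zero a ⟧ *_) (hlin-prod Ks (X ∘ suc)))))) (∫*ʳ K (prodF L (λ i → ∫ (lookup Ks i) (λ a → ⟦ X (suc i) a ⟧))) (λ a → ⟦ X zero a ⟧))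

wt-swap : ∀ {A} (P : Finite A) → Swap (∑ P) → ∀ β p → Swap (wt P β p)
wt-swap P sw β p L f = trans (sw L (λ a b → β b * f a b)) (∫≡ (∑ P) (λ b → ∫* L (β b) (λ a → f a b)))

opaque
  leᵇ : ℚ → ℚ → Bool
  leᵇ x y = ⌊ x ℚₚ.≤? y ⌋

  leᵇ-true : ∀ x y → leᵇ x y ≡ true → x ≤ y
  leᵇ-true x y p with x ℚₚ.≤? y
  ... | yes q = q

  leᵇ-false : ∀ x y → leᵇ x y ≡ false → y ≤ x
  leᵇ-false x y p with x ℚₚ.≤? y
  ... | no q = <⇒≤ (ℚₚ.≰⇒> q)

  -- Integrated, this says that a function bounded by 1 with mean at least 2ε is at least ε on a set
  -- of measure at least ε.
  split-≤ : ∀ x ε → 0ℚ ≤ ε → x ≤ 1ℚ → x ≤ ⟦ leᵇ ε x ⟧ + ε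
  split-≤ x ε ε≥0 h with ε ℚₚ.≤? x
  ... | yes _ = ≤-trans h (≤-by (l ε) ε≥0)
    where l : ∀ x → (1ℚ + x) - 1ℚ ≡ x
          l = solve-∀ ℛ
  ... | no q = ≤-trans (<⇒≤ (ℚₚ.≰⇒> q)) (≤-reflexive (sym (+-identityˡ ε)))

cancel-+ : ∀ a b c → a + c ≤ b + c → a ≤ b
cancel-+ a b c h = ≤-by (l a b c) (Δ h)
  where l : ∀ a b c → b - a ≡ (b + c) - (a + c)
        l = solve-∀ ℛ

½½ : ∀ a → a ≡ a * half + a * half
½½ = solve-∀ ℛ

module _ {n : ℕ} where

  laws : ∀ {A} {P : Finite A} {M L} → Str P n M → suc n ⊑ M → Vec (Fin (suc n)) L → Vec (Lin A) L
  laws s e ps = Vec.map (λ p → μ s (d p ⨟ e)) ps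

  lookup-laws : ∀ {A} {P : Finite A} {M L} (s : Str P n M) e (ps : Vec (Fin (suc n)) L) i → lookup (laws s e ps) i ≡ μ s (d (lookup ps i) ⨟ e)
  lookup-laws s e ps i = Vecₚ.lookup-map i (λ p → μ s (d p ⨟ e)) ps

  opaque
    -- `ps` need not contain every role: a colour that has been chosen already is built into `R`,
    -- and only the remaining ones are random.
    mass : ∀ {A} {P : Finite A} {M L} → Str P n M → suc n ⊑ M → Vec (Fin (suc n)) L → (Vec A L → Bool) → ℚ
    mass s e ps R = ∫ (hlin (laws s e ps)) (λ v → ⟦ R v ⟧)

    mass-def : ∀ {A} {P : Finite A} {M L} (s : Str P n M) e (ps : Vec (Fin (suc n)) L) R → mass s e ps R ≡ ∫ (hlin (laws s e ps)) (λ v → ⟦ R v ⟧)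
    mass-def s e ps R = refl

    mass-[] : ∀ {A} {P : Finite A} {M} (s : Str P n M) e (R : Vec A 0 → Bool) → mass s e [] R ≡ ⟦ R [] ⟧
    mass-[] s e R = refl

    mass-∷ : ∀ {A} {P : Finite A} {M L} (s : Str P n M) e p (ps : Vec (Fin (suc n)) L) R → mass s e (p ∷ ps) R ≡ ∫ (μ s (d p ⨟ e)) (λ a → mass s e ps (λ v → R (a ∷ v)))
    mass-∷ s e p ps R = refl

  laws-mean : ∀ {A} {P : Finite A} {M L} (s : Str P n M) e (ps : Vec (Fin (suc n)) L) → Mean (hlin (laws s e ps))
  laws-mean s e ps = hlin-mean (laws s e ps) (λ i → subst Mean (sym (lookup-laws s e ps i)) (μ-mean s (d (lookup ps i) ⨟ e)))

  mass≤1 : ∀ {A} {P : Finite A} {M L} (s : Str P n M) e (ps : Vec (Fin (suc n)) L) R → mass s e ps R ≤ 1ℚ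
  mass≤1 s e ps R = ≤-trans (≤-reflexive (mass-def s e ps R)) (mean-≤ (hlin (laws s e ps)) (laws-mean s e ps) {λ v → ⟦ R v ⟧} (λ v → ⟦⟧≤1 (R v)))

  mass-res : ∀ {A} {P : Finite A} {m M L} (s : Str P n M) (K : m ⊑ M) e (ps : Vec (Fin (suc n)) L) R → mass (res K s) e ps R ≡ mass s (e ⨟ K) ps R
  mass-res s K e ps R = trans (mass-def (res K s) e ps R) (trans (cong (λ Ks → ∫ (hlin Ks) (λ v → ⟦ R v ⟧)) (Vecₚ.map-cong (λ p → cong (μ s) (⨟-assoc (d p) e K)) ps)) (sym (mass-def s (e ⨟ K) ps R)))

  pick : ∀ {A : Set} {f L} → Vec (Fin (suc n)) L → suc n ⊑ f → Vec (n ⊑ f → A) L → Vec A L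
  pick ps e αs = Vec.zipWith (λ p α → α (d p ⨟ e)) ps αs

  only : ∀ {A M} → Fin (suc n) → (suc n ⊑ M → A → Bool) → Family {n} A M
  only p φ ℓ e a = if eqFin ℓ p then φ e a else true

  only-at : ∀ {A M} p (φ : suc n ⊑ M → A → Bool) e a → only p φ p e a ≡ φ e a
  only-at p φ e a rewrite ==-refl (finiteFin (suc n)) p = refl

  only-intro : ∀ {A M} p (φ : suc n ⊑ M → A → Bool) (E : Fin (suc n) → suc n ⊑ M) a → φ (E p) a ≡ true → ∀ ℓ → only p φ ℓ (E ℓ) a ≡ true
  only-intro p φ E a h ℓ with eqFin ℓ p in q
  ... | false = refl
  ... | true = subst (λ ℓ → φ (E ℓ) a ≡ true) (sym (==⇒≡ (finiteFin (suc n)) {ℓ} {p} q)) h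

  only-rich : ∀ {A} {P : Finite A} {M} (s : Str P n M) p (φ : suc n ⊑ M → A → Bool) δ → (∀ C → δ ≤ ∫ (μ s (centre n ⨟ C)) (λ a → ⟦ φ (petal n p ⨟ C) a ⟧)) → Rich s (only p φ) δ
  only-rich s p φ δ h C = ≤-trans (h C) (∫≤ (μ s (centre n ⨟ C)) {λ a → ⟦ φ (petal n p ⨟ C) a ⟧} {λ a → ⟦ allF (suc n) (λ ℓ → only p φ ℓ (petal n ℓ ⨟ C) a) ⟧} (λ a → ⟦⟧-mono {φ (petal n p ⨟ C) a} {allF (suc n) (λ ℓ → only p φ ℓ (petal n ℓ ⨟ C) a)} (λ t → allF-intro (suc n) (λ ℓ → only p φ ℓ (petal n ℓ ⨟ C) a) (only-intro p φ (λ ℓ → petal n ℓ ⨟ C) a t))))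

  petal-centre : ∀ {M} p (C : conf n ⊑ M) → d p ⨟ (petal n p ⨟ C) ≡ centre n ⨟ C
  petal-centre p C = trans (sym (⨟-assoc (d p) (petal n p) C)) (cong (_⨟ C) (d-free n 1 1 p zero zero))

  -- The reduced form of the fact that patterns with a vanishing ordering appear at every positive
  -- density: each role in `ps` receives its own colouring of the `n`-sets, and no relation between
  -- different roles is imposed.
  Vanish : ∀ {L} → Vec (Fin (suc n)) L → ℕ → ℚ → ℕ → Set₁
  Vanish {L} ps f ε M = ∀ {A} {P : Finite A} (s : Str P n M) (R : suc n ⊑ M → Vec A L → Bool) → (∀ e → ε ≤ mass s e ps (R e)) → DN (Σ[ K ∈ f ⊑ M ] Σ[ αs ∈ Vec (n ⊑ f → A) L ] (∀ e → R (e ⨟ K) (pick ps e αs) ≡ true))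

  -- Roles are fixed one at a time; each fixed role costs half of the mass.
  opaque
    vanish : ∀ {L} (ps : Vec (Fin (suc n)) L) f ε → 0ℚ < ε → Σ ℕ (Vanish ps f ε)
    vanish [] f ε ε>0 = f , λ s R h → pure (idT , [] , λ e → pos (R (e ⨟ idT) []) (subst (ε ≤_) (mass-[] s (e ⨟ idT) (R (e ⨟ idT))) (h (e ⨟ idT))))
      where
      pos : ∀ b → ε ≤ ⟦ b ⟧ → b ≡ true
      pos true _ = refl
      pos false p = contra ε>0 p
    vanish {suc L} (p ∷ ps) f ε ε>0 = go (vanish ps f ε' ε'>0)
      where
      ε' : ℚ
      ε' = ε * half
      ε'>0 : 0ℚ < ε'
      ε'>0 = *-pos ε>0 0<half
      go : Σ ℕ (Vanish ps f ε') → Σ ℕ (Vanish (p ∷ ps) f ε)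
      go (M' , rec) = go' (choose M' ε' ε'>0)
        where
        go' : Σ ℕ (Chooses ε' (λ {A} {M} X → Σ[ K ∈ M' ⊑ M ] Σ[ α ∈ (n ⊑ M' → A) ] (∀ ℓ e → X ℓ (e ⨟ K) (α (d ℓ ⨟ e)) ≡ true))) → Σ ℕ (Vanish (p ∷ ps) f ε)
        go' (M , ch) = M , run
          where
          run : Vanish (p ∷ ps) f ε M
          run {A} {P} s R h = ch s (only p φ) rich >>= λ (K , α , g) → rec (res K s) (λ e v → R (e ⨟ K) (α (d p ⨟ e) ∷ v)) (λ e → subst (ε' ≤_) (sym (mass-res s K e ps (λ v → R (e ⨟ K) (α (d p ⨟ e) ∷ v)))) (leᵇ-true ε' (m (e ⨟ K) (α (d p ⨟ e))) (trans (sym (only-at p φ (e ⨟ K) (α (d p ⨟ e)))) (g p e)))) >>= λ (K' , αs , g') →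
              pure (K' ⨟ K , (λ S → α (S ⨟ K')) ∷ αs , λ e → subst₂ (λ e₁ S → R e₁ (α S ∷ pick ps e αs) ≡ true) (⨟-assoc e K' K) (sym (⨟-assoc (d p) e K')) (g' e))
            where
            m : suc n ⊑ M → A → ℚ
            m e a = mass s e ps (λ v → R e (a ∷ v))
            φ : suc n ⊑ M → A → Bool
            φ e a = leᵇ ε' (m e a)
            ptwise : ∀ e a → m e a ≤ ⟦ φ e a ⟧ + ε'
            ptwise e a = split-≤ (m e a) ε' (<⇒≤ ε'>0) (mass≤1 s e ps (λ v → R e (a ∷ v)))
            rich : Rich s (only p φ) ε'
            rich = only-rich s p φ ε' λ C → cancel-+ ε' (X C) ε' (step C)
              where
              E : conf n ⊑ M → suc n ⊑ M
              E C = petal n p ⨟ C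
              X : conf n ⊑ M → ℚ
              X C = ∫ (μ s (centre n ⨟ C)) (λ a → ⟦ φ (E C) a ⟧)
              step : ∀ C → ε' + ε' ≤ X C + ε'
              step C = begin
                  ε' + ε'                                                          ≡⟨ sym (½½ ε) ⟩
                  ε                                                                ≤⟨ subst (ε ≤_) (mass-∷ s (E C) p ps (R (E C))) (h (E C)) ⟩
                  ∫ (μ s (d p ⨟ E C)) (m (E C))                                    ≡⟨ cong (λ S → ∫ (μ s S) (m (E C))) (petal-centre p C) ⟩
                  ∫ (μ s (centre n ⨟ C)) (m (E C))                                 ≤⟨ ∫≤ (μ s (centre n ⨟ C)) (ptwise (E C)) ⟩
                  ∫ (μ s (centre n ⨟ C)) (λ a → ⟦ φ (E C) a ⟧ + ε')                ≡⟨ ∫+ (μ s (centre n ⨟ C)) (λ a → ⟦ φ (E C) a ⟧) (λ _ → ε') ⟩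
                  X C + ∫ (μ s (centre n ⨟ C)) (λ _ → ε')                          ≡⟨ cong (X C +_) (mean-const (μ s (centre n ⨟ C)) (μ-mean s (centre n ⨟ C)) ε') ⟩
                  X C + ε'                                                         ∎
                where open ℚₚ.≤-Reasoning

-- Making finitely many quantities almost constant.

Rounds1 : ℕ → ℚ → ℕ → ℕ → ℕ → Set
Rounds1 k h j m M = ∀ (x : k ⊑ M → ℚ) → (∀ e → ν j * h ≤ x e) → (∀ e → x e ≤ 1ℚ) → DN (Σ[ K ∈ m ⊑ M ] Σ[ y ∈ ℚ ] (∀ e → (y ≤ x (e ⨟ K)) × (x (e ⨟ K) ≤ y + h)))

Rounds : ℕ → ℚ → ℕ → ℕ → ℕ → Set
Rounds k h L m M = ∀ (x : Fin L → k ⊑ M → ℚ) → (∀ ℓ e → 0ℚ ≤ x ℓ e) → (∀ ℓ e → x ℓ e ≤ 1ℚ) → DN (Σ[ K ∈ m ⊑ M ] Σ[ y ∈ (Fin L → ℚ) ] (∀ ℓ e → (y ℓ ≤ x ℓ (e ⨟ K)) × (x ℓ (e ⨟ K) ≤ y ℓ + h)))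

-- The size depends on the option `b`, because the pair of roles that wins determines how many
-- vertices the later steps consume.
Homogeneous : ∀ {B : Set} → ℕ → (B → ℕ) → List B → ℕ → Set₁
Homogeneous {B} cs size l M = ∀ (P : B → cs ⊑ M → Set) → (∀ C → ¬ (∀ {b} → b ∈ l → ¬ P b C)) → DN (Σ[ b ∈ B ] Σ[ K ∈ size b ⊑ M ] (b ∈ l × (∀ C → P b (C ⨟ K))))

opaque
  -- Climbs a grid of width `h`: by Ramsey's theorem all values reach the next grid point on a large
  -- subset, or all stay below it and hence lie in one interval. `fuel` counts the grid steps left
  -- before 1.
  round : ∀ k h → 0ℚ < h → ∀ fuel j → 1ℚ ≤ ν (fuel ℕ.+ j) * h → ∀ m → Σ ℕ (Rounds1 k h j m)
  round k h h>0 zero j p m = m , λ x lo hi → pure (idT , ν j * h , λ e → lo (e ⨟ idT) , ≤-trans (hi (e ⨟ idT)) (≤-trans p (≤-by (l (ν j * h) h) (<⇒≤ h>0))))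
    where l : ∀ a h → (a + h) - a ≡ h
          l = solve-∀ ℛ
  round k h h>0 (suc fuel) j p m = M , λ x lo hi → ramseyDN k M' m (λ e → ν (suc j) * h ≤ x e) >>= λ where
      (inj₁ (K , g)) → proj₂ r (λ e → x (e ⨟ K)) g (λ e → hi (e ⨟ K)) >>= λ (K' , y , g') → pure (K' ⨟ K , y , λ e → subst (λ e → (y ≤ x e) × (x e ≤ y + h)) (⨟-assoc e K' K) (g' e))
      (inj₂ (K , g)) → pure (K , ν j * h , λ e → lo (e ⨟ K) , ≤-trans (<⇒≤ (ℚₚ.≰⇒> (g e))) (≤-reflexive (l (ν j) h)))
    where
    r : Σ ℕ (Rounds1 k h (suc j) m)
    r = round k h h>0 fuel (suc j) (subst (λ i → 1ℚ ≤ ν i * h) (sym (ℕₚ.+-suc fuel j)) p) m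
    M' : ℕ
    M' = proj₁ r
    M : ℕ
    M = ramseyℕ k M' m
    l : ∀ j h → (1ℚ + j) * h ≡ j * h + h
    l = solve-∀ ℛ

  rounds : ∀ k h → 0ℚ < h → ∀ L m → Σ ℕ (Rounds k h L m)
  rounds k h h>0 zero m = m , λ x _ _ → pure (idT , (λ ()) , λ ())
  rounds k h h>0 (suc L) m = proj₁ r₁ , λ x lo hi → proj₂ r₁ (x zero) (λ e → subst (_≤ x zero e) (sym (*-zeroˡ h)) (lo zero e)) (hi zero) >>= λ (K , y , g) → proj₂ r (λ ℓ e → x (suc ℓ) (e ⨟ K)) (λ ℓ e → lo (suc ℓ) (e ⨟ K)) (λ ℓ e → hi (suc ℓ) (e ⨟ K)) >>= λ (K' , y' , g') →
      pure (K' ⨟ K , (λ { zero → y ; (suc ℓ) → y' ℓ }) , λ where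
        zero e → subst (λ e → (y ≤ x zero e) × (x zero e ≤ y + h)) (⨟-assoc e K' K) (g (e ⨟ K'))
        (suc ℓ) e → subst (λ e → (y' ℓ ≤ x (suc ℓ) e) × (x (suc ℓ) e ≤ y' ℓ + h)) (⨟-assoc e K' K) (g' ℓ e))
    where
    r : Σ ℕ (Rounds k h L m)
    r = rounds k h h>0 L m
    N : Σ[ N ∈ ℕ ] (1ℚ ≤ ν N * h)
    N = archimedean⁻¹ h h>0
    r₁ : Σ ℕ (Rounds1 k h 0 (proj₁ r))
    r₁ = round k h h>0 (proj₁ N) 0 (subst (λ i → 1ℚ ≤ ν i * h) (sym (ℕₚ.+-identityʳ (proj₁ N))) (proj₂ N)) (proj₁ r)

  homogeneous : ∀ {B : Set} cs (size : B → ℕ) (l : List B) → Σ ℕ (Homogeneous cs size l)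
  homogeneous cs size [] = cs , λ P h → ⊥-elim (h idT (λ ()))
  homogeneous cs size (b ∷ l) = ramseyℕ cs (size b) (proj₁ r) , λ P h → ramseyDN cs (size b) (proj₁ r) (P b) >>= λ where
      (inj₁ (K , g)) → pure (b , K , here refl , g)
      (inj₂ (K , g)) → proj₂ r (λ b C → P b (C ⨟ K)) (λ C q → h (C ⨟ K) (λ where
          (here refl) → g C
          (there m) → q m)) >>= λ (b' , K' , m , g') → pure (b' , K' ⨟ K , there m , λ C → subst (P b') (⨟-assoc C K' K) (g' C))
    where
    r : Σ ℕ (Homogeneous cs size l)
    r = homogeneous cs size l

-- Bounding a sum of measures by pairwise overlaps.

overlaps : ∀ L → (Fin L → Bool) → ℚ
overlaps zero Y = 0ℚ
overlaps (suc L) Y = ∫ (sumFin L) (λ j → ⟦ Y zero ∧ Y (suc j) ⟧) + overlaps L (Y ∘ suc)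

-- If `s` of the events occur, s - 1 is at most the number of pairs among them.
sum≤1+overlaps : ∀ L (Y : Fin L → Bool) → ∫ (sumFin L) (λ i → ⟦ Y i ⟧) ≤ 1ℚ + overlaps L Y
sum≤1+overlaps zero Y = 0≤1
sum≤1+overlaps (suc L) Y with Y zero
... | true = ≤-by (l (∫ (sumFin L) (λ i → ⟦ Y (suc i) ⟧)) (overlaps L (Y ∘ suc))) (overlaps≥0 L (Y ∘ suc))
  where
  l : ∀ s o → (1ℚ + (s + o)) - (1ℚ + s) ≡ o
  l = solve-∀ ℛ
  overlaps≥0 : ∀ L (Y : Fin L → Bool) → 0ℚ ≤ overlaps L Y
  overlaps≥0 zero Y = ≤-refl
  overlaps≥0 (suc L) Y = ∫≥0 (sumFin L) (λ j → ⟦⟧≥0 (Y zero ∧ Y (suc j))) ⊕ overlaps≥0 L (Y ∘ suc)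
... | false = ≤-trans (≤-trans (≤-reflexive (+-identityˡ (∫ (sumFin L) (λ i → ⟦ Y (suc i) ⟧)))) (sum≤1+overlaps L (Y ∘ suc))) (≤-reflexive (cong (1ℚ +_) (trans (sym (+-identityˡ (overlaps L (Y ∘ suc)))) (cong (_+ overlaps L (Y ∘ suc)) (sym (∫0 (sumFin L)))))))

overlaps-small : ∀ {A} (K : Lin A) L (Y : Fin L → A → Bool) δ → 0ℚ ≤ δ → (∀ i j → i Fin.< j → ∫ K (λ a → ⟦ Y i a ∧ Y j a ⟧) ≤ δ) → ∫ K (λ a → overlaps L (λ i → Y i a)) ≤ ν L * (ν L * δ)
overlaps-small K zero Y δ δ≥0 h = ≤-reflexive (trans (∫0 K) (sym (*-zeroˡ (0ℚ * δ))))
overlaps-small K (suc L) Y δ δ≥0 h = ≤-trans (≤-reflexive (∫+ K (λ a → ∫ (sumFin L) (λ j → ⟦ Y zero a ∧ Y (suc j) a ⟧)) (λ a → overlaps L (λ i → Y (suc i) a))))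
  (≤-trans (+-mono-≤ (≤-trans (≤-reflexive (sumFin-swap L K (λ a j → ⟦ Y zero a ∧ Y (suc j) a ⟧))) (≤-trans (∫≤ (sumFin L) (λ j → h zero (suc j) (s≤s z≤n))) (≤-reflexive (trans (∫const (sumFin L) δ) (cong (δ *_) (sumFin-1 L))))))
    (overlaps-small K L (Y ∘ suc) δ δ≥0 (λ i j p → h (suc i) (suc j) (s≤s p))))
  (≤-by (l (ν L) δ) (δ≥0 ⊕ (ν≥0 L ⊗ δ≥0))))
  where l : ∀ L δ → (1ℚ + L) * ((1ℚ + L) * δ) - (δ * L + L * (L * δ)) ≡ δ + L * δ
        l = solve-∀ ℛ

removeAt-map : ∀ {A B : Set} {L} (f : A → B) (xs : Vec A (suc L)) i → Vec.removeAt (Vec.map f xs) i ≡ Vec.map f (Vec.removeAt xs i)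
removeAt-map f (x ∷ xs) zero = refl
removeAt-map f (x ∷ xs@(_ ∷ _)) (suc i) = cong (f x ∷_) (removeAt-map f xs i)

zipWith-insertAt : ∀ {A B C : Set} {L} (f : A → B → C) (ps : Vec A (suc L)) (αs : Vec B L) i c → Vec.zipWith f ps (Vec.insertAt αs i c) ≡ Vec.insertAt (Vec.zipWith f (Vec.removeAt ps i) αs) i (f (lookup ps i) c)
zipWith-insertAt f (p ∷ ps) αs zero c = refl
zipWith-insertAt f (p ∷ ps@(_ ∷ _)) (α ∷ αs) (suc i) c = cong (f p α ∷_) (zipWith-insertAt f ps αs i c)

-- The theorem on reduced hypergraphs.

module Reduced (n : ℕ) where
  k = suc n

  roles : Vec (Fin k) k
  roles = Vec.allFin k

  lookup-roles : ∀ ℓ → lookup roles ℓ ≡ ℓ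
  lookup-roles ℓ = Vecₚ.lookup-allFin ℓ

  others : Fin k → Vec (Fin k) n
  others ℓ = Vec.removeAt roles ℓ

  ins : ∀ {A : Set} {M} → (k ⊑ M → Vec A k → Bool) → Fin k → k ⊑ M → A → Vec A n → Bool
  ins R ℓ e a v = R e (Vec.insertAt v ℓ a)

  module Projections {A : Set} {P : Finite A} (sw : Swap (∑ P)) {M : ℕ} (s : Str P n M) (R : k ⊑ M → Vec A k → Bool) (ε : ℚ) (ε≥0 : 0ℚ ≤ ε) where

    -- The measure of the ways to complete a colour of face `ℓ`. The projections `X ℓ e` keep only
    -- colours with a substantial link, so that `vanish` can later be applied to that link.
    link : Fin k → k ⊑ M → A → ℚ
    link ℓ e a = mass s e (others ℓ) (ins R ℓ e a)

    X : Fin k → k ⊑ M → A → Bool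
    X ℓ e a = leᵇ ε (link ℓ e a)

    x : Fin k → k ⊑ M → ℚ
    x ℓ e = ∫ (μ s (d ℓ ⨟ e)) (λ a → ⟦ X ℓ e a ⟧)

    x≥0 : ∀ ℓ e → 0ℚ ≤ x ℓ e
    x≥0 ℓ e = ∫≥0 (μ s (d ℓ ⨟ e)) {λ a → ⟦ X ℓ e a ⟧} (λ a → ⟦⟧≥0 (X ℓ e a))

    x≤1 : ∀ ℓ e → x ℓ e ≤ 1ℚ
    x≤1 ℓ e = mean-≤ (μ s (d ℓ ⨟ e)) (μ-mean s (d ℓ ⨟ e)) {λ a → ⟦ X ℓ e a ⟧} (λ a → ⟦⟧≤1 (X ℓ e a))

    module _ (e : k ⊑ M) where
      H : Lin (Vec A k)
      H = hlin (laws s e roles)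
      lookup-law : ∀ ℓ → lookup (laws s e roles) ℓ ≡ μ s (d ℓ ⨟ e)
      lookup-law ℓ = trans (lookup-laws s e roles ℓ) (cong (λ i → μ s (d i ⨟ e)) (lookup-roles ℓ))
      miss-X : Fin k → Vec A k → Bool
      miss-X ℓ v = R e v ∧ not (X ℓ e (lookup v ℓ))
      cover : ∀ v → ⟦ R e v ⟧ ≤ ⟦ allF k (λ ℓ → X ℓ e (lookup v ℓ)) ⟧ + ∫ (sumFin k) (λ ℓ → ⟦ miss-X ℓ v ⟧)
      cover v = go k (λ ℓ → X ℓ e (lookup v ℓ)) (R e v)
        where
        l : ∀ a b c → (0ℚ + (a + c)) - a ≡ c
        l = solve-∀ ℛ
        go : ∀ L (p : Fin L → Bool) r → ⟦ r ⟧ ≤ ⟦ allF L p ⟧ + ∫ (sumFin L) (λ ℓ → ⟦ r ∧ not (p ℓ) ⟧)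
        go zero p r = ≤-trans (⟦⟧≤1 r) (≤-reflexive (sym (+-identityʳ 1ℚ)))
        go (suc L) p r with p zero
        ... | true = ≤-trans (go L (p ∘ suc) r) (+-mono-≤ (≤-refl {⟦ allF L (p ∘ suc) ⟧}) (≤-trans (≤-reflexive (sym (+-identityˡ (∫ (sumFin L) (λ ℓ → ⟦ r ∧ not (p (suc ℓ)) ⟧))))) (+-mono-≤ (⟦⟧≥0 (r ∧ false)) (≤-refl {∫ (sumFin L) (λ ℓ → ⟦ r ∧ not (p (suc ℓ)) ⟧)}))))
        ... | false rewrite Boolₚ.∧-identityʳ r = ≤-by (l ⟦ r ⟧ 0ℚ (∫ (sumFin L) (λ ℓ → ⟦ r ∧ not (p (suc ℓ)) ⟧))) (∫≥0 (sumFin L) (λ ℓ → ⟦⟧≥0 (r ∧ not (p (suc ℓ)))))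
      miss-small : ∀ ℓ → ∫ H (λ v → ⟦ miss-X ℓ v ⟧) ≤ ε
      miss-small ℓ = begin
          ∫ H (λ v → ⟦ miss-X ℓ v ⟧)
            ≡⟨ hlin-extract (laws s e roles) (λ i → subst Swap (sym (lookup-law i)) (wt-swap P sw (β s (d i ⨟ e)) (β≥0 s (d i ⨟ e)))) ℓ (λ v → ⟦ miss-X ℓ v ⟧) ⟩
          ∫ (lookup (laws s e roles) ℓ) (λ a → ∫ (hlin (Vec.removeAt (laws s e roles) ℓ)) (λ v → ⟦ miss-X ℓ (Vec.insertAt v ℓ a) ⟧))
            ≤⟨ mean-≤ (lookup (laws s e roles) ℓ) (subst Mean (sym (lookup-law ℓ)) (μ-mean s (d ℓ ⨟ e))) {λ a → ∫ (hlin (Vec.removeAt (laws s e roles) ℓ)) (λ v → ⟦ miss-X ℓ (Vec.insertAt v ℓ a) ⟧)} small ⟩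
          ε ∎
        where
        open ℚₚ.≤-Reasoning
        small : ∀ a → ∫ (hlin (Vec.removeAt (laws s e roles) ℓ)) (λ v → ⟦ miss-X ℓ (Vec.insertAt v ℓ a) ⟧) ≤ ε
        small a = subst (λ Ks → ∫ (hlin Ks) (λ v → ⟦ miss-X ℓ (Vec.insertAt v ℓ a) ⟧) ≤ ε) (sym (removeAt-map (λ p → μ s (d p ⨟ e)) roles ℓ)) (subst (_≤ ε) (∫≡ K (λ v → cong (λ b → ⟦ R e (Vec.insertAt v ℓ a) ∧ not (X ℓ e b) ⟧) (sym (Vecₚ.insertAt-lookup v ℓ a)))) (go (X ℓ e a) refl))
          where
          K = hlin (laws s e (others ℓ))
          go : ∀ b → X ℓ e a ≡ b → ∫ K (λ v → ⟦ R e (Vec.insertAt v ℓ a) ∧ not (X ℓ e a) ⟧) ≤ ε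
          go true p = ≤-trans (≤-reflexive (trans (∫≡ K (λ v → trans (cong (λ b → ⟦ R e (Vec.insertAt v ℓ a) ∧ not b ⟧) p) (cong ⟦_⟧ (Boolₚ.∧-zeroʳ (R e (Vec.insertAt v ℓ a)))))) (∫0 K))) ε≥0
          go false p = ≤-trans (≤-reflexive (∫≡ K (λ v → trans (cong (λ b → ⟦ R e (Vec.insertAt v ℓ a) ∧ not b ⟧) p) (cong ⟦_⟧ (Boolₚ.∧-identityʳ (R e (Vec.insertAt v ℓ a))))))) (≤-trans (≤-reflexive (sym (mass-def s e (others ℓ) (ins R ℓ e a)))) (leᵇ-false ε (link ℓ e a) p))
      -- A tuple of `R` outside the product of the projections has a colour whose link is below `ε`;
      -- for each role this costs at most `ε`. The product itself has measure ∏ x by independence.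
      mass≤prod : mass s e roles (R e) ≤ prodF k (λ ℓ → x ℓ e) + ν k * ε
      mass≤prod = begin
          mass s e roles (R e)
            ≡⟨ mass-def s e roles (R e) ⟩
          ∫ H (λ v → ⟦ R e v ⟧)
            ≤⟨ ∫≤ H cover ⟩
          ∫ H (λ v → ⟦ allF k (λ ℓ → X ℓ e (lookup v ℓ)) ⟧ + ∫ (sumFin k) (λ ℓ → ⟦ miss-X ℓ v ⟧))
            ≡⟨ ∫+ H (λ v → ⟦ allF k (λ ℓ → X ℓ e (lookup v ℓ)) ⟧) (λ v → ∫ (sumFin k) (λ ℓ → ⟦ miss-X ℓ v ⟧)) ⟩
          ∫ H (λ v → ⟦ allF k (λ ℓ → X ℓ e (lookup v ℓ)) ⟧) + ∫ H (λ v → ∫ (sumFin k) (λ ℓ → ⟦ miss-X ℓ v ⟧))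
            ≡⟨ cong₂ _+_ (trans (hlin-prod (laws s e roles) (λ ℓ → X ℓ e)) (prodF-cong k (λ ℓ → cong (λ K → ∫ K (λ a → ⟦ X ℓ e a ⟧)) (lookup-law ℓ)))) (sumFin-swap k H (λ v ℓ → ⟦ miss-X ℓ v ⟧)) ⟩
          prodF k (λ ℓ → x ℓ e) + ∫ (sumFin k) (λ ℓ → ∫ H (λ v → ⟦ miss-X ℓ v ⟧))
            ≤⟨ +-mono-≤ (≤-refl {prodF k (λ ℓ → x ℓ e)}) (∫≤ (sumFin k) {λ ℓ → ∫ H (λ v → ⟦ miss-X ℓ v ⟧)} miss-small) ⟩
          prodF k (λ ℓ → x ℓ e) + ∫ (sumFin k) (λ _ → ε)
            ≡⟨ cong (prodF k (λ ℓ → x ℓ e) +_) (trans (∫const (sumFin k) ε) (trans (cong (ε *_) (sumFin-1 k)) (*-comm ε (ν k)))) ⟩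
          prodF k (λ ℓ → x ℓ e) + ν k * ε ∎
        where
        open ℚₚ.≤-Reasoning
        prodF-cong : ∀ L {f g : Fin L → ℚ} → (∀ i → f i ≡ g i) → prodF L f ≡ prodF L g
        prodF-cong zero h = refl
        prodF-cong (suc L) h = cong₂ _*_ (h zero) (prodF-cong L (h ∘ suc))

  pairs : List (Fin k × Fin k)
  pairs = List.filter (λ (i , j) → i Finₚ.<? j) (List.cartesianProduct (List.allFin k) (List.allFin k))

  pairs-complete : ∀ i j → i Fin.< j → (i , j) ∈ pairs
  pairs-complete i j p = ∈-filter⁺ (λ (i , j) → i Finₚ.<? j) (∈-cartesianProduct⁺ (∈-allFin i) (∈-allFin j)) p

  pairs-< : ∀ {i j} → (i , j) ∈ pairs → i Fin.< j
  pairs-< m = proj₂ (∈-filter⁻ (λ (i , j) → i Finₚ.<? j) {xs = List.cartesianProduct (List.allFin k) (List.allFin k)} m)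

  Shared : ∀ {A M} → ℕ → (k ⊑ M → Vec A k → Bool) → Set
  Shared {A} {M} f R = Σ[ i ∈ Fin k ] Σ[ j ∈ Fin k ] (i Fin.< j × Σ[ K ∈ f ⊑ M ] Σ[ a ∈ Vec (n ⊑ f → A) k ] Σ[ b ∈ Vec (n ⊑ f → A) k ]
    ((∀ S → lookup a i S ≡ lookup b j S) × (∀ e → R (e ⨟ K) (pick roles e a) ≡ true) × (∀ e → R (e ⨟ K) (pick roles e b) ≡ true)))

  ReducedThm : ℕ → ℚ → ℕ → Set₁
  ReducedThm f c M = ∀ {A} {P : Finite A} (sw : Swap (∑ P)) (s : Str P n M) (R : k ⊑ M → Vec A k → Bool) → (∀ e → c ≤ mass s e roles (R e)) → DN (Shared f R)

pick-map : ∀ {n} {A : Set} {f m L} (ps : Vec (Fin (suc n)) L) (e : suc n ⊑ f) (K : f ⊑ m) (αs : Vec (n ⊑ m → A) L) → pick ps e (Vec.map (λ α S → α (S ⨟ K)) αs) ≡ pick ps (e ⨟ K) αs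
pick-map [] e K [] = refl
pick-map (p ∷ ps) e K (α ∷ αs) = cong₂ _∷_ (cong α (⨟-assoc (d p) e K)) (pick-map ps e K αs)

module _ (n : ℕ) where
  open Reduced n

  pick-insert : ∀ {A : Set} {f} (e : k ⊑ f) i (αs : Vec (n ⊑ f → A) n) c → pick roles e (Vec.insertAt αs i c) ≡ Vec.insertAt (pick (others i) e αs) i (c (d i ⨟ e))
  pick-insert e i αs c = trans (zipWith-insertAt (λ p α → α (d p ⨟ e)) roles αs i c) (cong (λ p → Vec.insertAt (pick (others i) e αs) i (c (d p ⨟ e))) (lookup-roles i))

  Choice : ℕ → ℚ → ℕ → Set₁
  Choice m δ = Chooses δ (λ {A} {M} X → Σ[ K ∈ m ⊑ M ] Σ[ α ∈ (n ⊑ m → A) ] (∀ ℓ e → X ℓ (e ⨟ K) (α (d ℓ ⨟ e)) ≡ true))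

  -- The common colour is chosen first. With it fixed in role `i` the other roles are filled by
  -- `vanish`, and then once more with it fixed in role `j`. Every step passes to a subset, hence
  -- the nested sizes, built from `f` upwards.
  module Fixed (f : ℕ) (ε δ : ℚ) (i j : Fin k) (M₂ M₁ size : ℕ) (van₂ : Vanish (others j) f ε M₂) (van₁ : Vanish (others i) M₂ ε M₁) (cho : Choice M₁ δ size) where

    module _ {A : Set} {P : Finite A} {M : ℕ} (s : Str P n M) (R : k ⊑ M → Vec A k → Bool) (φ ψ : k ⊑ M → A → Bool)
             (φ-link : ∀ e a → φ e a ≡ true → ε ≤ mass s e (others i) (ins R i e a))
             (ψ-link : ∀ e a → ψ e a ≡ true → ε ≤ mass s e (others j) (ins R j e a)) where
      Y : Family {n} A M
      Y ℓ e a = only i φ ℓ e a ∧ only j ψ ℓ e a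
      Yᵢ : ∀ e a → Y i e a ≡ true → φ e a ≡ true
      Yᵢ e a t = trans (sym (only-at i φ e a)) (∧ˡ (only i φ i e a) (only j ψ i e a) t)
      Yⱼ : ∀ e a → Y j e a ≡ true → ψ e a ≡ true
      Yⱼ e a t = trans (sym (only-at j ψ e a)) (∧ʳ (only i φ j e a) (only j ψ j e a) t)
      shared : i Fin.< j → (L : size ⊑ M) → (∀ C → δ ≤ ∫ (μ s (centre n ⨟ (C ⨟ L))) (λ a → ⟦ φ (petal n i ⨟ (C ⨟ L)) a ∧ ψ (petal n j ⨟ (C ⨟ L)) a ⟧)) → DN (Shared f R)
      shared i<j L h = cho (res L s) (resX L Y) (rich-res {s = s} {X = Y} L richY) >>= step₀
        where
        richY : ∀ C → δ ≤ ∫ (μ s (centre n ⨟ (C ⨟ L))) (λ a → ⟦ allF k (λ ℓ → Y ℓ (petal n ℓ ⨟ (C ⨟ L)) a) ⟧)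
        richY C = ≤-trans (h C) (∫≤ (μ s (centre n ⨟ (C ⨟ L))) {λ a → ⟦ φ (E i) a ∧ ψ (E j) a ⟧} {λ a → ⟦ allF k (λ ℓ → Y ℓ (E ℓ) a) ⟧} (λ a → ⟦⟧-mono {φ (E i) a ∧ ψ (E j) a} {allF k (λ ℓ → Y ℓ (E ℓ) a)} (λ t → allF-intro k (λ ℓ → Y ℓ (E ℓ) a) (λ ℓ → ∧-intro (only-intro i (φ) E a (∧ˡ (φ (E i) a) (ψ (E j) a) t) ℓ) (only-intro j (ψ) E a (∧ʳ (φ (E i) a) (ψ (E j) a) t) ℓ)))))
          where E : Fin k → k ⊑ M
                E ℓ = petal n ℓ ⨟ (C ⨟ L)
        h₁ : (K₀ : M₁ ⊑ size) (c : n ⊑ M₁ → A) → (∀ ℓ e → Y ℓ ((e ⨟ K₀) ⨟ L) (c (d ℓ ⨟ e)) ≡ true) → ∀ e → ε ≤ mass (res K₀ (res L s)) e (others i) (ins R i ((e ⨟ K₀) ⨟ L) (c (d i ⨟ e)))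
        h₁ K₀ c g e = subst (ε ≤_) (sym (trans (mass-res (res L s) K₀ e (others i) (ins R i ((e ⨟ K₀) ⨟ L) (c (d i ⨟ e)))) (mass-res s L (e ⨟ K₀) (others i) (ins R i ((e ⨟ K₀) ⨟ L) (c (d i ⨟ e)))))) (φ-link ((e ⨟ K₀) ⨟ L) (c (d i ⨟ e)) (Yᵢ ((e ⨟ K₀) ⨟ L) (c (d i ⨟ e)) (g i e)))
        h₂ : (K₀ : M₁ ⊑ size) (c : n ⊑ M₁ → A) → (∀ ℓ e → Y ℓ ((e ⨟ K₀) ⨟ L) (c (d ℓ ⨟ e)) ≡ true) → (K₁ : M₂ ⊑ M₁) → ∀ e → ε ≤ mass (res K₁ (res K₀ (res L s))) e (others j) (ins R j (((e ⨟ K₁) ⨟ K₀) ⨟ L) (c (d j ⨟ (e ⨟ K₁))))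
        h₂ K₀ c g K₁ e = subst (ε ≤_) (sym (trans (mass-res (res K₀ (res L s)) K₁ e (others j) (ins R j (((e ⨟ K₁) ⨟ K₀) ⨟ L) (c (d j ⨟ (e ⨟ K₁))))) (trans (mass-res (res L s) K₀ (e ⨟ K₁) (others j) (ins R j (((e ⨟ K₁) ⨟ K₀) ⨟ L) (c (d j ⨟ (e ⨟ K₁))))) (mass-res s L ((e ⨟ K₁) ⨟ K₀) (others j) (ins R j (((e ⨟ K₁) ⨟ K₀) ⨟ L) (c (d j ⨟ (e ⨟ K₁)))))))) (ψ-link (((e ⨟ K₁) ⨟ K₀) ⨟ L) (c (d j ⨟ (e ⨟ K₁))) (Yⱼ (((e ⨟ K₁) ⨟ K₀) ⨟ L) (c (d j ⨟ (e ⨟ K₁))) (g j (e ⨟ K₁))))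
        result : ∀ {m m'} (K₀ : m ⊑ size) (K₁ : m' ⊑ m) (K₂ : f ⊑ m') (c : n ⊑ m → A) (α₁ : Vec (n ⊑ m' → A) n) (α₂ : Vec (n ⊑ f → A) n) → (∀ (e : k ⊑ m') → ins R i (((e ⨟ K₁) ⨟ K₀) ⨟ L) (c (d i ⨟ (e ⨟ K₁))) (pick (others i) e α₁) ≡ true) → (∀ (e : k ⊑ f) → ins R j ((((e ⨟ K₂) ⨟ K₁) ⨟ K₀) ⨟ L) (c (d j ⨟ ((e ⨟ K₂) ⨟ K₁))) (pick (others j) e α₂) ≡ true) → Shared f R
        result K₀ K₁ K₂ c α₁ α₂ g₁ g₂ = i , j , i<j , K₂ ⨟ (K₁ ⨟ (K₀ ⨟ L)) , a , b , (λ S → trans (cong (λ φ → φ S) (Vecₚ.insertAt-lookup (Vec.map (λ α S → α (S ⨟ K₂)) α₁) i c')) (sym (cong (λ φ → φ S) (Vecₚ.insertAt-lookup α₂ j c')))) , ga , gb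
          where
          c' : n ⊑ f → A
          c' S = c ((S ⨟ K₂) ⨟ K₁)
          a b : Vec (n ⊑ f → A) k
          a = Vec.insertAt (Vec.map (λ α S → α (S ⨟ K₂)) α₁) i c'
          b = Vec.insertAt α₂ j c'
          full : ∀ (e : k ⊑ f) → ((((e ⨟ K₂) ⨟ K₁) ⨟ K₀) ⨟ L) ≡ e ⨟ (K₂ ⨟ (K₁ ⨟ (K₀ ⨟ L)))
          full e = trans (⨟-assoc ((e ⨟ K₂) ⨟ K₁) K₀ L) (trans (⨟-assoc (e ⨟ K₂) K₁ (K₀ ⨟ L)) (⨟-assoc e K₂ (K₁ ⨟ (K₀ ⨟ L))))
          shift : ∀ ℓ (e : k ⊑ f) → c (d ℓ ⨟ ((e ⨟ K₂) ⨟ K₁)) ≡ c' (d ℓ ⨟ e)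
          shift ℓ e = cong c (sym (trans (cong (_⨟ K₁) (⨟-assoc (d ℓ) e K₂)) (⨟-assoc (d ℓ) (e ⨟ K₂) K₁)))
          ga : ∀ e → R (e ⨟ (K₂ ⨟ (K₁ ⨟ (K₀ ⨟ L)))) (pick roles e a) ≡ true
          ga e = trans (cong₂ R (sym (full e)) (trans (pick-insert e i (Vec.map (λ α S → α (S ⨟ K₂)) α₁) c') (cong₂ (λ v x → Vec.insertAt v i x) (pick-map (others i) e K₂ α₁) (sym (shift i e))))) (g₁ (e ⨟ K₂))
          gb : ∀ e → R (e ⨟ (K₂ ⨟ (K₁ ⨟ (K₀ ⨟ L)))) (pick roles e b) ≡ true
          gb e = trans (cong₂ R (sym (full e)) (trans (pick-insert e j α₂ c') (cong (Vec.insertAt (pick (others j) e α₂) j) (sym (shift j e))))) (g₂ e)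
        step₁ : (K₀ : M₁ ⊑ size) (c : n ⊑ M₁ → A) → (∀ ℓ e → Y ℓ ((e ⨟ K₀) ⨟ L) (c (d ℓ ⨟ e)) ≡ true) → Σ[ K₁ ∈ M₂ ⊑ M₁ ] Σ[ α₁ ∈ Vec (n ⊑ M₂ → A) n ] (∀ e → ins R i (((e ⨟ K₁) ⨟ K₀) ⨟ L) (c (d i ⨟ (e ⨟ K₁))) (pick (others i) e α₁) ≡ true) → DN (Shared f R)
        step₁ K₀ c g (K₁ , α₁ , g₁) = van₂ (res K₁ (res K₀ (res L s))) (λ e → ins R j (((e ⨟ K₁) ⨟ K₀) ⨟ L) (c (d j ⨟ (e ⨟ K₁)))) (h₂ K₀ c g K₁) >>= λ (K₂ , α₂ , g₂) → pure (result K₀ K₁ K₂ c α₁ α₂ g₁ g₂)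
        step₀ : Σ[ K₀ ∈ M₁ ⊑ size ] Σ[ c ∈ (n ⊑ M₁ → A) ] (∀ ℓ e → Y ℓ ((e ⨟ K₀) ⨟ L) (c (d ℓ ⨟ e)) ≡ true) → DN (Shared f R)
        step₀ (K₀ , c , g) = van₁ (res K₀ (res L s)) (λ e → ins R i ((e ⨟ K₀) ⨟ L) (c (d i ⨟ e))) (h₁ K₀ c g) >>= step₁ K₀ c g

  module Constants (f : ℕ) (c : ℚ) (c-big : 1ℚ < c * ν k ^ℚ k) where
    Q = ν k ^ℚ k
    Tgap = c * Q - 1ℚ
    Tgap>0 : 0ℚ < Tgap
    Tgap>0 = Δ< c-big
    D = ν k * Q
    D>0 : 0ℚ < D
    D>0 = *-pos (ν-pos n) (^ℚ-pos k (ν-pos n))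
    -- Half of the excess `Tgap` pays for the loss `ν k * ε` in `mass≤prod`, so `c'` times k^k still
    -- exceeds 1.
    ε = (Tgap * half) * inv D
    ε>0 : 0ℚ < ε
    ε>0 = *-pos (*-pos Tgap>0 0<half) (inv-pos D D>0)
    Dε : D * ε ≡ Tgap * half
    Dε = trans (r D (Tgap * half) (inv D)) (trans (cong (_* (Tgap * half)) (inv-r D D>0)) (*-identityˡ (Tgap * half)))
      where r : ∀ D t i → D * (t * i) ≡ (D * i) * t
            r = solve-∀ ℛ
    c' = c - ν k * ε
    c'-big : 1ℚ < c' * Q
    c'-big = <-by (trans (r c (ν k) ε Q half) (trans (cong (λ z → (c * Q - 1ℚ) - z) Dε) (r' Tgap))) (*-pos Tgap>0 0<half)
      where r : ∀ c k ε Q h → (c - k * ε) * Q - 1ℚ ≡ (c * Q - 1ℚ) - k * Q * ε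
            r = solve-∀ ℛ
            r' : ∀ t → t - t * half ≡ t * half
            r' = solve-∀ ℛ
    gap = sum-gap k c' c'-big
    ξ = proj₁ gap
    ξ>0 : 0ℚ < ξ
    ξ>0 = proj₁ (proj₂ gap)
    -- Rounding all `k` measures costs ξ/2. With the `δ` below, the overlaps cost at most
    -- `ν k * (ν k * δ)`, which is ξ/4, and another ξ/4 is left for the contradiction.
    h = (ξ * half) * inv (ν k)
    h>0 : 0ℚ < h
    h>0 = *-pos (*-pos ξ>0 0<half) (inv-pos (ν k) (ν-pos n))
    kh : ν k * h ≡ ξ * half
    kh = trans (r (ν k) (ξ * half) (inv (ν k))) (trans (cong (_* (ξ * half)) (inv-r (ν k) (ν-pos n))) (*-identityˡ (ξ * half)))
      where r : ∀ D t i → D * (t * i) ≡ (D * i) * t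
            r = solve-∀ ℛ
    δ = (h * half) * inv (ν k)
    δ>0 : 0ℚ < δ
    δ>0 = *-pos (*-pos h>0 0<half) (inv-pos (ν k) (ν-pos n))
    kkδ : ν k * (ν k * δ) ≡ (ξ * half) * half
    kkδ = trans (cong (ν k *_) (trans (r (ν k) (h * half) (inv (ν k))) (trans (cong (_* (h * half)) (inv-r (ν k) (ν-pos n))) (*-identityˡ (h * half))))) (trans (sym (*-assoc (ν k) h half)) (cong (_* half) kh))
      where r : ∀ D t i → D * (t * i) ≡ (D * i) * t
            r = solve-∀ ℛ

    van₂ : ∀ j → Σ ℕ (Vanish (others j) f ε)
    van₂ j = vanish (others j) f ε ε>0
    van₁ : ∀ i j → Σ ℕ (Vanish (others i) (proj₁ (van₂ j)) ε)
    van₁ i j = vanish (others i) (proj₁ (van₂ j)) ε ε>0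
    cho : ∀ i j → Σ ℕ (Choice (proj₁ (van₁ i j)) δ)
    cho i j = choose (proj₁ (van₁ i j)) δ δ>0
    sizes : Fin k × Fin k → ℕ
    sizes (i , j) = proj₁ (cho i j)
    hom : Σ ℕ (Homogeneous (conf n) sizes pairs)
    hom = homogeneous (conf n) sizes pairs
    rnd : Σ ℕ (Rounds k h k (proj₁ hom))
    rnd = rounds k h h>0 k (proj₁ hom)

    module _ {A : Set} {P : Finite A} (sw : Swap (∑ P)) (s : Str P n (proj₁ rnd)) (R : k ⊑ proj₁ rnd → Vec A k → Bool) (big : ∀ e → c ≤ mass s e roles (R e)) where
      open Projections sw s R ε (<⇒≤ ε>0)
      Pair : (K : proj₁ hom ⊑ proj₁ rnd) → Fin k × Fin k → conf n ⊑ proj₁ hom → Set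
      Pair K (i , j) C = δ ≤ ∫ (μ s (centre n ⨟ (C ⨟ K))) (λ a → ⟦ X i (petal n i ⨟ (C ⨟ K)) a ∧ X j (petal n j ⨟ (C ⨟ K)) a ⟧)
      -- The lower bound on the product is read off at the single edge `E zero`, while the measures
      -- on the centre come from all petals; the common approximate values `y` connect the two.
      -- Without an overlap of measure `δ` the `y` would add up to at most 1 + ξ/4, too little for
      -- `sum-gap` even after adding the rounding error.
      some-pair : (K : proj₁ hom ⊑ proj₁ rnd) (y : Fin k → ℚ) → (∀ ℓ e → (y ℓ ≤ x ℓ (e ⨟ K)) × (x ℓ (e ⨟ K) ≤ y ℓ + h)) → ∀ C → ¬ (∀ {b} → b ∈ pairs → ¬ Pair K b C)
      some-pair K y g C none-big = contra (<-by (r ξ) (*-pos (*-pos ξ>0 0<half) 0<half)) (cancel-+ (1ℚ + ξ) (1ℚ + (ξ * half) * half + ξ * half) 0ℚ (subst₂ _≤_ (sym (+-identityʳ (1ℚ + ξ))) (sym (+-identityʳ (1ℚ + (ξ * half) * half + ξ * half))) chain))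
        where
        r : ∀ ξ → (1ℚ + ξ) - (1ℚ + (ξ * half) * half + ξ * half) ≡ (ξ * half) * half
        r = solve-∀ ℛ
        S = centre n ⨟ (C ⨟ K)
        E : Fin k → k ⊑ proj₁ rnd
        E ℓ = petal n ℓ ⨟ (C ⨟ K)
        g' : ∀ ℓ₁ ℓ → (y ℓ ≤ x ℓ (E ℓ₁)) × (x ℓ (E ℓ₁) ≤ y ℓ + h)
        g' ℓ₁ ℓ = subst (λ e → (y ℓ ≤ x ℓ e) × (x ℓ e ≤ y ℓ + h)) (⨟-assoc (petal n ℓ₁) C K) (g ℓ (petal n ℓ₁ ⨟ C))
        yh≥0 : ∀ ℓ → 0ℚ ≤ y ℓ + h
        yh≥0 ℓ = ≤-trans (x≥0 ℓ (E zero)) (proj₂ (g' zero ℓ))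
        prod-big : c' ≤ prodF k (λ ℓ → y ℓ + h)
        prod-big = ≤-trans (cancel-+ c' (prodF k (λ ℓ → x ℓ (E zero))) (ν k * ε) (≤-trans (≤-reflexive (undiff (ν k * ε) c)) (≤-trans (big (E zero)) (mass≤prod (E zero))))) (prodF-mono k (λ ℓ → x≥0 ℓ (E zero)) (λ ℓ → proj₂ (g' zero ℓ)))
        x-centre : ∀ ℓ → x ℓ (E ℓ) ≡ ∫ (μ s S) (λ a → ⟦ X ℓ (E ℓ) a ⟧)
        x-centre ℓ = cong (λ S → ∫ (μ s S) (λ a → ⟦ X ℓ (E ℓ) a ⟧)) (petal-centre ℓ (C ⨟ K))
        sum-y : ∫ (sumFin k) y ≤ 1ℚ + (ξ * half) * half
        sum-y = begin
            ∫ (sumFin k) y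
              ≤⟨ ∫≤ (sumFin k) {y} {λ ℓ → ∫ (μ s S) (λ a → ⟦ X ℓ (E ℓ) a ⟧)} (λ ℓ → subst (y ℓ ≤_) (x-centre ℓ) (proj₁ (g' ℓ ℓ))) ⟩
            ∫ (sumFin k) (λ ℓ → ∫ (μ s S) (λ a → ⟦ X ℓ (E ℓ) a ⟧))
              ≡⟨ sym (sumFin-swap k (μ s S) (λ a ℓ → ⟦ X ℓ (E ℓ) a ⟧)) ⟩
            ∫ (μ s S) (λ a → ∫ (sumFin k) (λ ℓ → ⟦ X ℓ (E ℓ) a ⟧))
              ≤⟨ ∫≤ (μ s S) {λ a → ∫ (sumFin k) (λ ℓ → ⟦ X ℓ (E ℓ) a ⟧)} {λ a → 1ℚ + overlaps k (λ ℓ → X ℓ (E ℓ) a)} (λ a → sum≤1+overlaps k (λ ℓ → X ℓ (E ℓ) a)) ⟩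
            ∫ (μ s S) (λ a → 1ℚ + overlaps k (λ ℓ → X ℓ (E ℓ) a))
              ≡⟨ trans (∫+ (μ s S) (λ _ → 1ℚ) (λ a → overlaps k (λ ℓ → X ℓ (E ℓ) a))) (cong (_+ ∫ (μ s S) (λ a → overlaps k (λ ℓ → X ℓ (E ℓ) a))) (μ-mean s S)) ⟩
            1ℚ + ∫ (μ s S) (λ a → overlaps k (λ ℓ → X ℓ (E ℓ) a))
              ≤⟨ +-mono-≤ (≤-refl {1ℚ}) (overlaps-small (μ s S) k (λ ℓ → X ℓ (E ℓ)) δ (<⇒≤ δ>0) (λ i j p → <⇒≤ (ℚₚ.≰⇒> (none-big (pairs-complete i j p))))) ⟩
            1ℚ + ν k * (ν k * δ)
              ≡⟨ cong (1ℚ +_) kkδ ⟩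
            1ℚ + (ξ * half) * half ∎
          where open ℚₚ.≤-Reasoning
        chain : 1ℚ + ξ ≤ 1ℚ + (ξ * half) * half + ξ * half
        chain = begin
            1ℚ + ξ
              ≤⟨ proj₂ (proj₂ gap) (λ ℓ → y ℓ + h) yh≥0 prod-big ⟩
            ∫ (sumFin k) (λ ℓ → y ℓ + h)
              ≡⟨ trans (∫+ (sumFin k) y (λ _ → h)) (cong (∫ (sumFin k) y +_) (trans (∫const (sumFin k) h) (trans (cong (h *_) (sumFin-1 k)) (trans (*-comm h (ν k)) kh)))) ⟩
            ∫ (sumFin k) y + ξ * half
              ≤⟨ +-mono-≤ sum-y (≤-refl {ξ * half}) ⟩
            1ℚ + (ξ * half) * half + ξ * half ∎
          where open ℚₚ.≤-Reasoning
      conclude : DN (Shared f R)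
      conclude = proj₂ rnd x x≥0 x≤1 >>= λ (K , y , g) → proj₂ hom (Pair K) (some-pair K y g) >>= λ ((i , j) , L , m , q) →
        Fixed.shared f ε δ i j (proj₁ (van₂ j)) (proj₁ (van₁ i j)) (proj₁ (cho i j)) (proj₂ (van₂ j)) (proj₂ (van₁ i j)) (proj₂ (cho i j)) s R (X i) (X j) (λ e a → leᵇ-true ε (link i e a)) (λ e a → leᵇ-true ε (link j e a)) (pairs-< m) (L ⨟ K) (λ C → subst (λ C' → δ ≤ ∫ (μ s (centre n ⨟ C')) (λ a → ⟦ X i (petal n i ⨟ C') a ∧ X j (petal n j ⨟ C') a ⟧)) (⨟-assoc C L K) (q C))

  opaque
    reduced-theorem : ∀ f c → 1ℚ < c * ν k ^ℚ k → Σ ℕ (ReducedThm f c)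
    reduced-theorem f c p = proj₁ (Constants.rnd f c p) , λ sw s R big → Constants.conclude f c p sw s R big

-- Conditional means and their energy.

ratio-cancel : ∀ F m → 0ℚ ≤ F → F ≤ m → F * inv m * m ≡ F
ratio-cancel F m F≥0 F≤m = go (nonneg-cases (≤-trans F≥0 F≤m))
  where
  r : ∀ F i m → F * i * m ≡ F * (m * i)
  r = solve-∀ ℛ
  go : (0ℚ < m) ⊎ (0ℚ ≡ m) → F * inv m * m ≡ F
  go (inj₁ m>0) = trans (r F (inv m) m) (trans (cong (F *_) (inv-r m m>0)) (*-identityʳ F))
  go (inj₂ m≡0) = trans (cong (F * inv m *_) (sym m≡0)) (trans (*-zeroʳ (F * inv m)) (ℚₚ.≤-antisym F≥0 (subst (F ≤_) (sym m≡0) F≤m)))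

ratio-range : ∀ F m → 0ℚ ≤ F → F ≤ m → (0ℚ ≤ F * inv m) × (F * inv m ≤ 1ℚ)
ratio-range F m F≥0 F≤m = go (nonneg-cases (≤-trans F≥0 F≤m))
  where
  go : (0ℚ < m) ⊎ (0ℚ ≡ m) → (0ℚ ≤ F * inv m) × (F * inv m ≤ 1ℚ)
  go (inj₁ m>0) = F≥0 ⊗ <⇒≤ (inv-pos m m>0) , ≤-trans (*-monoˡ (inv m) (<⇒≤ (inv-pos m m>0)) F≤m) (≤-reflexive (inv-r m m>0))
  go (inj₂ m≡0) = ≤-reflexive (sym z) , ≤-trans (≤-reflexive z) 0≤1
    where
    z : F * inv m ≡ 0ℚ
    z = trans (cong (_* inv m) (ℚₚ.≤-antisym (subst (F ≤_) (sym m≡0) F≤m) F≥0)) (*-zeroˡ (inv m))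

module _ {X C : Set} (L : Lin X) (PC : Finite C) (sw : Swap (∑ PC)) (c : X → C) where

  cell : C → X → ℚ
  cell p x = ⟦ _==_ PC p (c x) ⟧

  cell≥0 : ∀ p x → 0ℚ ≤ cell p x
  cell≥0 p x = ⟦⟧≥0 (_==_ PC p (c x))

  opaque
    cond : (X → ℚ) → C → ℚ
    cond f p = ∫ L (λ x → cell p x * f x) * inv (∫ L (cell p))

    cond-def : ∀ f p → cond f p ≡ ∫ L (λ x → cell p x * f x) * inv (∫ L (cell p))
    cond-def f p = refl

  module _ (f : X → ℚ) (f≥0 : ∀ x → 0ℚ ≤ f x) (f≤1 : ∀ x → f x ≤ 1ℚ) where

    cell-f≥0 : ∀ p → 0ℚ ≤ ∫ L (λ x → cell p x * f x)
    cell-f≥0 p = ∫≥0 L {λ x → cell p x * f x} (λ x → cell≥0 p x ⊗ f≥0 x)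

    cell-f≤ : ∀ p → ∫ L (λ x → cell p x * f x) ≤ ∫ L (cell p)
    cell-f≤ p = ∫≤ L {λ x → cell p x * f x} {cell p} (λ x → ≤-trans (*-monoʳ (cell p x) (cell≥0 p x) (f≤1 x)) (≤-reflexive (*-identityʳ (cell p x))))

    -- On a null cell both sides vanish, as the numerator is bounded by the measure of the cell.
    cond-cell : ∀ p → cond f p * ∫ L (cell p) ≡ ∫ L (λ x → cell p x * f x)
    cond-cell p = trans (cong (_* ∫ L (cell p)) (cond-def f p)) (ratio-cancel (∫ L (λ x → cell p x * f x)) (∫ L (cell p)) (cell-f≥0 p) (cell-f≤ p))

    cond-range : ∀ p → (0ℚ ≤ cond f p) × (cond f p ≤ 1ℚ)
    cond-range p = subst (λ z → (0ℚ ≤ z) × (z ≤ 1ℚ)) (sym (cond-def f p)) (ratio-range (∫ L (λ x → cell p x * f x)) (∫ L (cell p)) (cell-f≥0 p) (cell-f≤ p))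

  by-cells : ∀ (g : X → ℚ) → ∫ L g ≡ ∫ (∑ PC) (λ p → ∫ L (λ x → cell p x * g x))
  by-cells g = trans (∫≡ L (λ x → sym (∑-δ PC (λ _ → g x) (c x)))) (sw L (λ x p → ⟦ _==_ PC p (c x) ⟧ * g x))

  on-cell : ∀ (F : C → ℚ) p x → cell p x * F (c x) ≡ cell p x * F p
  on-cell F p x = go (_==_ PC p (c x)) refl
    where
    go : ∀ b → _==_ PC p (c x) ≡ b → ⟦ b ⟧ * F (c x) ≡ ⟦ b ⟧ * F p
    go true e = cong (λ q → 1ℚ * F q) (sym (==⇒≡ PC {p} {c x} e))
    go false e = trans (*-zeroˡ (F (c x))) (sym (*-zeroˡ (F p)))

  module _ (f : X → ℚ) (f≥0 : ∀ x → 0ℚ ≤ f x) (f≤1 : ∀ x → f x ≤ 1ℚ) where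

    mid : X → ℚ
    mid x = cond f (c x)

    cond-orth : ∀ (φ : C → ℚ) → ∫ L (λ x → (f x - mid x) * φ (c x)) ≡ 0ℚ
    cond-orth φ = trans (by-cells (λ x → (f x - mid x) * φ (c x))) (trans (∫≡ (∑ PC) each) (∫0 (∑ PC)))
      where
      r : ∀ e F m ψ → e * ((F - m) * ψ) ≡ (e * F) * ψ - (e * (m * ψ))
      r = solve-∀ ℛ
      r' : ∀ e a → e * a ≡ a * e
      r' = solve-∀ ℛ
      r'' : ∀ K M k ψ → K * ψ - (k * ψ) * M ≡ (K - k * M) * ψ
      r'' = solve-∀ ℛ
      each : ∀ p → ∫ L (λ x → cell p x * ((f x - mid x) * φ (c x))) ≡ 0ℚ
      each p = begin
          ∫ L (λ x → cell p x * ((f x - mid x) * φ (c x)))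
            ≡⟨ ∫≡ L (λ x → trans (on-cell (λ q → (f x - cond f q) * φ q) p x) (trans (r (cell p x) (f x) (cond f p) (φ p)) (cong (λ z → (cell p x * f x) * φ p - z) (r' (cell p x) (cond f p * φ p))))) ⟩
          ∫ L (λ x → (cell p x * f x) * φ p - (cond f p * φ p) * cell p x)
            ≡⟨ trans (∫- L (λ x → (cell p x * f x) * φ p) (λ x → (cond f p * φ p) * cell p x)) (cong₂ _-_ (∫*ʳ L (φ p) (λ x → cell p x * f x)) (∫* L (cond f p * φ p) (cell p))) ⟩
          ∫ L (λ x → cell p x * f x) * φ p - (cond f p * φ p) * ∫ L (cell p)
            ≡⟨ r'' (∫ L (λ x → cell p x * f x)) (∫ L (cell p)) (cond f p) (φ p) ⟩
          (∫ L (λ x → cell p x * f x) - cond f p * ∫ L (cell p)) * φ p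
            ≡⟨ cong (λ z → (∫ L (λ x → cell p x * f x) - z) * φ p) (cond-cell f f≥0 f≤1 p) ⟩
          (∫ L (λ x → cell p x * f x) - ∫ L (λ x → cell p x * f x)) * φ p
            ≡⟨ trans (cong (_* φ p) (+-inverseʳ (∫ L (λ x → cell p x * f x)))) (*-zeroˡ (φ p)) ⟩
          0ℚ ∎
        where open ≡-Reasoning

    pythagoras : ∀ (φ : C → ℚ) → ∫ L (λ x → (f x - φ (c x)) * (f x - φ (c x))) ≡ ∫ L (λ x → (f x - mid x) * (f x - mid x)) + ∫ L (λ x → (mid x - φ (c x)) * (mid x - φ (c x)))
    pythagoras φ = trans (∫≡ L (λ x → r (f x) (mid x) (φ (c x)))) (trans (∫+ L (λ x → (f x - mid x) * (f x - mid x) + (mid x - φ (c x)) * (mid x - φ (c x))) (λ x → (f x - mid x) * ψ (c x))) (trans (cong₂ _+_ (∫+ L (λ x → (f x - mid x) * (f x - mid x)) (λ x → (mid x - φ (c x)) * (mid x - φ (c x)))) (cond-orth ψ)) (+-identityʳ (∫ L (λ x → (f x - mid x) * (f x - mid x)) + ∫ L (λ x → (mid x - φ (c x)) * (mid x - φ (c x)))))))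
      where
      ψ : C → ℚ
      ψ q = (1ℚ + 1ℚ) * (cond f q - φ q)
      r : ∀ f m p → (f - p) * (f - p) ≡ ((f - m) * (f - m) + (m - p) * (m - p)) + (f - m) * ((1ℚ + 1ℚ) * (m - p))
      r = solve-∀ ℛ

    opaque
      -- The mean conditional variance of `f` given the colour. It can only fall under refinement
      -- and stays non-negative, which bounds the number of refinements.
      pot : ℚ
      pot = ∫ L (λ x → (f x - mid x) * (f x - mid x))
      pot-def : pot ≡ ∫ L (λ x → (f x - mid x) * (f x - mid x))
      pot-def = refl

    pot≥0 : 0ℚ ≤ pot
    pot≥0 = subst (0ℚ ≤_) (sym pot-def) (∫≥0 L {λ x → (f x - mid x) * (f x - mid x)} (λ x → sq≥0 (f x - mid x)))

    pot-best : ∀ (φ : C → ℚ) → pot ≤ ∫ L (λ x → (f x - φ (c x)) * (f x - φ (c x)))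
    pot-best φ = subst₂ _≤_ (sym pot-def) (sym (pythagoras φ)) (≤-by (r (∫ L (λ x → (f x - mid x) * (f x - mid x))) Z) (∫≥0 L {λ x → (mid x - φ (c x)) * (mid x - φ (c x))} (λ x → sq≥0 (mid x - φ (c x)))))
      where
      Z = ∫ L (λ x → (mid x - φ (c x)) * (mid x - φ (c x)))
      r : ∀ a z → (a + z) - a ≡ z
      r = solve-∀ ℛ

    -- Compared with the constant 0, a function with values in [0, 1] has a square no larger than
    -- itself. For the classes of a partition this bounds the total energy by 1, however many
    -- classes there are.
    pot≤∫ : pot ≤ ∫ L f
    pot≤∫ = ≤-trans (pot-best (λ _ → 0ℚ)) (∫≤ L {λ x → (f x - 0ℚ) * (f x - 0ℚ)} {f} (λ x → ≤-by (r (f x)) (f≥0 x ⊗ Δ {f x} {1ℚ} (f≤1 x))))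
      where r : ∀ a → a - (a - 0ℚ) * (a - 0ℚ) ≡ a * (1ℚ - a)
            r = solve-∀ ℛ

module Refinement {X C C' : Set} (L : Lin X) (mean : Mean L) (PC : Finite C) (sw : Swap (∑ PC)) (c : X → C) (PC' : Finite C') (sw' : Swap (∑ PC')) (c' : X → C') (π : C' → C) (πc : ∀ x → π (c' x) ≡ c x) (f : X → ℚ) (f≥0 : ∀ x → 0ℚ ≤ f x) (f≤1 : ∀ x → f x ≤ 1ℚ) where

  s s' : X → ℚ
  s x = cond L PC sw c f (c x)
  s' x = cond L PC' sw' c' f (c' x)

  old new : ℚ
  old = pot L PC sw c f f≥0 f≤1
  new = pot L PC' sw' c' f f≥0 f≤1

  -- Pythagoras for the finer conditional mean, measured from the coarser one, which is a function
  -- of the finer colour through `π`.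
  gain : old ≡ new + ∫ L (λ x → (s' x - s x) * (s' x - s x))
  gain = trans (pot-def L PC sw c f f≥0 f≤1) (trans (∫≡ L (λ x → cong (λ q → (f x - cond L PC sw c f q) * (f x - cond L PC sw c f q)) (sym (πc x)))) (trans (pythagoras L PC' sw' c' f f≥0 f≤1 (λ q → cond L PC sw c f (π q))) (cong₂ _+_ (sym (pot-def L PC' sw' c' f f≥0 f≤1)) (∫≡ L (λ x → cong (λ q → (s' x - cond L PC sw c f q) * (s' x - cond L PC sw c f q)) (πc x))))))

  new≤old : new ≤ old
  new≤old = subst (new ≤_) (sym gain) (≤-by (r new Z) (∫≥0 L {λ x → (s' x - s x) * (s' x - s x)} (λ x → sq≥0 (s' x - s x))))
    where
    Z = ∫ L (λ x → (s' x - s x) * (s' x - s x))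
    r : ∀ a z → (a + z) - a ≡ z
    r = solve-∀ ℛ

  -- Testing with θ·w for θ = ±ε: a test of correlation more than ε lowers the energy by ε².
  drop : ∀ (w : C' → Bool) ε → 0ℚ ≤ ε → ¬ Abs (∫ L (λ x → (f x - s x) * ⟦ w (c' x) ⟧)) ε → new ≤ old - ε * ε
  drop w ε ε≥0 bad = go (<-or-≤ ε γ) (<-or-≤ γ (- ε))
    where
    γ = ∫ L (λ x → (f x - s x) * ⟦ w (c' x) ⟧)
    W = ∫ L (λ x → ⟦ w (c' x) ⟧)
    W≤1 : W ≤ 1ℚ
    W≤1 = mean-≤ L mean {λ x → ⟦ w (c' x) ⟧} (λ x → ⟦⟧≤1 (w (c' x)))
    try : ∀ θ → new ≤ (old - (1ℚ + 1ℚ) * θ * γ) + θ * θ * W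
    try θ = ≤-trans (pot-best L PC' sw' c' f f≥0 f≤1 (λ q → cond L PC sw c f (π q) + θ * ⟦ w q ⟧)) (≤-reflexive eq)
      where
      r : ∀ f s t w → (f - (s + t * w)) * (f - (s + t * w)) ≡ ((f - s) * (f - s) - (1ℚ + 1ℚ) * t * ((f - s) * w)) + t * t * (w * w)
      r = solve-∀ ℛ
      eq : ∫ L (λ x → (f x - (cond L PC sw c f (π (c' x)) + θ * ⟦ w (c' x) ⟧)) * (f x - (cond L PC sw c f (π (c' x)) + θ * ⟦ w (c' x) ⟧))) ≡ (old - (1ℚ + 1ℚ) * θ * γ) + θ * θ * W
      eq = trans (∫≡ L (λ x → trans (cong (λ q → (f x - (cond L PC sw c f q + θ * ⟦ w (c' x) ⟧)) * (f x - (cond L PC sw c f q + θ * ⟦ w (c' x) ⟧))) (πc x)) (trans (r (f x) (s x) θ ⟦ w (c' x) ⟧) (cong (λ z → ((f x - s x) * (f x - s x) - (1ℚ + 1ℚ) * θ * ((f x - s x) * ⟦ w (c' x) ⟧)) + θ * θ * z) (⟦⟧-idem (w (c' x)))))))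
        (trans (∫+ L (λ x → (f x - s x) * (f x - s x) - (1ℚ + 1ℚ) * θ * ((f x - s x) * ⟦ w (c' x) ⟧)) (λ x → θ * θ * ⟦ w (c' x) ⟧))
        (cong₂ _+_ (trans (∫- L (λ x → (f x - s x) * (f x - s x)) (λ x → (1ℚ + 1ℚ) * θ * ((f x - s x) * ⟦ w (c' x) ⟧))) (cong₂ _-_ (sym (pot-def L PC sw c f f≥0 f≤1)) (∫* L ((1ℚ + 1ℚ) * θ) (λ x → (f x - s x) * ⟦ w (c' x) ⟧)))) (∫* L (θ * θ) (λ x → ⟦ w (c' x) ⟧))))
    go : (ε < γ) ⊎ (γ ≤ ε) → (γ < - ε) ⊎ (- ε ≤ γ) → new ≤ old - ε * ε
    go (inj₂ p) (inj₂ q) = ⊥-elim (bad (p , q))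
    go (inj₁ p) _ = ≤-trans (try ε) (≤-by (r old ε γ W) ((ε≥0 ⊗ Δ {ε} {γ} (<⇒≤ p) ⊕ ε≥0 ⊗ Δ {ε} {γ} (<⇒≤ p)) ⊕ (ε≥0 ⊗ ε≥0) ⊗ Δ {W} {1ℚ} W≤1))
      where r : ∀ o e g W → (o - e * e) - ((o - (1ℚ + 1ℚ) * e * g) + e * e * W) ≡ (e * (g - e) + e * (g - e)) + e * e * (1ℚ - W)
            r = solve-∀ ℛ
    go (inj₂ _) (inj₁ p) = ≤-trans (try (- ε)) (≤-by (r old ε γ W) ((ε≥0 ⊗ Δ {γ} { - ε} (<⇒≤ p) ⊕ ε≥0 ⊗ Δ {γ} { - ε} (<⇒≤ p)) ⊕ (ε≥0 ⊗ ε≥0) ⊗ Δ {W} {1ℚ} W≤1))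
      where r : ∀ o e g W → (o - e * e) - ((o - (1ℚ + 1ℚ) * (- e) * g) + (- e) * (- e) * W) ≡ (e * (- e - g) + e * (- e - g)) + e * e * (1ℚ - W)
            r = solve-∀ ℛ

-- Regularity of functions of j + 1 vertices relative to colourings of the j-tuples

sumBool-swap : Swap sumBool
sumBool-swap L f = ∫+ L (λ a → f a true) (λ a → f a false)

lin×-swap : ∀ {A B} {L : Lin A} {K : Lin B} → Swap L → Swap K → Swap (lin× L K)
lin×-swap {L = L} {K} p q H f = trans (p H (λ h a → ∫ K (λ b → f h (a , b)))) (∫≡ L (λ a → q H (λ h b → f h (a , b))))

sumN : (ℕ → ℕ) → ℕ → ℕ
sumN N zero = N zero
sumN N (suc i) = N (suc i) ℕ.+ sumN N i

N≤sumN : ∀ N {i I} → i ℕ.≤ I → N i ℕ.≤ sumN N I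
N≤sumN N {zero} {zero} z≤n = ℕₚ.≤-refl
N≤sumN N {i} {suc I} p with i ℕ.≤? I
... | yes q = ℕₚ.≤-trans (N≤sumN N q) (ℕₚ.m≤n+m (sumN N I) (N (suc I)))
... | no q with ℕₚ.≤-antisym p (ℕₚ.≰⇒> q)
... | refl = ℕₚ.m≤m+n (N (suc I)) (sumN N I)

-- A round that starts at index `i` may add `N i`. Summing `N` over all indices up to the current
-- bound gives an estimate that works for functions `N` that are not monotone.
iterBound : (ℕ → ℕ) → ℕ → ℕ → ℕ
iterBound N zero I = I
iterBound N (suc fuel) I = iterBound N fuel (sumN N I ℕ.+ I)

≤iterBound : ∀ N fuel I → I ℕ.≤ iterBound N fuel I
≤iterBound N zero I = ℕₚ.≤-refl
≤iterBound N (suc fuel) I = ℕₚ.≤-trans (ℕₚ.m≤n+m I (sumN N I)) (≤iterBound N fuel (sumN N I ℕ.+ I))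

module Colouring (j : ℕ) where
  -- After `i` refinements a colour of a `j`-tuple records, for each of the `i` tests, in which of
  -- its j + 1 sets the tuple lies. As the type depends on `i` only, the number of colours is
  -- independent of `n`.
  Col : ℕ → Set
  Col zero = ⊤
  Col (suc i) = Vec Bool (suc j) × Col i

  finiteCol : ∀ i → Finite (Col i)
  finiteCol zero = finite⊤
  finiteCol (suc i) = finite× (finiteVec finiteBool (suc j)) (finiteCol i)

  swapCol : ∀ i → Swap (∑ (finiteCol i))
  swapCol zero L f = refl
  swapCol (suc i) = lin×-swap {L = linVec sumBool (suc j)} {∑ (finiteCol i)} (linVec-swap sumBool sumBool-swap (suc j)) (swapCol i)

  Pat : ℕ → Set
  Pat i = Vec (Col i) (suc j)

  finitePat : ∀ i → Finite (Pat i)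
  finitePat i = finiteVec (finiteCol i) (suc j)

  swapPat : ∀ i → Swap (∑ (finitePat i))
  swapPat i = linVec-swap (∑ (finiteCol i)) (swapCol i) (suc j)

  module On (n : ℕ) where
    open Disc n

    pat : ∀ {i} → (Vec V j → Col i) → Vec V (suc j) → Pat i
    pat col x = tabulate (λ t → col (select (d t) x))

    opaque
      approx : ∀ {i} → (Vec V j → Col i) → (Vec V (suc j) → ℚ) → Pat i → ℚ
      approx {i} col f p = cond (𝔼 (suc j)) (finitePat i) (swapPat i) (pat col) f p
      approx-def : ∀ {i} (col : Vec V j → Col i) f p → approx col f p ≡ cond (𝔼 (suc j)) (finitePat i) (swapPat i) (pat col) f p
      approx-def col f p = refl

    module Fam {A : Set} (PA : Finite A) (f : A → Vec V (suc j) → ℚ) (f≥0 : ∀ a x → 0ℚ ≤ f a x) (f≤1 : ∀ a x → f a x ≤ 1ℚ) where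
      sOf : ∀ {i} → (Vec V j → Col i) → A → Vec V (suc j) → ℚ
      sOf col a x = approx col (f a) (pat col x)
      opaque
        pot₁ : ∀ {i} → (Vec V j → Col i) → A → ℚ
        pot₁ {i} col a = pot (𝔼 (suc j)) (finitePat i) (swapPat i) (pat col) (f a) (f≥0 a) (f≤1 a)
        pot₁≥0 : ∀ {i} (col : Vec V j → Col i) a → 0ℚ ≤ pot₁ col a
        pot₁≥0 {i} col a = pot≥0 (𝔼 (suc j)) (finitePat i) (swapPat i) (pat col) (f a) (f≥0 a) (f≤1 a)
        pot₁≤ : ∀ {i} (col : Vec V j → Col i) a → pot₁ col a ≤ ∫ (𝔼 (suc j)) (f a)
        pot₁≤ {i} col a = pot≤∫ (𝔼 (suc j)) (finitePat i) (swapPat i) (pat col) (f a) (f≥0 a) (f≤1 a)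
      Refines : ∀ {i i'} → (Vec V j → Col i') → (Vec V j → Col i) → Set
      Refines {i} {i'} col' col = Σ[ π ∈ (Col i' → Col i) ] (∀ y → π (col' y) ≡ col y)
      pat-π : ∀ {i i'} {col' : Vec V j → Col i'} {col : Vec V j → Col i} (ρ : Refines col' col) x → Vec.map (proj₁ ρ) (pat col' x) ≡ pat col x
      pat-π {col' = col'} {col} (π , h) x = trans (sym (Vecₚ.tabulate-∘ π (λ t → col' (select (d t) x)))) (Vecₚ.tabulate-cong (λ t → h (select (d t) x)))
      opaque
        unfolding pot₁ approx
        pot₁-gain : ∀ {i i'} {col' : Vec V j → Col i'} {col : Vec V j → Col i} → Refines col' col → ∀ a → pot₁ col a ≡ pot₁ col' a + ∫ (𝔼 (suc j)) (λ x → (sOf col' a x - sOf col a x) * (sOf col' a x - sOf col a x))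
        pot₁-gain {i} {i'} {col'} {col} ρ a = Refinement.gain (𝔼 (suc j)) (𝔼-mean (suc j)) (finitePat i) (swapPat i) (pat col) (finitePat i') (swapPat i') (pat col') (Vec.map (proj₁ ρ)) (pat-π ρ) (f a) (f≥0 a) (f≤1 a)
        pot₁-mono : ∀ {i i'} {col' : Vec V j → Col i'} {col : Vec V j → Col i} → Refines col' col → ∀ a → pot₁ col' a ≤ pot₁ col a
        pot₁-mono {i} {i'} {col'} {col} ρ a = Refinement.new≤old (𝔼 (suc j)) (𝔼-mean (suc j)) (finitePat i) (swapPat i) (pat col) (finitePat i') (swapPat i') (pat col') (Vec.map (proj₁ ρ)) (pat-π ρ) (f a) (f≥0 a) (f≤1 a)
        pot₁-drop : ∀ {i i'} {col' : Vec V j → Col i'} {col : Vec V j → Col i} → Refines col' col → ∀ a (w : Pat i' → Bool) ε → 0ℚ ≤ ε → ¬ Abs (∫ (𝔼 (suc j)) (λ x → (f a x - sOf col a x) * ⟦ w (pat col' x) ⟧)) ε → pot₁ col' a ≤ pot₁ col a - ε * ε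
        pot₁-drop {i} {i'} {col'} {col} ρ a w ε ε≥0 bad = Refinement.drop (𝔼 (suc j)) (𝔼-mean (suc j)) (finitePat i) (swapPat i) (pat col) (finitePat i') (swapPat i') (pat col') (Vec.map (proj₁ ρ)) (pat-π ρ) (f a) (f≥0 a) (f≤1 a) w ε ε≥0 bad
        sOf-range : ∀ {i} (col : Vec V j → Col i) a x → (0ℚ ≤ sOf col a x) × (sOf col a x ≤ 1ℚ)
        sOf-range {i} col a x = cond-range (𝔼 (suc j)) (finitePat i) (swapPat i) (pat col) (f a) (f≥0 a) (f≤1 a) (pat col x)
      Pot : ∀ {i} → (Vec V j → Col i) → ℚ
      Pot col = ∫ (∑ PA) (pot₁ col)
      Pot≥0 : ∀ {i} (col : Vec V j → Col i) → 0ℚ ≤ Pot col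
      Pot≥0 col = ∫≥0 (∑ PA) {pot₁ col} (pot₁≥0 col)
      refine : ∀ {i} → (Vec V j → Col i) → Test j → Vec V j → Col (suc i)
      refine col w y = tabulate (λ t → w t y) , col y
      refine-refines : ∀ {i} (col : Vec V j → Col i) w → Refines (refine col w) col
      refine-refines col w = proj₂ , λ y → refl
      -- Recovers the value of the last test from the facet colours: facet `t` contributes its bit
      -- `t`.
      read : ∀ {i} → Pat (suc i) → Bool
      read p = allF (suc j) (λ t → lookup (proj₁ (lookup p t)) t)
      read-pat : ∀ {i} (col : Vec V j → Col i) w x → read (pat (refine col w) x) ≡ evalT w x
      read-pat col w x = allF-cong (suc j) (λ t → trans (cong (λ q → lookup (proj₁ q) t) (lookup∘tabulate (λ t → refine col w (select (d t) x)) t)) (lookup∘tabulate (λ t' → w t' (select (d t) x)) t))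
        where
        allF-cong : ∀ m {p q : Fin m → Bool} → (∀ i → p i ≡ q i) → allF m p ≡ allF m q
        allF-cong zero h = refl
        allF-cong (suc m) h = cong₂ _∧_ (h zero) (allF-cong m (h ∘ suc))
      Violation : ∀ {i} → (Vec V j → Col i) → ℚ → Set
      Violation col ε = Σ[ a ∈ A ] Σ[ w ∈ Test j ] ¬ Abs (∫ (𝔼 (suc j)) (λ x → (f a x - sOf col a x) * ⟦ evalT w x ⟧)) ε
      -- The violating member loses ε² by `pot₁-drop`, and the energies of the other members do not
      -- increase.
      Pot-drop : ∀ {i} (col : Vec V j → Col i) ε → 0ℚ ≤ ε → (v : Violation col ε) → Pot (refine col (proj₁ (proj₂ v))) ≤ Pot col - ε * ε
      Pot-drop col ε ε≥0 (a₀ , w , bad) = ≤-trans (∫≤ (∑ PA) {pot₁ (refine col w)} {λ a → pot₁ col a - ⟦ _==_ PA a a₀ ⟧ * (ε * ε)} each) (≤-reflexive (trans (∫- (∑ PA) (pot₁ col) (λ a → ⟦ _==_ PA a a₀ ⟧ * (ε * ε))) (cong (λ z → Pot col - z) (∑-δ PA (λ _ → ε * ε) a₀))))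
        where
        ρ = refine-refines col w
        at : ∀ a b → _==_ PA a a₀ ≡ b → pot₁ (refine col w) a ≤ pot₁ col a - ⟦ b ⟧ * (ε * ε)
        at a false e = ≤-trans (pot₁-mono ρ a) (≤-reflexive (r (pot₁ col a) (ε * ε)))
          where r : ∀ a e → a ≡ a - 0ℚ * e
                r = solve-∀ ℛ
        at a true e = subst (λ a → pot₁ (refine col w) a ≤ pot₁ col a - 1ℚ * (ε * ε)) (sym (==⇒≡ PA {a} {a₀} e)) (subst (λ z → pot₁ (refine col w) a₀ ≤ pot₁ col a₀ - z) (sym (*-identityˡ (ε * ε)))
          (pot₁-drop ρ a₀ read ε ε≥0 (λ good → bad (subst (λ z → Abs z ε) (∫≡ (𝔼 (suc j)) (λ x → cong (λ b → (f a₀ x - sOf col a₀ x) * ⟦ b ⟧) (read-pat col w x))) good))))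
        each : ∀ a → pot₁ (refine col w) a ≤ pot₁ col a - ⟦ _==_ PA a a₀ ⟧ * (ε * ε)
        each a = at a (_==_ PA a a₀) refl
      Fine : ∀ {i} → (Vec V j → Col i) → ℚ → ℕ → Set
      Fine col ε I = Σ[ i' ∈ ℕ ] Σ[ col' ∈ (Vec V j → Col i') ] (i' ℕ.≤ I × Refines col' col × (∀ a → CutReg j (λ x → f a x - sOf col' a x) ε))
      -- A violated test is absorbed into the colouring, which lowers the energy by ε², so this
      -- happens at most `fuel` times; `lem` settles whether a violation is left.
      weak : ∀ ε → 0ℚ < ε → ∀ fuel {i} (col : Vec V j → Col i) → Pot col ≤ ν fuel * (ε * ε) → DN (Fine col ε (fuel ℕ.+ i))
      weak ε ε>0 fuel {i} col p = lem (Violation col ε) >>= split fuel p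
        where
        abs? : ∀ z → ¬ ¬ Abs z ε → Abs z ε
        abs? z h with z ℚₚ.≤? ε | (- ε) ℚₚ.≤? z
        ... | yes a | yes b = a , b
        ... | no a | _ = ⊥-elim (h (λ q → a (proj₁ q)))
        ... | yes _ | no b = ⊥-elim (h (λ q → b (proj₂ q)))
        r : ∀ n e → (1ℚ + n) * e - e ≡ n * e
        r = solve-∀ ℛ
        next : ∀ fuel → Pot col ≤ ν (suc fuel) * (ε * ε) → (v : Violation col ε) → Pot (refine col (proj₁ (proj₂ v))) ≤ ν fuel * (ε * ε)
        next fuel p v = ≤-trans (Pot-drop col ε (<⇒≤ ε>0) v) (subst (Pot col - ε * ε ≤_) (r (ν fuel) (ε * ε)) (ℚₚ.+-monoˡ-≤ (- (ε * ε)) p))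
        split : ∀ fuel → Pot col ≤ ν fuel * (ε * ε) → Violation col ε ⊎ ¬ Violation col ε → DN (Fine col ε (fuel ℕ.+ i))
        split fuel p (inj₂ no-v) = pure (i , col , ℕₚ.m≤n+m i fuel , (id , λ y → refl) , λ a w → abs? (∫ (𝔼 (suc j)) (λ x → (f a x - sOf col a x) * ⟦ evalT w x ⟧)) (λ bad → no-v (a , w , bad)))
        split zero p (inj₁ v) = contra (<-by (r' (ε * ε)) (*-pos ε>0 ε>0)) (≤-trans (Pot≥0 (refine col (proj₁ (proj₂ v)))) (≤-trans (Pot-drop col ε (<⇒≤ ε>0) v) (ℚₚ.+-monoˡ-≤ (- (ε * ε)) p)))
          where r' : ∀ e → 0ℚ - (0ℚ * e - e) ≡ e
                r' = solve-∀ ℛ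
        split (suc fuel) p (inj₁ v) = weak ε ε>0 fuel (refine col (proj₁ (proj₂ v))) (next fuel p v) >>= λ (i' , col' , le , (π , h) , reg) → pure (i' , col' , subst (i' ℕ.≤_) (ℕₚ.+-suc fuel i) le , ((λ q → proj₂ (π q)) , λ y → cong proj₂ (h y)) , reg)
      -- `f` splits into a function of the facet colours, the error `g - sOf col` that is small in
      -- mean square, and `f - g`, whose cut error `εf i` may depend on the number `i` that measures
      -- the colouring. In the proof `g` is the conditional mean for a finer colouring.
      Strong : (ℕ → ℚ) → ℚ → ℕ → Set
      Strong εf η I = Σ[ i ∈ ℕ ] Σ[ col ∈ (Vec V j → Col i) ] Σ[ g ∈ (A → Vec V (suc j) → ℚ) ] (i ℕ.≤ I × (∀ a x → (0ℚ ≤ g a x) × (g a x ≤ 1ℚ)) × (∀ a → CutReg j (λ x → f a x - g a x) (εf i)) × ∫ (∑ PA) (λ a → ∫ (𝔼 (suc j)) (λ x → (g a x - sOf col a x) * (g a x - sOf col a x))) ≤ η)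
      module _ (εf : ℕ → ℚ) (εf>0 : ∀ i → 0ℚ < εf i) (η : ℚ) (η>0 : 0ℚ < η) (N : ℕ → ℕ) (N-big : ∀ i → 1ℚ ≤ ν (N i) * (εf i * εf i)) (total : ∫ (∑ PA) (λ a → ∫ (𝔼 (suc j)) (f a)) ≤ 1ℚ) where
        Pot≤1 : ∀ {i} (col : Vec V j → Col i) → Pot col ≤ 1ℚ
        Pot≤1 col = ≤-trans (∫≤ (∑ PA) {pot₁ col} {λ a → ∫ (𝔼 (suc j)) (f a)} (pot₁≤ col)) total
        diff : ∀ {i i'} (col : Vec V j → Col i) (col' : Vec V j → Col i') → Refines col' col → Pot col ≡ Pot col' + ∫ (∑ PA) (λ a → ∫ (𝔼 (suc j)) (λ x → (sOf col' a x - sOf col a x) * (sOf col' a x - sOf col a x)))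
        diff col col' ρ = trans (∫≡ (∑ PA) (pot₁-gain ρ)) (∫+ (∑ PA) (pot₁ col') (λ a → ∫ (𝔼 (suc j)) (λ x → (sOf col' a x - sOf col a x) * (sOf col' a x - sOf col a x))))
        -- By `diff` the mean-square distance between two consecutive conditional means is the
        -- energy lost between them. Each distance above `η` uses up one unit of `fuel`.
        strong : ∀ fuel {i} I (col : Vec V j → Col i) → i ℕ.≤ I → Pot col ≤ ν fuel * η → DN (Strong εf η (iterBound N fuel I))
        strong fuel {i} I col i≤I p = weak (εf i) (εf>0 i) (N i) col (≤-trans (Pot≤1 col) (N-big i)) >>= next
          where
          next : Fine col (εf i) (N i ℕ.+ i) → DN (Strong εf η (iterBound N fuel I))
          next (i' , col' , le , ρ , reg) = cases fuel p (<-or-≤ η D)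
            where
            D = ∫ (∑ PA) (λ a → ∫ (𝔼 (suc j)) (λ x → (sOf col' a x - sOf col a x) * (sOf col' a x - sOf col a x)))
            fin : ∀ J → i ℕ.≤ J → D ≤ η → Strong εf η J
            fin J q h = i , col , sOf col' , q , sOf-range col' , reg , h
            lower : η < D → Pot col' ≤ Pot col - η
            lower h = ≤-by (trans (cong (λ z → (z - η) - Pot col') (diff col col' ρ)) (r (Pot col') D η)) (Δ {η} {D} (<⇒≤ h))
              where r : ∀ a D e → ((a + D) - e) - a ≡ D - e
                    r = solve-∀ ℛ
            cases : ∀ fuel → Pot col ≤ ν fuel * η → (η < D) ⊎ (D ≤ η) → DN (Strong εf η (iterBound N fuel I))
            cases fuel p (inj₂ h) = pure (fin (iterBound N fuel I) (ℕₚ.≤-trans i≤I (≤iterBound N fuel I)) h)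
            cases zero p (inj₁ h) = contra (<-by (r η) η>0) (≤-trans (Pot≥0 col') (≤-trans (lower h) (ℚₚ.+-monoˡ-≤ (- η) p)))
              where r : ∀ e → 0ℚ - (0ℚ * e - e) ≡ e
                    r = solve-∀ ℛ
            cases (suc fuel) p (inj₁ h) = strong fuel (sumN N I ℕ.+ I) col' (ℕₚ.≤-trans le (ℕₚ.+-mono-≤ (N≤sumN N i≤I) i≤I)) (≤-trans (lower h) (≤-trans (ℚₚ.+-monoˡ-≤ (- η) p) (≤-reflexive (r (ν fuel) η))))
              where r : ∀ n e → (1ℚ + n) * e - e ≡ n * e
                    r = solve-∀ ℛ

  opaque
    -- `I` is chosen before `n` and before the family: the means of the family add up to at most 1,
    -- so the initial energy does not grow with the number of its members.
    strong-regularity : ∀ (εf : ℕ → ℚ) → (∀ i → 0ℚ < εf i) → ∀ η → 0ℚ < η → Σ[ I ∈ ℕ ] (∀ n {A : Set} (PA : Finite A) (f : A → Vec (Fin (suc n)) (suc j) → ℚ) (f≥0 : ∀ a x → 0ℚ ≤ f a x) (f≤1 : ∀ a x → f a x ≤ 1ℚ) → ∫ (∑ PA) (λ a → ∫ (Disc.𝔼 n (suc j)) (f a)) ≤ 1ℚ → DN (On.Fam.Strong n PA f f≥0 f≤1 εf η I))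
    strong-regularity εf εf>0 η η>0 = iterBound N fuel 0 , λ n PA f f≥0 f≤1 total → On.Fam.strong n PA f f≥0 f≤1 εf εf>0 η η>0 N N-big total fuel 0 (λ _ → tt) z≤n (≤-trans (On.Fam.Pot≤1 n PA f f≥0 f≤1 εf εf>0 η η>0 N N-big total (λ _ → tt)) fuel-big)
      where
      N : ℕ → ℕ
      N i = proj₁ (archimedean⁻¹ (εf i * εf i) (*-pos (εf>0 i) (εf>0 i)))
      N-big : ∀ i → 1ℚ ≤ ν (N i) * (εf i * εf i)
      N-big i = proj₂ (archimedean⁻¹ (εf i * εf i) (*-pos (εf>0 i) (εf>0 i)))
      fuel : ℕ
      fuel = proj₁ (archimedean⁻¹ η η>0)
      fuel-big : 1ℚ ≤ ν fuel * η
      fuel-big = proj₂ (archimedean⁻¹ η η>0)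

-- Working inside one cell of the partition of the r-tuples

-- Derives a first-moment bound from a second-moment bound without square roots.
abs-trick : ∀ ω y → 0ℚ < ω → y ≤ ω + (y * y) * inv ω
abs-trick ω y ω>0 = *-cancel-pos ω ω>0 (≤-trans (≤-by (r ω y) (sq≥0 (y - ω * half) ⊕ (0≤¾ ⊗ sq≥0 ω))) (≤-reflexive (sym e)))
  where
  ¾ = half + half * half
  0≤¾ : 0ℚ ≤ ¾
  0≤¾ = <⇒≤ 0<half ⊕ (<⇒≤ 0<half ⊗ <⇒≤ 0<half)
  r : ∀ w y → (w * w + y * y) - w * y ≡ (y - w * half) * (y - w * half) + (half + half * half) * (w * w)
  r = solve-∀ ℛ
  r' : ∀ w Y i → w * (w + Y * i) ≡ w * w + Y * (w * i)
  r' = solve-∀ ℛ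
  e : ω * (ω + (y * y) * inv ω) ≡ ω * ω + y * y
  e = trans (r' ω (y * y) (inv ω)) (cong (ω * ω +_) (trans (cong ((y * y) *_) (inv-r ω ω>0)) (*-identityʳ (y * y))))

facetPat : ∀ {A : Set} {n j} → (Vec (Fin n) j → A) → Vec (Fin n) (suc j) → Vec A (suc j)
facetPat col y = tabulate (λ t → col (select (d t) y))

module Cell (r n M : ℕ) {A C : Set} (PA : Finite A) (PC : Finite C)
  (κ : Vec (Fin (suc n)) (suc r) → A) (col : Vec (Fin (suc n)) r → C)
  (B : A → Vec C (suc r) → ℚ) (B-range : ∀ a p → (0ℚ ≤ B a p) × (B a p ≤ 1ℚ))
  (g₂ : A → Vec (Fin (suc n)) (suc r) → ℚ) (x* : Vec (Fin (suc n)) M) where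
  open Disc n
  sr k : ℕ
  sr = suc r
  k = suc sr

  E : (Vec V M → ℚ) → ℚ
  E = ∫ (𝔼 M)

  P : (Vec V M → Bool) → ℚ
  P X = E (λ x → ⟦ X x ⟧)

  P-mono : ∀ X Y → (∀ x → X x ≡ true → Y x ≡ true) → P X ≤ P Y
  P-mono X Y h = ∫≤ (𝔼 M) {λ x → ⟦ X x ⟧} {λ x → ⟦ Y x ⟧} (λ x → ⟦⟧-mono {X x} {Y x} (h x))

  P-ext : ∀ X Y → (∀ x → X x ≡ Y x) → P X ≡ P Y
  P-ext X Y h = ∫≡ (𝔼 M) (λ x → cong ⟦_⟧ (h x))

  P≥0 : ∀ X → 0ℚ ≤ P X
  P≥0 X = ∫≥0 (𝔼 M) {λ x → ⟦ X x ⟧} (λ x → ⟦⟧≥0 (X x))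

  patC : Vec V sr → Vec C sr
  patC y = tabulate (λ t → col (select (d t) y))

  same : r ⊑ M → Vec V M → Bool
  same T x = _==_ PC (col (select T x)) (col (select T x*))

  -- Inside this event every (r+1)-subtuple has the facet pattern that it has in `x*`, so each
  -- density `B a` becomes a constant, `β*`.
  u : Vec V M → Bool
  u x = allL (λ T → same T x) (thins r M)

  m = P u

  u-pat : ∀ x → u x ≡ true → ∀ (S : sr ⊑ M) → patC (select S x) ≡ patC (select S x*)
  u-pat x h S = Vecₚ.tabulate-cong (λ t → trans (cong col (sym (select-⨟ (d t) S x))) (trans (==⇒≡ PC (allL-elim (λ T → same T x) (thins r M) h (thins-complete (d t ⨟ S)))) (cong col (select-⨟ (d t) S x*))))

  u-adm : ∀ {j} → r ℕ.≤ j → (S : suc j ⊑ M) → Adm S u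
  u-adm {j} le S = adm-all S same (thins r M) (λ {T} _ → adm-dep (proj₂ (cov-small S T le (ℕₚ.n≤1+n j))) (λ y → _==_ PC (col y) (col (select T x*))))

  fac : A → sr ⊑ M → Vec V M → Bool
  fac a S x = _==_ PA a (κ (select S x))

  β* : sr ⊑ M → A → ℚ
  β* S a = B a (patC (select S x*))

  module Removal (ω : ℚ) (ω>0 : 0ℚ < ω) (ε₂ : ℚ) (ε₂≤ : ε₂ ≤ ω * m)
                 (reg₂ : ∀ a → CutReg r (λ y → ⟦ _==_ PA a (κ y) ⟧ - g₂ a y) ε₂)
                 (var₂ : ∀ S a → E (λ x → ⟦ u x ⟧ * ((g₂ a (select S x) - B a (patC (select S x))) * (g₂ a (select S x) - B a (patC (select S x))))) ≤ (ω * ω) * m) where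

    -- One share is the cut error `ε₂`; the other two are the two terms of `abs-trick`.
    err = (ω + ω + ω) * m

    module One (S : sr ⊑ M) (a : A) (X : Vec V M → Bool) (adm : Adm S X) (X≤u : ∀ x → X x ≡ true → u x ≡ true) where
      b = β* S a
      y : Vec V M → ℚ
      y x = g₂ a (select S x) - B a (patC (select S x))
      first : Abs (E (λ x → (⟦ fac a S x ⟧ - g₂ a (select S x)) * ⟦ X x ⟧)) ε₂
      first = cut-lift {F = λ y → ⟦ _==_ PA a (κ y) ⟧ - g₂ a y} {X = X} S (reg₂ a) adm
      -- Used with 1 and with -1 to bound the deviation from both sides; the square in `abs-trick`
      -- does not see the sign.
      second : ∀ (sg : ℚ) → sg * sg ≡ 1ℚ → E (λ x → sg * y x * ⟦ X x ⟧) ≤ (ω + ω) * m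
      second sg sg² = ≤-trans (∫≤ (𝔼 M) {λ x → sg * y x * ⟦ X x ⟧} {λ x → ω * ⟦ u x ⟧ + (⟦ u x ⟧ * (y x * y x)) * inv ω} each) (≤-trans (≤-reflexive (trans (∫+ (𝔼 M) (λ x → ω * ⟦ u x ⟧) (λ x → (⟦ u x ⟧ * (y x * y x)) * inv ω)) (cong₂ _+_ (∫* (𝔼 M) ω (λ x → ⟦ u x ⟧)) (∫*ʳ (𝔼 M) (inv ω) (λ x → ⟦ u x ⟧ * (y x * y x)))))) (≤-trans (+-mono-≤ (≤-refl {ω * m}) (*-monoˡ (inv ω) (<⇒≤ (inv-pos ω ω>0)) (var₂ S a))) (≤-reflexive (trans (r₁ ω m (inv ω)) (trans (cong (λ z → ω * m + z * (ω * m)) (inv-r ω ω>0)) (r₂ ω m))))))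
        where
        r₁ : ∀ w m i → w * m + w * w * m * i ≡ w * m + (w * i) * (w * m)
        r₁ = solve-∀ ℛ
        r₂ : ∀ w m → w * m + 1ℚ * (w * m) ≡ (w + w) * m
        r₂ = solve-∀ ℛ
        r₃ : ∀ s y → (s * y) * (s * y) ≡ (s * s) * (y * y)
        r₃ = solve-∀ ℛ
        r₄ : ∀ w Y i → w + Y * i ≡ w * 1ℚ + (1ℚ * Y) * i
        r₄ = solve-∀ ℛ
        each : ∀ x → sg * y x * ⟦ X x ⟧ ≤ ω * ⟦ u x ⟧ + (⟦ u x ⟧ * (y x * y x)) * inv ω
        each x = go (X x) refl (u x) refl
          where
          go : ∀ b → X x ≡ b → ∀ c → u x ≡ c → sg * y x * ⟦ b ⟧ ≤ ω * ⟦ c ⟧ + (⟦ c ⟧ * (y x * y x)) * inv ω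
          go false _ c _ = ≤-trans (≤-reflexive (*-zeroʳ (sg * y x))) ((<⇒≤ ω>0 ⊗ ⟦⟧≥0 c) ⊕ ((⟦⟧≥0 c ⊗ sq≥0 (y x)) ⊗ <⇒≤ (inv-pos ω ω>0)))
          go true p false q = case trans (sym (X≤u x p)) q of λ ()
          go true p true q = ≤-trans (≤-reflexive (*-identityʳ (sg * y x))) (≤-trans (abs-trick ω (sg * y x) ω>0) (≤-reflexive (trans (cong (λ z → ω + z * inv ω) (trans (r₃ sg (y x)) (trans (cong (_* (y x * y x)) sg²) (*-identityˡ (y x * y x))))) (r₄ ω (y x * y x) (inv ω)))))
      -- Inside the cell a colour class behaves like a coin of bias `b` that is independent of every
      -- admissible event: cut regularity replaces its indicator by `g₂`, and the mean-square bound
      -- replaces `g₂` by the constant.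
      removal : Abs (E (λ x → ⟦ X x ⟧ * ⟦ fac a S x ⟧) - b * P X) err
      removal = subst (λ z → Abs z err) (sym split) (≤-trans (+-mono-≤ (≤-trans (proj₁ first) ε₂≤) up) (≤-reflexive (r₁ ω m)) , ≤-trans (≤-reflexive (r₂ ω m)) (+-mono-≤ (≤-trans (neg-antimono-≤ ε₂≤) (proj₂ first)) down))
        where
        r₁ : ∀ w m → w * m + (w + w) * m ≡ (w + w + w) * m
        r₁ = solve-∀ ℛ
        r₂ : ∀ w m → - ((w + w + w) * m) ≡ - (w * m) + - ((w + w) * m)
        r₂ = solve-∀ ℛ
        r₃ : ∀ X f g b → X * f - b * X ≡ (f - g) * X + 1ℚ * (g - b) * X
        r₃ = solve-∀ ℛ
        r₄ : ∀ y X → - 1ℚ * y * X ≡ - 1ℚ * (1ℚ * y * X)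
        r₄ = solve-∀ ℛ
        r₅ : ∀ z → - 1ℚ * z ≡ - z
        r₅ = solve-∀ ℛ
        Y = E (λ x → 1ℚ * y x * ⟦ X x ⟧)
        up : Y ≤ (ω + ω) * m
        up = second 1ℚ refl
        down : - ((ω + ω) * m) ≤ Y
        down = subst (- ((ω + ω) * m) ≤_) (r₆ Y) (neg-antimono-≤ (≤-trans (≤-reflexive (trans (sym (r₅ Y)) (trans (sym (∫* (𝔼 M) (- 1ℚ) (λ x → 1ℚ * y x * ⟦ X x ⟧))) (∫≡ (𝔼 M) (λ x → sym (r₄ (y x) ⟦ X x ⟧)))))) (second (- 1ℚ) refl)))
          where r₆ : ∀ z → - (- z) ≡ z
                r₆ = solve-∀ ℛ
        ptw : ∀ x → ⟦ X x ⟧ * ⟦ fac a S x ⟧ - b * ⟦ X x ⟧ ≡ (⟦ fac a S x ⟧ - g₂ a (select S x)) * ⟦ X x ⟧ + 1ℚ * y x * ⟦ X x ⟧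
        ptw x = go (X x) refl
          where
          z₀ : ∀ f b g y → 0ℚ * f - b * 0ℚ ≡ (f - g) * 0ℚ + 1ℚ * y * 0ℚ
          z₀ = solve-∀ ℛ
          go : ∀ c → X x ≡ c → ⟦ c ⟧ * ⟦ fac a S x ⟧ - b * ⟦ c ⟧ ≡ (⟦ fac a S x ⟧ - g₂ a (select S x)) * ⟦ c ⟧ + 1ℚ * y x * ⟦ c ⟧
          go false _ = z₀ ⟦ fac a S x ⟧ b (g₂ a (select S x)) (y x)
          go true p = trans (r₃ 1ℚ ⟦ fac a S x ⟧ (g₂ a (select S x)) b) (cong (λ q → (⟦ fac a S x ⟧ - g₂ a (select S x)) * 1ℚ + 1ℚ * (g₂ a (select S x) - B a q) * 1ℚ) (sym (u-pat x (X≤u x p) S)))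
        split : E (λ x → ⟦ X x ⟧ * ⟦ fac a S x ⟧) - b * P X ≡ E (λ x → (⟦ fac a S x ⟧ - g₂ a (select S x)) * ⟦ X x ⟧) + Y
        split = trans (trans (cong (λ z → E (λ x → ⟦ X x ⟧ * ⟦ fac a S x ⟧) - z) (sym (∫* (𝔼 M) b (λ x → ⟦ X x ⟧)))) (sym (∫- (𝔼 M) (λ x → ⟦ X x ⟧ * ⟦ fac a S x ⟧) (λ x → b * ⟦ X x ⟧)))) (trans (∫≡ (𝔼 M) ptw) (∫+ (𝔼 M) (λ x → (⟦ fac a S x ⟧ - g₂ a (select S x)) * ⟦ X x ⟧) (λ x → 1ℚ * y x * ⟦ X x ⟧)))

    -- a partial prescription of colours: S ↦ nothing imposes no condition
    fac? : Maybe A → sr ⊑ M → Vec V M → Bool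
    fac? nothing S x = true
    fac? (just a) S x = fac a S x

    β? : Maybe A → sr ⊑ M → ℚ
    β? nothing S = 1ℚ
    β? (just a) S = β* S a

    β?-range : ∀ a S → (0ℚ ≤ β? a S) × (β? a S ≤ 1ℚ)
    β?-range nothing S = 0≤1 , ≤-refl
    β?-range (just a) S = B-range a (patC (select S x*))

    err≥0 : 0ℚ ≤ err
    err≥0 = ((<⇒≤ ω>0 ⊕ <⇒≤ ω>0) ⊕ <⇒≤ ω>0) ⊗ P≥0 u

    fac?-adm : ∀ a S' S → S' ≢ S → Adm S (fac? a S')
    fac?-adm nothing S' S ne = adm-true S
    fac?-adm (just a) S' S ne = [ (λ (δ , p) → ⊥-elim (ne (sym (trans p (trans (cong (_⨟ S') (id-unique δ)) (⨟-idˡ S')))))) , (λ (τ , c) → adm-dep c (λ y → _==_ PA a (κ y))) ]′ (cov-diff S S')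

    removal? : ∀ a S (X : Vec V M → Bool) → Adm S X → (∀ x → X x ≡ true → u x ≡ true) → Abs (P (λ x → X x ∧ fac? a S x) - β? a S * P X) err
    removal? nothing S X adm le = subst (λ z → Abs z err) (sym (trans (cong (_- 1ℚ * P X) (P-ext (λ x → X x ∧ true) X (λ x → Boolₚ.∧-identityʳ (X x)))) (r₀ (P X)))) (err≥0 , ≤-trans (neg-antimono-≤ err≥0) (≤-refl {0ℚ}))
      where r₀ : ∀ z → z - 1ℚ * z ≡ 0ℚ
            r₀ = solve-∀ ℛ
    removal? (just a) S X adm le = subst (λ z → Abs (z - β* S a * P X) err) (∫≡ (𝔼 M) (λ x → sym (⟦∧⟧ (X x) (fac a S x)))) (One.removal S a X adm le)

    module _ {D : Set} (ι : D → sr ⊑ M) (ι-inj : ∀ {S S'} → ι S ≡ ι S' → S ≡ S') (α : D → Maybe A) where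
      facs : List D → Vec V M → Bool
      facs l x = allL (λ S → fac? (α S) (ι S) x) l
      βs : List D → ℚ
      βs l = prodL (λ S → β? (α S) (ι S)) l
      βs-range : ∀ l → (0ℚ ≤ βs l) × (βs l ≤ 1ℚ)
      βs-range [] = 0≤1 , ≤-refl
      βs-range (S ∷ l) = proj₁ (β?-range (α S) (ι S)) ⊗ proj₁ (βs-range l) , *-mono {d = 1ℚ} (proj₁ (β?-range (α S) (ι S))) 0≤1 (proj₂ (β?-range (α S) (ι S))) (proj₂ (βs-range l))
      -- The colour conditions are removed one at a time. Those that remain are admissible for the
      -- current set because the sets are distinct, and since all factors are at most 1 the errors
      -- merely add up.
      removals : ∀ l → Unique l → (X : Vec V M → Bool) → (∀ S → S ∈ l → Adm (ι S) X) → (∀ x → X x ≡ true → u x ≡ true) → Abs (P (λ x → X x ∧ facs l x) - βs l * P X) (ν (length l) * err)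
      removals [] _ X adm le = subst₂ Abs (sym (trans (cong (_- 1ℚ * P X) (P-ext (λ x → X x ∧ true) X (λ x → Boolₚ.∧-identityʳ (X x)))) (r₀ (P X)))) (sym (*-zeroˡ err)) (≤-refl , ≤-refl)
        where r₀ : ∀ z → z - 1ℚ * z ≡ 0ℚ
              r₀ = solve-∀ ℛ
      removals (S ∷ l) (S∉l ∷ uniq) X adm le = combine (removal? (α S) (ι S) (λ x → X x ∧ facs l x) adm' (λ x h → le x (∧ˡ (X x) (facs l x) h))) (removals l uniq X (λ S' p → adm S' (there p)) le)
        where
        b = β? (α S) (ι S)
        Q₀ = P (λ x → X x ∧ (fac? (α S) (ι S) x ∧ facs l x))
        Q₁ = P (λ x → X x ∧ facs l x)
        adm' : Adm (ι S) (λ x → X x ∧ facs l x)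
        adm' = adm-∧ (ι S) X (facs l) (adm S (here refl)) (adm-all (ι S) (λ S' x → fac? (α S') (ι S') x) l (λ {S'} p → fac?-adm (α S') (ι S') (ι S) (λ e → All.lookup S∉l p (sym (ι-inj e)))))
        perm : ∀ x a f → (x ∧ a) ∧ f ≡ x ∧ (f ∧ a)
        perm false a f = refl
        perm true a f = Boolₚ.∧-comm a f
        combine : Abs (P (λ x → (X x ∧ facs l x) ∧ fac? (α S) (ι S) x) - b * Q₁) err → Abs (Q₁ - βs l * P X) (ν (length l) * err) → Abs (Q₀ - b * βs l * P X) ((1ℚ + ν (length l)) * err)
        combine (p₁ , p₂) (q₁ , q₂) = subst (λ z → Abs (z - b * βs l * P X) ((1ℚ + ν (length l)) * err)) (P-ext (λ x → (X x ∧ facs l x) ∧ fac? (α S) (ι S) x) (λ x → X x ∧ (fac? (α S) (ι S) x ∧ facs l x)) (λ x → perm (X x) (facs l x) (fac? (α S) (ι S) x))) (abs-chain (P (λ x → (X x ∧ facs l x) ∧ fac? (α S) (ι S) x)) b Q₁ (βs l * P X) (b * βs l * P X) err (ν (length l) * err) ((1ℚ + ν (length l)) * err) (β?-range (α S) (ι S)) (sym (*-assoc b (βs l) (P X))) (r₀ (ν (length l)) err) p₁ p₂ q₁ q₂ (ν≥0 (length l) ⊗ err≥0))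
          where
          r₀ : ∀ n e → (1ℚ + n) * e ≡ e + n * e
          r₀ = solve-∀ ℛ
          abs-chain : ∀ q b Q z bz e f g → (0ℚ ≤ b) × (b ≤ 1ℚ) → b * z ≡ bz → g ≡ e + f → q - b * Q ≤ e → - e ≤ q - b * Q → Q - z ≤ f → - f ≤ Q - z → 0ℚ ≤ f → Abs (q - bz) g
          abs-chain q b Q z bz e f g (b≥0 , b≤1) refl refl p₁ p₂ q₁ q₂ f≥0 = ≤-by (s₁ q b Q z e f) (Δ {q - b * Q} {e} p₁ ⊕ (b≥0 ⊗ Δ {Q - z} {f} q₁ ⊕ Δ {b} {1ℚ} b≤1 ⊗ f≥0)) , ≤-by (s₂ q b Q z e f) (Δ { - e} {q - b * Q} p₂ ⊕ (b≥0 ⊗ Δ { - f} {Q - z} q₂ ⊕ Δ {b} {1ℚ} b≤1 ⊗ f≥0))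
            where
            s₁ : ∀ q b Q z e f → (e + f) - (q - b * z) ≡ (e - (q - b * Q)) + (b * (f - (Q - z)) + (1ℚ - b) * f)
            s₁ = solve-∀ ℛ
            s₂ : ∀ q b Q z e f → (q - b * z) - (- (e + f)) ≡ ((q - b * Q) - (- e)) + (b * ((Q - z) - (- f)) + (1ℚ - b) * f)
            s₂ = solve-∀ ℛ

-- Choosing a typical cell.

patL : ∀ {r n M} {C : Set} → (Vec (Fin (suc n)) r → C) → (l : List (r ⊑ M)) → Vec (Fin (suc n)) M → Vec C (length l)
patL col [] x = []
patL col (T ∷ l) x = col (select T x) ∷ patL col l x

eq-patL : ∀ {r n M} {C : Set} (PC : Finite C) (col : Vec (Fin (suc n)) r → C) (l : List (r ⊑ M)) x y → eqVec PC (patL col l x) (patL col l y) ≡ allL (λ T → _==_ PC (col (select T x)) (col (select T y))) l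
eq-patL PC col [] x y = refl
eq-patL PC col (T ∷ l) x y = cong (_==_ PC (col (select T x)) (col (select T y)) ∧_) (eq-patL PC col l x y)

size≥1 : ∀ {C} (PC : Finite C) → C → 1ℚ ≤ ∣ PC ∣f
size≥1 PC c = ≤-trans (≤-reflexive (sym (∑-δ PC (λ _ → 1ℚ) c))) (∫≤ (∑ PC) {λ a → ⟦ _==_ PC a c ⟧ * 1ℚ} {λ _ → 1ℚ} (λ a → ≤-trans (≤-reflexive (*-identityʳ ⟦ _==_ PC a c ⟧)) (⟦⟧≤1 (_==_ PC a c))))

quarter : ℚ
quarter = half * half

0<quarter : 0ℚ < quarter
0<quarter = *-pos 0<half 0<half

-- The denominator is the number of colour patterns on all `r`-subsets of [M]; the numerator only
-- has to stay below 1/2, for the contradiction with `quarter<half`.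
cellSize : ∀ {C} → Finite C → ℕ → ℕ → ℚ
cellSize PC r M = quarter * inv ∣ finiteVec PC (length (thins r M)) ∣f

sameCell : ∀ {r n M} {C : Set} (PC : Finite C) (col : Vec (Fin (suc n)) r → C) → Vec (Fin (suc n)) M → Vec (Fin (suc n)) M → Bool
sameCell {r} {n} {M} PC col x* x = allL (λ T → _==_ PC (col (select T x)) (col (select T x*))) (thins r M)

-- `L` is a penalty of mean at most 1/2. Averaging 1 - `L` over the patterns produces a cell that is
-- large and lightly penalised at once; a pattern that no tuple has contributes nothing, so a
-- representative `x*` exists.
select-cell : ∀ {r n M} {C : Set} (PC : Finite C) (sw : Swap (∑ PC)) (col : Vec (Fin (suc n)) r → C) (L : Vec (Fin (suc n)) M → ℚ) → ∫ (Disc.𝔼 n M) L ≤ half → DN (Σ[ x* ∈ Vec (Fin (suc n)) M ] cellSize PC r M ≤ ∫ (Disc.𝔼 n M) (λ x → ⟦ sameCell PC col x* x ⟧ * (1ℚ - L x)))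
select-cell {r} {n} {M} {C} PC sw col L L≤ none = contra quarter<half (≤-trans half≤ (≤-trans (≤-reflexive total) (≤-trans (∫≤ (∑ PP) {E} {λ _ → cs} each) (≤-reflexive (trans (∫const (∑ PP) cs) (trans (*-assoc quarter (inv ∣ PP ∣f) ∣ PP ∣f) (trans (cong (quarter *_) (trans (*-comm (inv ∣ PP ∣f) ∣ PP ∣f) (inv-r ∣ PP ∣f PP>0))) (*-identityʳ quarter))))))))
  where
  open Disc n
  l = thins r M
  PP = finiteVec PC (length l)
  cs = cellSize PC r M
  ptn : Vec V M → Vec C (length l)
  ptn = patL col l
  x₀ : Vec V M
  x₀ = Vec.replicate M zero
  PP>0 : 0ℚ < ∣ PP ∣f
  PP>0 = <-≤-trans 0<1 (size≥1 PP (ptn x₀))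
  E : Vec C (length l) → ℚ
  E ζ = ∫ (𝔼 M) (λ x → ⟦ eqVec PC ζ (ptn x) ⟧ * (1ℚ - L x))
  quarter<half : quarter < half
  quarter<half = ℚₚ.*-monoʳ-<-pos half half<1
    where
    half<1 : half < 1ℚ
    half<1 = <-by {half} {1ℚ} {half} refl 0<half
  half≤ : half ≤ ∫ (𝔼 M) (λ x → 1ℚ - L x)
  half≤ = ≤-trans (≤-by (r₀ (∫ (𝔼 M) L)) (Δ {∫ (𝔼 M) L} {half} L≤)) (≤-reflexive (sym (trans (∫- (𝔼 M) (λ _ → 1ℚ) L) (cong (_- ∫ (𝔼 M) L) (𝔼-mean M)))))
    where r₀ : ∀ L → (1ℚ - L) - half ≡ half - L
          r₀ = solve-∀ ℛ
  total : ∫ (𝔼 M) (λ x → 1ℚ - L x) ≡ ∫ (∑ PP) E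
  total = trans (∫≡ (𝔼 M) (λ x → sym (∑-δ PP (λ _ → 1ℚ - L x) (ptn x)))) (linVec-swap (∑ PC) sw (length l) (𝔼 M) (λ x ζ → ⟦ eqVec PC ζ (ptn x) ⟧ * (1ℚ - L x)))
  cs≥0 : 0ℚ ≤ cs
  cs≥0 = <⇒≤ (*-pos 0<quarter (inv-pos ∣ PP ∣f PP>0))
  each : ∀ ζ → E ζ ≤ cs
  each ζ = [ (λ gt → ⊥-elim (lem (Σ[ x* ∈ Vec V M ] ptn x* ≡ ζ) (found gt))) , id ]′ (<-or-≤ cs (E ζ))
    where
    found : cs < E ζ → (Σ[ x* ∈ Vec V M ] ptn x* ≡ ζ) ⊎ ¬ (Σ[ x* ∈ Vec V M ] ptn x* ≡ ζ) → ⊥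
    found gt (inj₁ (x* , refl)) = none (x* , ≤-trans (<⇒≤ gt) (≤-reflexive (∫≡ (𝔼 M) (λ x → cong (λ b → ⟦ b ⟧ * (1ℚ - L x)) (trans (==-sym PP (ptn x*) (ptn x)) (eq-patL PC col l x x*))))))
    found gt (inj₂ no-x) = contra gt (≤-trans (≤-reflexive (trans (∫≡ (𝔼 M) (λ x → trans (cong (λ b → ⟦ b ⟧ * (1ℚ - L x)) (==-false PP {ζ} {ptn x} (λ e → no-x (x , sym e)))) (*-zeroˡ (1ℚ - L x)))) (∫0 (𝔼 M)))) cs≥0)

-- The pattern to be embedded and the colours prescribed for it.

eqT : ∀ {k m} → k ⊑ m → k ⊑ m → Bool
eqT done done = true
eqT (skip e) (skip e') = eqT e e'
eqT (keep e) (keep e') = eqT e e'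
eqT _ _ = false

eqT⇒≡ : ∀ {k m} (e e' : k ⊑ m) → eqT e e' ≡ true → e ≡ e'
eqT⇒≡ done done p = refl
eqT⇒≡ (skip e) (skip e') p = cong skip (eqT⇒≡ e e' p)
eqT⇒≡ (keep e) (keep e') p = cong keep (eqT⇒≡ e e' p)

eqT-refl : ∀ {k m} (e : k ⊑ m) → eqT e e ≡ true
eqT-refl done = refl
eqT-refl (skip e) = eqT-refl e
eqT-refl (keep e) = eqT-refl e

module Pattern (sr f : ℕ) where
  -- A k-graph on the ordered vertex set [f], its edges split into two sides. A shadow set has one role, except that it may have role i on the true side and j on the false side.
  record FPat (i j : Fin (suc sr)) : Set where
    field
      inE : suc sr ⊑ f → Bool
      side : suc sr ⊑ f → Bool
      consistent : ∀ e e' → inE e ≡ true → inE e' ≡ true → ∀ ℓ ℓ' → d ℓ ⨟ e ≡ d ℓ' ⨟ e' → (side e ≡ side e' × ℓ ≡ ℓ') ⊎ ((side e ≡ true × side e' ≡ false × ℓ ≡ i × ℓ' ≡ j) ⊎ (side e ≡ false × side e' ≡ true × ℓ ≡ j × ℓ' ≡ i))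

  module Assign {i j : Fin (suc sr)} (F : FPat i j) {A : Set} (a b : Vec (sr ⊑ f → A) (suc sr)) (a≡b : ∀ S → lookup a i S ≡ lookup b j S) where
    open FPat F
    open Reduced sr using (roles; lookup-roles)

    El : List (suc sr ⊑ f)
    El = List.filter (λ e → inE e Boolₚ.≟ true) (thins (suc sr) f)

    El-uniq : Unique El
    El-uniq = Uniqueₚ.filter⁺ (λ e → inE e Boolₚ.≟ true) (thins-unique (suc sr) f)

    El-in : ∀ {e} → e ∈ El → inE e ≡ true
    El-in p = proj₂ (∈-filter⁻ (λ e → inE e Boolₚ.≟ true) {xs = thins (suc sr) f} p)

    in-El : ∀ e → inE e ≡ true → e ∈ El
    in-El e p = ∈-filter⁺ (λ e → inE e Boolₚ.≟ true) (thins-complete e) p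

    pal : Bool → Vec (sr ⊑ f → A) (suc sr)
    pal true = a
    pal false = b

    val : suc sr ⊑ f → Fin (suc sr) → A
    val e ℓ = lookup (pal (side e)) ℓ (d ℓ ⨟ e)

    -- A facet shared by the two sides has role `i` in one edge and `j` in the other, and there the
    -- assignments `a` and `b` agree by hypothesis. So every shadow set gets one well-defined
    -- colour.
    val-≡ : ∀ e e' → inE e ≡ true → inE e' ≡ true → ∀ ℓ ℓ' → d ℓ ⨟ e ≡ d ℓ' ⨟ e' → val e ℓ ≡ val e' ℓ'
    val-≡ e e' p p' ℓ ℓ' q = go (consistent e e' p p' ℓ ℓ' q)
      where
      go : (side e ≡ side e' × ℓ ≡ ℓ') ⊎ ((side e ≡ true × side e' ≡ false × ℓ ≡ i × ℓ' ≡ j) ⊎ (side e ≡ false × side e' ≡ true × ℓ ≡ j × ℓ' ≡ i)) → val e ℓ ≡ val e' ℓ'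
      go (inj₁ (s , refl)) = cong₂ (λ c S → lookup (pal c) ℓ S) s q
      go (inj₂ (inj₁ (s , s' , refl , refl))) = trans (cong₂ (λ c S → lookup (pal c) i S) s q) (trans (a≡b (d ℓ' ⨟ e')) (cong (λ c → lookup (pal c) j (d ℓ' ⨟ e')) (sym s')))
      go (inj₂ (inj₂ (s , s' , refl , refl))) = trans (cong₂ (λ c S → lookup (pal c) j S) s q) (trans (sym (a≡b (d ℓ' ⨟ e'))) (cong (λ c → lookup (pal c) i (d ℓ' ⨟ e')) (sym s')))

    facets : List (suc sr ⊑ f × Fin (suc sr))
    facets = List.cartesianProduct El (List.allFin (suc sr))

    find : List (suc sr ⊑ f × Fin (suc sr)) → sr ⊑ f → Maybe A
    find [] S = nothing
    find ((e , ℓ) ∷ l) S = if eqT (d ℓ ⨟ e) S then just (val e ℓ) else find l S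

    find-sound : ∀ l S v → find l S ≡ just v → Σ[ e ∈ suc sr ⊑ f ] Σ[ ℓ ∈ Fin (suc sr) ] ((e , ℓ) ∈ l × d ℓ ⨟ e ≡ S × val e ℓ ≡ v)
    find-sound ((e , ℓ) ∷ l) S v p = go (eqT (d ℓ ⨟ e) S) refl p
      where
      go : ∀ c → eqT (d ℓ ⨟ e) S ≡ c → (if c then just (val e ℓ) else find l S) ≡ just v → Σ[ e₁ ∈ suc sr ⊑ f ] Σ[ ℓ₁ ∈ Fin (suc sr) ] ((e₁ , ℓ₁) ∈ ((e , ℓ) ∷ l) × d ℓ₁ ⨟ e₁ ≡ S × val e₁ ℓ₁ ≡ v)
      go true q refl = e , ℓ , here refl , eqT⇒≡ (d ℓ ⨟ e) S q , refl
      go false q r = let e₁ , ℓ₁ , m , rest = find-sound l S v r in e₁ , ℓ₁ , there m , rest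

    find-complete : ∀ l e ℓ → (e , ℓ) ∈ l → Σ[ v ∈ A ] find l (d ℓ ⨟ e) ≡ just v
    find-complete ((e₁ , ℓ₁) ∷ l) e ℓ m = go (eqT (d ℓ₁ ⨟ e₁) (d ℓ ⨟ e)) refl m
      where
      go : ∀ c → eqT (d ℓ₁ ⨟ e₁) (d ℓ ⨟ e) ≡ c → (e , ℓ) ∈ ((e₁ , ℓ₁) ∷ l) → Σ[ v ∈ A ] (if c then just (val e₁ ℓ₁) else find l (d ℓ ⨟ e)) ≡ just v
      go true q _ = val e₁ ℓ₁ , refl
      go false q (here refl) = case trans (sym (eqT-refl (d ℓ ⨟ e))) q of λ ()
      go false q (there m) = find-complete l e ℓ m

    α : sr ⊑ f → Maybe A
    α = find facets

    facet-El : ∀ {e ℓ} → (e , ℓ) ∈ facets → e ∈ El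
    facet-El m = proj₁ (∈-cartesianProduct⁻ El (List.allFin (suc sr)) m)

    cl : suc sr ⊑ f → Vec A (suc sr)
    cl e = pick roles e (pal (side e))

    lookup-cl : ∀ e ℓ → lookup (cl e) ℓ ≡ val e ℓ
    lookup-cl e ℓ = trans (Vecₚ.lookup-zipWith (λ p α → α (d p ⨟ e)) ℓ roles (pal (side e))) (cong (λ p → lookup (pal (side e)) ℓ (d p ⨟ e)) (lookup-roles ℓ))

    α-cl : ∀ {e} → e ∈ El → ∀ ℓ → α (d ℓ ⨟ e) ≡ just (lookup (cl e) ℓ)
    α-cl {e} m ℓ = go (find-complete facets e ℓ (∈-cartesianProduct⁺ m (∈-allFin ℓ)))
      where
      go : Σ[ v ∈ A ] α (d ℓ ⨟ e) ≡ just v → α (d ℓ ⨟ e) ≡ just (lookup (cl e) ℓ)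
      go (v , p) = trans p (cong just (go' (find-sound facets (d ℓ ⨟ e) v p)))
        where
        go' : Σ[ e₁ ∈ suc sr ⊑ f ] Σ[ ℓ₁ ∈ Fin (suc sr) ] ((e₁ , ℓ₁) ∈ facets × d ℓ₁ ⨟ e₁ ≡ d ℓ ⨟ e × val e₁ ℓ₁ ≡ v) → v ≡ lookup (cl e) ℓ
        go' (e₁ , ℓ₁ , m₁ , q , refl) = trans (val-≡ e₁ e (El-in (facet-El m₁)) (El-in m) ℓ₁ ℓ q) (sym (lookup-cl e ℓ))

-- Tuples with repeated vertices.

notIn : ∀ {n m} → Fin n → Vec (Fin n) m → Bool
notIn a [] = true
notIn a (b ∷ x) = not (eqFin a b) ∧ notIn a x

distinct : ∀ {n m} → Vec (Fin n) m → Bool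
distinct [] = true
distinct (a ∷ x) = notIn a x ∧ distinct x

⟦not∧⟧ : ∀ a b → ⟦ not (a ∧ b) ⟧ ≤ ⟦ not a ⟧ + ⟦ not b ⟧
⟦not∧⟧ true b = ≤-reflexive (sym (+-identityˡ ⟦ not b ⟧))
⟦not∧⟧ false b = ≤-by (l ⟦ not b ⟧) (⟦⟧≥0 (not b))
  where l : ∀ b → (1ℚ + b) - 1ℚ ≡ b
        l = solve-∀ ℛ

avg-eq : ∀ n (a : Fin (suc n)) → ∫ (avg n) (λ b → ⟦ eqFin a b ⟧) ≡ inv (ν (suc n))
avg-eq n a = trans (cong (inv (ν (suc n)) *_) (trans (∫≡ (sumFin (suc n)) (λ b → trans (cong ⟦_⟧ (==-sym (finiteFin (suc n)) a b)) (sym (*-identityʳ ⟦ eqFin b a ⟧)))) (∑-δ (finiteFin (suc n)) (λ _ → 1ℚ) a))) (*-identityʳ (inv (ν (suc n))))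

not-not : ∀ b → not (not b) ≡ b
not-not true = refl
not-not false = refl

repeat≤ : ∀ n m (a : Fin (suc n)) → ∫ (Disc.𝔼 n m) (λ x → ⟦ not (notIn a x) ⟧) ≤ ν m * inv (ν (suc n))
repeat≤ n zero a = ≤-reflexive (sym (*-zeroˡ (inv (ν (suc n)))))
repeat≤ n (suc m) a = ≤-trans (∫≤ (𝔼 (suc m)) {λ x → ⟦ not (notIn a x) ⟧} {λ { (b ∷ x) → ⟦ eqFin a b ⟧ + ⟦ not (notIn a x) ⟧ }} (λ { (b ∷ x) → subst (λ c → ⟦ not (notIn a (b ∷ x)) ⟧ ≤ ⟦ c ⟧ + ⟦ not (notIn a x) ⟧) (not-not (eqFin a b)) (⟦not∧⟧ (not (eqFin a b)) (notIn a x)) })) (≤-trans (≤-reflexive (trans (∫≡ (avg n) (λ b → trans (∫+ (𝔼 m) (λ _ → ⟦ eqFin a b ⟧) (λ x → ⟦ not (notIn a x) ⟧)) (cong (_+ R) (mean-const (𝔼 m) (𝔼-mean m) ⟦ eqFin a b ⟧)))) (trans (∫+ (avg n) (λ b → ⟦ eqFin a b ⟧) (λ _ → R)) (cong₂ _+_ (avg-eq n a) (mean-const (avg n) (avg-mean n) R))))) (≤-trans (+-mono-≤ (≤-refl {inv (ν (suc n))}) (repeat≤ n m a)) (≤-reflexive (l (ν m) (inv (ν (suc n)))))))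
  where
  open Disc n
  R = ∫ (𝔼 m) (λ x → ⟦ not (notIn a x) ⟧)
  l : ∀ m i → i + m * i ≡ (1ℚ + m) * i
  l = solve-∀ ℛ

indistinct≤ : ∀ n m → ∫ (Disc.𝔼 n m) (λ x → ⟦ not (distinct x) ⟧) ≤ (ν m * ν m) * inv (ν (suc n))
indistinct≤ n zero = ≤-reflexive (sym (*-zeroˡ (inv (ν (suc n)))))
indistinct≤ n (suc m) = ≤-trans (∫≤ (𝔼 (suc m)) {λ x → ⟦ not (distinct x) ⟧} {λ { (b ∷ x) → ⟦ not (notIn b x) ⟧ + ⟦ not (distinct x) ⟧ }} (λ { (b ∷ x) → ⟦not∧⟧ (notIn b x) (distinct x) })) (≤-trans (≤-reflexive (∫≡ (avg n) (λ b → ∫+ (𝔼 m) (λ x → ⟦ not (notIn b x) ⟧) (λ x → ⟦ not (distinct x) ⟧)))) (≤-trans (mean-≤ (avg n) (avg-mean n) {λ b → ∫ (𝔼 m) (λ x → ⟦ not (notIn b x) ⟧) + ∫ (𝔼 m) (λ x → ⟦ not (distinct x) ⟧)} (λ b → +-mono-≤ (repeat≤ n m b) (indistinct≤ n m))) (≤-by (l (ν m) i) (((0≤1 ⊕ ν≥0 m) ⊗ i≥0)))))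
  where
  open Disc n
  i = inv (ν (suc n))
  i≥0 : 0ℚ ≤ i
  i≥0 = <⇒≤ (inv-pos (ν (suc n)) (ν-pos n))
  l : ∀ m i → ((1ℚ + m) * (1ℚ + m)) * i - (m * i + m * m * i) ≡ (1ℚ + m) * i
  l = solve-∀ ℛ

notIn-select : ∀ {n m k} (e : k ⊑ m) (a : Fin n) (x : Vec (Fin n) m) → notIn a x ≡ true → notIn a (select e x) ≡ true
notIn-select done a x p = refl
notIn-select (skip e) a (b ∷ x) p = notIn-select e a x (∧ʳ (not (eqFin a b)) (notIn a x) p)
notIn-select (keep e) a (b ∷ x) p = ∧-intro (∧ˡ (not (eqFin a b)) (notIn a x) p) (notIn-select e a x (∧ʳ (not (eqFin a b)) (notIn a x) p))

distinct-select : ∀ {n m k} (e : k ⊑ m) (x : Vec (Fin n) m) → distinct x ≡ true → distinct (select e x) ≡ true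
distinct-select done x p = refl
distinct-select (skip e) (a ∷ x) p = distinct-select e x (∧ʳ (notIn a x) (distinct x) p)
distinct-select (keep e) (a ∷ x) p = ∧-intro (notIn-select e a x (∧ˡ (notIn a x) (distinct x) p)) (distinct-select e x (∧ʳ (notIn a x) (distinct x) p))

miss-d : ∀ {j} (t : Fin (suc j)) → miss (d t) ≡ t
miss-d zero = refl
miss-d {suc j} (suc t) = cong suc (miss-d t)

prodL-tabulate : ∀ {A : Set} n (f : A → ℚ) (g : Fin n → A) → prodL f (List.tabulate g) ≡ prodF n (f ∘ g)
prodL-tabulate zero f g = refl
prodL-tabulate (suc n) f g = cong (f (g zero) *_) (prodL-tabulate n f (g ∘ suc))

hlin-wt : ∀ {n} {A : Set} {P : Finite A} {M L} (s : Str P n M) e (ps : Vec (Fin (suc n)) L) f → ∫ (hlin (laws s e ps)) f ≡ ∫ (linVec (∑ P) L) (λ v → prodF L (λ i → β s (d (lookup ps i) ⨟ e) (lookup v i)) * f v)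
hlin-wt s e [] f = sym (*-identityˡ (f []))
hlin-wt {P = P} {L = suc L} s e (p ∷ ps) f = ∫≡ (∑ P) (λ a → trans (cong (β s (d p ⨟ e) a *_) (hlin-wt s e ps (λ v → f (a ∷ v)))) (trans (sym (∫* (linVec (∑ P) L) (β s (d p ⨟ e) a) (λ v → Π v * f (a ∷ v)))) (∫≡ (linVec (∑ P) L) (λ v → sym (*-assoc (β s (d p ⨟ e) a) (Π v) (f (a ∷ v)))))))
  where Π = λ v → prodF L (λ i → β s (d (lookup ps i) ⨟ e) (lookup v i))

eqVec-lookup : ∀ {A} (P : Finite A) {m} (a : Vec A m) (q : Fin m → A) → eqVec P a (tabulate q) ≡ true → ∀ i → _==_ P (lookup a i) (q i) ≡ true
eqVec-lookup P (a ∷ as) q h zero = ∧ˡ (_==_ P a (q zero)) (eqVec P as (tabulate (q ∘ suc))) h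
eqVec-lookup P (a ∷ as) q h (suc i) = eqVec-lookup P as (q ∘ suc) (∧ʳ (_==_ P a (q zero)) (eqVec P as (tabulate (q ∘ suc))) h) i

eqVec-intro : ∀ {A} (P : Finite A) {m} (a : Vec A m) (q : Fin m → A) → (∀ i → _==_ P (lookup a i) (q i) ≡ true) → eqVec P a (tabulate q) ≡ true
eqVec-intro P [] q h = refl
eqVec-intro P (a ∷ as) q h = ∧-intro (h zero) (eqVec-intro P as (q ∘ suc) (h ∘ suc))

-- Density and counting inside one cell.

module Top (r n M : ℕ) {A C : Set} (PA : Finite A) (swA : Swap (∑ PA)) (PC : Finite C)
  (κ : Vec (Fin (suc n)) (suc r) → A) (col : Vec (Fin (suc n)) r → C)
  (B : A → Vec C (suc r) → ℚ) (B-range : ∀ a p → (0ℚ ≤ B a p) × (B a p ≤ 1ℚ))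
  (g₂ : A → Vec (Fin (suc n)) (suc r) → ℚ) (x* : Vec (Fin (suc n)) M)
  (B-sum : ∀ S → ∫ (∑ PA) (Cell.β* r n M PA PC κ col B B-range g₂ x* S) ≡ 1ℚ)
  (ω : ℚ) (ω>0 : 0ℚ < ω) (ε₂ : ℚ) (ε₂≤ : ε₂ ≤ ω * Cell.m r n M PA PC κ col B B-range g₂ x*)
  (reg₂ : ∀ a → Disc.CutReg n r (λ y → ⟦ _==_ PA a (κ y) ⟧ - g₂ a y) ε₂)
  (var₂ : ∀ S a → ∫ (Disc.𝔼 n M) (λ x → ⟦ Cell.u r n M PA PC κ col B B-range g₂ x* x ⟧ * ((g₂ a (select S x) - B a (facetPat col (select S x))) * (g₂ a (select S x) - B a (facetPat col (select S x))))) ≤ (ω * ω) * Cell.m r n M PA PC κ col B B-range g₂ x*)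
  (h : Vec (Fin (suc n)) (suc (suc r)) → Bool) (W : Vec A (suc (suc r)) → ℚ)
  (g₁ : Vec (Fin (suc n)) (suc (suc r)) → ℚ) (g₁-range : ∀ z → (0ℚ ≤ g₁ z) × (g₁ z ≤ 1ℚ))
  (ε₁ : ℚ) (ε₁≥0 : 0ℚ ≤ ε₁) (reg₁ : Disc.CutReg n (suc r) (λ z → ⟦ h z ⟧ - g₁ z) ε₁)
  (τ : ℚ) (Bad : Vec (Fin (suc n)) (suc (suc r)) → Bool)
  (near : ∀ z → Bad z ≡ false → Abs (g₁ z - W (tabulate (λ t → κ (select (d t) z)))) τ)
  (ε₀ δ c₃ : ℚ) (ε₀≥0 : 0ℚ ≤ ε₀) (τ≥0 : 0ℚ ≤ τ) (δ≥0 : 0ℚ ≤ δ) (c₃>0 : 0ℚ < c₃) (c₃≤1 : c₃ ≤ 1ℚ) where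
  open Disc n
  open Cell r n M PA PC κ col B B-range g₂ x*

  open Removal ω ω>0 ε₂ ε₂≤ reg₂ var₂
  open Reduced sr using (roles; lookup-roles)

  patA : Vec V k → Vec A k
  patA z = tabulate (λ t → κ (select (d t) z))

  bad : k ⊑ M → Vec V M → Bool
  bad e x = Bad (select e x)

  hit : k ⊑ M → Vec V M → Bool
  hit e x = h (select e x)

  G : k ⊑ M → Vec A k → Vec V M → Bool
  G e a x = eqVec PA a (patA (select e x))

  str : Str PA sr M
  β str = β*
  β≥0 str S a = proj₁ (B-range a (patC (select S x*)))
  β1 str = B-sum

  Πβ : k ⊑ M → Vec A k → ℚ
  Πβ e a = prodF k (λ ℓ → β* (d ℓ ⨟ e) (lookup a ℓ))

  uG : k ⊑ M → Vec A k → Vec V M → Bool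
  uG e a x = u x ∧ G e a x

  facet-inj : ∀ (e : k ⊑ M) {ℓ ℓ' : Fin k} → d ℓ ⨟ e ≡ d ℓ' ⨟ e → ℓ ≡ ℓ'
  facet-inj e {ℓ} {ℓ'} p = trans (sym (miss-d ℓ)) (trans (cong miss (⨟-injective e p)) (miss-d ℓ'))

  G-fac : ∀ e a x → G e a x ≡ true → ∀ ℓ → fac (lookup a ℓ) (d ℓ ⨟ e) x ≡ true
  G-fac e a x p ℓ = subst (λ y → _==_ PA (lookup a ℓ) (κ y) ≡ true) (sym (select-⨟ (d ℓ) e x)) (eqVec-lookup PA a (λ t → κ (select (d t) (select e x))) p ℓ)

  fac-G : ∀ e a x → (∀ ℓ → fac (lookup a ℓ) (d ℓ ⨟ e) x ≡ true) → G e a x ≡ true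
  fac-G e a x p = eqVec-intro PA a (λ t → κ (select (d t) (select e x))) (λ ℓ → subst (λ y → _==_ PA (lookup a ℓ) (κ y) ≡ true) (select-⨟ (d ℓ) e x) (p ℓ))

  G-est : ∀ e a → Abs (P (uG e a) - Πβ e a * m) (ν k * err)
  G-est e a = subst₂ Abs (cong₂ (λ p q → p - q * m) (P-ext (λ x → u x ∧ facs ι inj α (List.allFin k) x) (uG e a) (λ x → cong (u x ∧_) (bool-ext (λ q → fac-G e a x (λ ℓ → allL-elim (λ ℓ → fac? (α ℓ) (ι ℓ) x) (List.allFin k) q (∈-allFin ℓ))) (λ q → allL-intro (λ ℓ → fac? (α ℓ) (ι ℓ) x) (List.allFin k) (λ {ℓ} _ → G-fac e a x q ℓ))))) (prodL-tabulate k (λ ℓ → β? (α ℓ) (ι ℓ)) id)) (cong (λ l → ν l * err) (Listₚ.length-tabulate {n = k} id)) (removals ι inj α (List.allFin k) (Uniqueₚ.allFin⁺ k) u (λ S _ → u-adm ℕₚ.≤-refl (ι S)) (λ x q → q))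
    where
    ι : Fin k → sr ⊑ M
    ι ℓ = d ℓ ⨟ e
    α : Fin k → Maybe A
    α ℓ = just (lookup a ℓ)
    inj : ∀ {ℓ ℓ'} → ι ℓ ≡ ι ℓ' → ℓ ≡ ℓ'
    inj = facet-inj e

  -- The usable colour tuples: substantial weight, no rare colour, and few vertex tuples on which
  -- `g₁` strays from `W`. The last clause is relative to the event `uG`, which lets it persist when
  -- further colours are prescribed.
  R : k ⊑ M → Vec A k → Bool
  R e a = leᵇ ε₀ (W a) ∧ (allF k (λ ℓ → leᵇ δ (β* (d ℓ ⨟ e) (lookup a ℓ))) ∧ leᵇ (P (λ x → uG e a x ∧ bad e x)) (c₃ * P (uG e a)))

  G-W : ∀ e a x → G e a x ≡ true → W (patA (select e x)) ≡ W a
  G-W e a x p = cong W (sym (==⇒≡ (finiteVec PA k) {a} {patA (select e x)} p))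

  uG-adm : ∀ e a → Adm e (uG e a)
  uG-adm e a = adm-∧ e u (G e a) (u-adm (ℕₚ.n≤1+n r) e) (adm-ext (λ x → sym (G≡ x)) (adm-all e (λ ℓ x → fac (lookup a ℓ) (d ℓ ⨟ e) x) (List.allFin k) (λ {ℓ} _ → adm-dep (proj₂ (cov-small e (d ℓ ⨟ e) ℕₚ.≤-refl (ℕₚ.n≤1+n sr))) (λ y → _==_ PA (lookup a ℓ) (κ y)))))
    where
    G≡ : ∀ x → G e a x ≡ allL (λ ℓ → fac (lookup a ℓ) (d ℓ ⨟ e) x) (List.allFin k)
    G≡ x = bool-ext (λ q → allL-intro (λ ℓ → fac (lookup a ℓ) (d ℓ ⨟ e) x) (List.allFin k) (λ {ℓ} _ → G-fac e a x q ℓ)) (λ q → fac-G e a x (λ ℓ → allL-elim (λ ℓ → fac (lookup a ℓ) (d ℓ ⨟ e) x) (List.allFin k) q (∈-allFin ℓ)))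

  swap-h : ∀ e (X : Vec V M → Bool) → Adm e X → Abs (P (λ x → X x ∧ hit e x) - E (λ x → g₁ (select e x) * ⟦ X x ⟧)) ε₁
  swap-h e X adm = subst (λ z → Abs z ε₁) (trans (∫≡ (𝔼 M) (λ x → trans (r₀ ⟦ hit e x ⟧ (g₁ (select e x)) ⟦ X x ⟧) (cong (_- g₁ (select e x) * ⟦ X x ⟧) (sym (⟦∧⟧ (X x) (hit e x)))))) (∫- (𝔼 M) (λ x → ⟦ X x ∧ hit e x ⟧) (λ x → g₁ (select e x) * ⟦ X x ⟧))) (cut-lift {F = λ z → ⟦ h z ⟧ - g₁ z} {X = X} e reg₁ adm)
    where r₀ : ∀ h g X → (h - g) * X ≡ X * h - g * X
          r₀ = solve-∀ ℛ

  ic₃ K₀ : ℚ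
  ic₃ = inv c₃
  K₀ = ε₁ + (δ * m + ν k * err)

  bound : k ⊑ M → Vec A k → ℚ
  bound e a = ((Πβ e a * ⟦ R e a ⟧) * m + (ε₀ + τ) * P (uG e a)) + ((1ℚ + ic₃) * P (λ x → uG e a x ∧ bad e x) + K₀)

  prodF≤ : ∀ L (x : Fin L → ℚ) → (∀ i → (0ℚ ≤ x i) × (x i ≤ 1ℚ)) → ∀ i → prodF L x ≤ x i
  prodF≤1 : ∀ L (x : Fin L → ℚ) → (∀ i → (0ℚ ≤ x i) × (x i ≤ 1ℚ)) → prodF L x ≤ 1ℚ
  prodF≤1 zero x p = ≤-refl
  prodF≤1 (suc L) x p = *-mono {d = 1ℚ} (proj₁ (p zero)) 0≤1 (proj₂ (p zero)) (prodF≤1 L (x ∘ suc) (p ∘ suc))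
  prodF≤ (suc L) x p zero = ≤-trans (*-monoʳ (x zero) (proj₁ (p zero)) (prodF≤1 L (x ∘ suc) (p ∘ suc))) (≤-reflexive (*-identityʳ (x zero)))
  prodF≤ (suc L) x p (suc i) = ≤-trans (*-monoˡ (prodF L (x ∘ suc)) (prodF≥0 L (λ i → proj₁ (p (suc i)))) (proj₂ (p zero))) (≤-trans (≤-reflexive (*-identityˡ (prodF L (x ∘ suc)))) (prodF≤ L (x ∘ suc) (p ∘ suc) i))

  Th : k ⊑ M → Vec A k → ℚ
  Th e a = P (λ x → uG e a x ∧ hit e x)

  allF-false : ∀ L (p : Fin L → Bool) → allF L p ≡ false → Σ[ i ∈ Fin L ] p i ≡ false
  allF-false (suc L) p q = go (p zero) refl q
    where
    go : ∀ b → p zero ≡ b → b ∧ allF L (p ∘ suc) ≡ false → Σ[ i ∈ Fin (suc L) ] p i ≡ false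
    go false e _ = zero , e
    go true e r = let i , s = allF-false L (p ∘ suc) r in suc i , s

  -- Usable tuples contribute their product measure. Failing a clause is charged to a term of its
  -- own: too many bad tuples to `ic₃` times their measure, a rare colour to `δ * m`, a small weight
  -- to `ε₀ + τ` and the bad tuples.
  T≤bound : ∀ e a → Th e a ≤ bound e a
  T≤bound e a = cases (leᵇ ε₀ (W a)) refl (allF k (λ ℓ → leᵇ δ (β* (d ℓ ⨟ e) (lookup a ℓ)))) refl (leᵇ Q (c₃ * p)) refl
    where
    p = P (uG e a)
    Q = P (λ x → uG e a x ∧ bad e x)
    π = Πβ e a
    p≥0 : 0ℚ ≤ p
    p≥0 = P≥0 (uG e a)
    Q≥0 : 0ℚ ≤ Q
    Q≥0 = P≥0 (λ x → uG e a x ∧ bad e x)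
    m≥0 : 0ℚ ≤ m
    m≥0 = P≥0 u
    ic₃≥0 : 0ℚ ≤ ic₃
    ic₃≥0 = <⇒≤ (inv-pos c₃ c₃>0)
    ke≥0 : 0ℚ ≤ ν k * err
    ke≥0 = ν≥0 k ⊗ err≥0
    T≤p : Th e a ≤ p
    T≤p = P-mono (λ x → uG e a x ∧ hit e x) (uG e a) (λ x q → ∧ˡ (uG e a x) (hit e x) q)
    p≤ : p ≤ π * m + ν k * err
    p≤ = ≤-by (r₀ p (π * m) (ν k * err)) (Δ {p - π * m} {ν k * err} (proj₁ (G-est e a)))
      where r₀ : ∀ p q e → (q + e) - p ≡ e - (p - q)
            r₀ = solve-∀ ℛ
    cases : ∀ b₁ → leᵇ ε₀ (W a) ≡ b₁ → ∀ b₂ → allF k (λ ℓ → leᵇ δ (β* (d ℓ ⨟ e) (lookup a ℓ))) ≡ b₂ → ∀ b₃ → leᵇ Q (c₃ * p) ≡ b₃ → Th e a ≤ ((π * ⟦ b₁ ∧ (b₂ ∧ b₃) ⟧) * m + (ε₀ + τ) * p) + ((1ℚ + ic₃) * Q + K₀)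
    cases true e₁ true e₂ true e₃ = ≤-trans T≤p (≤-trans p≤ (≤-by (s₁ π m (ν k * err) ε₀ τ p ic₃ Q ε₁ δ) ((((ε₀≥0 ⊕ τ≥0) ⊗ p≥0) ⊕ ((0≤1 ⊕ ic₃≥0) ⊗ Q≥0)) ⊕ (ε₁≥0 ⊕ δ≥0 ⊗ m≥0))))
      where s₁ : ∀ π m ke e₀ t p i Q e₁ dl → (((π * 1ℚ) * m + (e₀ + t) * p) + ((1ℚ + i) * Q + (e₁ + (dl * m + ke)))) - (π * m + ke) ≡ ((e₀ + t) * p + (1ℚ + i) * Q) + (e₁ + dl * m)
            s₁ = solve-∀ ℛ
    cases true e₁ true e₂ false e₃ = ≤-trans T≤p (≤-trans p≤iQ (≤-by (s₁ π m (ν k * err) ε₀ τ p ic₃ Q ε₁ δ) ((((ε₀≥0 ⊕ τ≥0) ⊗ p≥0) ⊕ Q≥0) ⊕ (ε₁≥0 ⊕ (δ≥0 ⊗ m≥0 ⊕ ke≥0)))))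
      where
      s₁ : ∀ π m ke e₀ t p i Q e₁ dl → (((π * 0ℚ) * m + (e₀ + t) * p) + ((1ℚ + i) * Q + (e₁ + (dl * m + ke)))) - i * Q ≡ ((e₀ + t) * p + Q) + (e₁ + (dl * m + ke))
      s₁ = solve-∀ ℛ
      p≤iQ : p ≤ ic₃ * Q
      p≤iQ = ≤-trans (≤-div c₃ c₃>0 (leᵇ-false Q (c₃ * p) e₃)) (≤-reflexive (*-comm Q ic₃))
    cases true e₁ false e₂ b₃ e₃ = ≤-trans T≤p (≤-trans p≤ (≤-trans (+-mono-≤ (*-monoˡ m m≥0 small) (≤-refl {ν k * err})) (≤-by (s₁ π m (ν k * err) ε₀ τ p ic₃ Q ε₁ δ) ((((ε₀≥0 ⊕ τ≥0) ⊗ p≥0) ⊕ ((0≤1 ⊕ ic₃≥0) ⊗ Q≥0)) ⊕ ε₁≥0))))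
      where
      s₁ : ∀ π m ke e₀ t p i Q e₁ dl → (((π * 0ℚ) * m + (e₀ + t) * p) + ((1ℚ + i) * Q + (e₁ + (dl * m + ke)))) - (dl * m + ke) ≡ ((e₀ + t) * p + (1ℚ + i) * Q) + e₁
      s₁ = solve-∀ ℛ
      small : π ≤ δ
      small = go (allF-false k (λ ℓ → leᵇ δ (β* (d ℓ ⨟ e) (lookup a ℓ))) e₂)
        where
        go : Σ[ ℓ ∈ Fin k ] leᵇ δ (β* (d ℓ ⨟ e) (lookup a ℓ)) ≡ false → π ≤ δ
        go (ℓ , q) = ≤-trans (prodF≤ k (λ ℓ → β* (d ℓ ⨟ e) (lookup a ℓ)) (λ ℓ → B-range (lookup a ℓ) (patC (select (d ℓ ⨟ e) x*))) ℓ) (leᵇ-false δ (β* (d ℓ ⨟ e) (lookup a ℓ)) q)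
    cases false e₁ b₂ e₂ b₃ e₃ = ≤-trans T≤ (≤-by (s₁ π m (ν k * err) ε₀ τ p ic₃ Q ε₁ δ) ((ic₃≥0 ⊗ Q≥0) ⊕ (δ≥0 ⊗ m≥0 ⊕ ke≥0)))
      where
      s₁ : ∀ π m ke e₀ t p i Q e₁ dl → (((π * 0ℚ) * m + (e₀ + t) * p) + ((1ℚ + i) * Q + (e₁ + (dl * m + ke)))) - ((e₀ + t) * p + Q + e₁) ≡ i * Q + (dl * m + ke)
      s₁ = solve-∀ ℛ
      W≤ : W a ≤ ε₀
      W≤ = leᵇ-false ε₀ (W a) e₁
      ptw : ∀ x → g₁ (select e x) * ⟦ uG e a x ⟧ ≤ (ε₀ + τ) * ⟦ uG e a x ⟧ + ⟦ uG e a x ∧ bad e x ⟧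
      ptw x = go (uG e a x) refl (bad e x) refl
        where
        go : ∀ c → uG e a x ≡ c → ∀ b → bad e x ≡ b → g₁ (select e x) * ⟦ c ⟧ ≤ (ε₀ + τ) * ⟦ c ⟧ + ⟦ c ∧ b ⟧
        go false _ b _ = ≤-reflexive (s₂ (g₁ (select e x)) (ε₀ + τ))
          where s₂ : ∀ g t → g * 0ℚ ≡ t * 0ℚ + 0ℚ
                s₂ = solve-∀ ℛ
        go true _ true _ = ≤-by (s₂ (g₁ (select e x)) (ε₀ + τ)) ((ε₀≥0 ⊕ τ≥0) ⊕ Δ {g₁ (select e x)} {1ℚ} (proj₂ (g₁-range (select e x))))
          where s₂ : ∀ g t → (t * 1ℚ + 1ℚ) - g * 1ℚ ≡ t + (1ℚ - g)
                s₂ = solve-∀ ℛ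
        go true q false b = ≤-by (s₂ (g₁ (select e x)) ε₀ τ (W a)) (Δ {W a} {ε₀} W≤ ⊕ Δ {g₁ (select e x) - W a} {τ} (subst (λ z → g₁ (select e x) - z ≤ τ) (G-W e a x (∧ʳ (u x) (G e a x) q)) (proj₁ (near (select e x) b))))
          where s₂ : ∀ g e₀ t W → ((e₀ + t) * 1ℚ + 0ℚ) - g * 1ℚ ≡ (e₀ - W) + (t - (g - W))
                s₂ = solve-∀ ℛ
      T≤ : Th e a ≤ (ε₀ + τ) * p + Q + ε₁
      T≤ = ≤-by (s₂ (Th e a) (E (λ x → g₁ (select e x) * ⟦ uG e a x ⟧)) ((ε₀ + τ) * p + Q) ε₁) (Δ {Th e a - E (λ x → g₁ (select e x) * ⟦ uG e a x ⟧)} {ε₁} (proj₁ (swap-h e (uG e a) (uG-adm e a))) ⊕ Δ {E (λ x → g₁ (select e x) * ⟦ uG e a x ⟧)} {(ε₀ + τ) * p + Q} (≤-trans (∫≤ (𝔼 M) {λ x → g₁ (select e x) * ⟦ uG e a x ⟧} {λ x → (ε₀ + τ) * ⟦ uG e a x ⟧ + ⟦ uG e a x ∧ bad e x ⟧} ptw) (≤-reflexive (trans (∫+ (𝔼 M) (λ x → (ε₀ + τ) * ⟦ uG e a x ⟧) (λ x → ⟦ uG e a x ∧ bad e x ⟧)) (cong (_+ Q) (∫* (𝔼 M) (ε₀ + τ) (λ x → ⟦ uG e a x ⟧)))))))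
        where s₂ : ∀ T g q e → (q + e) - T ≡ (e - (T - g)) + (q - g)
              s₂ = solve-∀ ℛ

  AK : Lin (Vec A k)
  AK = linVec (∑ PA) k

  by-colours : ∀ e (X : Vec V M → Bool) → P X ≡ ∫ AK (λ a → P (λ x → X x ∧ G e a x))
  by-colours e X = trans (∫≡ (𝔼 M) (λ x → sym (trans (∫≡ AK (λ a → ⟦∧⟧' (X x) (G e a x))) (∑-δ (finiteVec PA k) (λ _ → ⟦ X x ⟧) (patA (select e x)))))) (linVec-swap (∑ PA) swA k (𝔼 M) (λ x a → ⟦ X x ∧ G e a x ⟧))
    where ⟦∧⟧' : ∀ a b → ⟦ a ∧ b ⟧ ≡ ⟦ b ⟧ * ⟦ a ⟧
          ⟦∧⟧' a b = trans (⟦∧⟧ a b) (*-comm ⟦ a ⟧ ⟦ b ⟧)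

  mass-Πβ : ∀ e → mass str e roles (R e) ≡ ∫ AK (λ a → Πβ e a * ⟦ R e a ⟧)
  mass-Πβ e = trans (mass-def str e roles (R e)) (trans (hlin-wt str e roles (λ v → ⟦ R e v ⟧)) (∫≡ AK (λ a → cong (_* ⟦ R e a ⟧) (prodF-cong k (λ i → cong (λ j → β* (d j ⨟ e) (lookup a i)) (lookup-roles i))))))
    where
    prodF-cong : ∀ L {f g : Fin L → ℚ} → (∀ i → f i ≡ g i) → prodF L f ≡ prodF L g
    prodF-cong zero h = refl
    prodF-cong (suc L) h = cong₂ _*_ (h zero) (prodF-cong L (h ∘ suc))

  ∣AK∣ : ℚ
  ∣AK∣ = ∫ AK (λ _ → 1ℚ)

  -- Read backwards, the edge density in the cell bounds the mass of `R` from below.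
  hits≤ : ∀ e → P (λ x → u x ∧ hit e x) ≤ (mass str e roles (R e) * m + (ε₀ + τ) * m) + ((1ℚ + ic₃) * P (λ x → u x ∧ bad e x) + K₀ * ∣AK∣)
  hits≤ e = begin
      P (λ x → u x ∧ hit e x)
        ≡⟨ by-colours e (λ x → u x ∧ hit e x) ⟩
      ∫ AK (λ a → P (λ x → (u x ∧ hit e x) ∧ G e a x))
        ≡⟨ ∫≡ AK (λ a → P-ext (λ x → (u x ∧ hit e x) ∧ G e a x) (λ x → uG e a x ∧ hit e x) (λ x → perm (u x) (hit e x) (G e a x))) ⟩
      ∫ AK (Th e)
        ≤⟨ ∫≤ AK {Th e} {bound e} (T≤bound e) ⟩
      ∫ AK (bound e)
        ≡⟨ trans (∫+ AK (λ a → (Πβ e a * ⟦ R e a ⟧) * m + (ε₀ + τ) * P (uG e a)) (λ a → (1ℚ + ic₃) * P (λ x → uG e a x ∧ bad e x) + K₀)) (cong₂ _+_ part₁ part₂) ⟩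
      (mass str e roles (R e) * m + (ε₀ + τ) * m) + ((1ℚ + ic₃) * P (λ x → u x ∧ bad e x) + K₀ * ∣AK∣) ∎
    where
    open ℚₚ.≤-Reasoning
    perm : ∀ a b c → (a ∧ b) ∧ c ≡ (a ∧ c) ∧ b
    perm false b c = refl
    perm true b c = Boolₚ.∧-comm b c
    part₁ : ∫ AK (λ a → (Πβ e a * ⟦ R e a ⟧) * m + (ε₀ + τ) * P (uG e a)) ≡ mass str e roles (R e) * m + (ε₀ + τ) * m
    part₁ = trans (∫+ AK (λ a → (Πβ e a * ⟦ R e a ⟧) * m) (λ a → (ε₀ + τ) * P (uG e a))) (cong₂ _+_ (trans (∫*ʳ AK m (λ a → Πβ e a * ⟦ R e a ⟧)) (cong (_* m) (sym (mass-Πβ e)))) (trans (∫* AK (ε₀ + τ) (λ a → P (uG e a))) (cong ((ε₀ + τ) *_) (sym (by-colours e u)))))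
    part₂ : ∫ AK (λ a → (1ℚ + ic₃) * P (λ x → uG e a x ∧ bad e x) + K₀) ≡ (1ℚ + ic₃) * P (λ x → u x ∧ bad e x) + K₀ * ∣AK∣
    part₂ = trans (∫+ AK (λ a → (1ℚ + ic₃) * P (λ x → uG e a x ∧ bad e x)) (λ _ → K₀)) (cong₂ _+_ (trans (∫* AK (1ℚ + ic₃) (λ a → P (λ x → uG e a x ∧ bad e x))) (cong ((1ℚ + ic₃) *_) (trans (∫≡ AK (λ a → P-ext (λ x → uG e a x ∧ bad e x) (λ x → (u x ∧ bad e x) ∧ G e a x) (λ x → sym (perm (u x) (bad e x) (G e a x))))) (sym (by-colours e (λ x → u x ∧ bad e x)))))) (∫const AK K₀))

  module Count (f : ℕ) (I : f ⊑ M) (α : sr ⊑ f → Maybe A) (δ≤1 : δ ≤ 1ℚ)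
               (α-δ : ∀ S a → α S ≡ just a → δ ≤ β* (S ⨟ I) a)
               (El : List (k ⊑ f)) (uniq : Unique El) (cl : k ⊑ f → Vec A k)
               (α-cl : ∀ {e} → e ∈ El → ∀ ℓ → α (d ℓ ⨟ e) ≡ just (lookup (cl e) ℓ))
               (R-cl : ∀ {e} → e ∈ El → R (e ⨟ I) (cl e) ≡ true)
               (θ≥0 : 0ℚ ≤ ε₀ - τ) (θ≤1 : ε₀ - τ ≤ 1ℚ) where

    θ : ℚ
    θ = ε₀ - τ

    ι : sr ⊑ f → sr ⊑ M
    ι S = S ⨟ I

    ι-inj : ∀ {S S'} → ι S ≡ ι S' → S ≡ S'
    ι-inj = ⨟-injective I

    Ls : List (sr ⊑ f)
    Ls = thins sr f

    Fall : Vec V M → Bool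
    Fall = facs ι ι-inj α Ls

    uF : Vec V M → Bool
    uF x = u x ∧ Fall x

    N₀ slack : ℚ
    N₀ = P uF
    slack = ν (length Ls) * err

    slack≥0 : 0ℚ ≤ slack
    slack≥0 = ν≥0 (length Ls) ⊗ err≥0

    βs≥ : ∀ l → δ ^ℚ length l ≤ βs ι ι-inj α l
    βs≥ [] = ≤-refl
    βs≥ (S ∷ l) = *-mono δ≥0 (proj₁ (βs-range ι ι-inj α l)) (one (α S) refl) (βs≥ l)
      where
      one : ∀ a → α S ≡ a → δ ≤ β? a (ι S)
      one nothing e = δ≤1
      one (just a) e = α-δ S a e

    N₀-low : δ ^ℚ length Ls * m - slack ≤ N₀
    N₀-low = ≤-by (r₀ N₀ (βs ι ι-inj α Ls) m (δ ^ℚ length Ls) slack) (Δ { - slack} {N₀ - βs ι ι-inj α Ls * m} (proj₂ (removals ι ι-inj α Ls (thins-unique sr f) u (λ S _ → u-adm ℕₚ.≤-refl (ι S)) (λ x q → q))) ⊕ Δ {δ ^ℚ length Ls} {βs ι ι-inj α Ls} (βs≥ Ls) ⊗ P≥0 u)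
      where r₀ : ∀ N b m p s → N - (p * m - s) ≡ ((N - b * m) - (- s)) + (b - p) * m
            r₀ = solve-∀ ℛ

    module Edge (e : k ⊑ f) (e∈ : e ∈ El) where
      e' : k ⊑ M
      e' = e ⨟ I
      a : Vec A k
      a = cl e
      Facet : sr ⊑ f → Set
      Facet S = Σ[ ℓ ∈ Fin k ] S ≡ d ℓ ⨟ e
      split : ∀ S → Facet S ⊎ (Σ[ τ ∈ r ⊑ sr ] Cov (ι S) e' τ)
      split S = [ (λ (δ' , p) → inj₁ (miss δ' , ⨟-injective I (trans p (trans (sym (⨟-assoc δ' e I)) (cong (λ z → (z ⨟ e) ⨟ I) (sym (d-miss δ'))))))) , inj₂ ]′ (cov-diff (ι S) e')
      facetᵇ : sr ⊑ f → Bool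
      facetᵇ S = [ (λ _ → true) , (λ _ → false) ]′ (split S)
      l' : List (sr ⊑ f)
      l' = List.filter (λ S → facetᵇ S Boolₚ.≟ false) Ls
      non-facet : ∀ S → facetᵇ S ≡ false → Σ[ τ ∈ r ⊑ sr ] Cov (ι S) e' τ
      non-facet S q with split S
      ... | inj₂ c = c
      is-facet : ∀ S → facetᵇ S ≡ true → Facet S
      is-facet S q with split S
      ... | inj₁ p = p
      fac-facet : ∀ x ℓ → fac? (α (d ℓ ⨟ e)) (ι (d ℓ ⨟ e)) x ≡ fac (lookup a ℓ) (d ℓ ⨟ e') x
      fac-facet x ℓ = trans (cong (λ z → fac? z (ι (d ℓ ⨟ e)) x) (α-cl e∈ ℓ)) (cong (λ S → fac (lookup a ℓ) S x) (⨟-assoc (d ℓ) e I))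
      F' : Vec V M → Bool
      F' = facs ι ι-inj α l'
      Fall→ : ∀ x → Fall x ≡ true → G e' a x ∧ F' x ≡ true
      Fall→ x q = ∧-intro (fac-G e' a x (λ ℓ → trans (sym (fac-facet x ℓ)) (at (d ℓ ⨟ e)))) (allL-intro (λ S → fac? (α S) (ι S) x) l' (λ {S} _ → at S))
        where
        at : ∀ S → fac? (α S) (ι S) x ≡ true
        at S = allL-elim (λ S → fac? (α S) (ι S) x) Ls q (thins-complete S)
      →Fall : ∀ x → G e' a x ≡ true → F' x ≡ true → Fall x ≡ true
      →Fall x g q = allL-intro (λ S → fac? (α S) (ι S) x) Ls (λ {S} p → at S p (facetᵇ S) refl)
        where
        at : ∀ S → S ∈ Ls → ∀ b → facetᵇ S ≡ b → fac? (α S) (ι S) x ≡ true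
        at S p false z = allL-elim (λ S → fac? (α S) (ι S) x) l' q (∈-filter⁺ (λ S → facetᵇ S Boolₚ.≟ false) p z)
        at S p true z = go (is-facet S z)
          where
          go : Facet S → fac? (α S) (ι S) x ≡ true
          go (ℓ , refl) = trans (fac-facet x ℓ) (G-fac e' a x g ℓ)
      regroup : ∀ (Y : Vec V M → Bool) → P (λ x → uF x ∧ Y x) ≡ P (λ x → (uG e' a x ∧ Y x) ∧ F' x)
      regroup Y = P-ext (λ x → uF x ∧ Y x) (λ x → (uG e' a x ∧ Y x) ∧ F' x) (λ x → bool-ext
        (λ q → let q₁ = ∧ˡ (uF x) (Y x) q ; q₂ = Fall→ x (∧ʳ (u x) (Fall x) q₁) in ∧-intro (∧-intro (∧-intro (∧ˡ (u x) (Fall x) q₁) (∧ˡ (G e' a x) (F' x) q₂)) (∧ʳ (uF x) (Y x) q)) (∧ʳ (G e' a x) (F' x) q₂))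
        (λ q → let q₁ = ∧ˡ (uG e' a x ∧ Y x) (F' x) q ; q₂ = ∧ˡ (uG e' a x) (Y x) q₁ in ∧-intro (∧-intro (∧ˡ (u x) (G e' a x) q₂) (→Fall x (∧ʳ (u x) (G e' a x) q₂) (∧ʳ (uG e' a x ∧ Y x) (F' x) q))) (∧ʳ (uG e' a x) (Y x) q₁)))
      on-e-adm : ∀ S → S ∈ l' → (φ : Vec V k → Bool) → Adm (ι S) (λ x → φ (select e' x))
      on-e-adm S p φ = adm-dep (proj₂ (non-facet S (proj₂ (∈-filter⁻ (λ S → facetᵇ S Boolₚ.≟ false) {xs = Ls} p)))) φ
      est : ∀ (φ : Vec V k → Bool) → Abs (P (λ x → uF x ∧ φ (select e' x)) - βs ι ι-inj α l' * P (λ x → uG e' a x ∧ φ (select e' x))) (ν (length l') * err)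
      est φ = subst (λ z → Abs (z - βs ι ι-inj α l' * P X) (ν (length l') * err)) (sym (regroup (λ x → φ (select e' x)))) (removals ι ι-inj α l' (Uniqueₚ.filter⁺ (λ S → facetᵇ S Boolₚ.≟ false) (thins-unique sr f)) X
          (λ S p → adm-∧ (ι S) (uG e' a) (λ x → φ (select e' x)) (adm-∧ (ι S) u (G e' a) (u-adm ℕₚ.≤-refl (ι S)) (on-e-adm S p (λ z → eqVec PA a (patA z)))) (on-e-adm S p φ))
          (λ x q → ∧ˡ (u x) (G e' a x) (∧ˡ (uG e' a x) (φ (select e' x)) q)))
        where
        X : Vec V M → Bool
        X x = uG e' a x ∧ φ (select e' x)
      -- Prescribing the colours of the sets that are not faces of `e` scales the measure of the bad
      -- tuples and that of all tuples by nearly the same factor `βs`, so the ratio `c₃` granted by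
      -- `R` is preserved.
      few-bad : P (λ x → uF x ∧ bad e' x) ≤ c₃ * N₀ + (slack + slack)
      few-bad = final (P (λ x → uF x ∧ bad e' x)) N₀ (P (λ x → uG e' a x ∧ bad e' x)) (P (uG e' a)) (βs ι ι-inj α l') (ν (length l') * err) (proj₁ (βs-range ι ι-inj α l')) (proj₁ (est Bad)) low ratio (*-monoˡ err err≥0 (ν-mono (Listₚ.length-filter (λ S → facetᵇ S Boolₚ.≟ false) Ls)))
        where
        ratio : P (λ x → uG e' a x ∧ bad e' x) ≤ c₃ * P (uG e' a)
        ratio = leᵇ-true _ _ (∧ʳ (allF k (λ ℓ → leᵇ δ (β* (d ℓ ⨟ e') (lookup a ℓ)))) (leᵇ (P (λ x → uG e' a x ∧ bad e' x)) (c₃ * P (uG e' a))) (∧ʳ (leᵇ ε₀ (W a)) (allF k (λ ℓ → leᵇ δ (β* (d ℓ ⨟ e') (lookup a ℓ))) ∧ leᵇ (P (λ x → uG e' a x ∧ bad e' x)) (c₃ * P (uG e' a))) (R-cl e∈)))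
        low : - (ν (length l') * err) ≤ N₀ - βs ι ι-inj α l' * P (uG e' a)
        low = subst₂ (λ y z → - (ν (length l') * err) ≤ y - βs ι ι-inj α l' * z) (P-ext (λ x → uF x ∧ true) uF (λ x → Boolₚ.∧-identityʳ (uF x))) (P-ext (λ x → uG e' a x ∧ true) (uG e' a) (λ x → Boolₚ.∧-identityʳ (uG e' a x))) (proj₂ (est (λ _ → true)))
        final : ∀ q N qb p b s' → 0ℚ ≤ b → q - b * qb ≤ s' → - s' ≤ N - b * p → qb ≤ c₃ * p → s' ≤ slack → q ≤ c₃ * N + (slack + slack)
        final q N qb p b s' b≥0 p₁ p₂ p₃ p₄ = ≤-by (r₀ q N qb p b s' c₃ slack) ((Δ {q - b * qb} {s'} p₁ ⊕ b≥0 ⊗ Δ {qb} {c₃ * p} p₃) ⊕ ((<⇒≤ c₃>0 ⊗ Δ { - s'} {N - b * p} p₂ ⊕ (Δ {s'} {slack} p₄ ⊕ <⇒≤ c₃>0 ⊗ Δ {s'} {slack} p₄)) ⊕ Δ {c₃} {1ℚ} c₃≤1 ⊗ slack≥0))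
          where r₀ : ∀ q N qb p b s' c s → (c * N + (s + s)) - q ≡ ((s' - (q - b * qb)) + b * (c * p - qb)) + ((c * ((N - b * p) - (- s')) + ((s - s') + c * (s - s'))) + (1ℚ - c) * s)
                r₀ = solve-∀ ℛ
      W≥ : ε₀ ≤ W a
      W≥ = leᵇ-true ε₀ (W a) (∧ˡ (leᵇ ε₀ (W a)) (allF k (λ ℓ → leᵇ δ (β* (d ℓ ⨟ e') (lookup a ℓ))) ∧ leᵇ (P (λ x → uG e' a x ∧ bad e' x)) (c₃ * P (uG e' a))) (R-cl e∈))

    hits : List (k ⊑ f) → Vec V M → Bool
    hits l x = allL (λ e → hit (e ⨟ I) x) l

    Z : List (k ⊑ f) → ℚ
    Z l = P (λ x → uF x ∧ hits l x)

    loss : ℚ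
    loss = (c₃ * N₀ + (slack + slack)) + ε₁

    loss≥0 : 0ℚ ≤ loss
    loss≥0 = ((<⇒≤ c₃>0 ⊗ P≥0 uF) ⊕ (slack≥0 ⊕ slack≥0)) ⊕ ε₁≥0

    Fall-adm : ∀ (e : k ⊑ M) → Adm e Fall
    Fall-adm e = adm-all e (λ S x → fac? (α S) (ι S) x) Ls (λ {S} _ → one S (α S))
      where
      one : ∀ S a → Adm e (fac? a (ι S))
      one S nothing = adm-true e
      one S (just a) = adm-dep (proj₂ (cov-small e (ι S) ℕₚ.≤-refl (ℕₚ.n≤1+n sr))) (λ y → _==_ PA a (κ y))

    -- All other conditions are admissible for `e`, so `swap-h` may replace the indicator of the
    -- edge by `g₁`. Off the bad tuples `g₁` is at least `ε₀ - τ`, because `W` is at least `ε₀` at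
    -- the colours of `e`.
    step : ∀ e l → e ∈ El → (∀ {e'} → e' ∈ l → e' ≢ e) → θ * Z l - loss ≤ Z (e ∷ l)
    step e l e∈ ne = ≤-trans (≤-by (r₀ θ (Z l) (P (λ x → X x ∧ bad e' x)) (c₃ * N₀ + (slack + slack)) ε₁ gE) (Δ {θ * Z l - P (λ x → X x ∧ bad e' x)} {gE} gE≥ ⊕ Δ {P (λ x → X x ∧ bad e' x)} {c₃ * N₀ + (slack + slack)} X-bad)) (≤-trans (≤-by (r₁ gE (P (λ x → X x ∧ hit e' x)) ε₁) (Δ { - ε₁} {P (λ x → X x ∧ hit e' x) - gE} (proj₂ (swap-h e' X X-adm)))) (≤-reflexive (P-ext (λ x → X x ∧ hit e' x) (λ x → uF x ∧ hits (e ∷ l) x) (λ x → perm (uF x) (hits l x) (hit e' x)))))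
      where
      open Edge e e∈
      X : Vec V M → Bool
      X x = uF x ∧ hits l x
      gE : ℚ
      gE = E (λ x → g₁ (select e' x) * ⟦ X x ⟧)
      perm : ∀ a b c → (a ∧ b) ∧ c ≡ a ∧ (c ∧ b)
      perm false b c = refl
      perm true b c = Boolₚ.∧-comm b c
      r₀ : ∀ t Z b B e g → (g - e) - (t * Z - (B + e)) ≡ (g - (t * Z - b)) + (B - b)
      r₀ = solve-∀ ℛ
      r₁ : ∀ g p e → p - (g - e) ≡ (p - g) - (- e)
      r₁ = solve-∀ ℛ
      X-adm : Adm e' X
      X-adm = adm-∧ e' uF (hits l) (adm-∧ e' u Fall (u-adm (ℕₚ.n≤1+n r) e') (Fall-adm e')) (adm-all e' (λ e₁ x → hit (e₁ ⨟ I) x) l (λ {e₁} p → other e₁ (ne p)))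
        where
        other : ∀ e₁ → e₁ ≢ e → Adm e' (λ x → hit (e₁ ⨟ I) x)
        other e₁ e₁≢e = [ (λ (δ' , p) → ⊥-elim (e₁≢e (sym (⨟-injective I (trans p (trans (cong (_⨟ (e₁ ⨟ I)) (id-unique δ')) (⨟-idˡ (e₁ ⨟ I)))))))) , (λ (τ' , c) → adm-dep c h) ]′ (cov-diff e' (e₁ ⨟ I))
      X-bad : P (λ x → X x ∧ bad e' x) ≤ c₃ * N₀ + (slack + slack)
      X-bad = ≤-trans (P-mono (λ x → X x ∧ bad e' x) (λ x → uF x ∧ bad e' x) (λ x q → ∧-intro (∧ˡ (uF x) (hits l x) (∧ˡ (X x) (bad e' x) q)) (∧ʳ (X x) (bad e' x) q))) few-bad
      ptw : ∀ x → θ * ⟦ X x ⟧ - ⟦ X x ∧ bad e' x ⟧ ≤ g₁ (select e' x) * ⟦ X x ⟧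
      ptw x = go (X x) refl (bad e' x) refl
        where
        go : ∀ c → X x ≡ c → ∀ b → bad e' x ≡ b → θ * ⟦ c ⟧ - ⟦ c ∧ b ⟧ ≤ g₁ (select e' x) * ⟦ c ⟧
        go false _ b _ = ≤-reflexive (s₂ (g₁ (select e' x)) θ)
          where s₂ : ∀ g t → t * 0ℚ - 0ℚ ≡ g * 0ℚ
                s₂ = solve-∀ ℛ
        go true _ true _ = ≤-by (s₂ (g₁ (select e' x)) θ) (proj₁ (g₁-range (select e' x)) ⊕ Δ {θ} {1ℚ} θ≤1)
          where s₂ : ∀ g t → g * 1ℚ - (t * 1ℚ - 1ℚ) ≡ g + (1ℚ - t)
                s₂ = solve-∀ ℛ
        go true q false b = ≤-by (s₂ (g₁ (select e' x)) ε₀ τ (W a)) (Δ {ε₀} {W a} W≥ ⊕ Δ { - τ} {g₁ (select e' x) - W a} (subst (λ z → - τ ≤ g₁ (select e' x) - z) (G-W e' a x (∧ˡ (G e' a x) (F' x) (Fall→ x (∧ʳ (u x) (Fall x) (∧ˡ (uF x) (hits l x) q))))) (proj₂ (near (select e' x) b))))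
          where s₂ : ∀ g e₀ t W → g * 1ℚ - ((e₀ - t) * 1ℚ - 0ℚ) ≡ (W - e₀) + ((g - W) - (- t))
                s₂ = solve-∀ ℛ
      gE≥ : θ * Z l - P (λ x → X x ∧ bad e' x) ≤ gE
      gE≥ = ≤-trans (≤-reflexive (sym (trans (∫- (𝔼 M) (λ x → θ * ⟦ X x ⟧) (λ x → ⟦ X x ∧ bad e' x ⟧)) (cong (_- P (λ x → X x ∧ bad e' x)) (∫* (𝔼 M) θ (λ x → ⟦ X x ⟧)))))) (∫≤ (𝔼 M) {λ x → θ * ⟦ X x ⟧ - ⟦ X x ∧ bad e' x ⟧} {λ x → g₁ (select e' x) * ⟦ X x ⟧} ptw)

    all-edges : ∀ l → Unique l → (∀ {e} → e ∈ l → e ∈ El) → θ ^ℚ length l * N₀ - ν (length l) * loss ≤ Z l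
    all-edges [] _ sub = ≤-reflexive (trans (r₀ N₀ loss) (P-ext uF (λ x → uF x ∧ true) (λ x → sym (Boolₚ.∧-identityʳ (uF x)))))
      where r₀ : ∀ N b → 1ℚ * N - 0ℚ * b ≡ N
            r₀ = solve-∀ ℛ
    all-edges (e ∷ l) (e∉ ∷ un) sub = ≤-trans (≤-by (r₀ θ (θ ^ℚ length l) N₀ (ν (length l)) loss (Z l)) (θ≥0 ⊗ Δ {θ ^ℚ length l * N₀ - ν (length l) * loss} {Z l} (all-edges l un (sub ∘ there)) ⊕ (Δ {θ} {1ℚ} θ≤1 ⊗ (ν≥0 (length l) ⊗ loss≥0)))) (step e l (sub (here refl)) (λ p q → All.lookup e∉ p (sym q)))
      where r₀ : ∀ t T N n b Z → (t * Z - b) - (t * T * N - (1ℚ + n) * b) ≡ t * (Z - (T * N - n * b)) + (1ℚ - t) * (n * b)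
            r₀ = solve-∀ ℛ

  -- The relations between the constants, in the form in which the certificates need them: `K₁` to
  -- `K₃` bound losses in the mass of `R`, `S₁` to `S₃` compare the counting errors and the main
  -- term with `σ`, and `C₁`, `C₂` keep the total loss below the main term.
  record FinishHyp (f M₀ : ℕ) (p ρ σ dd c z₀ cs : ℚ) (J : M₀ ⊑ M) : Set where
    constructor finish-hyp
    field
      cs≤m : cs ≤ m
      m>0 : 0ℚ < m
      bad-small : ∀ (e : suc (suc r) ⊑ M) → P (λ x → u x ∧ Bad (select e x)) ≤ p * m
      ρ≥0 : 0ℚ ≤ ρ
      σ≥0 : 0ℚ ≤ σ
      δ≤1 : δ ≤ 1ℚ
      θ≥0 : 0ℚ ≤ ε₀ - τ
      θ≤1 : ε₀ - τ ≤ 1ℚ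
      p-small : (1ℚ + inv c₃) * p ≤ ρ
      ε₀-small : ε₀ + τ ≤ ρ
      K₁ : (∫ (linVec (∑ PA) (suc (suc r))) (λ _ → 1ℚ)) * ε₁ ≤ ρ * quarter * cs
      K₂ : (∫ (linVec (∑ PA) (suc (suc r))) (λ _ → 1ℚ)) * δ ≤ ρ * quarter
      K₃ : (∫ (linVec (∑ PA) (suc (suc r))) (λ _ → 1ℚ)) * (ν (suc (suc r)) * (ω + ω + ω)) ≤ ρ * quarter
      c-room : c + ((ρ + ρ) + ρ) ≤ dd
      S₁ : ν (length (thins (suc r) f)) * (ω + ω + ω) ≤ σ
      S₂ : ε₁ ≤ σ * cs
      S₃ : σ ≤ (δ ^ℚ length (thins (suc r) f)) * half
      C₁ : ν (length (thins (suc (suc r)) f)) * c₃ ≤ ((ε₀ - τ) ^ℚ length (thins (suc (suc r)) f)) * quarter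
      C₂ : ν (length (thins (suc (suc r)) f)) * ((σ + σ) + σ) ≤ (((ε₀ - τ) ^ℚ length (thins (suc (suc r)) f)) * quarter) * ((δ ^ℚ length (thins (suc r) f)) * half)
      z-small : z₀ < ((((ε₀ - τ) ^ℚ length (thins (suc (suc r)) f)) * half) * ((δ ^ℚ length (thins (suc r) f)) * half)) * cs
      few : (ν M * ν M) * inv (ν (suc n)) ≤ z₀
      denseJ : ∀ (e : suc (suc r) ⊑ M₀) → dd * m ≤ P (λ x → u x ∧ h (select (e ⨟ J) x))

  module Finish (f M₀ : ℕ) (p ρ σ dd c z₀ cs : ℚ) (J : M₀ ⊑ M) (hyps : FinishHyp f M₀ p ρ σ dd c z₀ cs J) (RT : Reduced.ReducedThm (suc r) f c M₀) (FP : ∀ i j → i Fin.< j → Pattern.FPat (suc r) f i j) where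
    open FinishHyp hyps
    open Pattern (suc r) f

    Copy : Set
    Copy = Σ[ i ∈ Fin (suc (suc r)) ] Σ[ j ∈ Fin (suc (suc r)) ] Σ[ i<j ∈ i Fin.< j ] Σ[ y ∈ Vec V f ] (distinct y ≡ true × (∀ e → FPat.inE (FP i j i<j) e ≡ true → h (select e y) ≡ true))

    mass-big : ∀ e → dd * m ≤ P (λ x → u x ∧ h (select e x)) → c ≤ mass str e roles (R e)
    mass-big e hyp = *-cancel-pos m m>0 (fin (mass str e roles (R e)) (P (λ x → u x ∧ h (select e x))) (P (λ x → u x ∧ Bad (select e x))) hyp (hits≤ e) (bad-small e))
      where
      r₀ : ∀ m c μ' H b ρ et q iq kA K dd → m * μ' - m * c ≡ (((μ' * m + et * m) + (iq * b + K * kA)) - H) + ((H - dd * m) + ((dd - (c + ((ρ + ρ) + ρ))) * m + ((ρ - et) * m + (iq * (q * m - b) + ((ρ - iq * q) * m + (ρ * m - K * kA))))))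
      r₀ = solve-∀ ℛ
      K≤ : K₀ * (∫ (linVec (∑ PA) (suc (suc r))) (λ _ → 1ℚ)) ≤ ρ * m
      K≤ = ≤-by (r₁ ε₁ δ m (ν (suc (suc r))) ω (∫ (linVec (∑ PA) (suc (suc r))) (λ _ → 1ℚ)) ρ cs) ((Δ {(∫ (linVec (∑ PA) (suc (suc r))) (λ _ → 1ℚ)) * ε₁} {ρ * quarter * cs} K₁ ⊕ (ρ≥0 ⊗ <⇒≤ 0<quarter) ⊗ Δ {cs} {m} cs≤m) ⊕ ((Δ {(∫ (linVec (∑ PA) (suc (suc r))) (λ _ → 1ℚ)) * δ} {ρ * quarter} K₂ ⊗ P≥0 u ⊕ Δ {(∫ (linVec (∑ PA) (suc (suc r))) (λ _ → 1ℚ)) * (ν (suc (suc r)) * (ω + ω + ω))} {ρ * quarter} K₃ ⊗ P≥0 u) ⊕ ((ρ≥0 ⊗ <⇒≤ 0<quarter) ⊗ P≥0 u)))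
        where
        r₁ : ∀ e dl m k w A ρ cs → ρ * m - (e + (dl * m + k * ((w + w + w) * m))) * A ≡ ((ρ * quarter * cs - A * e) + ρ * quarter * (m - cs)) + (((ρ * quarter - A * dl) * m + (ρ * quarter - A * (k * (w + w + w))) * m) + ρ * quarter * m)
        r₁ = solve-∀ ℛ
      fin : ∀ μ' H b → dd * m ≤ H → H ≤ (μ' * m + (ε₀ + τ) * m) + ((1ℚ + inv c₃) * b + K₀ * (∫ (linVec (∑ PA) (suc (suc r))) (λ _ → 1ℚ))) → b ≤ p * m → m * c ≤ m * μ'
      fin μ' H b h₁ h₂ h₃ = ≤-by (r₀ m c μ' H b ρ (ε₀ + τ) p (1ℚ + inv c₃) (∫ (linVec (∑ PA) (suc (suc r))) (λ _ → 1ℚ)) K₀ dd) (Δ {H} {(μ' * m + (ε₀ + τ) * m) + ((1ℚ + inv c₃) * b + K₀ * (∫ (linVec (∑ PA) (suc (suc r))) (λ _ → 1ℚ)))} h₂ ⊕ (Δ {dd * m} {H} h₁ ⊕ (Δ {c + ((ρ + ρ) + ρ)} {dd} c-room ⊗ P≥0 u ⊕ (Δ {ε₀ + τ} {ρ} ε₀-small ⊗ P≥0 u ⊕ ((0≤1 ⊕ <⇒≤ (inv-pos c₃ c₃>0)) ⊗ Δ {b} {p * m} h₃ ⊕ (Δ {(1ℚ + inv c₃) * p} {ρ} p-small ⊗ P≥0 u ⊕ Δ {K₀ * (∫ (linVec (∑ PA) (suc (suc r))) (λ _ → 1ℚ))} {ρ * m} K≤))))))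

    RJ : suc (suc r) ⊑ M₀ → Vec A (suc (suc r)) → Bool
    RJ e = R (e ⨟ J)

    sharedJ : DN (Reduced.Shared (suc r) f RJ)
    sharedJ = RT swA (res J str) RJ (λ e → subst (c ≤_) (sym (mass-res str J e roles (RJ e))) (mass-big (e ⨟ J) (denseJ e)))

    module WithRoles (i j : Fin (suc (suc r))) (i<j : i Fin.< j) (K : f ⊑ M₀) (a b : Vec (suc r ⊑ f → A) (suc (suc r))) (a≡b : ∀ S → lookup a i S ≡ lookup b j S) (ga : ∀ e → RJ (e ⨟ K) (pick roles e a) ≡ true) (gb : ∀ e → RJ (e ⨟ K) (pick roles e b) ≡ true) where
      F : FPat i j
      F = FP i j i<j
      open Assign F a b a≡b using (El; El-uniq; in-El; pal; val; α; α-cl; cl; lookup-cl; facets; facet-El; find-sound)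
      I : f ⊑ M
      I = K ⨟ J
      R-any : ∀ s e → R (e ⨟ I) (pick roles e (pal s)) ≡ true
      R-any true e = subst (λ e' → R e' (pick roles e a) ≡ true) (⨟-assoc e K J) (ga e)
      R-any false e = subst (λ e' → R e' (pick roles e b) ≡ true) (⨟-assoc e K J) (gb e)
      R-cl : ∀ {e} → e ∈ El → R (e ⨟ I) (cl e) ≡ true
      R-cl {e} _ = R-any (FPat.side F e) e
      R-δ : ∀ e ℓ → δ ≤ β* ((d ℓ ⨟ e) ⨟ I) (val e ℓ)
      R-δ e ℓ = subst₂ (λ S v → δ ≤ β* S v) (sym (⨟-assoc (d ℓ) e I)) (lookup-cl e ℓ) (leᵇ-true δ (β* (d ℓ ⨟ (e ⨟ I)) (lookup (cl e) ℓ)) (allF-elim (suc (suc r)) (λ ℓ → leᵇ δ (β* (d ℓ ⨟ (e ⨟ I)) (lookup (cl e) ℓ))) (∧ˡ _ (leᵇ (P (λ x → uG (e ⨟ I) (cl e) x ∧ bad (e ⨟ I) x)) (c₃ * P (uG (e ⨟ I) (cl e)))) (∧ʳ (leᵇ ε₀ (W (cl e))) _ (R-any (FPat.side F e) e))) ℓ))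
      α-δ : ∀ S v → α S ≡ just v → δ ≤ β* (S ⨟ I) v
      α-δ S v q = go (find-sound facets S v q)
        where
        go : Σ[ e ∈ suc (suc r) ⊑ f ] Σ[ ℓ ∈ Fin (suc (suc r)) ] ((e , ℓ) ∈ facets × d ℓ ⨟ e ≡ S × val e ℓ ≡ v) → δ ≤ β* (S ⨟ I) v
        go (e , ℓ , _ , refl , refl) = R-δ e ℓ
      module Ct = Count f I α δ≤1 α-δ El El-uniq cl α-cl R-cl θ≥0 θ≤1
      len≤ : length El ℕ.≤ (length (thins (suc (suc r)) f))
      len≤ = Listₚ.length-filter (λ e → FPat.inE F e Boolₚ.≟ true) (thins (suc (suc r)) f)
      θ-anti : ∀ {a b} → a ℕ.≤ b → (ε₀ - τ) ^ℚ b ≤ (ε₀ - τ) ^ℚ a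
      θ-anti {b = b} z≤n = ^ℚ≤1 b θ≥0 θ≤1
      θ-anti (s≤s {m = x} {n = y} q) = *-monoʳ (ε₀ - τ) θ≥0 (θ-anti q)
      slack≤ : Ct.slack ≤ σ * m
      slack≤ = ≤-trans (≤-reflexive (sym (*-assoc (ν (length (thins (suc r) f))) (ω + ω + ω) m))) (*-monoˡ m (P≥0 u) S₁)
      N₀-big : ((δ ^ℚ length (thins (suc r) f)) * half) * m ≤ Ct.N₀
      N₀-big = fin Ct.N₀ Ct.slack Ct.N₀-low slack≤
        where
        r₀ : ∀ N s π m σ → N - (π * half) * m ≡ (N - (π * m - s)) + ((σ * m - s) + (π * half - σ) * m)
        r₀ = solve-∀ ℛ
        fin : ∀ N s → (δ ^ℚ length (thins (suc r) f)) * m - s ≤ N → s ≤ σ * m → ((δ ^ℚ length (thins (suc r) f)) * half) * m ≤ N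
        fin N s h₁ h₂ = ≤-by (r₀ N s (δ ^ℚ length (thins (suc r) f)) m σ) (Δ {(δ ^ℚ length (thins (suc r) f)) * m - s} {N} h₁ ⊕ (Δ {s} {σ * m} h₂ ⊕ Δ {σ} {(δ ^ℚ length (thins (suc r) f)) * half} S₃ ⊗ P≥0 u))
      t≥0 : 0ℚ ≤ ((ε₀ - τ) ^ℚ length (thins (suc (suc r)) f))
      t≥0 = ^ℚ≥0 (length (thins (suc (suc r)) f)) θ≥0
      -- A quarter of the main term covers the bad tuples (`C₁`) and a quarter the remaining errors
      -- (`C₂`); the half that is left exceeds `z₀`.
      Z-big : z₀ < Ct.Z El
      Z-big = <-≤-trans z-small (fin Ct.N₀ Ct.slack (Ct.Z El) ((ε₀ - τ) ^ℚ length El) (ν (length El)) (P≥0 Ct.uF) (Ct.all-edges El El-uniq id) (θ-anti len≤) (ν-mono len≤) slack≤ N₀-big Ct.slack≥0)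
        where
        r₀ : ∀ N s Z T l t nE c₃ e σ π m cs → Z - ((t * half) * (π * half)) * cs ≡ (Z - (T * N - l * ((c₃ * N + (s + s)) + e))) + ((T - t) * N + ((nE - l) * ((c₃ * N + (s + s)) + e) + ((t * quarter - nE * c₃) * N + (nE * ((σ * m - s) + (σ * m - s)) + (nE * (σ * cs - e) + (nE * (σ * (m - cs)) + (((t * quarter) * (π * half) - nE * ((σ + σ) + σ)) * m + (t * quarter * (N - (π * half) * m) + (t * half * (N - (π * half) * m) + (t * half) * (π * half) * (m - cs))))))))))
        r₀ = solve-∀ ℛ
        fin : ∀ N s Z T l → 0ℚ ≤ N → T * N - l * ((c₃ * N + (s + s)) + ε₁) ≤ Z → ((ε₀ - τ) ^ℚ length (thins (suc (suc r)) f)) ≤ T → l ≤ ν (length (thins (suc (suc r)) f)) → s ≤ σ * m → ((δ ^ℚ length (thins (suc r) f)) * half) * m ≤ N → 0ℚ ≤ s → ((((ε₀ - τ) ^ℚ length (thins (suc (suc r)) f)) * half) * ((δ ^ℚ length (thins (suc r) f)) * half)) * cs ≤ Z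
        fin N s Z T l N≥0 h₁ h₂ h₃ h₄ h₅ s≥0 = ≤-by (r₀ N s Z T l ((ε₀ - τ) ^ℚ length (thins (suc (suc r)) f)) (ν (length (thins (suc (suc r)) f))) c₃ ε₁ σ (δ ^ℚ length (thins (suc r) f)) m cs)
          (Δ {T * N - l * ((c₃ * N + (s + s)) + ε₁)} {Z} h₁ ⊕ (Δ {((ε₀ - τ) ^ℚ length (thins (suc (suc r)) f))} {T} h₂ ⊗ N≥0 ⊕ (Δ {l} {ν (length (thins (suc (suc r)) f))} h₃ ⊗ ((<⇒≤ c₃>0 ⊗ N≥0 ⊕ (s≥0 ⊕ s≥0)) ⊕ ε₁≥0) ⊕ (Δ {ν (length (thins (suc (suc r)) f)) * c₃} {((ε₀ - τ) ^ℚ length (thins (suc (suc r)) f)) * quarter} C₁ ⊗ N≥0 ⊕ (ν≥0 (length (thins (suc (suc r)) f)) ⊗ (Δ {s} {σ * m} h₄ ⊕ Δ {s} {σ * m} h₄) ⊕ (ν≥0 (length (thins (suc (suc r)) f)) ⊗ Δ {ε₁} {σ * cs} S₂ ⊕ (ν≥0 (length (thins (suc (suc r)) f)) ⊗ (σ≥0 ⊗ Δ {cs} {m} cs≤m) ⊕ (Δ {ν (length (thins (suc (suc r)) f)) * ((σ + σ) + σ)} {(((ε₀ - τ) ^ℚ length (thins (suc (suc r)) f)) * quarter) * ((δ ^ℚ length (thins (suc r) f)) * half)} C₂ ⊗ P≥0 u ⊕ ((t≥0 ⊗ <⇒≤ 0<quarter) ⊗ Δ {((δ ^ℚ length (thins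 (suc r) f)) * half) * m} {N} h₅ ⊕ ((t≥0 ⊗ <⇒≤ 0<half) ⊗ Δ {((δ ^ℚ length (thins (suc r) f)) * half) * m} {N} h₅ ⊕ ((t≥0 ⊗ <⇒≤ 0<half) ⊗ (^ℚ≥0 (length (thins (suc r) f)) δ≥0 ⊗ <⇒≤ 0<half)) ⊗ Δ {cs} {m} cs≤m))))))))))
      -- More tuples satisfy all conditions than have a repeated vertex, so one of them is
      -- injective.
      found : DN Copy
      found no-copy = contra Z-big (≤-trans (P-mono (λ x → Ct.uF x ∧ Ct.hits El x) (λ x → not (distinct x)) imp) (≤-trans (indistinct≤ n M) few))
        where
        imp : ∀ x → Ct.uF x ∧ Ct.hits El x ≡ true → not (distinct x) ≡ true
        imp x q = go (distinct x) refl
          where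
          go : ∀ b → distinct x ≡ b → not b ≡ true
          go false _ = refl
          go true dx = ⊥-elim (no-copy (i , j , i<j , select I x , distinct-select I x dx , λ e inE → subst (λ z → h z ≡ true) (select-⨟ e I x) (allL-elim (λ e → h (select (e ⨟ I) x)) El (∧ʳ (Ct.uF x) (Ct.hits El x) q) (in-El e inE))))

    conclusion : DN Copy
    conclusion = sharedJ >>= λ (i , j , i<j , K , a , b , a≡b , ga , gb) → WithRoles.found i j i<j K a b a≡b ga gb

-- From the regularity data to a copy of the pattern

sq-abs : ∀ y τ → 0ℚ ≤ τ → y * y ≤ τ * τ → y ≤ τ
sq-abs y τ τ≥0 h = [ (λ lt → contra (lt² lt) h) , id ]′ (<-or-≤ τ y)
  where
  r : ∀ y t → y * y - t * t ≡ (y - t) * (y - t) + ((y - t) * t + (y - t) * t)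
  r = solve-∀ ℛ
  lt² : τ < y → τ * τ < y * y
  lt² lt = <-by (r y τ) (+-pos (*-pos (Δ< lt) (Δ< lt)) ((<⇒≤ (Δ< lt) ⊗ τ≥0) ⊕ (<⇒≤ (Δ< lt) ⊗ τ≥0)))

record CoreHyp (r n f M M₁ : ℕ) {A C : Set} (PA : Finite A) (swA : Swap (∑ PA)) (PC : Finite C) (swC : Swap (∑ PC))
            (κ : Vec (Fin (suc n)) (suc r) → A) (col : Vec (Fin (suc n)) r → C)
            (B : A → Vec C (suc r) → ℚ) (B-range : ∀ a p → (0ℚ ≤ B a p) × (B a p ≤ 1ℚ))
            (g₂ : A → Vec (Fin (suc n)) (suc r) → ℚ)
            (h : Vec (Fin (suc n)) (suc (suc r)) → Bool) (W : Vec A (suc (suc r)) → ℚ)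
            (g₁ : Vec (Fin (suc n)) (suc (suc r)) → ℚ) (g₁-range : ∀ z → (0ℚ ≤ g₁ z) × (g₁ z ≤ 1ℚ))
            (ω τ ε₀ δ c₃ p ρ σ ε₁ ε₂ η₁ η₂ dd c z₀ : ℚ) : Set where
  constructor core-hyp
  field
    ω>0 : 0ℚ < ω
    τ>0 : 0ℚ < τ
    δ≥0 : 0ℚ ≤ δ
    δ≤1 : δ ≤ 1ℚ
    c₃>0 : 0ℚ < c₃
    c₃≤1 : c₃ ≤ 1ℚ
    p>0 : 0ℚ < p
    ρ≥0 : 0ℚ ≤ ρ
    ε₁≥0 : 0ℚ ≤ ε₁
    θ≥0 : 0ℚ ≤ (ε₀ - τ)
    θ≤1 : (ε₀ - τ) ≤ 1ℚ
    σ≥0 : 0ℚ ≤ σ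
    reg₁ : Disc.CutReg n (suc r) (λ z → ⟦ h z ⟧ - g₁ z) ε₁
    reg₂ : ∀ a → Disc.CutReg n r (λ y → ⟦ _==_ PA a (κ y) ⟧ - g₂ a y) ε₂
    var₁ : ∫ (Disc.𝔼 n (suc (suc r))) (λ z → (g₁ z - W (facetPat κ z)) * (g₁ z - W (facetPat κ z))) ≤ η₁
    var₂ : ∫ (∑ PA) (λ a → ∫ (Disc.𝔼 n (suc r)) (λ y → (g₂ a y - B a (facetPat col y)) * (g₂ a y - B a (facetPat col y)))) ≤ η₂
    B-sum : ∀ q → 0ℚ < ∫ (Disc.𝔼 n (suc r)) (λ y → ⟦ eqVec PC q (facetPat col y) ⟧) → ∫ (∑ PA) (λ a → B a q) ≡ 1ℚ
    cs>0 : 0ℚ < (cellSize PC r M₁)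
    η₁-small : ν (length (thins (suc (suc r)) M₁)) * ((η₁ * inv (τ * τ)) * inv p) ≤ quarter
    η₂-small : ν (length (thins (suc r) M₁)) * (η₂ * inv (ω * ω)) ≤ quarter
    ε₂-small : ε₂ ≤ ω * (cellSize PC r M₁)
    p-small : (1ℚ + inv c₃) * p ≤ ρ
    ε₀-small : ε₀ + τ ≤ ρ
    K₁ : (∫ (linVec (∑ PA) (suc (suc r))) (λ _ → 1ℚ)) * ε₁ ≤ ρ * quarter * (cellSize PC r M₁)
    K₂ : (∫ (linVec (∑ PA) (suc (suc r))) (λ _ → 1ℚ)) * δ ≤ ρ * quarter
    K₃ : (∫ (linVec (∑ PA) (suc (suc r))) (λ _ → 1ℚ)) * (ν (suc (suc r)) * (ω + ω + ω)) ≤ ρ * quarter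
    c-room : c + ((ρ + ρ) + ρ) ≤ dd
    S₁ : ν (length (thins (suc r) f)) * (ω + ω + ω) ≤ σ
    S₂ : ε₁ ≤ σ * (cellSize PC r M₁)
    S₃ : σ ≤ (δ ^ℚ length (thins (suc r) f)) * half
    C₁ : ν (length (thins (suc (suc r)) f)) * c₃ ≤ ((ε₀ - τ) ^ℚ length (thins (suc (suc r)) f)) * quarter
    C₂ : ν (length (thins (suc (suc r)) f)) * ((σ + σ) + σ) ≤ (((ε₀ - τ) ^ℚ length (thins (suc (suc r)) f)) * quarter) * ((δ ^ℚ length (thins (suc r) f)) * half)
    z-small : z₀ < ((((ε₀ - τ) ^ℚ length (thins (suc (suc r)) f)) * half) * ((δ ^ℚ length (thins (suc r) f)) * half)) * (cellSize PC r M₁)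
    few : (ν M₁ * ν M₁) * inv (ν (suc n)) ≤ z₀
    dense : ∀ (x* : Vec (Fin (suc n)) M₁) → (cellSize PC r M₁) ≤ ∫ (Disc.𝔼 n M₁) (λ x → ⟦ sameCell PC col x* x ⟧) → DN (Σ[ J ∈ M ⊑ M₁ ] (∀ e → dd * ∫ (Disc.𝔼 n M₁) (λ x → ⟦ sameCell PC col x* x ⟧) ≤ ∫ (Disc.𝔼 n M₁) (λ x → ⟦ sameCell PC col x* x ∧ h (select (e ⨟ J) x) ⟧)))

module Core (r n f M M₁ : ℕ) {A C : Set} (PA : Finite A) (swA : Swap (∑ PA)) (PC : Finite C) (swC : Swap (∑ PC))
  (κ : Vec (Fin (suc n)) (suc r) → A) (col : Vec (Fin (suc n)) r → C)
  (B : A → Vec C (suc r) → ℚ) (B-range : ∀ a p → (0ℚ ≤ B a p) × (B a p ≤ 1ℚ))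
  (g₂ : A → Vec (Fin (suc n)) (suc r) → ℚ)
  (h : Vec (Fin (suc n)) (suc (suc r)) → Bool) (W : Vec A (suc (suc r)) → ℚ)
  (g₁ : Vec (Fin (suc n)) (suc (suc r)) → ℚ) (g₁-range : ∀ z → (0ℚ ≤ g₁ z) × (g₁ z ≤ 1ℚ))
  (ω τ ε₀ δ c₃ p ρ σ ε₁ ε₂ η₁ η₂ dd c z₀ : ℚ)
  (hyp : CoreHyp r n f M M₁ PA swA PC swC κ col B B-range g₂ h W g₁ g₁-range ω τ ε₀ δ c₃ p ρ σ ε₁ ε₂ η₁ η₂ dd c z₀)
  (RT : Reduced.ReducedThm (suc r) f c M)
  (FP : ∀ i j → i Fin.< j → Pattern.FPat (suc r) f i j) where
  open CoreHyp hyp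
  open Disc n
  open Pattern (suc r) f

  y₁ : Vec V (suc (suc r)) → ℚ
  y₁ z = g₁ z - W ((facetPat κ) z)

  -- The deviation from `W` exceeds `τ`, written with squares because regularity bounds the mean
  -- square.
  Bad : Vec V (suc (suc r)) → Bool
  Bad z = not (leᵇ (y₁ z * y₁ z) (τ * τ))

  near : ∀ z → Bad z ≡ false → Abs (y₁ z) τ
  near z q = sq-abs (y₁ z) τ (<⇒≤ τ>0) sq , subst (- τ ≤_) (nn (y₁ z)) (neg-antimono-≤ (sq-abs (- y₁ z) τ (<⇒≤ τ>0) (≤-trans (≤-reflexive (nsq (y₁ z))) sq)))
    where
    sq : y₁ z * y₁ z ≤ τ * τ
    sq = leᵇ-true (y₁ z * y₁ z) (τ * τ) (trans (sym (not-not (leᵇ (y₁ z * y₁ z) (τ * τ)))) (cong not q))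
    nn : ∀ y → - (- y) ≡ y
    nn = solve-∀ ℛ
    nsq : ∀ y → (- y) * (- y) ≡ y * y
    nsq = solve-∀ ℛ

  ττ>0 : 0ℚ < τ * τ
  ττ>0 = *-pos τ>0 τ>0

  Bad≤ : ∀ z → ⟦ Bad z ⟧ ≤ (y₁ z * y₁ z) * inv (τ * τ)
  Bad≤ z = go (leᵇ (y₁ z * y₁ z) (τ * τ)) refl
    where
    go : ∀ b → leᵇ (y₁ z * y₁ z) (τ * τ) ≡ b → ⟦ not b ⟧ ≤ (y₁ z * y₁ z) * inv (τ * τ)
    go true _ = sq≥0 (y₁ z) ⊗ <⇒≤ (inv-pos (τ * τ) ττ>0)
    go false q = ≤-div (τ * τ) ττ>0 (≤-trans (≤-reflexive (*-identityʳ (τ * τ))) (leᵇ-false (y₁ z * y₁ z) (τ * τ) q))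

  P-Bad : ∫ (𝔼 (suc (suc r))) (λ z → ⟦ Bad z ⟧) ≤ η₁ * inv (τ * τ)
  P-Bad = ≤-trans (∫≤ (𝔼 (suc (suc r))) {λ z → ⟦ Bad z ⟧} {λ z → (y₁ z * y₁ z) * inv (τ * τ)} Bad≤) (≤-trans (≤-reflexive (∫*ʳ (𝔼 (suc (suc r))) (inv (τ * τ)) (λ z → y₁ z * y₁ z))) (*-monoˡ (inv (τ * τ)) (<⇒≤ (inv-pos (τ * τ) ττ>0)) var₁))

  y₂ : A → Vec V (suc r) → ℚ
  y₂ a y = g₂ a y - B a ((facetPat col) y)

  D₂ : Vec V (suc r) → ℚ
  D₂ y = ∫ (∑ PA) (λ a → y₂ a y * y₂ a y)

  ωω>0 : 0ℚ < ω * ω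
  ωω>0 = *-pos ω>0 ω>0

  -- The penalty given to `select-cell`. Every defect is divided by the amount of it that is
  -- tolerated, so in a cell whose penalty is at most its measure, each single defect is within its
  -- tolerance (`below`).
  L₁ L₂ L : Vec V M₁ → ℚ
  L₁ x = sumL (λ e → ⟦ Bad (select e x) ⟧ * inv p) (thins (suc (suc r)) M₁)
  L₂ x = sumL (λ S → D₂ (select S x) * inv (ω * ω)) (thins (suc r) M₁)
  L x = L₁ x + L₂ x

  marg : ∀ {m} (e : m ⊑ M₁) (Φ : Vec V m → ℚ) → ∫ (𝔼 M₁) (λ x → Φ (select e x)) ≡ ∫ (𝔼 m) Φ
  marg = marginal (avg n) (avg-mean n) (avg-swap n)

  L₁-small : ∫ (𝔼 M₁) L₁ ≤ quarter
  L₁-small = ≤-trans (≤-reflexive (∫sumL (𝔼 M₁) (λ e x → ⟦ Bad (select e x) ⟧ * inv p) (thins (suc (suc r)) M₁))) (≤-trans (sumL-≤ {f = λ e → ∫ (𝔼 M₁) (λ x → ⟦ Bad (select e x) ⟧ * inv p)} (λ e → ≤-trans (≤-reflexive (trans (∫*ʳ (𝔼 M₁) (inv p) (λ x → ⟦ Bad (select e x) ⟧)) (cong (_* inv p) (marg e (λ z → ⟦ Bad z ⟧))))) (*-monoˡ (inv p) (<⇒≤ (inv-pos p p>0)) P-Bad)) (thins (suc (suc r)) M₁)) η₁-small)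

  E-D₂ : ∫ (𝔼 (suc r)) D₂ ≤ η₂
  E-D₂ = ≤-trans (≤-reflexive (swA (𝔼 (suc r)) (λ y a → y₂ a y * y₂ a y))) var₂

  L₂-small : ∫ (𝔼 M₁) L₂ ≤ quarter
  L₂-small = ≤-trans (≤-reflexive (∫sumL (𝔼 M₁) (λ S x → D₂ (select S x) * inv (ω * ω)) (thins (suc r) M₁))) (≤-trans (sumL-≤ {f = λ S → ∫ (𝔼 M₁) (λ x → D₂ (select S x) * inv (ω * ω))} (λ S → ≤-trans (≤-reflexive (trans (∫*ʳ (𝔼 M₁) (inv (ω * ω)) (λ x → D₂ (select S x))) (cong (_* inv (ω * ω)) (marg S D₂)))) (*-monoˡ (inv (ω * ω)) (<⇒≤ (inv-pos (ω * ω) ωω>0)) E-D₂)) (thins (suc r) M₁)) η₂-small)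

  L-small : ∫ (𝔼 M₁) L ≤ half
  L-small = ≤-trans (≤-reflexive (∫+ (𝔼 M₁) L₁ L₂)) (+-mono-≤ L₁-small L₂-small)

  D₂≥0 : ∀ y → 0ℚ ≤ D₂ y
  D₂≥0 y = ∫≥0 (∑ PA) {λ a → y₂ a y * y₂ a y} (λ a → sq≥0 (y₂ a y))

  terms₁≥0 : ∀ x (e : suc (suc r) ⊑ M₁) → 0ℚ ≤ ⟦ Bad (select e x) ⟧ * inv p
  terms₁≥0 x e = ⟦⟧≥0 (Bad (select e x)) ⊗ <⇒≤ (inv-pos p p>0)

  terms₂≥0 : ∀ x (S : suc r ⊑ M₁) → 0ℚ ≤ D₂ (select S x) * inv (ω * ω)
  terms₂≥0 x S = D₂≥0 (select S x) ⊗ <⇒≤ (inv-pos (ω * ω) ωω>0)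

  L₁≥0 : ∀ x → 0ℚ ≤ L₁ x
  L₁≥0 x = sumL≥0 (terms₁≥0 x) (thins (suc (suc r)) M₁)

  L₂≥0 : ∀ x → 0ℚ ≤ L₂ x
  L₂≥0 x = sumL≥0 (terms₂≥0 x) (thins (suc r) M₁)

  module AtCell (x* : Vec V M₁) (big : (cellSize PC r M₁) ≤ ∫ (𝔼 M₁) (λ x → ⟦ sameCell PC col x* x ⟧ * (1ℚ - L x))) where
    open Cell r n M₁ PA PC κ col B B-range g₂ x*

    uL : ℚ
    uL = E (λ x → ⟦ u x ⟧ * L x)

    big' : (cellSize PC r M₁) ≤ m - uL
    big' = ≤-trans big (≤-reflexive (trans (∫≡ (𝔼 M₁) (λ x → r₀ ⟦ u x ⟧ (L x))) (∫- (𝔼 M₁) (λ x → ⟦ u x ⟧) (λ x → ⟦ u x ⟧ * L x))))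
      where r₀ : ∀ u L → u * (1ℚ - L) ≡ u - u * L
            r₀ = solve-∀ ℛ

    uL≥0 : 0ℚ ≤ uL
    uL≥0 = ∫≥0 (𝔼 M₁) {λ x → ⟦ u x ⟧ * L x} (λ x → ⟦⟧≥0 (u x) ⊗ (L₁≥0 x ⊕ L₂≥0 x))

    cs≤m : (cellSize PC r M₁) ≤ m
    cs≤m = ≤-by (r₀ (cellSize PC r M₁) m uL) (Δ {(cellSize PC r M₁)} {m - uL} big' ⊕ uL≥0)
      where r₀ : ∀ c m l → m - c ≡ ((m - l) - c) + l
            r₀ = solve-∀ ℛ

    m>0 : 0ℚ < m
    m>0 = <-≤-trans cs>0 cs≤m

    uL≤m : uL ≤ m
    uL≤m = ≤-by (r₀ (cellSize PC r M₁) m uL) (Δ {(cellSize PC r M₁)} {m - uL} big' ⊕ <⇒≤ cs>0)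
      where r₀ : ∀ c m l → m - l ≡ ((m - l) - c) + c
            r₀ = solve-∀ ℛ

    below : ∀ (Φ : Vec V M₁ → ℚ) i → (0<i : 0ℚ < i) → (∀ x → Φ x * inv i ≤ L x) → E (λ x → ⟦ u x ⟧ * Φ x) ≤ i * m
    below Φ i i>0 h' = ≤-trans (≤-reflexive (trans (∫≡ (𝔼 M₁) (λ x → trans (sym (*-identityˡ (⟦ u x ⟧ * Φ x))) (trans (cong (_* (⟦ u x ⟧ * Φ x)) (sym (inv-r i i>0))) (r₀ i (inv i) ⟦ u x ⟧ (Φ x))))) (∫* (𝔼 M₁) i (λ x → ⟦ u x ⟧ * (Φ x * inv i))))) (*-monoʳ i (<⇒≤ i>0) (≤-trans (∫≤ (𝔼 M₁) {λ x → ⟦ u x ⟧ * (Φ x * inv i)} {λ x → ⟦ u x ⟧ * L x} (λ x → *-monoʳ ⟦ u x ⟧ (⟦⟧≥0 (u x)) (h' x))) uL≤m))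
      where r₀ : ∀ i j u φ → (i * j) * (u * φ) ≡ i * (u * (φ * j))
            r₀ = solve-∀ ℛ

    +ˡ : ∀ {a b c} → 0ℚ ≤ c → a ≤ b → a ≤ b + c
    +ˡ {a} {b} {c} q h' = ≤-by (r₀ a b c) (Δ {a} {b} h' ⊕ q)
      where r₀ : ∀ a b c → (b + c) - a ≡ (b - a) + c
            r₀ = solve-∀ ℛ

    +ʳ : ∀ {a b c} → 0ℚ ≤ b → a ≤ c → a ≤ b + c
    +ʳ {a} {b} {c} q h' = ≤-by (r₀ a b c) (q ⊕ Δ {a} {c} h')
      where r₀ : ∀ a b c → (b + c) - a ≡ b + (c - a)
            r₀ = solve-∀ ℛ

    bad-small : ∀ (e : suc (suc r) ⊑ M₁) → P (λ x → u x ∧ Bad (select e x)) ≤ p * m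
    bad-small e = ≤-trans (≤-reflexive (∫≡ (𝔼 M₁) (λ x → ⟦∧⟧ (u x) (Bad (select e x))))) (below (λ x → ⟦ Bad (select e x) ⟧) p p>0 (λ x → +ˡ {⟦ Bad (select e x) ⟧ * inv p} {L₁ x} {L₂ x} (L₂≥0 x) (sumL-≥ {f = λ e → ⟦ Bad (select e x) ⟧ * inv p} (terms₁≥0 x) (thins-complete e))))

    term≤sum : ∀ a y → y₂ a y * y₂ a y ≤ D₂ y
    term≤sum a y = ≤-trans (≤-reflexive (sym (∑-δ PA (λ b → y₂ b y * y₂ b y) a))) (∫≤ (∑ PA) {λ b → ⟦ _==_ PA b a ⟧ * (y₂ b y * y₂ b y)} {λ b → y₂ b y * y₂ b y} (λ b → ≤-trans (*-monoˡ (y₂ b y * y₂ b y) (sq≥0 (y₂ b y)) (⟦⟧≤1 (_==_ PA b a))) (≤-reflexive (*-identityˡ (y₂ b y * y₂ b y)))))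

    var-small : ∀ S a → E (λ x → ⟦ u x ⟧ * (y₂ a (select S x) * y₂ a (select S x))) ≤ (ω * ω) * m
    var-small S a = below (λ x → y₂ a (select S x) * y₂ a (select S x)) (ω * ω) ωω>0 (λ x → +ʳ {(y₂ a (select S x) * y₂ a (select S x)) * inv (ω * ω)} {L₁ x} {L₂ x} (L₁≥0 x) (≤-trans (*-monoˡ (inv (ω * ω)) (<⇒≤ (inv-pos (ω * ω) ωω>0)) (term≤sum a (select S x))) (sumL-≥ {f = λ S → D₂ (select S x) * inv (ω * ω)} (terms₂≥0 x) (thins-complete S))))

    -- The facet pattern of `x*` has positive probability because the cell has; on a null pattern
    -- all densities would be 0.
    B-sum* : ∀ S → ∫ (∑ PA) (β* S) ≡ 1ℚ
    B-sum* S = B-sum ((facetPat col) (select S x*)) (<-≤-trans m>0 (≤-trans (∫≤ (𝔼 M₁) {λ x → ⟦ u x ⟧} {λ x → ⟦ eqVec PC ((facetPat col) (select S x*)) ((facetPat col) (select S x)) ⟧} (λ x → ⟦⟧-mono {u x} {eqVec PC ((facetPat col) (select S x*)) ((facetPat col) (select S x))} (λ q → subst (λ z → eqVec PC ((facetPat col) (select S x*)) z ≡ true) (sym (u-pat x q S)) (==-refl (finiteVec PC (suc r)) ((facetPat col) (select S x*)))))) (≤-reflexive (marg S (λ y → ⟦ eqVec PC ((facetPat col) (select S x*)) ((facetPat col) y) ⟧)))))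

    ε₂≤ : ε₂ ≤ ω * m
    ε₂≤ = ≤-trans ε₂-small (*-monoʳ ω (<⇒≤ ω>0) cs≤m)

    ε₀≥0 : 0ℚ ≤ ε₀
    ε₀≥0 = ≤-by (r₀ ε₀ τ) (θ≥0 ⊕ <⇒≤ τ>0)
      where r₀ : ∀ e t → e - 0ℚ ≡ (e - t) + t
            r₀ = solve-∀ ℛ

    finish : ∀ (J : M ⊑ M₁) → (∀ e → dd * m ≤ P (λ x → u x ∧ h (select (e ⨟ J) x))) → DN (Σ[ i ∈ Fin (suc (suc r)) ] Σ[ j ∈ Fin (suc (suc r)) ] Σ[ i<j ∈ i Fin.< j ] Σ[ y ∈ Vec V f ] (distinct y ≡ true × (∀ e → FPat.inE (FP i j i<j) e ≡ true → h (select e y) ≡ true)))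
    finish J dj = Top.Finish.conclusion r n M₁ PA swA PC κ col B B-range g₂ x* B-sum* ω ω>0 ε₂ ε₂≤ reg₂ var-small h W g₁ g₁-range ε₁ ε₁≥0 reg₁ τ Bad near ε₀ δ c₃ ε₀≥0 (<⇒≤ τ>0) δ≥0 c₃>0 c₃≤1
      f M p ρ σ dd c z₀ (cellSize PC r M₁) J (Top.finish-hyp cs≤m m>0 bad-small ρ≥0 σ≥0 δ≤1 θ≥0 θ≤1 p-small ε₀-small K₁ K₂ K₃ c-room S₁ S₂ S₃ C₁ C₂ z-small few dj) RT FP

  conclusion : DN (Σ[ i ∈ Fin (suc (suc r)) ] Σ[ j ∈ Fin (suc (suc r)) ] Σ[ i<j ∈ i Fin.< j ] Σ[ y ∈ Vec V f ] (distinct y ≡ true × (∀ e → FPat.inE (FP i j i<j) e ≡ true → h (select e y) ≡ true)))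
  conclusion = select-cell PC swC col L L-small >>= λ (x* , big) → dense x* (AtCell.cs≤m x* big) >>= λ (J , dj) → AtCell.finish x* big J dj

-- The hierarchy of constants.

min-over : ∀ (g : ℕ → ℚ) → (∀ i → 0ℚ < g i) → ∀ N → Σ[ μ ∈ ℚ ] (0ℚ < μ × (∀ i → i ℕ.≤ N → μ ≤ g i))
min-over g g>0 zero = g 0 , g>0 0 , λ { zero z≤n → ≤-refl }
min-over g g>0 (suc N) = go (min-over g g>0 N)
  where
  go : Σ[ μ ∈ ℚ ] (0ℚ < μ × (∀ i → i ℕ.≤ N → μ ≤ g i)) → Σ[ μ ∈ ℚ ] (0ℚ < μ × (∀ i → i ℕ.≤ suc N → μ ≤ g i))
  go (μ , μ>0 , h) = μ ℚ.⊓ g (suc N) , pos , below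
    where
    pos : 0ℚ < μ ℚ.⊓ g (suc N)
    pos with ℚₚ.⊓-sel μ (g (suc N))
    ... | inj₁ e = subst (0ℚ <_) (sym e) μ>0
    ... | inj₂ e = subst (0ℚ <_) (sym e) (g>0 (suc N))
    below : ∀ i → i ℕ.≤ suc N → μ ℚ.⊓ g (suc N) ≤ g i
    below i p with i ℕ.≤? N
    ... | yes q = ≤-trans (ℚₚ.p⊓q≤p μ (g (suc N))) (h i q)
    ... | no q with ℕₚ.≤-antisym p (ℕₚ.≰⇒> q)
    ... | refl = ℚₚ.p⊓q≤q μ (g (suc N))

1≤ν : ∀ n → 1ℚ ≤ ν (suc n)
1≤ν n = ≤-by (l (ν n)) (ν≥0 n)
  where l : ∀ n → (1ℚ + n) - 1ℚ ≡ n
        l = solve-∀ ℛ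

*≤ : ∀ a b → 0ℚ ≤ a → b ≤ 1ℚ → a * b ≤ a
*≤ a b p q = ≤-trans (*-monoʳ a p q) (≤-reflexive (*-identityʳ a))

≤* : ∀ a b → 0ℚ ≤ a → 1ℚ ≤ b → a ≤ a * b
≤* a b p q = ≤-trans (≤-reflexive (sym (*-identityʳ a))) (*-monoʳ a p q)

inv≤1 : ∀ y → 1ℚ ≤ y → inv y ≤ 1ℚ
inv≤1 y p = ≤-trans (≤-reflexive (sym (*-identityˡ (inv y)))) (≤-trans (*-monoˡ (inv y) (<⇒≤ (inv-pos y y>0)) p) (≤-reflexive (inv-r y y>0)))
  where y>0 : 0ℚ < y
        y>0 = <-≤-trans 0<1 p

cancel-inv : ∀ y x → 0ℚ < y → y * (x * inv y) ≡ x
cancel-inv y x p = trans (l y x (inv y)) (trans (cong (_* x) (inv-r y p)) (*-identityˡ x))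
  where l : ∀ y x i → y * (x * i) ≡ (y * i) * x
        l = solve-∀ ℛ

ν≤ : ∀ n → ν n ≤ ν (suc n)
ν≤ n = ≤-by (l (ν n)) 0≤1
  where l : ∀ n → (1ℚ + n) - n ≡ 1ℚ
        l = solve-∀ ℛ

frac≤ : ∀ n x → 0ℚ ≤ x → ν n * (x * inv (ν (suc n))) ≤ x
frac≤ n x p = ≤-trans (*-monoˡ {ν n} {ν (suc n)} (x * inv (ν (suc n))) (p ⊗ <⇒≤ (inv-pos (ν (suc n)) (ν-pos n))) (ν≤ n)) (≤-reflexive (cancel-inv (ν (suc n)) x (ν-pos n)))

Mean-≤1 : ∀ {A : Set} (L : Lin A) → Mean L → ∀ (X : A → Bool) → ∫ L (λ a → ⟦ X a ⟧) ≤ 1ℚ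
Mean-≤1 L m X = mean-≤ L m {λ a → ⟦ X a ⟧} (λ a → ⟦⟧≤1 (X a))

half≤1 : half ≤ 1ℚ
half≤1 = ≤-by {half} {1ℚ} {half} refl (<⇒≤ 0<half)

quarter≤1 : quarter ≤ 1ℚ
quarter≤1 = ≤-trans (*≤ half half (<⇒≤ 0<half) half≤1) half≤1

module Upper (r f : ℕ) (FP : ∀ i j → i Fin.< j → Pattern.FPat (suc r) f i j) (dns c : ℚ) (c≥0 : 0ℚ ≤ c) (c<d : c < dns) (d≤1 : dns ≤ 1ℚ) (c-big : 1ℚ < c * ν (suc (suc r)) ^ℚ suc (suc r)) where
  open Pattern (suc r) f
  module CA = Colouring (suc r)
  module CC = Colouring r

  k : ℕ
  k = suc (suc r)

  RTh : Σ ℕ (Reduced.ReducedThm (suc r) f c)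
  RTh = reduced-theorem (suc r) f c c-big

  M : ℕ
  M = proj₁ RTh

  ρ : ℚ
  -- Three shares cover the losses in the mass of `R`, the fourth the loss of density on passing to
  -- a cell.
  ρ = (dns - c) * quarter

  ρ>0 : 0ℚ < ρ
  ρ>0 = *-pos (Δ< c<d) 0<quarter

  ρ≤1 : ρ ≤ 1ℚ
  ρ≤1 = ≤-trans (*≤ (dns - c) quarter (<⇒≤ (Δ< c<d)) quarter≤1) (≤-by (l dns c) (Δ {dns} {1ℚ} d≤1 ⊕ c≥0))
    where l : ∀ d c → 1ℚ - (d - c) ≡ (1ℚ - d) + c
          l = solve-∀ ℛ

  ε₀ τ θ t c₃ p : ℚ
  ε₀ = ρ * half
  τ = ε₀ * half
  θ = ε₀ - τ
  nE nS : ℕ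
  nE = length (thins k f)
  nS = length (thins (suc r) f)
  t = θ ^ℚ nE
  -- All edges together may lose a quarter of the main factor `t` to bad tuples; `suc nE` keeps the
  -- divisor positive even when [f] contains no `k`-set.
  c₃ = (t * quarter) * inv (ν (suc nE))
  p = ρ * inv (1ℚ + inv c₃)

  ε₀>0 : 0ℚ < ε₀
  ε₀>0 = *-pos ρ>0 0<half
  τ>0 : 0ℚ < τ
  τ>0 = *-pos ε₀>0 0<half
  θ≡τ : θ ≡ τ
  θ≡τ = l ε₀
    where l : ∀ e → e - e * half ≡ e * half
          l = solve-∀ ℛ
  θ>0 : 0ℚ < θ
  θ>0 = subst (0ℚ <_) (sym θ≡τ) τ>0
  θ≤1 : θ ≤ 1ℚ
  θ≤1 = subst (_≤ 1ℚ) (sym θ≡τ) (≤-trans (*≤ ε₀ half (<⇒≤ ε₀>0) half≤1) (≤-trans (*≤ ρ half (<⇒≤ ρ>0) half≤1) ρ≤1))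
  t>0 : 0ℚ < t
  t>0 = ^ℚ-pos nE θ>0
  t≤1 : t ≤ 1ℚ
  t≤1 = ^ℚ≤1 nE (<⇒≤ θ>0) θ≤1
  tq>0 : 0ℚ < t * quarter
  tq>0 = *-pos t>0 0<quarter
  tq≤1 : t * quarter ≤ 1ℚ
  tq≤1 = ≤-trans (*≤ t quarter (<⇒≤ t>0) quarter≤1) t≤1
  iE>0 : 0ℚ < inv (ν (suc nE))
  iE>0 = inv-pos (ν (suc nE)) (ν-pos nE)
  iE≤1 : inv (ν (suc nE)) ≤ 1ℚ
  iE≤1 = inv≤1 (ν (suc nE)) (1≤ν nE)
  c₃>0 : 0ℚ < c₃
  c₃>0 = *-pos tq>0 iE>0
  c₃≤1 : c₃ ≤ 1ℚ
  c₃≤1 = ≤-trans (*≤ (t * quarter) (inv (ν (suc nE))) (<⇒≤ tq>0) iE≤1) tq≤1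
  Ic : ℚ
  Ic = 1ℚ + inv c₃
  Ic>0 : 0ℚ < Ic
  Ic>0 = +-pos 0<1 (<⇒≤ (inv-pos c₃ c₃>0))
  p>0 : 0ℚ < p
  p>0 = *-pos ρ>0 (inv-pos Ic Ic>0)
  ε₀-small : ε₀ + τ ≤ ρ
  ε₀-small = ≤-by (l ρ) (<⇒≤ ρ>0 ⊗ <⇒≤ 0<quarter)
    where l : ∀ ρ → ρ - (ρ * half + ρ * half * half) ≡ ρ * quarter
          l = solve-∀ ℛ
  c-room : c + ((ρ + ρ) + ρ) ≤ dns - ρ
  c-room = ≤-reflexive (l dns c)
    where l : ∀ d c → c + (((d - c) * quarter + (d - c) * quarter) + (d - c) * quarter) ≡ d - (d - c) * quarter
          l = solve-∀ ℛ
  ρq : ℚ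
  ρq = ρ * quarter
  ρq>0 : 0ℚ < ρq
  ρq>0 = *-pos ρ>0 0<quarter
  ρq≤1 : ρq ≤ 1ℚ
  ρq≤1 = ≤-trans (*≤ ρ quarter (<⇒≤ ρ>0) quarter≤1) ρ≤1

  module WithM₁ (M₁ : ℕ) where
    nk nS₁ : ℕ
    nk = length (thins k M₁)
    nS₁ = length (thins (suc r) M₁)
    ττ>0 : 0ℚ < τ * τ
    ττ>0 = *-pos τ>0 τ>0
    η₁ : ℚ
    η₁ = ((quarter * inv (ν (suc nk))) * p) * (τ * τ)
    η₁>0 : 0ℚ < η₁
    η₁>0 = *-pos (*-pos (*-pos 0<quarter (inv-pos (ν (suc nk)) (ν-pos nk))) p>0) ττ>0
    η₁-small : ν nk * ((η₁ * inv (τ * τ)) * inv p) ≤ quarter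
    η₁-small = ≤-trans (≤-reflexive (cong (ν nk *_) (trans (cong (_* inv p) (undo ((quarter * inv (ν (suc nk))) * p) (τ * τ) ττ>0)) (undo (quarter * inv (ν (suc nk))) p p>0)))) (frac≤ nk quarter (<⇒≤ 0<quarter))
      where
      undo : ∀ x y → 0ℚ < y → (x * y) * inv y ≡ x
      undo x y q = trans (*-assoc x y (inv y)) (trans (cong (x *_) (inv-r y q)) (*-identityʳ x))

    cs : ℕ → ℚ
    cs i = cellSize (CC.finiteCol i) r M₁
    dflt : ∀ i → CC.Col i
    dflt zero = tt
    dflt (suc i) = Vec.replicate (suc r) true , dflt i
    cs>0 : ∀ i → 0ℚ < cs i
    cs>0 i = *-pos 0<quarter (inv-pos ∣ PP ∣f (<-≤-trans 0<1 (size≥1 PP (Vec.replicate (length (thins r M₁)) (dflt i)))))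
      where PP = finiteVec (CC.finiteCol i) (length (thins r M₁))
    dfltA : ∀ i → CA.Col i
    dfltA zero = tt
    dfltA (suc i) = Vec.replicate (suc (suc r)) true , dfltA i

    module At (iA : ℕ) where
      kA δ π₀ D₃ σ Ω ω η₂ : ℚ
      kA = ∫ (linVec (∑ (CA.finiteCol iA)) k) (λ _ → 1ℚ)
      kA≥1 : 1ℚ ≤ kA
      kA≥1 = size≥1 (finiteVec (CA.finiteCol iA) k) (Vec.replicate k (dfltA iA))
      kA>0 : 0ℚ < kA
      kA>0 = <-≤-trans 0<1 kA≥1
      ikA>0 : 0ℚ < inv kA
      ikA>0 = inv-pos kA kA>0
      -- `kA` counts the colour tuples, over which the loss from rare colours is summed.
      δ = ρq * inv kA
      δ>0 : 0ℚ < δ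
      δ>0 = *-pos ρq>0 ikA>0
      δ≤1 : δ ≤ 1ℚ
      δ≤1 = ≤-trans (*≤ ρq (inv kA) (<⇒≤ ρq>0) (inv≤1 kA kA≥1)) ρq≤1
      π₀ = δ ^ℚ nS
      π₀>0 : 0ℚ < π₀
      π₀>0 = ^ℚ-pos nS δ>0
      π₀≤1 : π₀ ≤ 1ℚ
      π₀≤1 = ^ℚ≤1 nS (<⇒≤ δ>0) δ≤1
      πh>0 : 0ℚ < π₀ * half
      πh>0 = *-pos π₀>0 0<half
      D₃ = (1ℚ + 1ℚ + 1ℚ) * ν (suc nE)
      three≥1 : 1ℚ ≤ 1ℚ + 1ℚ + 1ℚ
      three≥1 = ≤-by {1ℚ} {1ℚ + 1ℚ + 1ℚ} {1ℚ + 1ℚ} refl (0≤1 ⊕ 0≤1)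
      D₃≥1 : 1ℚ ≤ D₃
      D₃≥1 = ≤-trans three≥1 (≤* (1ℚ + 1ℚ + 1ℚ) (ν (suc nE)) (≤-trans 0≤1 three≥1) (1≤ν nE))
      D₃>0 : 0ℚ < D₃
      D₃>0 = <-≤-trans 0<1 D₃≥1
      σ = ((t * quarter) * (π₀ * half)) * inv D₃
      σ>0 : 0ℚ < σ
      σ>0 = *-pos (*-pos tq>0 πh>0) (inv-pos D₃ D₃>0)
      S₃ : σ ≤ π₀ * half
      S₃ = ≤-trans (*≤ ((t * quarter) * (π₀ * half)) (inv D₃) (<⇒≤ (*-pos tq>0 πh>0)) (inv≤1 D₃ D₃≥1)) (≤-trans (*-monoˡ {t * quarter} {1ℚ} (π₀ * half) (<⇒≤ πh>0) tq≤1) (≤-reflexive (*-identityˡ (π₀ * half))))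
      σ≤1 : σ ≤ 1ℚ
      σ≤1 = ≤-trans S₃ (≤-trans (*≤ π₀ half (<⇒≤ π₀>0) half≤1) π₀≤1)
      C₂ : ν nE * ((σ + σ) + σ) ≤ (t * quarter) * (π₀ * half)
      C₂ = ≤-trans (*-monoˡ {ν nE} {ν (suc nE)} ((σ + σ) + σ) ((<⇒≤ σ>0 ⊕ <⇒≤ σ>0) ⊕ <⇒≤ σ>0) (ν≤ nE)) (≤-reflexive (trans (l₁ (ν (suc nE)) σ) (cancel-inv D₃ ((t * quarter) * (π₀ * half)) D₃>0)))
        where
        l₁ : ∀ n s → n * ((s + s) + s) ≡ (1ℚ + 1ℚ + 1ℚ) * n * s
        l₁ = solve-∀ ℛ
      Ω = (1ℚ + 1ℚ + 1ℚ) * (kA * (ν k * ν (suc nS)))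
      Ω>0 : 0ℚ < Ω
      Ω>0 = *-pos (<-≤-trans 0<1 three≥1) (*-pos kA>0 (*-pos (ν-pos (suc r)) (ν-pos nS)))
      σρ : ℚ
      σρ = σ * ρq
      σρ>0 : 0ℚ < σρ
      σρ>0 = *-pos σ>0 ρq>0
      -- Small enough for two sums at once: over the colour tuples in `K₃` and over the facets of
      -- the pattern in `S₁`.
      ω = σρ * inv Ω
      ω>0 : 0ℚ < ω
      ω>0 = *-pos σρ>0 (inv-pos Ω Ω>0)
      Ωω : Ω * ω ≡ σρ
      Ωω = cancel-inv Ω σρ Ω>0
      ω≥0 : 0ℚ ≤ ω
      ω≥0 = <⇒≤ ω>0
      K₃ : kA * (ν k * (ω + ω + ω)) ≤ ρ * quarter
      K₃ = ≤-trans (≤* (kA * (ν k * (ω + ω + ω))) (ν (suc nS)) (<⇒≤ kA>0 ⊗ (ν≥0 k ⊗ ((ω≥0 ⊕ ω≥0) ⊕ ω≥0))) (1≤ν nS)) (≤-trans (≤-reflexive (trans (l kA (ν k) ω (ν (suc nS))) Ωω)) (≤-trans (*-monoˡ {σ} {1ℚ} ρq (<⇒≤ ρq>0) σ≤1) (≤-reflexive (*-identityˡ ρq))))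
        where l : ∀ A k w s → (A * (k * (w + w + w))) * s ≡ (1ℚ + 1ℚ + 1ℚ) * (A * (k * s)) * w
              l = solve-∀ ℛ
      S₁ : ν nS * (ω + ω + ω) ≤ σ
      S₁ = ≤-trans (*-monoˡ {ν nS} {ν (suc nS)} (ω + ω + ω) ((ω≥0 ⊕ ω≥0) ⊕ ω≥0) (ν≤ nS)) (≤-trans (≤* (ν (suc nS) * (ω + ω + ω)) (kA * ν k) (ν≥0 (suc nS) ⊗ ((ω≥0 ⊕ ω≥0) ⊕ ω≥0)) (≤-trans kA≥1 (≤* kA (ν k) (<⇒≤ kA>0) (1≤ν (suc r))))) (≤-trans (≤-reflexive (trans (l kA (ν k) ω (ν (suc nS))) Ωω)) (*≤ σ ρq (<⇒≤ σ>0) ρq≤1)))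
        where
        l : ∀ A k w s → (s * (w + w + w)) * (A * k) ≡ (1ℚ + 1ℚ + 1ℚ) * (A * (k * s)) * w
        l = solve-∀ ℛ
      ωω>0 : 0ℚ < ω * ω
      ωω>0 = *-pos ω>0 ω>0
      η₂ = (quarter * inv (ν (suc nS₁))) * (ω * ω)
      η₂>0 : 0ℚ < η₂
      η₂>0 = *-pos (*-pos 0<quarter (inv-pos (ν (suc nS₁)) (ν-pos nS₁))) ωω>0
      η₂-small : ν nS₁ * (η₂ * inv (ω * ω)) ≤ quarter
      η₂-small = ≤-trans (≤-reflexive (cong (ν nS₁ *_) (trans (*-assoc (quarter * inv (ν (suc nS₁))) (ω * ω) (inv (ω * ω))) (trans (cong ((quarter * inv (ν (suc nS₁))) *_) (inv-r (ω * ω) ωω>0)) (*-identityʳ (quarter * inv (ν (suc nS₁)))))))) (frac≤ nS₁ quarter (<⇒≤ 0<quarter))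
      -- The error allowed for `i` is proportional to `cs i`, the size of the cells that a colouring
      -- with this `i` produces.
      reg = CC.strong-regularity (λ i → ω * cs i) (λ i → *-pos ω>0 (cs>0 i)) η₂ η₂>0
      IC : ℕ
      IC = proj₁ reg
      γs : Σ[ μ ∈ ℚ ] (0ℚ < μ × (∀ i → i ℕ.≤ IC → μ ≤ cs i))
      γs = min-over cs cs>0 IC
      γ ε₁ z : ℚ
      γ = proj₁ γs
      γ>0 : 0ℚ < γ
      γ>0 = proj₁ (proj₂ γs)
      -- The edges must be regular against every cell size that the lower colouring may produce,
      -- hence the minimum `γ` over all indices up to `IC`. As `ε₁` depends on `iA` through `kA`, it
      -- is the error function handed to `top`.
      ε₁ = (σρ * γ) * inv kA
      ε₁>0 : 0ℚ < ε₁
      ε₁>0 = *-pos (*-pos σρ>0 γ>0) ikA>0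
      tπ : ℚ
      tπ = (t * half) * (π₀ * half)
      tπ>0 : 0ℚ < tπ
      tπ>0 = *-pos (*-pos t>0 0<half) πh>0
      z = (tπ * γ) * half
      z>0 : 0ℚ < z
      z>0 = *-pos (*-pos tπ>0 γ>0) 0<half
      module _ (i : ℕ) (i≤ : i ℕ.≤ IC) where
        γ≤ : γ ≤ cs i
        γ≤ = proj₂ (proj₂ γs) i i≤
        K₁ : kA * ε₁ ≤ ρ * quarter * cs i
        K₁ = ≤-trans (≤-reflexive (cancel-inv kA (σρ * γ) kA>0)) (*-mono {σρ} {ρq} {γ} {cs i} (<⇒≤ σρ>0) (<⇒≤ (cs>0 i)) (≤-trans (*-monoˡ {σ} {1ℚ} ρq (<⇒≤ ρq>0) σ≤1) (≤-reflexive (*-identityˡ ρq))) γ≤)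
        S₂ : ε₁ ≤ σ * cs i
        S₂ = ≤-trans (*≤ (σρ * γ) (inv kA) (<⇒≤ (*-pos σρ>0 γ>0)) (inv≤1 kA kA≥1)) (*-mono {σρ} {σ} {γ} {cs i} (<⇒≤ σρ>0) (<⇒≤ (cs>0 i)) (*≤ σ ρq (<⇒≤ σ>0) ρq≤1) γ≤)
        z< : z < tπ * cs i
        z< = <-≤-trans (<-by (l (tπ * γ)) (*-pos (*-pos tπ>0 γ>0) 0<half)) (*-monoʳ tπ (<⇒≤ tπ>0) γ≤)
          where l : ∀ x → x - x * half ≡ x * half
                l = solve-∀ ℛ

    top = CA.strong-regularity At.ε₁ At.ε₁>0 η₁ η₁>0
    IA : ℕ
    IA = proj₁ top
    γ₀s : Σ[ μ ∈ ℚ ] (0ℚ < μ × (∀ i → i ℕ.≤ IA → μ ≤ At.γ i))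
    γ₀s = min-over At.γ At.γ>0 IA
    z₀s : Σ[ μ ∈ ℚ ] (0ℚ < μ × (∀ i → i ℕ.≤ IA → μ ≤ At.z i))
    z₀s = min-over At.z At.z>0 IA
    γ₀ z₀ : ℚ
    γ₀ = proj₁ γ₀s
    z₀ = proj₁ z₀s

    -- `M₁` is kept apart from `M` because for k = 3 the density is recovered only on a subset `J`
    -- of the indices, which may depend on the cell.
    Dense₀ : ∀ n → (Vec (Fin (suc n)) k → Bool) → Set₁
    Dense₀ n h = ∀ {C : Set} (PC : Finite C) (col : Vec (Fin (suc n)) r → C) (x* : Vec (Fin (suc n)) M₁) → γ₀ ≤ ∫ (Disc.𝔼 n M₁) (λ x → ⟦ sameCell PC col x* x ⟧) → DN (Σ[ J ∈ M ⊑ M₁ ] (∀ e → (dns - ρ) * ∫ (Disc.𝔼 n M₁) (λ x → ⟦ sameCell PC col x* x ⟧) ≤ ∫ (Disc.𝔼 n M₁) (λ x → ⟦ sameCell PC col x* x ∧ h (select (e ⨟ J) x) ⟧)))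

    FoundCopy : ∀ n → (Vec (Fin (suc n)) k → Bool) → Set
    FoundCopy n h = Σ[ i ∈ Fin k ] Σ[ j ∈ Fin k ] Σ[ i<j ∈ i Fin.< j ] Σ[ y ∈ Vec (Fin (suc n)) f ] (distinct y ≡ true × (∀ e → FPat.inE (FP i j i<j) e ≡ true → h (select e y) ≡ true))

    upper : ∀ n (h : Vec (Fin (suc n)) k → Bool) → Dense₀ n h → (ν M₁ * ν M₁) * inv (ν (suc n)) ≤ z₀ → DN (FoundCopy n h)
    upper n h dense few = proj₂ top n finite⊤ (λ _ z → ⟦ h z ⟧) (λ _ z → ⟦⟧≥0 (h z)) (λ _ z → ⟦⟧≤1 (h z)) (Mean-≤1 (Disc.𝔼 n k) (Disc.𝔼-mean n k) h) >>= stage₁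
      where
      open Disc n
      f₁ : ⊤ → Vec V k → ℚ
      f₁ _ z = ⟦ h z ⟧
      stage₁ : CA.On.Fam.Strong n finite⊤ f₁ (λ _ z → ⟦⟧≥0 (h z)) (λ _ z → ⟦⟧≤1 (h z)) At.ε₁ η₁ IA → DN (FoundCopy n h)
      -- The indicators of the colour classes add up to 1 at every tuple, so the whole family is
      -- regularised at a cost independent of the number of colours.
      stage₁ (iA , κ , g₁ , iA≤ , g₁-range , reg₁ , var₁) = proj₂ reg n PA f₂ (λ a y → ⟦⟧≥0 (_==_ PA a (κ y))) (λ a y → ⟦⟧≤1 (_==_ PA a (κ y))) (≤-reflexive total) >>= stage₂
        where
        open At iA
        PA = CA.finiteCol iA
        f₂ : CA.Col iA → Vec V (suc r) → ℚ
        f₂ a y = ⟦ _==_ PA a (κ y) ⟧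
        one : ∀ y → ∫ (∑ PA) (λ a → f₂ a y) ≡ 1ℚ
        one y = trans (∫≡ (∑ PA) (λ a → sym (*-identityʳ (f₂ a y)))) (∑-δ PA (λ _ → 1ℚ) (κ y))
        total : ∫ (∑ PA) (λ a → ∫ (𝔼 (suc r)) (f₂ a)) ≡ 1ℚ
        total = trans (sym (CA.swapCol iA (𝔼 (suc r)) (λ y a → f₂ a y))) (trans (∫≡ (𝔼 (suc r)) one) (𝔼-mean (suc r)))
        stage₂ : CC.On.Fam.Strong n PA f₂ (λ a y → ⟦⟧≥0 (_==_ PA a (κ y))) (λ a y → ⟦⟧≤1 (_==_ PA a (κ y))) (λ i → ω * cs i) η₂ IC → DN (FoundCopy n h)
        stage₂ (iC , col , g₂ , iC≤ , g₂-range , reg₂ , var₂) = Core.conclusion r n f M M₁ PA (CA.swapCol iA) PC (CC.swapCol iC) κ col B B-range g₂ h W (g₁ tt) (g₁-range tt) ω τ ε₀ δ c₃ p ρ σ ε₁ (ω * cs iC) η₁ η₂ (dns - ρ) c z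
            (core-hyp ω>0 τ>0 (<⇒≤ δ>0) δ≤1 c₃>0 c₃≤1 p>0 (<⇒≤ ρ>0) (<⇒≤ ε₁>0) (<⇒≤ θ>0) θ≤1 (<⇒≤ σ>0) (reg₁ tt) reg₂ var₁ var₂ B-sum (cs>0 iC) η₁-small η₂-small ≤-refl
            (≤-reflexive (cancel-inv Ic ρ Ic>0)) ε₀-small (K₁ iC iC≤) (≤-reflexive (cancel-inv kA ρq kA>0)) K₃ c-room S₁ (S₂ iC iC≤) S₃ (frac≤ nE (t * quarter) (<⇒≤ tq>0)) C₂ (z< iC iC≤) (≤-trans few (proj₂ (proj₂ z₀s) iA iA≤))
            (λ x* big → dense PC col x* (≤-trans (proj₂ (proj₂ γ₀s) iA iA≤) (≤-trans (γ≤ iC iC≤) big)))) (proj₂ RTh) FP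
          where
          PC = CC.finiteCol iC
          module N = CC.On n
          B : CA.Col iA → Vec (CC.Col iC) (suc r) → ℚ
          B a q = N.approx col (f₂ a) q
          W : Vec (CA.Col iA) k → ℚ
          W q = CA.On.approx n κ (f₁ tt) q
          LL = 𝔼 (suc r)
          PP = CC.finitePat iC
          sw = CC.swapPat iC
          pc : Vec V (suc r) → CC.Pat iC
          pc = N.pat col
          B-range : ∀ a q → (0ℚ ≤ B a q) × (B a q ≤ 1ℚ)
          B-range a q = subst (λ z → (0ℚ ≤ z) × (z ≤ 1ℚ)) (sym (N.approx-def col (f₂ a) q)) (cond-range LL PP sw pc (f₂ a) (λ y → ⟦⟧≥0 (_==_ PA a (κ y))) (λ y → ⟦⟧≤1 (_==_ PA a (κ y))) q)
          B-sum : ∀ q → 0ℚ < ∫ LL (λ y → ⟦ eqVec (CC.finiteCol iC) q (pc y) ⟧) → ∫ (∑ PA) (λ a → B a q) ≡ 1ℚ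
          B-sum q q>0 = trans (∫≡ (∑ PA) (λ a → trans (N.approx-def col (f₂ a) q) (cond-def LL PP sw pc (f₂ a) q))) (trans (∫*ʳ (∑ PA) (inv m₀) (λ a → ∫ LL (λ y → cell LL PP sw pc q y * f₂ a y))) (trans (cong (_* inv m₀) (trans (sym (CA.swapCol iA LL (λ y a → cell LL PP sw pc q y * f₂ a y))) (∫≡ LL (λ y → trans (∫* (∑ PA) (cell LL PP sw pc q y) (λ a → f₂ a y)) (trans (cong (cell LL PP sw pc q y *_) (one y)) (*-identityʳ (cell LL PP sw pc q y))))))) (inv-r m₀ q>0)))
            where
            m₀ : ℚ
            m₀ = ∫ LL (cell LL PP sw pc q)

-- Subsets, tuples and the counts in the definition of density.

T⇒≡ : ∀ {b} → T b → b ≡ true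
T⇒≡ {true} _ = refl

≡⇒T : ∀ {b} → b ≡ true → T b
≡⇒T refl = tt

lookup-ext : ∀ {A : Set} {m} {x y : Vec A m} → (∀ i → lookup x i ≡ lookup y i) → x ≡ y
lookup-ext {x = []} {[]} p = refl
lookup-ext {x = a ∷ x} {b ∷ y} p = cong₂ _∷_ (p zero) (lookup-ext (p ∘ suc))

infix 4 _∈ˢ_
_∈ˢ_ : ∀ {n} → Fin n → Subset n → Set
v ∈ˢ S = lookup S v ≡ true

set-ext : ∀ {n} {S U : Subset n} → (∀ v → v ∈ˢ S → v ∈ˢ U) → (∀ v → v ∈ˢ U → v ∈ˢ S) → S ≡ U
set-ext p q = lookup-ext (λ v → bool-ext (p v) (q v))

eqFin⇒≡ : ∀ {n} (a b : Fin n) → eqFin a b ≡ true → a ≡ b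
eqFin⇒≡ {n} a b = ==⇒≡ (finiteFin n)

∈-single⁺ : ∀ {n} (v : Fin n) → v ∈ˢ ⁅ v ⁆
∈-single⁺ zero = refl
∈-single⁺ (suc v) = ∈-single⁺ v

∈-single⁻ : ∀ {n} (v w : Fin n) → v ∈ˢ ⁅ w ⁆ → v ≡ w
∈-single⁻ zero zero p = refl
∈-single⁻ (suc v) zero p = case trans (sym (Vecₚ.lookup-replicate v false)) p of λ ()
∈-single⁻ (suc v) (suc w) p = cong suc (∈-single⁻ v w p)

single-injective : ∀ {n} {v w : Fin n} → ⁅ v ⁆ ≡ ⁅ w ⁆ → v ≡ w
single-injective {v = v} {w} p = ∈-single⁻ v w (subst (v ∈ˢ_) p (∈-single⁺ v))

toSet : ∀ {n j} → Vec (Fin n) j → Subset n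
toSet {n} [] = Vec.replicate n false
toSet (v ∷ z) = toSet z Vec.[ v ]≔ true

∈-update⁻ : ∀ {n} (S : Subset n) v w → w ∈ˢ (S Vec.[ v ]≔ true) → (w ≡ v) ⊎ (w ∈ˢ S)
∈-update⁻ S v w p with w Finₚ.≟ v
... | yes q = inj₁ q
... | no q = inj₂ (trans (sym (Vecₚ.lookup∘update′ q S true)) p)

∈-update⁺ : ∀ {n} (S : Subset n) v w → w ∈ˢ S → w ∈ˢ (S Vec.[ v ]≔ true)
∈-update⁺ S v w p with w Finₚ.≟ v
... | yes refl = Vecₚ.lookup∘update v S true
... | no q = trans (Vecₚ.lookup∘update′ q S true) p

∈-toSet⁺ : ∀ {n j} (z : Vec (Fin n) j) i → lookup z i ∈ˢ toSet z
∈-toSet⁺ (v ∷ z) zero = Vecₚ.lookup∘update v (toSet z) true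
∈-toSet⁺ (v ∷ z) (suc i) = ∈-update⁺ (toSet z) v (lookup z i) (∈-toSet⁺ z i)

∈-toSet⁻ : ∀ {n j} (z : Vec (Fin n) j) v → v ∈ˢ toSet z → Σ[ i ∈ Fin j ] lookup z i ≡ v
∈-toSet⁻ [] v p = case trans (sym (Vecₚ.lookup-replicate v false)) p of λ ()
∈-toSet⁻ (w ∷ z) v p = [ (λ q → zero , sym q) , (λ q → let i , e = ∈-toSet⁻ z v q in suc i , e) ]′ (∈-update⁻ (toSet z) w v p)

notIn-elim : ∀ {n j} {a : Fin n} (z : Vec (Fin n) j) → notIn a z ≡ true → ∀ i → lookup z i ≢ a
notIn-elim {n} {a = a} (b ∷ z) p zero refl = case trans (sym (cong not (==-refl (finiteFin n) a))) (∧ˡ (not (eqFin a b)) (notIn a z) p) of λ ()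
notIn-elim {a = a} (b ∷ z) p (suc i) q = notIn-elim z (∧ʳ (not (eqFin a b)) (notIn a z) p) i q

notIn-intro : ∀ {n j} {a : Fin n} (z : Vec (Fin n) j) → (∀ i → lookup z i ≢ a) → notIn a z ≡ true
notIn-intro [] p = refl
notIn-intro {n} {a = a} (b ∷ z) p = ∧-intro (cong not (==-false (finiteFin n) (λ e → p zero (sym e)))) (notIn-intro z (p ∘ suc))

distinct-injective : ∀ {n j} (z : Vec (Fin n) j) → distinct z ≡ true → ∀ i i' → lookup z i ≡ lookup z i' → i ≡ i'
distinct-injective (a ∷ z) p zero zero q = refl
distinct-injective (a ∷ z) p zero (suc i') q = ⊥-elim (notIn-elim z (∧ˡ (notIn a z) (distinct z) p) i' (sym q))
distinct-injective (a ∷ z) p (suc i) zero q = ⊥-elim (notIn-elim z (∧ˡ (notIn a z) (distinct z) p) i q)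
distinct-injective (a ∷ z) p (suc i) (suc i') q = cong suc (distinct-injective z (∧ʳ (notIn a z) (distinct z) p) i i' q)

injective-distinct : ∀ {n j} (z : Vec (Fin n) j) → (∀ i i' → lookup z i ≡ lookup z i' → i ≡ i') → distinct z ≡ true
injective-distinct [] p = refl
injective-distinct (a ∷ z) p = ∧-intro (notIn-intro z (λ i q → case p (suc i) zero q of λ ())) (injective-distinct z (λ i i' q → Finₚ.suc-injective (p (suc i) (suc i') q)))

card-insert : ∀ {n} (S : Subset n) v → lookup S v ≡ false → ∣ S Vec.[ v ]≔ true ∣ ≡ suc ∣ S ∣
card-insert (false ∷ S) zero p = refl
card-insert (true ∷ S) (suc v) p = cong suc (card-insert S v p)
card-insert (false ∷ S) (suc v) p = card-insert S v p

card-∅ : ∀ n → ∣ Vec.replicate n false ∣ ≡ 0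
card-∅ zero = refl
card-∅ (suc n) = card-∅ n

notIn-toSet : ∀ {n j} {a : Fin n} (z : Vec (Fin n) j) → notIn a z ≡ true → lookup (toSet z) a ≡ false
notIn-toSet {a = a} z p with lookup (toSet z) a in e
... | false = refl
... | true = let i , q = ∈-toSet⁻ z a e in ⊥-elim (notIn-elim z p i q)

card-toSet : ∀ {n j} (z : Vec (Fin n) j) → distinct z ≡ true → ∣ toSet z ∣ ≡ j
card-toSet {n} [] p = card-∅ n
card-toSet (a ∷ z) p = trans (card-insert (toSet z) a (notIn-toSet z (∧ˡ (notIn a z) (distinct z) p))) (cong suc (card-toSet z (∧ʳ (notIn a z) (distinct z) p)))

thinning : ∀ {n} (S : Subset n) → ∣ S ∣ ⊑ n
thinning [] = done
thinning (true ∷ S) = keep (thinning S)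
thinning (false ∷ S) = skip (thinning S)

positions : ∀ {j n} → j ⊑ n → Vec (Fin n) j
positions e = tabulate (ix e)

ix-injective : ∀ {j n} (e : j ⊑ n) t t' → ix e t ≡ ix e t' → t ≡ t'
ix-injective (skip e) t t' p = ix-injective e t t' (Finₚ.suc-injective p)
ix-injective (keep e) zero zero p = refl
ix-injective (keep e) (suc t) (suc t') p = cong suc (ix-injective e t t' (Finₚ.suc-injective p))

distinct-tabulate : ∀ {n j} (g : Fin j → Fin n) → (∀ i i' → g i ≡ g i' → i ≡ i') → distinct (tabulate g) ≡ true
distinct-tabulate g p = injective-distinct (tabulate g) (λ i i' q → p i i' (trans (sym (lookup∘tabulate g i)) (trans q (lookup∘tabulate g i'))))

∈-thinning⁺ : ∀ {n} (S : Subset n) t → ix (thinning S) t ∈ˢ S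
∈-thinning⁺ (true ∷ S) zero = refl
∈-thinning⁺ (true ∷ S) (suc t) = ∈-thinning⁺ S t
∈-thinning⁺ (false ∷ S) t = ∈-thinning⁺ S t

∈-thinning⁻ : ∀ {n} (S : Subset n) v → v ∈ˢ S → Σ[ t ∈ Fin ∣ S ∣ ] ix (thinning S) t ≡ v
∈-thinning⁻ (true ∷ S) zero p = zero , refl
∈-thinning⁻ (true ∷ S) (suc v) p = let t , q = ∈-thinning⁻ S v p in suc t , cong suc q
∈-thinning⁻ (false ∷ S) (suc v) p = let t , q = ∈-thinning⁻ S v p in t , cong suc q

lookup-positions : ∀ {j n} (e : j ⊑ n) t → lookup (positions e) t ≡ ix e t
lookup-positions e = lookup∘tabulate (ix e)

positions-distinct : ∀ {j n} (e : j ⊑ n) → distinct (positions e) ≡ true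
positions-distinct e = distinct-tabulate (ix e) (ix-injective e)

toSet-thinning : ∀ {n} (S : Subset n) → toSet (positions (thinning S)) ≡ S
toSet-thinning S = set-ext
  (λ v p → let i , q = ∈-toSet⁻ (positions (thinning S)) v p in subst (_∈ˢ S) (trans (sym (lookup-positions (thinning S) i)) q) (∈-thinning⁺ S i))
  (λ v p → let t , q = ∈-thinning⁻ S v p in subst (_∈ˢ toSet (positions (thinning S))) (trans (lookup-positions (thinning S) t) q) (∈-toSet⁺ (positions (thinning S)) t))

enumerate : ∀ {n j} (S : Subset n) → ∣ S ∣ ≡ j → Σ[ e ∈ j ⊑ n ] toSet (positions e) ≡ S
enumerate S refl = thinning S , toSet-thinning S

toSet-≡ : ∀ {n i j} (z : Vec (Fin n) i) (y : Vec (Fin n) j) → (∀ t → Σ[ s ∈ Fin j ] lookup y s ≡ lookup z t) → (∀ s → Σ[ t ∈ Fin i ] lookup z t ≡ lookup y s) → toSet z ≡ toSet y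
toSet-≡ z y p q = set-ext
  (λ v m → let t , e = ∈-toSet⁻ z v m ; s , e' = p t in subst (_∈ˢ toSet y) (trans e' e) (∈-toSet⁺ y s))
  (λ v m → let s , e = ∈-toSet⁻ y v m ; t , e' = q s in subst (_∈ˢ toSet z) (trans e' e) (∈-toSet⁺ z t))

toSet-select⊆ : ∀ {n j m} (e : j ⊑ m) (z : Vec (Fin n) m) v → v ∈ˢ toSet (select e z) → v ∈ˢ toSet z
toSet-select⊆ e z v p = let i , q = ∈-toSet⁻ (select e z) v p in subst (_∈ˢ toSet z) (trans (sym (lookup-select e z i)) q) (∈-toSet⁺ z (ix e i))

sub-select : ∀ {n j m} (z : Vec (Fin n) m) (U : Subset n) → distinct z ≡ true → (∀ v → v ∈ˢ U → v ∈ˢ toSet z) → ∣ U ∣ ≡ j → Σ[ e ∈ j ⊑ m ] toSet (select e z) ≡ U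
sub-select {n} {j} {m} z U dz sub c = go (enumerate {j = ∣ A ∣} A refl)
  where
  A : Subset m
  A = tabulate (λ i → lookup U (lookup z i))
  A-at : ∀ i → lookup A i ≡ lookup U (lookup z i)
  A-at i = lookup∘tabulate (λ i → lookup U (lookup z i)) i
  go : Σ[ e ∈ ∣ A ∣ ⊑ m ] toSet (positions e) ≡ A → Σ[ e ∈ j ⊑ m ] toSet (select e z) ≡ U
  go (e , p) = subst (λ a → Σ[ e ∈ a ⊑ m ] toSet (select e z) ≡ U) (trans (sym (trans (cong ∣_∣ (sym same)) (card-toSet (select e z) (distinct-select e z dz)))) c) (e , same)
    where
    same : toSet (select e z) ≡ U
    same = set-ext
      (λ v q → let i , r = ∈-toSet⁻ (select e z) v q in subst (_∈ˢ U) (trans (sym (lookup-select e z i)) r) (trans (sym (A-at (ix e i))) (subst (ix e i ∈ˢ_) p (subst (_∈ˢ toSet (positions e)) (lookup-positions e i) (∈-toSet⁺ (positions e) i)))))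
      (λ v q → let i , r = ∈-toSet⁻ z v (sub v q) ; t , s = ∈-toSet⁻ (positions e) i (subst (i ∈ˢ_) (sym p) (trans (A-at i) (trans (cong (lookup U) r) q))) in
         subst (_∈ˢ toSet (select e z)) (trans (lookup-select e z t) (trans (cong (lookup z) (trans (sym (lookup-positions e t)) s)) r)) (∈-toSet⁺ (select e z) t))

allSubsets-complete : ∀ {n} (S : Subset n) → S ∈ allSubsets n
allSubsets-complete [] = here refl
allSubsets-complete (true ∷ S) = ∈-++⁺ˡ (∈-map⁺ (true ∷_) (allSubsets-complete S))
allSubsets-complete {suc n} (false ∷ S) = ∈-++⁺ʳ (List.map (true ∷_) (allSubsets n)) (∈-map⁺ (false ∷_) (allSubsets-complete S))

all≡allL : ∀ {A : Set} (p : A → Bool) l → BoolL.all p l ≡ allL p l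
all≡allL p [] = refl
all≡allL p (a ∷ l) = cong (p a ∧_) (all≡allL p l)

⊆ᵇ-elim : ∀ {n} (U S : Subset n) → U ⊆ᵇ S ≡ true → ∀ v → v ∈ˢ U → v ∈ˢ S
⊆ᵇ-elim (true ∷ U) (b ∷ S) p zero q = ∧ˡ b (U ⊆ᵇ S) p
⊆ᵇ-elim (a ∷ U) (b ∷ S) p (suc v) q = ⊆ᵇ-elim U S (∧ʳ (not a ∨ b) (U ⊆ᵇ S) p) v q

⊆ᵇ-intro : ∀ {n} (U S : Subset n) → (∀ v → v ∈ˢ U → v ∈ˢ S) → U ⊆ᵇ S ≡ true
⊆ᵇ-intro [] [] p = refl
⊆ᵇ-intro (false ∷ U) (b ∷ S) p = ⊆ᵇ-intro U S (p ∘ suc)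
⊆ᵇ-intro (true ∷ U) (b ∷ S) p = ∧-intro (p zero refl) (⊆ᵇ-intro U S (p ∘ suc))

module _ {n : ℕ} (k j : ℕ) (G : Subset n → Bool) (S : Subset n) where
  private
    Q : Subset n → Bool
    Q U = not ((U ⊆ᵇ S) ∧ (∣ U ∣ ℕ.≡ᵇ j)) ∨ G U

  inK-card : inK k j G S ≡ true → ∣ S ∣ ≡ k
  inK-card p = ℕₚ.≡ᵇ⇒≡ ∣ S ∣ k (≡⇒T (∧ˡ (∣ S ∣ ℕ.≡ᵇ k) (BoolL.all Q (allSubsets n)) p))

  inK-elim : inK k j G S ≡ true → ∀ U → (∀ v → v ∈ˢ U → v ∈ˢ S) → ∣ U ∣ ≡ j → G U ≡ true
  inK-elim p U sub c = go (U ⊆ᵇ S) (∣ U ∣ ℕ.≡ᵇ j) (⊆ᵇ-intro U S sub) (T⇒≡ (ℕₚ.≡⇒≡ᵇ ∣ U ∣ j c)) (allL-elim Q (allSubsets n) (trans (sym (all≡allL Q (allSubsets n))) (∧ʳ (∣ S ∣ ℕ.≡ᵇ k) (BoolL.all Q (allSubsets n)) p)) (allSubsets-complete U))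
    where
    go : ∀ a b → a ≡ true → b ≡ true → not (a ∧ b) ∨ G U ≡ true → G U ≡ true
    go true true _ _ q = q

  inK-intro : ∣ S ∣ ≡ k → (∀ U → (∀ v → v ∈ˢ U → v ∈ˢ S) → ∣ U ∣ ≡ j → G U ≡ true) → inK k j G S ≡ true
  inK-intro c p = ∧-intro (T⇒≡ (ℕₚ.≡⇒≡ᵇ ∣ S ∣ k c)) (trans (all≡allL Q (allSubsets n)) (allL-intro Q (allSubsets n) (λ {U} _ → go U (U ⊆ᵇ S) (∣ U ∣ ℕ.≡ᵇ j) refl refl)))
    where
    go : ∀ U a b → U ⊆ᵇ S ≡ a → (∣ U ∣ ℕ.≡ᵇ j) ≡ b → not (a ∧ b) ∨ G U ≡ true
    go U false b _ _ = refl
    go U true false _ _ = refl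
    go U true true q r = p U (⊆ᵇ-elim U S q) (ℕₚ.≡ᵇ⇒≡ ∣ U ∣ j (≡⇒T r))

∑S : ∀ n → Lin (Subset n)
∑S n = linVec sumBool n

ν-count : ∀ {n} (p : Subset n → Bool) → ν (count p) ≡ ∫ (∑S n) (λ S → ⟦ p S ⟧)
ν-count {n} p = trans (list (allSubsets n)) (tree n (λ S → ⟦ p S ⟧))
  where
  list : ∀ l → ν (ℕL.sum (List.map (λ S → if p S then 1 else 0) l)) ≡ sumL (λ S → ⟦ p S ⟧) l
  list [] = refl
  list (S ∷ l) = trans (ν-+ (if p S then 1 else 0) (ℕL.sum (List.map (λ S → if p S then 1 else 0) l))) (cong₂ _+_ (one (p S)) (list l))
    where
    one : ∀ b → ν (if b then 1 else 0) ≡ ⟦ b ⟧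
    one true = refl
    one false = refl
  sum-++ : ∀ {A : Set} (f : A → ℚ) l l' → sumL f (l ++ l') ≡ sumL f l + sumL f l'
  sum-++ f [] l' = sym (+-identityˡ (sumL f l'))
  sum-++ f (a ∷ l) l' = trans (cong (f a +_) (sum-++ f l l')) (sym (ℚₚ.+-assoc (f a) (sumL f l) (sumL f l')))
  sum-map : ∀ {A B : Set} (f : B → ℚ) (g : A → B) l → sumL f (List.map g l) ≡ sumL (f ∘ g) l
  sum-map f g [] = refl
  sum-map f g (a ∷ l) = cong (f (g a) +_) (sum-map f g l)
  tree : ∀ n (f : Subset n → ℚ) → sumL f (allSubsets n) ≡ ∫ (∑S n) f
  tree zero f = +-identityʳ (f [])
  tree (suc n) f = trans (sum-++ f (List.map (true ∷_) (allSubsets n)) (List.map (false ∷_) (allSubsets n))) (cong₂ _+_ (trans (sum-map f (true ∷_) (allSubsets n)) (tree n (f ∘ (true ∷_)))) (trans (sum-map f (false ∷_) (allSubsets n)) (tree n (f ∘ (false ∷_)))))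

module _ {k n : ℕ} (j : ℕ) (dns μ : ℚ) (H : KGraph k n) (G : Subset n → Bool) where
  -- The excess of edges over density `dns`. It is linear in the indicator of 𝒦_k(G), so it can be
  -- averaged over a random G.
  surplus : ℚ
  surplus = ∫ (∑S n) (λ S → ⟦ inK k j G S ⟧ * (⟦ edge H S ⟧ - dns))

  surplus-count : surplus ≡ ℕtoℚ (count (λ S → inK k j G S ∧ edge H S)) - dns * ℕtoℚ (count (inK k j G))
  surplus-count = trans (∫≡ (∑S n) (λ S → trans (l ⟦ inK k j G S ⟧ ⟦ edge H S ⟧ dns) (cong (_- dns * ⟦ inK k j G S ⟧) (sym (⟦∧⟧ (inK k j G S) (edge H S))))))
    (trans (∫- (∑S n) (λ S → ⟦ inK k j G S ∧ edge H S ⟧) (λ S → dns * ⟦ inK k j G S ⟧))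
      (cong₂ _-_ (sym (trans (ℕtoℚ≡ν (count (λ S → inK k j G S ∧ edge H S))) (ν-count (λ S → inK k j G S ∧ edge H S)))) (trans (∫* (∑S n) dns (λ S → ⟦ inK k j G S ⟧)) (cong (dns *_) (sym (trans (ℕtoℚ≡ν (count (inK k j G))) (ν-count (inK k j G))))))))
    where l : ∀ a b d → a * (b - d) ≡ a * b - d * a
          l = solve-∀ ℛ

  scale-count : ℕtoℚ (n ℕ.^ k) ≡ ν n ^ℚ k
  scale-count = trans (ℕtoℚ≡ν (n ℕ.^ k)) (ν-^ n k)

  dense⇒surplus : (dns * ℕtoℚ (count (inK k j G))) - (μ * ℕtoℚ (n ℕ.^ k)) ≤ ℕtoℚ (count (λ S → inK k j G S ∧ edge H S)) → - (μ * ν n ^ℚ k) ≤ surplus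
  dense⇒surplus p = subst₂ (λ N s → - (μ * N) ≤ s) scale-count (sym surplus-count) (≤-by (l A B (μ * ℕtoℚ (n ℕ.^ k))) (Δ {B - μ * ℕtoℚ (n ℕ.^ k)} {A} p))
    where
    A = ℕtoℚ (count (λ S → inK k j G S ∧ edge H S))
    B = dns * ℕtoℚ (count (inK k j G))
    l : ∀ A B m → (A - B) - (- m) ≡ A - (B - m)
    l = solve-∀ ℛ

  surplus⇒dense : - (μ * ν n ^ℚ k) ≤ surplus → (dns * ℕtoℚ (count (inK k j G))) - (μ * ℕtoℚ (n ℕ.^ k)) ≤ ℕtoℚ (count (λ S → inK k j G S ∧ edge H S))
  surplus⇒dense p = ≤-by (l A B (μ * ℕtoℚ (n ℕ.^ k))) (Δ (subst₂ (λ N s → - (μ * N) ≤ s) (sym scale-count) surplus-count p))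
    where
    A = ℕtoℚ (count (λ S → inK k j G S ∧ edge H S))
    B = dns * ℕtoℚ (count (inK k j G))
    l : ∀ A B m → A - (B - m) ≡ (A - B) - (- m)
    l = solve-∀ ℛ

-- Random functions on the subsets of [n]

data Tree (B : Set) : ℕ → Set where
  leaf : B → Tree B 0
  node : ∀ {n} → Tree B n → Tree B n → Tree B (suc n)

get : ∀ {B n} → Tree B n → Subset n → B
get (leaf b) [] = b
get (node l r) (true ∷ S) = get l S
get (node l r) (false ∷ S) = get r S

set : ∀ {B n} → Tree B n → Subset n → B → Tree B n
set (leaf _) [] b = leaf b
set (node l r) (true ∷ S) b = node (set l S b) r
set (node l r) (false ∷ S) b = node l (set r S b)

get-set : ∀ {B n} (χ : Tree B n) S b → get (set χ S b) S ≡ b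
get-set (leaf _) [] b = refl
get-set (node l r) (true ∷ S) b = get-set l S b
get-set (node l r) (false ∷ S) b = get-set r S b

get-set-other : ∀ {B n} (χ : Tree B n) S U b → S ≢ U → get (set χ S b) U ≡ get χ U
get-set-other (leaf _) [] [] b p = ⊥-elim (p refl)
get-set-other (node l r) (true ∷ S) (true ∷ U) b p = get-set-other l S U b (p ∘ cong (true ∷_))
get-set-other (node l r) (true ∷ S) (false ∷ U) b p = refl
get-set-other (node l r) (false ∷ S) (true ∷ U) b p = refl
get-set-other (node l r) (false ∷ S) (false ∷ U) b p = get-set-other r S U b (p ∘ cong (false ∷_))

-- Storing a function on subsets as a binary tree makes the product measure an iterated integral, in
-- which the value at a single set can be redrawn.
linTree : ∀ {B} n → (Subset n → Lin B) → Lin (Tree B n)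
∫ (linTree zero L) f = ∫ (L []) (λ b → f (leaf b))
∫ (linTree (suc n) L) f = ∫ (linTree n (L ∘ (true ∷_))) (λ l → ∫ (linTree n (L ∘ (false ∷_))) (λ r → f (node l r)))
∫+ (linTree zero L) f g = ∫+ (L []) (λ b → f (leaf b)) (λ b → g (leaf b))
∫+ (linTree (suc n) L) f g = trans (∫≡ (linTree n (L ∘ (true ∷_))) (λ l → ∫+ (linTree n (L ∘ (false ∷_))) (λ r → f (node l r)) (λ r → g (node l r)))) (∫+ (linTree n (L ∘ (true ∷_))) (λ l → ∫ (linTree n (L ∘ (false ∷_))) (λ r → f (node l r))) (λ l → ∫ (linTree n (L ∘ (false ∷_))) (λ r → g (node l r))))
∫* (linTree zero L) c f = ∫* (L []) c (λ b → f (leaf b))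
∫* (linTree (suc n) L) c f = trans (∫≡ (linTree n (L ∘ (true ∷_))) (λ l → ∫* (linTree n (L ∘ (false ∷_))) c (λ r → f (node l r)))) (∫* (linTree n (L ∘ (true ∷_))) c (λ l → ∫ (linTree n (L ∘ (false ∷_))) (λ r → f (node l r))))
∫≤ (linTree zero L) p = ∫≤ (L []) (λ b → p (leaf b))
∫≤ (linTree (suc n) L) p = ∫≤ (linTree n (L ∘ (true ∷_))) (λ l → ∫≤ (linTree n (L ∘ (false ∷_))) (λ r → p (node l r)))

linTree-mean : ∀ {B} n (L : Subset n → Lin B) → (∀ S → Mean (L S)) → Mean (linTree n L)
linTree-mean zero L m = m []
linTree-mean (suc n) L m = trans (∫≡ (linTree n (L ∘ (true ∷_))) (λ l → linTree-mean n (L ∘ (false ∷_)) (m ∘ (false ∷_)))) (linTree-mean n (L ∘ (true ∷_)) (m ∘ (true ∷_)))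

linTree-low : ∀ {B} n (L : Subset n → Lin B) → (∀ S → Low (L S)) → Low (linTree n L)
linTree-low zero L m f = let b , p = m [] (λ b → f (leaf b)) in leaf b , p
linTree-low (suc n) L m f =
  let l , p = linTree-low n (L ∘ (true ∷_)) (m ∘ (true ∷_)) (λ l → ∫ (linTree n (L ∘ (false ∷_))) (λ r → f (node l r)))
      r , q = linTree-low n (L ∘ (false ∷_)) (m ∘ (false ∷_)) (λ r → f (node l r))
  in node l r , ≤-trans q p

resampleTree : ∀ {B} n (L : Subset n → Lin B) → (∀ S → Mean (L S)) → (∀ S → Swap (L S)) → ∀ S (Φ : Tree B n → ℚ) → ∫ (linTree n L) Φ ≡ ∫ (linTree n L) (λ χ → ∫ (L S) (λ b → Φ (set χ S b)))
resampleTree zero L m s [] Φ = sym (mean-const (L []) (m []) (∫ (L []) (λ b → Φ (leaf b))))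
resampleTree (suc n) L m s (true ∷ S) Φ = trans (resampleTree n Lt (m ∘ (true ∷_)) (s ∘ (true ∷_)) S (λ l → ∫ (linTree n Lf) (λ r → Φ (node l r)))) (∫≡ (linTree n Lt) (λ l → sym (s (true ∷ S) (linTree n Lf) (λ r b → Φ (node (set l S b) r)))))
  where
  Lt = L ∘ (true ∷_)
  Lf = L ∘ (false ∷_)
resampleTree (suc n) L m s (false ∷ S) Φ = ∫≡ (linTree n (L ∘ (true ∷_))) (λ l → resampleTree n (L ∘ (false ∷_)) (m ∘ (false ∷_)) (s ∘ (false ∷_)) S (λ r → Φ (node l r)))

prodF-cong : ∀ n {x y : Fin n → ℚ} → (∀ i → x i ≡ y i) → prodF n x ≡ prodF n y
prodF-cong zero p = refl
prodF-cong (suc n) p = cong₂ _*_ (p zero) (prodF-cong n (p ∘ suc))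

⟦allF⟧ : ∀ n (p : Fin n → Bool) → ⟦ allF n p ⟧ ≡ prodF n (λ i → ⟦ p i ⟧)
⟦allF⟧ zero p = refl
⟦allF⟧ (suc n) p = trans (⟦∧⟧ (p zero) (allF n (p ∘ suc))) (cong (⟦ p zero ⟧ *_) (⟦allF⟧ n (p ∘ suc)))

module Random {B : Set} (n : ℕ) (L : Subset n → Lin B) (mean : ∀ S → Mean (L S)) (swap : ∀ S → Swap (L S)) where
  ℙ : Lin (Tree B n)
  ℙ = linTree n L

  ℙ-mean : Mean ℙ
  ℙ-mean = linTree-mean n L mean

  -- The value at `S` is independent of every quantity that redrawing it leaves unchanged.
  factor : ∀ S (φ : B → ℚ) (Ψ : Tree B n → ℚ) → (∀ χ b → Ψ (set χ S b) ≡ Ψ χ) → ∫ ℙ (λ χ → φ (get χ S) * Ψ χ) ≡ ∫ (L S) φ * ∫ ℙ Ψ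
  factor S φ Ψ p = trans (resampleTree n L mean swap S (λ χ → φ (get χ S) * Ψ χ)) (trans (∫≡ ℙ (λ χ → trans (∫≡ (L S) (λ b → cong₂ _*_ (cong φ (get-set χ S b)) (p χ b))) (∫*ʳ (L S) (Ψ χ) φ))) (∫* ℙ (∫ (L S) φ) Ψ))

  independent : ∀ {j} (z : Vec (Fin n) j) → distinct z ≡ true → (φ : Fin j → B → ℚ) → ∫ ℙ (λ χ → prodF j (λ i → φ i (get χ ⁅ lookup z i ⁆))) ≡ prodF j (λ i → ∫ (L ⁅ lookup z i ⁆) (φ i))
  independent [] p φ = ℙ-mean
  independent {suc j} (v ∷ z) p φ = trans (factor ⁅ v ⁆ (φ zero) (λ χ → prodF j (λ i → φ (suc i) (get χ ⁅ lookup z i ⁆))) (λ χ b → prodF-cong j (λ i → cong (φ (suc i)) (get-set-other χ ⁅ v ⁆ ⁅ lookup z i ⁆ b (λ e → notIn-elim z (∧ˡ (notIn v z) (distinct z) p) i (sym (single-injective e)))))))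
    (cong (∫ (L ⁅ v ⁆) (φ zero) *_) (independent z (∧ʳ (notIn v z) (distinct z) p) (φ ∘ suc)))

-- Change of variables along `g`, a bijection from the part of `A` cut out by `Z` onto the part of
-- `B` cut out by `Y`.
sum-by : ∀ {A B : Set} (PA : Finite A) (PB : Finite B) → Swap (∑ PB) → (Z : A → Bool) (g : A → B) (Y : B → Bool) (φ : B → ℚ) →
  (∀ a → Z a ≡ true → Y (g a) ≡ true) → (∀ b → Y b ≡ true → Σ[ a ∈ A ] (Z a ≡ true × g a ≡ b)) → (∀ a a' → Z a ≡ true → Z a' ≡ true → g a ≡ g a' → a ≡ a') →
  ∫ (∑ PA) (λ a → ⟦ Z a ⟧ * φ (g a)) ≡ ∫ (∑ PB) (λ b → ⟦ Y b ⟧ * φ b)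
sum-by {A} {B} PA PB swB Z g Y φ fwd bwd inj = trans (∫≡ (∑ PA) (λ a → sym (∑-δ PB (λ b → ⟦ Z a ⟧ * φ b) (g a)))) (trans (swB (∑ PA) (λ a b → ⟦ _==_ PB b (g a) ⟧ * (⟦ Z a ⟧ * φ b))) (∫≡ (∑ PB) (λ b → at b (Y b) refl)))
  where
  join : ∀ x y c → ⟦ x ⟧ * (⟦ y ⟧ * c) ≡ ⟦ x ∧ y ⟧ * c
  join x y c = trans (sym (*-assoc ⟦ x ⟧ ⟦ y ⟧ c)) (cong (_* c) (sym (⟦∧⟧ x y)))
  at : ∀ b y → Y b ≡ y → ∫ (∑ PA) (λ a → ⟦ _==_ PB b (g a) ⟧ * (⟦ Z a ⟧ * φ b)) ≡ ⟦ y ⟧ * φ b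
  at b true q = go (bwd b q)
    where
    go : Σ[ a ∈ A ] (Z a ≡ true × g a ≡ b) → ∫ (∑ PA) (λ a → ⟦ _==_ PB b (g a) ⟧ * (⟦ Z a ⟧ * φ b)) ≡ 1ℚ * φ b
    go (a₀ , z₀ , e₀) = trans (∫≡ (∑ PA) (λ a → trans (join (_==_ PB b (g a)) (Z a) (φ b)) (cong (λ c → ⟦ c ⟧ * φ b) (bool-ext
        (λ h → subst (λ c → _==_ PA a c ≡ true) (inj a a₀ (∧ʳ (_==_ PB b (g a)) (Z a) h) z₀ (trans (sym (==⇒≡ PB (∧ˡ (_==_ PB b (g a)) (Z a) h))) (sym e₀))) (==-refl PA a))
        (λ h → subst (λ c → (_==_ PB b (g c) ∧ Z c) ≡ true) (sym (==⇒≡ PA h)) (∧-intro (subst (λ c → _==_ PB b c ≡ true) (sym e₀) (==-refl PB b)) z₀))))))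
      (trans (∑-δ PA (λ _ → φ b) a₀) (sym (*-identityˡ (φ b))))
  at b false q = trans (∫≡ (∑ PA) (λ a → trans (join (_==_ PB b (g a)) (Z a) (φ b)) (trans (cong (λ c → ⟦ c ⟧ * φ b) (bool-ext {_==_ PB b (g a) ∧ Z a} {false} (λ h → trans (sym q) (trans (cong Y (==⇒≡ PB (∧ˡ (_==_ PB b (g a)) (Z a) h))) (fwd a (∧ʳ (_==_ PB b (g a)) (Z a) h)))) (λ ()))) (*-zeroˡ (φ b))))) (trans (∫0 (∑ PA)) (sym (*-zeroˡ (φ b))))

∑S-swap : ∀ n → Swap (∑S n)
∑S-swap n = linVec-swap sumBool sumBool-swap n

finiteS : ∀ n → Finite (Subset n)
finiteS n = finiteVec finiteBool n

finiteTuple : ∀ n j → Finite (Vec (Fin n) j)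
finiteTuple n j = finiteVec (finiteFin n) j

sum-avg : ∀ n j (f : Vec (Fin (suc n)) j → ℚ) → ∫ (linVec (sumFin (suc n)) j) f ≡ ν (suc n) ^ℚ j * ∫ (Disc.𝔼 n j) f
sum-avg n zero f = sym (*-identityˡ (f []))
sum-avg n (suc j) f = trans (∫≡ (sumFin (suc n)) (λ v → sum-avg n j (λ x → f (v ∷ x)))) (trans (∫* (sumFin (suc n)) N (λ v → ∫ (Disc.𝔼 n j) (λ x → f (v ∷ x)))) (sym (trans (l (ν (suc n)) N (inv (ν (suc n))) (∫ (sumFin (suc n)) (λ v → ∫ (Disc.𝔼 n j) (λ x → f (v ∷ x))))) (trans (cong (_* (N * ∫ (sumFin (suc n)) (λ v → ∫ (Disc.𝔼 n j) (λ x → f (v ∷ x))))) (inv-r (ν (suc n)) (ν-pos n))) (*-identityˡ _)))))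
  where
  N = ν (suc n) ^ℚ j
  l : ∀ n N i s → (n * N) * (i * s) ≡ (n * i) * (N * s)
  l = solve-∀ ℛ

injective⇒surjective : ∀ {m} (g : Fin m → Fin m) → (∀ i j → g i ≡ g j → i ≡ j) → ∀ y → Σ[ i ∈ Fin m ] g i ≡ y
injective⇒surjective {suc m} g inj y with Finₚ.any? (λ i → g i Finₚ.≟ y)
... | yes p = p
... | no p = ⊥-elim (ℕₚ.1+n≰n (Finₚ.injective⇒≤ {f = λ i → Fin.punchOut {i = y} {j = g i} (λ e → p (i , sym e))} (λ {i} {j} e → inj i j (Finₚ.punchOut-injective (λ e → p (i , sym e)) (λ e → p (j , sym e)) e))))

-- Density inside a cell, k ≥ 4: a random labelling by [k] orders every k-set of the test graph

anyF : ∀ n → (Fin n → Bool) → Bool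
anyF zero p = false
anyF (suc n) p = p zero ∨ anyF n (p ∘ suc)

∨-elim : ∀ a b → a ∨ b ≡ true → (a ≡ true) ⊎ (b ≡ true)
∨-elim true b p = inj₁ refl
∨-elim false b p = inj₂ p

∨-introˡ : ∀ {a} b → a ≡ true → a ∨ b ≡ true
∨-introˡ b refl = refl

∨-introʳ : ∀ a {b} → b ≡ true → a ∨ b ≡ true
∨-introʳ true p = refl
∨-introʳ false p = p

anyF-elim : ∀ n (p : Fin n → Bool) → anyF n p ≡ true → Σ[ i ∈ Fin n ] p i ≡ true
anyF-elim (suc n) p q = [ (λ h → zero , h) , (λ h → let i , e = anyF-elim n (p ∘ suc) h in suc i , e) ]′ (∨-elim (p zero) (anyF n (p ∘ suc)) q)

anyF-intro : ∀ n (p : Fin n → Bool) i → p i ≡ true → anyF n p ≡ true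
anyF-intro (suc n) p zero h = ∨-introˡ (anyF n (p ∘ suc)) h
anyF-intro (suc n) p (suc i) h = ∨-introʳ (p zero) (anyF-intro n (p ∘ suc) i h)

anyV : ∀ {n} j → (Vec (Fin n) j → Bool) → Bool
anyV zero p = p []
anyV {n} (suc j) p = anyF n (λ v → anyV j (λ y → p (v ∷ y)))

anyV-elim : ∀ {n} j (p : Vec (Fin n) j → Bool) → anyV j p ≡ true → Σ[ y ∈ Vec (Fin n) j ] p y ≡ true
anyV-elim zero p q = [] , q
anyV-elim {n} (suc j) p q = let v , h = anyF-elim n (λ v → anyV j (λ y → p (v ∷ y))) q ; y , e = anyV-elim j (λ y → p (v ∷ y)) h in v ∷ y , e

anyV-intro : ∀ {n} j (p : Vec (Fin n) j → Bool) y → p y ≡ true → anyV j p ≡ true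
anyV-intro zero p [] h = h
anyV-intro {n} (suc j) p (v ∷ y) h = anyF-intro n (λ v → anyV j (λ y → p (v ∷ y))) v (anyV-intro j (λ y → p (v ∷ y)) y h)

anyL : ∀ {A : Set} → (A → Bool) → List A → Bool
anyL p [] = false
anyL p (a ∷ l) = p a ∨ anyL p l

anyL-elim : ∀ {A : Set} (p : A → Bool) l → anyL p l ≡ true → Σ[ a ∈ A ] p a ≡ true
anyL-elim p (a ∷ l) q = [ (λ h → a , h) , anyL-elim p l ]′ (∨-elim (p a) (anyL p l) q)

anyL-intro : ∀ {A : Set} (p : A → Bool) l {a} → a ∈ l → p a ≡ true → anyL p l ≡ true
anyL-intro p (a ∷ l) (here refl) h = ∨-introˡ (anyL p l) h
anyL-intro p (a ∷ l) (there m) h = ∨-introʳ (p a) (anyL-intro p l m h)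

ix-id : ∀ {m} (t : Fin m) → ix idT t ≡ t
ix-id zero = refl
ix-id (suc t) = cong suc (ix-id t)

someT : ∀ {r k} → r ℕ.≤ k → r ⊑ k
someT z≤n = none
someT (s≤s p) = keep (someT p)

cover₁ : ∀ {r k} → 1 ℕ.≤ r → r ℕ.≤ k → ∀ t → Σ[ τ ∈ r ⊑ k ] Σ[ a ∈ Fin r ] ix τ a ≡ t
cover₁ {suc r} {suc k} p (s≤s q) zero = keep (someT q) , zero , refl
cover₁ {suc r} {suc k} p q (suc t) with suc r ℕ.≤? k
... | yes s = let τ , a , e = cover₁ p s t in skip τ , a , cong suc e
... | no s with ℕₚ.≤-antisym q (ℕₚ.≰⇒> s)
... | refl = idT , suc t , ix-id (suc t)

-- The place where `r` at least 2, that is k ≥ 4, enters: a graph on `r`-sets can compare any two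
-- vertices of a `k`-set.
cover₂ : ∀ {r k} → 2 ℕ.≤ r → r ℕ.≤ k → ∀ t t' → Σ[ τ ∈ r ⊑ k ] Σ[ a ∈ Fin r ] Σ[ a' ∈ Fin r ] (ix τ a ≡ t × ix τ a' ≡ t')
cover₂ {suc r} {suc k} (s≤s p) (s≤s q) zero zero = keep (someT q) , zero , zero , refl , refl
cover₂ {suc r} {suc k} (s≤s p) (s≤s q) zero (suc t') = let τ , a , e = cover₁ p q t' in keep τ , zero , suc a , refl , cong suc e
cover₂ {suc r} {suc k} (s≤s p) (s≤s q) (suc t) zero = let τ , a , e = cover₁ p q t in keep τ , suc a , zero , cong suc e , refl
cover₂ {suc r} {suc k} p q (suc t) (suc t') with suc r ℕ.≤? k
... | yes s = let τ , a , a' , e , e' = cover₂ p s t t' in skip τ , a , a' , cong suc e , cong suc e'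
... | no s with ℕₚ.≤-antisym q (ℕₚ.≰⇒> s)
... | refl = idT , suc t , suc t' , ix-id (suc t) , ix-id (suc t')

thin-range : ∀ {j k} (τ τ' : j ⊑ k) → (∀ i → Σ[ b ∈ Fin j ] ix τ' b ≡ ix τ i) → (∀ b → Σ[ i ∈ Fin j ] ix τ i ≡ ix τ' b) → τ ≡ τ'
thin-range done done p q = refl
thin-range (skip τ) (skip τ') p q = cong skip (thin-range τ τ' (λ i → let b , e = p i in b , Finₚ.suc-injective e) (λ b → let i , e = q b in i , Finₚ.suc-injective e))
thin-range (skip τ) (keep τ') p q = case proj₂ (q zero) of λ ()
thin-range (keep τ) (skip τ') p q = case proj₂ (p zero) of λ ()
thin-range (keep τ) (keep τ') p q = cong keep (thin-range τ τ' (λ i → down τ' (ix τ i) (p (suc i))) (λ b → down τ (ix τ' b) (q (suc b))))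
  where
  down : ∀ {j k} (τ : j ⊑ k) v → Σ[ b ∈ Fin (suc j) ] ix (keep τ) b ≡ suc v → Σ[ b ∈ Fin j ] ix τ b ≡ v
  down τ v (suc b , e) = b , Finₚ.suc-injective e

indistinct-slack : ∀ n k (a : Vec (Fin (suc n)) k → ℚ) → (∀ z → - 1ℚ ≤ a z) → ∫ (Disc.𝔼 n k) (λ z → ⟦ distinct z ⟧ * a z) - (ν k * ν k) * inv (ν (suc n)) ≤ ∫ (Disc.𝔼 n k) a
indistinct-slack n k a a≥-1 = ≤-trans (≤-by (l Yd ((ν k * ν k) * inv (ν (suc n))) Nd) (Δ {Nd} {(ν k * ν k) * inv (ν (suc n))} (indistinct≤ n k))) (≤-trans (≤-reflexive (sym (∫- (𝔼 k) (λ z → ⟦ distinct z ⟧ * a z) (λ z → ⟦ not (distinct z) ⟧)))) (∫≤ (𝔼 k) at))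
  where
  open Disc n
  Yd = ∫ (𝔼 k) (λ z → ⟦ distinct z ⟧ * a z)
  Nd = ∫ (𝔼 k) (λ z → ⟦ not (distinct z) ⟧)
  l : ∀ Y i N → (Y - N) - (Y - i) ≡ i - N
  l = solve-∀ ℛ
  at : ∀ z → ⟦ distinct z ⟧ * a z - ⟦ not (distinct z) ⟧ ≤ a z
  at z = go (distinct z)
    where
    t : ∀ x → x - (1ℚ * x - 0ℚ) ≡ 0ℚ
    t = solve-∀ ℛ
    f : ∀ x → x - (0ℚ * x - 1ℚ) ≡ x - (- 1ℚ)
    f = solve-∀ ℛ
    go : ∀ b → ⟦ b ⟧ * a z - ⟦ not b ⟧ ≤ a z
    go true = ≤-by (t (a z)) ≤-refl
    go false = ≤-by (f (a z)) (Δ { - 1ℚ} {a z} (a≥-1 z))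

module Rainbow (r n : ℕ) (2≤r : 2 ℕ.≤ r) (w : r ⊑ suc (suc r) → Vec (Fin (suc n)) r → Bool) where
  open Disc n

  k : ℕ
  k = suc (suc r)

  r≤k : r ℕ.≤ k
  r≤k = ℕₚ.m≤n⇒m≤1+n (ℕₚ.n≤1+n r)

  Lab : Set
  Lab = Tree (Fin k) (suc n)

  lb : Lab → V → Fin k
  lb ρ v = get ρ ⁅ v ⁆

  LB : ∀ {j} → Lab → (Fin j → Fin k) → Vec V j → Bool
  LB {j} ρ g y = allF j (λ i → eqFin (g i) (lb ρ (lookup y i)))

  evalK : Vec V k → Bool
  evalK z = allL (λ τ → w τ (select τ z)) (thins r k)

  LB-elim : ∀ {j} ρ (g : Fin j → Fin k) y → LB ρ g y ≡ true → ∀ i → g i ≡ lb ρ (lookup y i)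
  LB-elim {j} ρ g y p i = eqFin⇒≡ (g i) (lb ρ (lookup y i)) (allF-elim j _ p i)

  LB-intro : ∀ {j} ρ (g : Fin j → Fin k) y → (∀ i → g i ≡ lb ρ (lookup y i)) → LB ρ g y ≡ true
  LB-intro {j} ρ g y p = allF-intro j _ (λ i → subst (λ c → eqFin (g i) c ≡ true) (p i) (==-refl (finiteFin k) (g i)))

  LB-distinct : ∀ ρ z → LB ρ id z ≡ true → distinct z ≡ true
  LB-distinct ρ z p = injective-distinct z (λ i i' e → trans (LB-elim ρ id z p i) (trans (cong (lb ρ) e) (sym (LB-elim ρ id z p i'))))

  -- An edge must carry distinct labels and, listed in their order, pass the test of the positions
  -- that the labels name. In this way an unordered graph encodes tests that depend on positions.
  G : Lab → Subset (suc n) → Bool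
  G ρ U = anyV r (λ y → eqVec finiteBool (toSet y) U ∧ anyL (λ τ → LB ρ (ix τ) y ∧ w τ y) (thins r k))

  G-elim : ∀ ρ U → G ρ U ≡ true → Σ[ y ∈ Vec V r ] Σ[ τ ∈ r ⊑ k ] (toSet y ≡ U × LB ρ (ix τ) y ≡ true × w τ y ≡ true)
  G-elim ρ U p =
    let y , q = anyV-elim r (λ y → eqVec finiteBool (toSet y) U ∧ anyL (λ τ → LB ρ (ix τ) y ∧ w τ y) (thins r k)) p
        τ , s = anyL-elim (λ τ → LB ρ (ix τ) y ∧ w τ y) (thins r k) (∧ʳ (eqVec finiteBool (toSet y) U) _ q)
    in y , τ , ==⇒≡ (finiteS (suc n)) (∧ˡ (eqVec finiteBool (toSet y) U) _ q) , ∧ˡ (LB ρ (ix τ) y) (w τ y) s , ∧ʳ (LB ρ (ix τ) y) (w τ y) s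

  G-intro : ∀ ρ y τ → LB ρ (ix τ) y ≡ true → w τ y ≡ true → G ρ (toSet y) ≡ true
  G-intro ρ y τ p q = anyV-intro r _ y (∧-intro (==-refl (finiteS (suc n)) (toSet y)) (anyL-intro (λ τ → LB ρ (ix τ) y ∧ w τ y) (thins r k) (thins-complete τ) (∧-intro p q)))

  Z : Lab → Vec V k → Bool
  Z ρ z = LB ρ id z ∧ evalK z

  module At (ρ : Lab) where
    Y : Subset (suc n) → Bool
    Y = inK k r (G ρ)

    LB-select : ∀ z → LB ρ id z ≡ true → ∀ {j} (τ : j ⊑ k) → LB ρ (ix τ) (select τ z) ≡ true
    LB-select z p τ = LB-intro ρ (ix τ) (select τ z) (λ i → trans (LB-elim ρ id z p (ix τ i)) (cong (lb ρ) (sym (lookup-select τ z i))))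

    fwd : ∀ z → Z ρ z ≡ true → Y (toSet z) ≡ true
    fwd z p = inK-intro k r (G ρ) (toSet z) (card-toSet z dz) (λ U sub c → let τ , e = sub-select z U dz sub c in subst (λ U → G ρ U ≡ true) e (G-intro ρ (select τ z) τ (LB-select z lz τ) (allL-elim (λ τ → w τ (select τ z)) (thins r k) (∧ʳ (LB ρ id z) (evalK z) p) (thins-complete τ))))
      where
      lz : LB ρ id z ≡ true
      lz = ∧ˡ (LB ρ id z) (evalK z) p
      dz : distinct z ≡ true
      dz = LB-distinct ρ z lz

    inj : ∀ z z' → Z ρ z ≡ true → Z ρ z' ≡ true → toSet z ≡ toSet z' → z ≡ z'
    inj z z' p p' e = lookup-ext at
      where
      lz = LB-elim ρ id z (∧ˡ (LB ρ id z) (evalK z) p)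
      lz' = LB-elim ρ id z' (∧ˡ (LB ρ id z') (evalK z') p')
      at : ∀ i → lookup z i ≡ lookup z' i
      at i = let i' , q = ∈-toSet⁻ z' (lookup z i) (subst (lookup z i ∈ˢ_) e (∈-toSet⁺ z i)) in
        trans (sym q) (cong (lookup z') (trans (lz' i') (trans (cong (lb ρ) q) (sym (lz i)))))

    -- Any two vertices of `S` lie in a common edge of `G ρ`, so their labels differ; hence each of
    -- the `k` labels occurs once, and they list `S` in an order that passes all tests.
    bwd : ∀ S → Y S ≡ true → Σ[ z ∈ Vec V k ] (Z ρ z ≡ true × toSet z ≡ S)
    bwd S p = go (enumerate S (inK-card k r (G ρ) S p))
      where
      go : Σ[ e ∈ k ⊑ suc n ] toSet (positions e) ≡ S → Σ[ z ∈ Vec V k ] (Z ρ z ≡ true × toSet z ≡ S)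
      go (e , e≡) = z , ∧-intro lz (allL-intro (λ τ → w τ (select τ z)) (thins r k) (λ {τ} _ → test τ)) , z≡
        where
        s : Vec V k
        s = positions e
        ds : distinct s ≡ true
        ds = positions-distinct e
        ℓ : Fin k → Fin k
        ℓ t = lb ρ (lookup s t)
        member : ∀ {m} (x : Vec V m) → distinct x ≡ true → (∀ v → v ∈ˢ toSet x → v ∈ˢ S) → (τ : r ⊑ m) → Σ[ y ∈ Vec V r ] Σ[ τ' ∈ r ⊑ k ] (toSet y ≡ toSet (select τ x) × LB ρ (ix τ') y ≡ true × w τ' y ≡ true)
        member x dx sub τ = G-elim ρ (toSet (select τ x)) (inK-elim k r (G ρ) S p (toSet (select τ x)) (λ v q → sub v (toSet-select⊆ τ x v q)) (card-toSet (select τ x) (distinct-select τ x dx)))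
        ℓ-inj : ∀ t t' → ℓ t ≡ ℓ t' → t ≡ t'
        ℓ-inj t t' q = distinct-injective s ds t t' (go₂ (cover₂ 2≤r r≤k t t'))
          where
          go₂ : Σ[ τ ∈ r ⊑ k ] Σ[ a ∈ Fin r ] Σ[ a' ∈ Fin r ] (ix τ a ≡ t × ix τ a' ≡ t') → lookup s t ≡ lookup s t'
          go₂ (τ , a , a' , refl , refl) =
            let y , τ' , y≡ , ly , _ = member s ds (λ v → subst (v ∈ˢ_) e≡) τ
                b , eb = ∈-toSet⁻ y (lookup (select τ s) a) (subst (lookup (select τ s) a ∈ˢ_) (sym y≡) (∈-toSet⁺ (select τ s) a))
                b' , eb' = ∈-toSet⁻ y (lookup (select τ s) a') (subst (lookup (select τ s) a' ∈ˢ_) (sym y≡) (∈-toSet⁺ (select τ s) a'))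
                f = trans eb (lookup-select τ s a)
                f' = trans eb' (lookup-select τ s a')
                b≡ = ix-injective τ' b b' (trans (LB-elim ρ (ix τ') y ly b) (trans (cong (lb ρ) f) (trans q (trans (cong (lb ρ) (sym f')) (sym (LB-elim ρ (ix τ') y ly b'))))))
            in trans (sym f) (trans (cong (lookup y) b≡) f')
        π : Fin k → Fin k
        π i = proj₁ (injective⇒surjective ℓ ℓ-inj i)
        ℓπ : ∀ i → ℓ (π i) ≡ i
        ℓπ i = proj₂ (injective⇒surjective ℓ ℓ-inj i)
        z : Vec V k
        z = tabulate (λ i → lookup s (π i))
        z-at : ∀ i → lookup z i ≡ lookup s (π i)
        z-at = lookup∘tabulate (λ i → lookup s (π i))
        lz : LB ρ id z ≡ true
        lz = LB-intro ρ id z (λ i → trans (sym (ℓπ i)) (cong (lb ρ) (sym (z-at i))))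
        z≡ : toSet z ≡ S
        z≡ = trans (toSet-≡ z s (λ i → π i , sym (z-at i)) (λ t → ℓ t , trans (z-at (ℓ t)) (cong (lookup s) (ℓ-inj (π (ℓ t)) t (ℓπ (ℓ t)))))) e≡
        test : ∀ τ → w τ (select τ z) ≡ true
        test τ = go₃ (member z (LB-distinct ρ z lz) (λ v → subst (v ∈ˢ_) z≡) τ)
          where
          lτ = LB-elim ρ (ix τ) (select τ z) (LB-select z lz τ)
          go₃ : Σ[ y ∈ Vec V r ] Σ[ τ' ∈ r ⊑ k ] (toSet y ≡ toSet (select τ z) × LB ρ (ix τ') y ≡ true × w τ' y ≡ true) → w τ (select τ z) ≡ true
          go₃ (y , τ' , y≡ , ly , wy) = subst₂ (λ τ x → w τ x ≡ true) (sym τ≡) (sym (lookup-ext (λ i → trans (sym (proj₂ (at i))) (cong (lookup y) (ix-injective τ' (proj₁ (at i)) i (trans (lab (proj₁ (at i)) i (proj₂ (at i))) (cong (λ τ → ix τ i) τ≡))))))) wy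
            where
            lab : ∀ b i → lookup y b ≡ lookup (select τ z) i → ix τ' b ≡ ix τ i
            lab b i q = trans (LB-elim ρ (ix τ') y ly b) (trans (cong (lb ρ) q) (sym (lτ i)))
            at : ∀ i → Σ[ b ∈ Fin r ] lookup y b ≡ lookup (select τ z) i
            at i = ∈-toSet⁻ y (lookup (select τ z) i) (subst (lookup (select τ z) i ∈ˢ_) (sym y≡) (∈-toSet⁺ (select τ z) i))
            at' : ∀ b → Σ[ i ∈ Fin r ] lookup (select τ z) i ≡ lookup y b
            at' b = ∈-toSet⁻ (select τ z) (lookup y b) (subst (lookup y b ∈ˢ_) y≡ (∈-toSet⁺ y b))
            τ≡ : τ ≡ τ'
            τ≡ = thin-range τ τ' (λ i → proj₁ (at i) , lab (proj₁ (at i)) i (proj₂ (at i))) (λ b → proj₁ (at' b) , sym (lab b (proj₁ (at' b)) (sym (proj₂ (at' b)))))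

    rainbow-sum : ∀ (φ : Subset (suc n) → ℚ) → ∫ (linVec (sumFin (suc n)) k) (λ z → ⟦ Z ρ z ⟧ * φ (toSet z)) ≡ ∫ (∑S (suc n)) (λ S → ⟦ Y S ⟧ * φ S)
    rainbow-sum φ = sum-by (finiteTuple (suc n) k) (finiteS (suc n)) (∑S-swap (suc n)) (Z ρ) toSet Y φ fwd bwd inj

  -- The probability that random labels agree with the positions of a given tuple of distinct
  -- vertices.
  κ : ℚ
  κ = prodF k (λ _ → inv (ν k))

  open Random (suc n) (λ _ → avg (suc r)) (λ _ → avg-mean (suc r)) (λ _ → avg-swap (suc r))

  rainbow-prob : ∀ z → ∫ ℙ (λ ρ → ⟦ LB ρ id z ⟧) ≡ κ * ⟦ distinct z ⟧
  rainbow-prob z = go (distinct z) refl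
    where
    go : ∀ b → distinct z ≡ b → ∫ ℙ (λ ρ → ⟦ LB ρ id z ⟧) ≡ κ * ⟦ b ⟧
    go true q = trans (∫≡ ℙ (λ ρ → ⟦allF⟧ k (λ i → eqFin i (lb ρ (lookup z i))))) (trans (independent z q (λ i b → ⟦ eqFin i b ⟧)) (trans (prodF-cong k (avg-eq (suc r))) (sym (*-identityʳ κ))))
    go false q = trans (∫≡ ℙ (λ ρ → cong ⟦_⟧ (bool-ext {LB ρ id z} {false} (λ p → trans (sym q) (LB-distinct ρ z p)) (λ ())))) (trans (∫0 ℙ) (sym (*-zeroʳ κ)))

  module Bound (H : KGraph k (suc n)) (dns μ : ℚ) (d≤1 : dns ≤ 1ℚ) (dense : Dense r dns μ H) where
    N : ℚ
    N = ν (suc n) ^ℚ k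

    N>0 : 0ℚ < N
    N>0 = ^ℚ-pos k (ν-pos n)

    c : Vec V k → ℚ
    c z = ⟦ edge H (toSet z) ⟧ - dns

    c≥-1 : ∀ z → - 1ℚ ≤ c z
    c≥-1 z = ≤-by (l ⟦ edge H (toSet z) ⟧ dns) (⟦⟧≥0 (edge H (toSet z)) ⊕ Δ {dns} {1ℚ} d≤1)
      where l : ∀ h d → (h - d) - (- 1ℚ) ≡ h + (1ℚ - d)
            l = solve-∀ ℛ

    each : ∀ ρ → - μ ≤ ∫ (𝔼 k) (λ z → ⟦ Z ρ z ⟧ * c z)
    each ρ = *-cancel-pos N N>0 (≤-trans (≤-reflexive (l N μ)) (≤-trans (dense⇒surplus r dns μ H (G ρ) (dense (G ρ))) (≤-reflexive (trans (sym (At.rainbow-sum ρ (λ S → ⟦ edge H S ⟧ - dns))) (sum-avg n k (λ z → ⟦ Z ρ z ⟧ * c z))))))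
      where l : ∀ N m → N * (- m) ≡ - (m * N)
            l = solve-∀ ℛ

    a : Vec V k → ℚ
    a z = ⟦ evalK z ⟧ * c z

    averaged : - μ ≤ κ * ∫ (𝔼 k) (λ z → ⟦ distinct z ⟧ * a z)
    averaged = ≤-trans (≤-reflexive (sym (mean-const ℙ ℙ-mean (- μ)))) (≤-trans (∫≤ ℙ each) (≤-reflexive (trans (linVec-swap (avg n) (avg-swap n) k ℙ (λ ρ z → ⟦ Z ρ z ⟧ * c z)) (trans (∫≡ (𝔼 k) at) (∫* (𝔼 k) κ (λ z → ⟦ distinct z ⟧ * a z))))))
      where
      at : ∀ z → ∫ ℙ (λ ρ → ⟦ Z ρ z ⟧ * c z) ≡ κ * (⟦ distinct z ⟧ * a z)
      at z = trans (∫≡ ℙ (λ ρ → trans (cong (_* c z) (⟦∧⟧ (LB ρ id z) (evalK z))) (*-assoc ⟦ LB ρ id z ⟧ ⟦ evalK z ⟧ (c z)))) (trans (∫*ʳ ℙ (a z) (λ ρ → ⟦ LB ρ id z ⟧)) (trans (cong (_* a z) (rainbow-prob z)) (*-assoc κ ⟦ distinct z ⟧ (a z))))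

    κ>0 : 0ℚ < κ
    κ>0 = pos k
      where
      pos : ∀ m → 0ℚ < prodF m (λ _ → inv (ν k))
      pos zero = 0<1
      pos (suc m) = *-pos (inv-pos (ν k) (ν-pos (suc r))) (pos m)

    -- Density against each `G ρ`, averaged over `ρ`, sees a tuple with probability `κ`; hence the
    -- division by `κ`. The second term pays for tuples with repeated vertices.
    bound : - (μ * inv κ + (ν k * ν k) * inv (ν (suc n))) ≤ ∫ (𝔼 k) a
    bound = ≤-trans (≤-by (l (μ * inv κ) Yd ((ν k * ν k) * inv (ν (suc n)))) (Δ { - (μ * inv κ)} {Yd} first)) (indistinct-slack n k a a≥-1)
      where
      Yd = ∫ (𝔼 k) (λ z → ⟦ distinct z ⟧ * a z)
      l : ∀ m Y i → (Y - i) - (- (m + i)) ≡ Y - (- m)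
      l = solve-∀ ℛ
      first : - (μ * inv κ) ≤ Yd
      first = *-cancel-pos κ κ>0 (≤-trans (≤-reflexive (trans (r₁ κ (μ * inv κ)) (cong -_ (cancel-inv κ μ κ>0)))) averaged)
        where r₁ : ∀ κ x → κ * (- x) ≡ - (κ * x)
              r₁ = solve-∀ ℛ
      a≥-1 : ∀ z → - 1ℚ ≤ a z
      a≥-1 z = go (evalK z)
        where
        go : ∀ b → - 1ℚ ≤ ⟦ b ⟧ * c z
        go true = ≤-trans (c≥-1 z) (≤-reflexive (sym (*-identityˡ (c z))))
        go false = ≤-trans (neg-antimono-≤ 0≤1) (≤-reflexive (sym (*-zeroˡ (c z))))

module _ {n M k : ℕ} (u : Vec (Fin (suc n)) M → Bool) (g : Vec (Fin (suc n)) M → Bool) (dns : ℚ) where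
  open Disc n

  signed : ℚ
  signed = ∫ (𝔼 M) (λ x → ⟦ u x ⟧ * (⟦ g x ⟧ - dns))

  signed-≡ : signed ≡ ∫ (𝔼 M) (λ x → ⟦ u x ∧ g x ⟧) - dns * ∫ (𝔼 M) (λ x → ⟦ u x ⟧)
  signed-≡ = trans (∫≡ (𝔼 M) (λ x → trans (l ⟦ u x ⟧ ⟦ g x ⟧ dns) (cong (_- dns * ⟦ u x ⟧) (sym (⟦∧⟧ (u x) (g x)))))) (trans (∫- (𝔼 M) (λ x → ⟦ u x ∧ g x ⟧) (λ x → dns * ⟦ u x ⟧)) (cong (λ z → ∫ (𝔼 M) (λ x → ⟦ u x ∧ g x ⟧) - z) (∫* (𝔼 M) dns (λ x → ⟦ u x ⟧))))
    where l : ∀ a b d → a * (b - d) ≡ a * b - d * a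
          l = solve-∀ ℛ

  signed⇒dense : ∀ ε ρ γ → 0ℚ ≤ ρ → - ε ≤ signed → ε ≤ ρ * γ → γ ≤ ∫ (𝔼 M) (λ x → ⟦ u x ⟧) → (dns - ρ) * ∫ (𝔼 M) (λ x → ⟦ u x ⟧) ≤ ∫ (𝔼 M) (λ x → ⟦ u x ∧ g x ⟧)
  signed⇒dense ε ρ γ ρ≥0 p q s = ≤-by (l X P dns ρ ε γ) ((Δ { - ε} {X - dns * P} (subst (- ε ≤_) signed-≡ p) ⊕ Δ {ε} {ρ * γ} q) ⊕ (ρ≥0 ⊗ Δ {γ} {P} s))
    where
    X = ∫ (𝔼 M) (λ x → ⟦ u x ∧ g x ⟧)
    P = ∫ (𝔼 M) (λ x → ⟦ u x ⟧)
    l : ∀ X P d ρ ε γ → X - (d - ρ) * P ≡ (((X - d * P) - (- ε)) + (ρ * γ - ε)) + ρ * (P - γ)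
    l = solve-∀ ℛ

module _ (r n M : ℕ) (2≤r : 2 ℕ.≤ r) {C : Set} (PC : Finite C) (col : Vec (Fin (suc n)) r → C) (x* : Vec (Fin (suc n)) M) (e : suc (suc r) ⊑ M) where
  open Disc n

  private
    k : ℕ
    k = suc (suc r)
    cv : (T : r ⊑ M) → Σ[ τ ∈ r ⊑ k ] Cov e T τ
    cv T = cov-small e T ℕₚ.≤-refl (ℕₚ.m≤n⇒m≤1+n (ℕₚ.n≤1+n r))
    check : r ⊑ M → Vec V M → Bool
    check T x = _==_ PC (col (select T x)) (col (select T x*))
    w : Vec V M → r ⊑ k → Vec V r → Bool
    w x τ y = allL (λ T → if eqT (proj₁ (cv T)) τ then check T (put e (put τ y (Vec.replicate k zero)) x) else true) (thins r M)
    at : ∀ x z T → check T (put e (put (proj₁ (cv T)) (select (proj₁ (cv T)) z) (Vec.replicate k zero)) x) ≡ check T (put e z x)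
    at x z T = cong (λ s → _==_ PC (col s) (col (select T x*))) (cov-dep (proj₂ (cv T)) x (select-put (proj₁ (cv T)) (select (proj₁ (cv T)) z) (Vec.replicate k zero)))
    cell-test : ∀ x z → sameCell PC col x* (put e z x) ≡ Rainbow.evalK r n 2≤r (w x) z
    cell-test x z = bool-ext
      (λ h → allL-intro _ (thins r k) (λ {τ} _ → allL-intro _ (thins r M) (λ {T} _ → go T τ (eqT (proj₁ (cv T)) τ) refl (allL-elim (λ T → check T (put e z x)) (thins r M) h (thins-complete T)))))
      (λ h → allL-intro (λ T → check T (put e z x)) (thins r M) (λ {T} _ → back T (allL-elim _ (thins r M) (allL-elim (λ τ → w x τ (select τ z)) (thins r k) h (thins-complete (proj₁ (cv T)))) (thins-complete T))))
      where
      go : ∀ T τ b → eqT (proj₁ (cv T)) τ ≡ b → check T (put e z x) ≡ true → (if b then check T (put e (put τ (select τ z) (Vec.replicate k zero)) x) else true) ≡ true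
      go T τ false q h = refl
      go T τ true q h = subst (λ τ → check T (put e (put τ (select τ z) (Vec.replicate k zero)) x) ≡ true) (eqT⇒≡ (proj₁ (cv T)) τ q) (trans (at x z T) h)
      back : ∀ T → (if eqT (proj₁ (cv T)) (proj₁ (cv T)) then check T (put e (put (proj₁ (cv T)) (select (proj₁ (cv T)) z) (Vec.replicate k zero)) x) else true) ≡ true → check T (put e z x) ≡ true
      back T h = trans (sym (at x z T)) (subst (λ b → (if b then check T (put e (put (proj₁ (cv T)) (select (proj₁ (cv T)) z) (Vec.replicate k zero)) x) else true) ≡ true) (eqT-refl (proj₁ (cv T))) h)

  -- With the coordinates outside `e` frozen, the cell is a conjunction of tests on `r`-subtuples of
  -- the remaining ones, which is the form that `Rainbow` handles.
  cell-dense₄ : (H : KGraph k (suc n)) (dns μ ρ γ : ℚ) → dns ≤ 1ℚ → 0ℚ ≤ ρ → Dense r dns μ H → μ * inv (prodF k (λ _ → inv (ν k))) + (ν k * ν k) * inv (ν (suc n)) ≤ ρ * γ → γ ≤ ∫ (𝔼 M) (λ x → ⟦ sameCell PC col x* x ⟧) →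
    (dns - ρ) * ∫ (𝔼 M) (λ x → ⟦ sameCell PC col x* x ⟧) ≤ ∫ (𝔼 M) (λ x → ⟦ sameCell PC col x* x ∧ edge H (toSet (select e x)) ⟧)
  cell-dense₄ H dns μ ρ γ d≤1 ρ≥0 dense small big = signed⇒dense {k = k} (sameCell PC col x*) (λ x → edge H (toSet (select e x))) dns ε ρ γ ρ≥0 low small big
    where
    ε = μ * inv (prodF k (λ _ → inv (ν k))) + (ν k * ν k) * inv (ν (suc n))
    low : - ε ≤ ∫ (𝔼 M) (λ x → ⟦ sameCell PC col x* x ⟧ * (⟦ edge H (toSet (select e x)) ⟧ - dns))
    low = ≤-trans (≤-reflexive (sym (mean-const (𝔼 M) (𝔼-mean M) (- ε)))) (≤-trans (∫≤ (𝔼 M) (λ x → Rainbow.Bound.bound r n 2≤r (w x) H dns μ d≤1 dense)) (≤-reflexive (sym (trans (resample (avg n) (avg-mean n) (avg-swap n) e (λ x → ⟦ sameCell PC col x* x ⟧ * (⟦ edge H (toSet (select e x)) ⟧ - dns))) (∫≡ (𝔼 M) (λ x → ∫≡ (𝔼 k) (λ z → cong₂ (λ b y → ⟦ b ⟧ * (⟦ edge H (toSet y) ⟧ - dns)) (cell-test x z) (select-put e z x))))))))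

-- Sets counted through their orderings.

fact : ℕ → ℚ
fact zero = 1ℚ
fact (suc j) = ν (suc j) * fact j

fact-pos : ∀ j → 0ℚ < fact j
fact-pos zero = 0<1
fact-pos (suc j) = *-pos (ν-pos j) (fact-pos j)

sum-members : ∀ {n} (S : Subset n) → ∫ (sumFin n) (λ v → ⟦ lookup S v ⟧) ≡ ν ∣ S ∣
sum-members [] = refl
sum-members (true ∷ S) = cong (1ℚ +_) (sum-members S)
sum-members (false ∷ S) = trans (+-identityˡ _) (sum-members S)

card-remove : ∀ {n} (S : Subset n) v → lookup S v ≡ true → ∣ S ∣ ≡ suc ∣ S Vec.[ v ]≔ false ∣
card-remove (true ∷ S) zero p = refl
card-remove (true ∷ S) (suc v) p = cong suc (card-remove S v p)
card-remove (false ∷ S) (suc v) p = card-remove S v p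

-- Induction on the first entry `v`: it must belong to `S`, and the rest is an ordering of `S`
-- without `v`.
orderings : ∀ {n} j (S : Subset n) → ∫ (linVec (sumFin n) j) (λ z → ⟦ distinct z ∧ eqVec finiteBool (toSet z) S ⟧) ≡ fact j * ⟦ ∣ S ∣ ℕ.≡ᵇ j ⟧
orderings {n} zero S = trans (cong ⟦_⟧ (bool-ext
  (λ h → T⇒≡ (ℕₚ.≡⇒≡ᵇ ∣ S ∣ 0 (trans (cong ∣_∣ (sym (==⇒≡ (finiteS n) {toSet {n} []} {S} h))) (card-∅ n))))
  (λ h → subst (λ U → eqVec finiteBool (toSet {n} []) U ≡ true) (proj₂ (enumerate {j = 0} S (ℕₚ.≡ᵇ⇒≡ ∣ S ∣ 0 (≡⇒T h)))) (==-refl (finiteS n) (toSet {n} []))))) (sym (*-identityˡ _))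
orderings {n} (suc j) S = trans (∫≡ (sumFin n) (λ v → trans (∫≡ (linVec (sumFin n) j) (λ z → trans (cong ⟦_⟧ (split v z)) (⟦∧⟧ (lookup S v) (distinct z ∧ eqVec finiteBool (toSet z) (S Vec.[ v ]≔ false))))) (trans (∫* (linVec (sumFin n) j) ⟦ lookup S v ⟧ (λ z → ⟦ distinct z ∧ eqVec finiteBool (toSet z) (S Vec.[ v ]≔ false) ⟧)) (trans (cong (⟦ lookup S v ⟧ *_) (orderings j (S Vec.[ v ]≔ false))) (size v (lookup S v) refl)))))
    (trans (∫*ʳ (sumFin n) (fact j * B) (λ v → ⟦ lookup S v ⟧)) (trans (cong (_* (fact j * B)) (sum-members S)) (whole (∣ S ∣ ℕ.≡ᵇ suc j) refl)))
  where
  B : ℚ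
  B = ⟦ ∣ S ∣ ℕ.≡ᵇ suc j ⟧
  size : ∀ v b → lookup S v ≡ b → ⟦ b ⟧ * (fact j * ⟦ ∣ S Vec.[ v ]≔ false ∣ ℕ.≡ᵇ j ⟧) ≡ ⟦ b ⟧ * (fact j * B)
  size v false q = trans (*-zeroˡ (fact j * ⟦ ∣ S Vec.[ v ]≔ false ∣ ℕ.≡ᵇ j ⟧)) (sym (*-zeroˡ (fact j * B)))
  size v true q = cong (λ c → 1ℚ * (fact j * ⟦ c ℕ.≡ᵇ suc j ⟧)) (sym (card-remove S v q))
  l : ∀ a b → a * (b * 1ℚ) ≡ (a * b) * 1ℚ
  l = solve-∀ ℛ
  l₀ : ∀ a b c → a * (b * 0ℚ) ≡ c * 0ℚ
  l₀ = solve-∀ ℛ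
  whole : ∀ b → (∣ S ∣ ℕ.≡ᵇ suc j) ≡ b → ν ∣ S ∣ * (fact j * ⟦ b ⟧) ≡ (ν (suc j) * fact j) * ⟦ b ⟧
  whole true q = trans (cong (λ c → ν c * (fact j * 1ℚ)) (ℕₚ.≡ᵇ⇒≡ ∣ S ∣ (suc j) (≡⇒T q))) (l (ν (suc j)) (fact j))
  whole false q = l₀ (ν ∣ S ∣) (fact j) (ν (suc j) * fact j)
  split : ∀ v z → (notIn v z ∧ distinct z) ∧ eqVec finiteBool (toSet z Vec.[ v ]≔ true) S ≡ lookup S v ∧ (distinct z ∧ eqVec finiteBool (toSet z) (S Vec.[ v ]≔ false))
  split v z = bool-ext
    (λ h → fw (∧ˡ (notIn v z) (distinct z) (∧ˡ (notIn v z ∧ distinct z) _ h)) (∧ʳ (notIn v z) (distinct z) (∧ˡ (notIn v z ∧ distinct z) _ h)) (==⇒≡ (finiteS n) (∧ʳ (notIn v z ∧ distinct z) _ h)))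
    (λ h → bw (∧ˡ (lookup S v) _ h) (∧ˡ (distinct z) _ (∧ʳ (lookup S v) _ h)) (==⇒≡ (finiteS n) (∧ʳ (distinct z) _ (∧ʳ (lookup S v) _ h))))
    where
    fw : notIn v z ≡ true → distinct z ≡ true → toSet z Vec.[ v ]≔ true ≡ S → lookup S v ∧ (distinct z ∧ eqVec finiteBool (toSet z) (S Vec.[ v ]≔ false)) ≡ true
    fw p q e = ∧-intro (trans (cong (λ U → lookup U v) (sym e)) (Vecₚ.lookup∘update v (toSet z) true)) (∧-intro q (subst (λ U → eqVec finiteBool (toSet z) U ≡ true) (sym (trans (cong (Vec._[ v ]≔ false) (sym e)) (trans (Vecₚ.[]≔-idempotent (toSet z) v) (trans (cong (toSet z Vec.[ v ]≔_) (sym (notIn-toSet z p))) (Vecₚ.[]≔-lookup (toSet z) v))))) (==-refl (finiteS n) (toSet z))))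
    bw : lookup S v ≡ true → distinct z ≡ true → toSet z ≡ S Vec.[ v ]≔ false → (notIn v z ∧ distinct z) ∧ eqVec finiteBool (toSet z Vec.[ v ]≔ true) S ≡ true
    bw p q e = ∧-intro (∧-intro (notIn-intro z (λ i r → case trans (sym (subst (λ w → w ∈ˢ toSet z) r (∈-toSet⁺ z i))) (trans (cong (λ U → lookup U v) e) (Vecₚ.lookup∘update v S false)) of λ ())) q)
      (subst (λ U → eqVec finiteBool U S ≡ true) (sym (trans (cong (Vec._[ v ]≔ true) e) (trans (Vecₚ.[]≔-idempotent S v) (trans (cong (S Vec.[ v ]≔_) (sym p)) (Vecₚ.[]≔-lookup S v))))) (==-refl (finiteS n) S))

sum-tuples : ∀ {n} j (ψ : Subset n → ℚ) → ∫ (linVec (sumFin n) j) (λ z → ⟦ distinct z ⟧ * ψ (toSet z)) ≡ fact j * ∫ (∑S n) (λ S → ⟦ ∣ S ∣ ℕ.≡ᵇ j ⟧ * ψ S)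
sum-tuples {n} j ψ = trans (∫≡ LL (λ z → sym (∑-δ (finiteS n) (λ S → ⟦ distinct z ⟧ * ψ S) (toSet z)))) (trans (∑S-swap n LL (λ z S → ⟦ eqVec finiteBool S (toSet z) ⟧ * (⟦ distinct z ⟧ * ψ S)))
    (trans (∫≡ (∑S n) (λ S → trans (∫≡ LL (λ z → trans (l ⟦ eqVec finiteBool S (toSet z) ⟧ ⟦ distinct z ⟧ (ψ S)) (cong (_* ψ S) (trans (cong (λ b → ⟦ distinct z ⟧ * ⟦ b ⟧) (==-sym (finiteS n) S (toSet z))) (sym (⟦∧⟧ (distinct z) (eqVec finiteBool (toSet z) S))))))) (trans (∫*ʳ LL (ψ S) (λ z → ⟦ distinct z ∧ eqVec finiteBool (toSet z) S ⟧)) (trans (cong (_* ψ S) (orderings j S)) (*-assoc (fact j) ⟦ ∣ S ∣ ℕ.≡ᵇ j ⟧ (ψ S)))))) (∫* (∑S n) (fact j) (λ S → ⟦ ∣ S ∣ ℕ.≡ᵇ j ⟧ * ψ S))))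
  where
  LL = linVec (sumFin n) j
  l : ∀ a b c → a * (b * c) ≡ (b * a) * c
  l = solve-∀ ℛ

surplus-tuples : ∀ {k n} (j : ℕ) (dns : ℚ) (H : KGraph k (suc n)) (G : Subset (suc n) → Bool) → fact k * ∫ (∑S (suc n)) (λ S → ⟦ inK k j G S ⟧ * (⟦ edge H S ⟧ - dns)) ≡ ν (suc n) ^ℚ k * ∫ (Disc.𝔼 n k) (λ z → ⟦ distinct z ⟧ * (⟦ inK k j G (toSet z) ⟧ * (⟦ edge H (toSet z) ⟧ - dns)))
surplus-tuples {k} {n} j dns H G = trans (cong (fact k *_) (∫≡ (∑S (suc n)) (λ S → sized S (inK k j G S) refl))) (trans (sym (sum-tuples k (λ S → ⟦ inK k j G S ⟧ * (⟦ edge H S ⟧ - dns)))) (sum-avg n k (λ z → ⟦ distinct z ⟧ * (⟦ inK k j G (toSet z) ⟧ * (⟦ edge H (toSet z) ⟧ - dns)))))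
  where
  sized : ∀ S b → inK k j G S ≡ b → ⟦ b ⟧ * (⟦ edge H S ⟧ - dns) ≡ ⟦ ∣ S ∣ ℕ.≡ᵇ k ⟧ * (⟦ b ⟧ * (⟦ edge H S ⟧ - dns))
  sized S true q = sym (trans (cong (λ b → ⟦ b ⟧ * (1ℚ * (⟦ edge H S ⟧ - dns))) (T⇒≡ (ℕₚ.≡⇒≡ᵇ ∣ S ∣ k (inK-card k j G S q)))) (*-identityˡ _))
  sized S false q = l ⟦ ∣ S ∣ ℕ.≡ᵇ k ⟧ (⟦ edge H S ⟧ - dns)
    where l : ∀ a b → 0ℚ * b ≡ a * (0ℚ * b)
          l = solve-∀ ℛ

-- Density inside a cell when k = 3: weighted vertex sets

bern : ∀ t → 0ℚ ≤ t → t ≤ 1ℚ → Lin Bool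
∫ (bern t p q) f = t * f true + (1ℚ - t) * f false
∫+ (bern t p q) f g = l t (f true) (f false) (g true) (g false)
  where l : ∀ t a b c d → t * (a + c) + (1ℚ - t) * (b + d) ≡ (t * a + (1ℚ - t) * b) + (t * c + (1ℚ - t) * d)
        l = solve-∀ ℛ
∫* (bern t p q) c f = l t c (f true) (f false)
  where l : ∀ t c a b → t * (c * a) + (1ℚ - t) * (c * b) ≡ c * (t * a + (1ℚ - t) * b)
        l = solve-∀ ℛ
∫≤ (bern t p q) h = +-mono-≤ (*-monoʳ t p (h true)) (*-monoʳ (1ℚ - t) (Δ {t} {1ℚ} q) (h false))

bern-mean : ∀ t p q → Mean (bern t p q)
bern-mean t p q = l t
  where l : ∀ t → t * 1ℚ + (1ℚ - t) * 1ℚ ≡ 1ℚ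
        l = solve-∀ ℛ

bern-swap : ∀ t p q → Swap (bern t p q)
bern-swap t p q L f = trans (∫+ L (λ a → t * f a true) (λ a → (1ℚ - t) * f a false)) (cong₂ _+_ (∫* L t (λ a → f a true)) (∫* L (1ℚ - t) (λ a → f a false)))

first : ∀ {n} → Subset (suc n) → Fin (suc n)
first {zero} S = zero
first {suc n} (true ∷ S) = zero
first {suc n} (false ∷ S) = suc (first S)

first-single : ∀ {n} (v : Fin (suc n)) → first ⁅ v ⁆ ≡ v
first-single {zero} zero = refl
first-single {suc n} zero = refl
first-single {suc n} (suc v) = cong suc (first-single v)

toSet-single : ∀ {n} (v : Fin n) → toSet (v ∷ []) ≡ ⁅ v ⁆
toSet-single v = set-ext (λ w p → [ (λ { refl → ∈-single⁺ v }) , (λ q → case trans (sym (Vecₚ.lookup-replicate w false)) q of λ ()) ]′ (∈-update⁻ (Vec.replicate _ false) v w p)) (λ w p → subst (_∈ˢ toSet (v ∷ [])) (sym (∈-single⁻ w v p)) (∈-toSet⁺ (v ∷ []) zero))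

head-select : ∀ {A : Set} {m} (e : 1 ⊑ m) (x : Vec A m) → select e x ≡ lookup x (ix e zero) ∷ []
head-select e x = lookup-ext {x = select e x} (λ { zero → lookup-select e x zero })

pointT : ∀ {m} (c : Fin m) → Σ[ e ∈ 1 ⊑ m ] ix e zero ≡ c
pointT {m} c = go (cover₁ {1} {m} (s≤s z≤n) (ℕₚ.≤-trans (s≤s z≤n) (Finₚ.toℕ<n c)) c)
  where
  go : Σ[ e ∈ 1 ⊑ m ] Σ[ a ∈ Fin 1 ] ix e a ≡ c → Σ[ e ∈ 1 ⊑ m ] ix e zero ≡ c
  go (e , zero , p) = e , p

inK-vertices : ∀ {n} k (G : Subset n → Bool) (z : Vec (Fin n) k) → distinct z ≡ true → inK k 1 G (toSet z) ≡ allF k (λ i → G ⁅ lookup z i ⁆)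
inK-vertices k G z dz = bool-ext
  (λ h → allF-intro k (λ i → G ⁅ lookup z i ⁆) (λ i → subst (λ U → G U ≡ true) (toSet-single (lookup z i)) (inK-elim k 1 G (toSet z) h (toSet (lookup z i ∷ [])) (λ v p → [ (λ { refl → ∈-toSet⁺ z i }) , (λ q → case trans (sym (Vecₚ.lookup-replicate v false)) q of λ ()) ]′ (∈-update⁻ (Vec.replicate _ false) (lookup z i) v p)) (card-toSet (lookup z i ∷ []) refl))))
  (λ h → inK-intro k 1 G (toSet z) (card-toSet z dz) (λ U sub c → let τ , e = sub-select {j = 1} z U dz sub c in subst (λ U → G U ≡ true) (trans (sym (toSet-single (lookup z (ix τ zero)))) (trans (cong toSet (sym (head-select τ z))) e)) (allF-elim k (λ i → G ⁅ lookup z i ⁆) h (ix τ zero))))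

module Weighted (k n : ℕ) (H : KGraph k (suc n)) (dns μ : ℚ) (dense : Dense 1 dns μ H) (t : Fin (suc n) → ℚ) (t≥0 : ∀ v → 0ℚ ≤ t v) (t≤1 : ∀ v → t v ≤ 1ℚ) where
  open Disc n

  LL : Subset (suc n) → Lin Bool
  LL S = bern (t (first S)) (t≥0 (first S)) (t≤1 (first S))

  open Random (suc n) LL (λ S → bern-mean (t (first S)) (t≥0 (first S)) (t≤1 (first S))) (λ S → bern-swap (t (first S)) (t≥0 (first S)) (t≤1 (first S)))

  c : Vec V k → ℚ
  c z = ⟦ edge H (toSet z) ⟧ - dns

  N : ℚ
  N = ν (suc n) ^ℚ k

  each : ∀ G → - (fact k * μ) ≤ ∫ (𝔼 k) (λ z → ⟦ distinct z ⟧ * (⟦ inK k 1 (get G) (toSet z) ⟧ * c z))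
  each G = *-cancel-pos N (^ℚ-pos k (ν-pos n)) (≤-trans (≤-reflexive (l N (fact k) μ)) (≤-trans (*-monoʳ (fact k) (<⇒≤ (fact-pos k)) (dense⇒surplus 1 dns μ H (get G) (dense (get G)))) (≤-reflexive (surplus-tuples 1 dns H (get G)))))
    where l : ∀ N f m → N * (- (f * m)) ≡ f * (- (m * N))
          l = solve-∀ ℛ

  prob : ∀ z → ∫ ℙ (λ G → ⟦ distinct z ⟧ * (⟦ inK k 1 (get G) (toSet z) ⟧ * c z)) ≡ ⟦ distinct z ⟧ * (prodF k (λ i → t (lookup z i)) * c z)
  prob z = go (distinct z) refl
    where
    go : ∀ b → distinct z ≡ b → ∫ ℙ (λ G → ⟦ b ⟧ * (⟦ inK k 1 (get G) (toSet z) ⟧ * c z)) ≡ ⟦ b ⟧ * (prodF k (λ i → t (lookup z i)) * c z)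
    go false q = trans (∫* ℙ 0ℚ (λ G → ⟦ inK k 1 (get G) (toSet z) ⟧ * c z)) (trans (*-zeroˡ (∫ ℙ (λ G → ⟦ inK k 1 (get G) (toSet z) ⟧ * c z))) (sym (*-zeroˡ (prodF k (λ i → t (lookup z i)) * c z))))
    go true q = trans (∫* ℙ 1ℚ (λ G → ⟦ inK k 1 (get G) (toSet z) ⟧ * c z)) (cong (1ℚ *_) (trans (∫*ʳ ℙ (c z) (λ G → ⟦ inK k 1 (get G) (toSet z) ⟧)) (cong (_* c z) (trans (∫≡ ℙ (λ G → trans (cong ⟦_⟧ (inK-vertices k (get G) z q)) (⟦allF⟧ k (λ i → get G ⁅ lookup z i ⁆)))) (trans (independent z q (λ _ b → ⟦ b ⟧)) (prodF-cong k (λ i → trans (l (t (first ⁅ lookup z i ⁆))) (cong t (first-single (lookup z i))))))))))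
      where l : ∀ t → t * 1ℚ + (1ℚ - t) * 0ℚ ≡ t
            l = solve-∀ ℛ

  -- A weighted count is the mean count in a random vertex set that contains each `v` independently
  -- with probability `t v`, so density passes from sets to weights.
  weighted : - (fact k * μ) ≤ ∫ (𝔼 k) (λ z → ⟦ distinct z ⟧ * (prodF k (λ i → t (lookup z i)) * c z))
  weighted = ≤-trans (≤-reflexive (sym (mean-const ℙ ℙ-mean (- (fact k * μ))))) (≤-trans (∫≤ ℙ each) (≤-reflexive (trans (linVec-swap (avg n) (avg-swap n) k ℙ (λ G z → ⟦ distinct z ⟧ * (⟦ inK k 1 (get G) (toSet z) ⟧ * c z))) (∫≡ (𝔼 k) prob))))

prod-∫ : ∀ {A : Set} (L : Lin A) k (f : Fin k → A → ℚ) → ∫ (linVec L k) (λ c → prodF k (λ i → f i (lookup c i))) ≡ prodF k (λ i → ∫ L (f i))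
prod-∫ L zero f = refl
prod-∫ L (suc k) f = trans (∫≡ L (λ a → trans (∫* (linVec L k) (f zero a) (λ c → prodF k (λ i → f (suc i) (lookup c i)))) (cong (f zero a *_) (prod-∫ L k (f ∘ suc))))) (∫*ʳ L (prodF k (λ i → ∫ L (f (suc i)))) (f zero))

prodF-* : ∀ k (x y : Fin k → ℚ) → prodF k (λ i → x i * y i) ≡ prodF k x * prodF k y
prodF-* zero x y = refl
prodF-* (suc k) x y = trans (cong ((x zero * y zero) *_) (prodF-* k (x ∘ suc) (y ∘ suc))) (l (x zero) (y zero) (prodF k (x ∘ suc)) (prodF k (y ∘ suc)))
  where l : ∀ a b c d → (a * b) * (c * d) ≡ (a * c) * (b * d)
        l = solve-∀ ℛ

rest-prod : ∀ {j M} → j ⊑ M → (Fin M → ℚ) → ℚ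
rest-prod done q = 1ℚ
rest-prod (skip e) q = q zero * rest-prod e (q ∘ suc)
rest-prod (keep e) q = rest-prod e (q ∘ suc)

rest-prod≥0 : ∀ {j M} (e : j ⊑ M) {q : Fin M → ℚ} → (∀ c → 0ℚ ≤ q c) → 0ℚ ≤ rest-prod e q
rest-prod≥0 done p = 0≤1
rest-prod≥0 (skip e) p = p zero ⊗ rest-prod≥0 e (p ∘ suc)
rest-prod≥0 (keep e) p = rest-prod≥0 e (p ∘ suc)

-- The coordinates outside `e` are independent of those in it and integrate to the constant
-- `rest-prod`.
split-prod : ∀ {A : Set} (L : Lin A) {j M} (e : j ⊑ M) (Φ : Fin M → A → ℚ) (Ψ : Vec A j → ℚ) → ∫ (linVec L M) (λ x → prodF M (λ c → Φ c (lookup x c)) * Ψ (select e x)) ≡ rest-prod e (λ c → ∫ L (Φ c)) * ∫ (linVec L j) (λ z → prodF j (λ i → Φ (ix e i) (lookup z i)) * Ψ z)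
split-prod L done Φ Ψ = sym (*-identityˡ (1ℚ * Ψ []))
split-prod L {j} {suc M} (skip e) Φ Ψ = trans (∫≡ L (λ v → trans (*-assoc-∫ (linVec L M) (Φ zero v) (λ x → prodF M (λ c → Φ (suc c) (lookup x c))) (λ x → Ψ (select e x))) (cong (Φ zero v *_) (split-prod L e (Φ ∘ suc) Ψ)))) (trans (∫*ʳ L _ (Φ zero)) (sym (*-assoc (∫ L (Φ zero)) (rest-prod e (λ c → ∫ L (Φ (suc c)))) _)))
split-prod L {suc j} {suc M} (keep e) Φ Ψ = trans (∫≡ L (λ v → trans (*-assoc-∫ (linVec L M) (Φ zero v) (λ x → prodF M (λ c → Φ (suc c) (lookup x c))) (λ x → Ψ (v ∷ select e x))) (trans (cong (Φ zero v *_) (split-prod L e (Φ ∘ suc) (λ z → Ψ (v ∷ z)))) (trans (l (Φ zero v) R (∫ (linVec L j) (λ z → prodF j (λ i → Φ (suc (ix e i)) (lookup z i)) * Ψ (v ∷ z)))) (cong (R *_) (sym (*-assoc-∫ (linVec L j) (Φ zero v) (λ z → prodF j (λ i → Φ (suc (ix e i)) (lookup z i))) (λ z → Ψ (v ∷ z)))))))))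
    (∫* L R (λ v → ∫ (linVec L j) (λ z → (Φ zero v * prodF j (λ i → Φ (suc (ix e i)) (lookup z i))) * Ψ (v ∷ z))))
  where
  R = rest-prod e (λ c → ∫ L (Φ (suc c)))
  l : ∀ a R x → a * (R * x) ≡ R * (a * x)
  l = solve-∀ ℛ

thin₂ : ∀ {m} (b c : Fin m) → b Fin.< c → Σ[ e ∈ 2 ⊑ m ] (ix e zero ≡ b × ix e (suc zero) ≡ c)
thin₂ zero (suc c) p = let e , q = pointT c in keep e , refl , cong suc q
thin₂ (suc b) (suc c) (s≤s p) = let e , q , q' = thin₂ b c p in skip e , cong suc q , cong suc q'

thin₃ : ∀ {m} (a b c : Fin m) → a Fin.< b → b Fin.< c → Σ[ e ∈ 3 ⊑ m ] (ix e zero ≡ a × ix e (suc zero) ≡ b × ix e (suc (suc zero)) ≡ c)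
thin₃ zero (suc b) (suc c) p (s≤s q) = let e , r , s = thin₂ b c q in keep e , refl , cong suc r , cong suc s
thin₃ (suc a) (suc b) (suc c) (s≤s p) (s≤s q) = let e , o , r , s = thin₃ a b c p q in skip e , cong suc o , cong suc r , cong suc s

-- The two transpositions generate all orders of three indices, which reduces six cases to the
-- increasing one.
by-sorting : ∀ {m} (P : Fin m → Fin m → Fin m → Set) → (∀ a b c → P b a c → P a b c) → (∀ a b c → P a c b → P a b c) → (∀ a b c → a Fin.< b → b Fin.< c → P a b c) → ∀ a b c → a ≢ b → a ≢ c → b ≢ c → P a b c
by-sorting {m} P s₁ s₂ base a b c a≢b a≢c b≢c = go (cmp a b a≢b) (cmp a c a≢c) (cmp b c b≢c)
  where
  cmp : ∀ (a b : Fin m) → a ≢ b → (a Fin.< b) ⊎ (b Fin.< a)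
  cmp a b n with ℕₚ.≤-total (toℕ a) (toℕ b)
  ... | inj₁ p = inj₁ (Finₚ.≤∧≢⇒< p n)
  ... | inj₂ p = inj₂ (Finₚ.≤∧≢⇒< p (n ∘ sym))
  go : (a Fin.< b) ⊎ (b Fin.< a) → (a Fin.< c) ⊎ (c Fin.< a) → (b Fin.< c) ⊎ (c Fin.< b) → P a b c
  go (inj₁ p) _ (inj₁ r) = base a b c p r
  go (inj₁ p) (inj₁ q) (inj₂ r) = s₂ a b c (base a c b q r)
  go (inj₁ p) (inj₂ q) (inj₂ r) = s₂ a b c (s₁ a c b (base c a b q p))
  go (inj₂ p) (inj₁ q) _ = s₁ a b c (base b a c p q)
  go (inj₂ p) (inj₂ q) (inj₁ r) = s₁ a b c (s₂ b a c (base b c a r q))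
  go (inj₂ p) (inj₂ q) (inj₂ r) = s₁ a b c (s₂ b a c (s₁ b c a (base c b a r p)))

-- If all triples of indices were bad, the vertex set weighted by the average of the normalised cells would violate density; the triples with repeated indices are a negligible fraction.
module Polar (n M m : ℕ) {C : Set} (PC : Finite C) (col : Vec (Fin (suc n)) 1 → C) (x* : Vec (Fin (suc n)) M) (I : suc m ⊑ M) (H : KGraph 3 (suc n)) (dns μ ρ γ : ℚ) (d≥0 : 0ℚ ≤ dns) (d≤1 : dns ≤ 1ℚ) (ρ≥0 : 0ℚ ≤ ρ) (γ>0 : 0ℚ < γ)
  (dense : Dense 1 dns μ H) (big : γ ≤ ∫ (Disc.𝔼 n M) (λ x → ⟦ sameCell PC col x* x ⟧))
  (bad : ∀ (e : 3 ⊑ suc m) → ∫ (Disc.𝔼 n M) (λ x → ⟦ sameCell PC col x* x ∧ edge H (toSet (select (e ⨟ I) x)) ⟧) ≤ (dns - ρ) * ∫ (Disc.𝔼 n M) (λ x → ⟦ sameCell PC col x* x ⟧)) where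
  open Disc n

  same : Fin M → V → Bool
  same c v = _==_ PC (col (v ∷ [])) (col (lookup x* c ∷ []))

  χ : Fin M → V → ℚ
  χ c v = ⟦ same c v ⟧

  cell-all : ∀ x → sameCell PC col x* x ≡ allF M (λ c → same c (lookup x c))
  cell-all x = bool-ext
    (λ h → allF-intro M _ (λ c → at c (pointT c) h))
    (λ h → allL-intro _ (thins 1 M) (λ {T} _ → subst₂ (λ a b → _==_ PC (col a) (col b) ≡ true) (sym (head-select T x)) (sym (head-select T x*)) (allF-elim M (λ c → same c (lookup x c)) h (ix T zero))))
    where
    at : ∀ c → Σ[ e ∈ 1 ⊑ M ] ix e zero ≡ c → sameCell PC col x* x ≡ true → same c (lookup x c) ≡ true
    at c (e , refl) h = subst₂ (λ a b → _==_ PC (col a) (col b) ≡ true) (head-select e x) (head-select e x*) (allL-elim _ (thins 1 M) h (thins-complete e))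

  cell-prod : ∀ x → ⟦ sameCell PC col x* x ⟧ ≡ prodF M (λ c → χ c (lookup x c))
  cell-prod x = trans (cong ⟦_⟧ (cell-all x)) (⟦allF⟧ M (λ c → same c (lookup x c)))

  P : ℚ
  P = ∫ (𝔼 M) (λ x → ⟦ sameCell PC col x* x ⟧)

  q iq : Fin M → ℚ
  q c = ∫ (avg n) (χ c)
  iq c = inv (q c)

  P≤q : ∀ c → P ≤ q c
  P≤q c = ≤-trans (∫≤ (𝔼 M) {λ x → ⟦ sameCell PC col x* x ⟧} {λ x → χ c (lookup x c)} (λ x → ⟦⟧-mono {sameCell PC col x* x} {same c (lookup x c)} (λ h → allF-elim M (λ c → same c (lookup x c)) (trans (sym (cell-all x)) h) c))) (≤-reflexive (go (pointT c)))
    where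
    go : Σ[ e ∈ 1 ⊑ M ] ix e zero ≡ c → ∫ (𝔼 M) (λ x → χ c (lookup x c)) ≡ q c
    go (e , refl) = trans (∫≡ (𝔼 M) (λ x → cong (χ (ix e zero)) (sym (lookup-select e x zero)))) (marginal (avg n) (avg-mean n) (avg-swap n) e (λ z → χ (ix e zero) (lookup z zero)))

  γ≤q : ∀ c → γ ≤ q c
  γ≤q c = ≤-trans big (P≤q c)
  q>0 : ∀ c → 0ℚ < q c
  q>0 c = <-≤-trans γ>0 (γ≤q c)
  iq>0 : ∀ c → 0ℚ < iq c
  iq>0 c = inv-pos (q c) (q>0 c)
  q≤1 : ∀ c → q c ≤ 1ℚ
  q≤1 c = Mean-≤1 (avg n) (avg-mean n) (same c)

  -- Each cell is normalised to mean 1, so that all triples of cells count equally in the average.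
  φ : Fin M → V → ℚ
  φ c v = χ c v * iq c

  φ≥0 : ∀ c v → 0ℚ ≤ φ c v
  φ≥0 c v = ⟦⟧≥0 (same c v) ⊗ <⇒≤ (iq>0 c)

  ∫φ : ∀ c → ∫ (avg n) (φ c) ≡ 1ℚ
  ∫φ c = trans (∫*ʳ (avg n) (iq c) (χ c)) (inv-r (q c) (q>0 c))

  cz : Vec V 3 → ℚ
  cz z = ⟦ edge H (toSet z) ⟧ - dns

  cz≤1 : ∀ z → cz z ≤ 1ℚ
  cz≤1 z = ≤-by (l ⟦ edge H (toSet z) ⟧ dns) (Δ {⟦ edge H (toSet z) ⟧} {1ℚ} (⟦⟧≤1 (edge H (toSet z))) ⊕ d≥0)
    where l : ∀ h d → 1ℚ - (h - d) ≡ (1ℚ - h) + d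
          l = solve-∀ ℛ

  A : (Fin 3 → Fin M) → Vec V 3 → ℚ
  A g z = prodF 3 (λ i → φ (g i) (lookup z i))

  A≥0 : ∀ g z → 0ℚ ≤ A g z
  A≥0 g z = prodF≥0 3 (λ i → φ≥0 (g i) (lookup z i))

  D : (Fin 3 → Fin M) → ℚ
  D g = ∫ (𝔼 3) (λ z → A g z * cz z)

  D≤1 : ∀ g → D g ≤ 1ℚ
  D≤1 g = ≤-trans (∫≤ (𝔼 3) {λ z → A g z * cz z} {A g} (λ z → *≤ (A g z) (cz z) (A≥0 g z) (cz≤1 z))) (≤-reflexive (trans (prod-∫ (avg n) 3 (λ i → φ (g i))) (prodF-cong 3 (λ i → ∫φ (g i)))))

  -- For r = 1 the cell is a product of vertex cells. The factors outside `e` cancel from the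
  -- assumed bound, and dividing by the measures of the three remaining cells leaves `- ρ`.
  D-bad : ∀ (e : 3 ⊑ M) → ∫ (𝔼 M) (λ x → ⟦ sameCell PC col x* x ∧ edge H (toSet (select e x)) ⟧) ≤ (dns - ρ) * P → D (ix e) ≤ - ρ
  D-bad e le = ≤-trans (≤-reflexive D≡) (≤-trans (*-monoʳ W (<⇒≤ W>0) X≤) (≤-reflexive (trans (l₂ W ρ Q) (trans (cong (λ z → - (ρ * z)) WQ) (cong -_ (*-identityʳ ρ))))))
    where
    R Q W X : ℚ
    R = rest-prod e q
    Q = prodF 3 (λ i → q (ix e i))
    W = prodF 3 (λ i → iq (ix e i))
    X = ∫ (𝔼 3) (λ z → prodF 3 (λ i → χ (ix e i) (lookup z i)) * cz z)
    l₂ : ∀ W ρ Q → W * (- (ρ * Q)) ≡ - (ρ * (W * Q))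
    l₂ = solve-∀ ℛ
    W>0 : 0ℚ < W
    W>0 = *-pos (iq>0 (ix e zero)) (*-pos (iq>0 (ix e (suc zero))) (*-pos (iq>0 (ix e (suc (suc zero)))) 0<1))
    WQ : W * Q ≡ 1ℚ
    WQ = trans (sym (prodF-* 3 (λ i → iq (ix e i)) (λ i → q (ix e i)))) (prodF-cong 3 {y = λ _ → 1ℚ} (λ i → trans (*-comm (iq (ix e i)) (q (ix e i))) (inv-r (q (ix e i)) (q>0 (ix e i)))))
    P≡ : P ≡ R * Q
    P≡ = trans (∫≡ (𝔼 M) (λ x → trans (cell-prod x) (sym (*-identityʳ _)))) (trans (split-prod (avg n) e χ (λ _ → 1ℚ)) (cong (R *_) (trans (∫≡ (𝔼 3) (λ z → *-identityʳ (prodF 3 (λ i → χ (ix e i) (lookup z i))))) (prod-∫ (avg n) 3 (λ i → χ (ix e i))))))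
    signed≡ : signed {k = 3} (sameCell PC col x*) (λ x → edge H (toSet (select e x))) dns ≡ R * X
    signed≡ = trans (∫≡ (𝔼 M) (λ x → cong (_* cz (select e x)) (cell-prod x))) (split-prod (avg n) e χ cz)
    Q≤1 : Q ≤ 1ℚ
    Q≤1 = prodF-mono 3 {λ i → q (ix e i)} {λ _ → 1ℚ} (λ i → <⇒≤ (q>0 (ix e i))) (λ i → q≤1 (ix e i))
    R>0 : 0ℚ < R
    R>0 = <-≤-trans γ>0 (≤-trans big (≤-trans (≤-reflexive P≡) (*≤ R Q (rest-prod≥0 e (λ c → <⇒≤ (q>0 c))) Q≤1)))
    X≤ : X ≤ - (ρ * Q)
    X≤ = *-cancel-pos R R>0 (≤-trans (≤-reflexive (trans (sym signed≡) (signed-≡ {k = 3} (sameCell PC col x*) (λ x → edge H (toSet (select e x))) dns))) (≤-trans (≤-by (l B P dns ρ) (Δ {B} {(dns - ρ) * P} le)) (≤-reflexive (trans (cong (λ z → - (ρ * z)) P≡) (l₃ ρ R Q)))))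
      where
      B = ∫ (𝔼 M) (λ x → ⟦ sameCell PC col x* x ∧ edge H (toSet (select e x)) ⟧)
      l : ∀ B P d ρ → - (ρ * P) - (B - d * P) ≡ (d - ρ) * P - B
      l = solve-∀ ℛ
      l₃ : ∀ ρ R Q → - (ρ * (R * Q)) ≡ R * (- (ρ * Q))
      l₃ = solve-∀ ℛ
    D≡ : D (ix e) ≡ W * X
    D≡ = trans (∫≡ (𝔼 3) (λ z → trans (cong (_* cz z) (prodF-* 3 (λ i → χ (ix e i) (lookup z i)) (λ i → iq (ix e i)))) (l₄ (prodF 3 (λ i → χ (ix e i) (lookup z i))) W (cz z)))) (∫* (𝔼 3) W (λ z → prodF 3 (λ i → χ (ix e i) (lookup z i)) * cz z))
      where l₄ : ∀ a w c → (a * w) * c ≡ w * (a * c)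
            l₄ = solve-∀ ℛ

  tri : Fin (suc m) → Fin (suc m) → Fin (suc m) → Fin 3 → Fin M
  tri a b c i = ix I (lookup (a ∷ b ∷ c ∷ []) i)

  Dt : Fin (suc m) → Fin (suc m) → Fin (suc m) → ℚ
  Dt a b c = D (tri a b c)

  swap₁ : ∀ a b c → Dt a b c ≡ Dt b a c
  swap₁ a b c = trans (avg-swap n (avg n) (λ v v' → ∫ (avg n) (λ v'' → A (tri a b c) (v ∷ v' ∷ v'' ∷ []) * cz (v ∷ v' ∷ v'' ∷ [])))) (∫≡ (avg n) (λ v' → ∫≡ (avg n) (λ v → ∫≡ (avg n) (λ v'' → cong₂ _*_ (l (φ (ix I a) v) (φ (ix I b) v') (φ (ix I c) v'')) (cong (λ S → ⟦ edge H S ⟧ - dns) (flip v v' v''))))))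
    where
    l : ∀ x y z → x * (y * (z * 1ℚ)) ≡ y * (x * (z * 1ℚ))
    l = solve-∀ ℛ
    flip : ∀ v v' v'' → toSet (v ∷ v' ∷ v'' ∷ []) ≡ toSet (v' ∷ v ∷ v'' ∷ [])
    flip v v' v'' = toSet-≡ (v ∷ v' ∷ v'' ∷ []) (v' ∷ v ∷ v'' ∷ []) (λ { zero → suc zero , refl ; (suc zero) → zero , refl ; (suc (suc zero)) → suc (suc zero) , refl }) (λ { zero → suc zero , refl ; (suc zero) → zero , refl ; (suc (suc zero)) → suc (suc zero) , refl })

  swap₂ : ∀ a b c → Dt a b c ≡ Dt a c b
  swap₂ a b c = ∫≡ (avg n) (λ v → trans (avg-swap n (avg n) (λ v' v'' → A (tri a b c) (v ∷ v' ∷ v'' ∷ []) * cz (v ∷ v' ∷ v'' ∷ []))) (∫≡ (avg n) (λ v'' → ∫≡ (avg n) (λ v' → cong₂ _*_ (l (φ (ix I a) v) (φ (ix I b) v') (φ (ix I c) v'')) (cong (λ S → ⟦ edge H S ⟧ - dns) (flip v v' v''))))))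
    where
    l : ∀ x y z → x * (y * (z * 1ℚ)) ≡ x * (z * (y * 1ℚ))
    l = solve-∀ ℛ
    flip : ∀ v v' v'' → toSet (v ∷ v' ∷ v'' ∷ []) ≡ toSet (v ∷ v'' ∷ v' ∷ [])
    flip v v' v'' = toSet-≡ (v ∷ v' ∷ v'' ∷ []) (v ∷ v'' ∷ v' ∷ []) (λ { zero → zero , refl ; (suc zero) → suc (suc zero) , refl ; (suc (suc zero)) → suc zero , refl }) (λ { zero → zero , refl ; (suc zero) → suc (suc zero) , refl ; (suc (suc zero)) → suc zero , refl })

  D-cong : ∀ {g g' : Fin 3 → Fin M} → (∀ i → g i ≡ g' i) → D g ≡ D g'
  D-cong p = ∫≡ (𝔼 3) (λ z → cong (_* cz z) (prodF-cong 3 (λ i → cong (λ c → φ c (lookup z i)) (p i))))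

  Dt-distinct : ∀ a b c → a ≢ b → a ≢ c → b ≢ c → Dt a b c ≤ - ρ
  Dt-distinct = by-sorting (λ a b c → Dt a b c ≤ - ρ) (λ a b c p → ≤-trans (≤-reflexive (swap₁ a b c)) p) (λ a b c p → ≤-trans (≤-reflexive (swap₂ a b c)) p) base
    where
    base : ∀ a b c → a Fin.< b → b Fin.< c → Dt a b c ≤ - ρ
    base a b c p q' = let e , p₀ , p₁ , p₂ = thin₃ a b c p q' in ≤-trans (≤-reflexive (D-cong {tri a b c} {ix (e ⨟ I)} (λ { zero → sym (trans (ix-⨟ e I zero) (cong (ix I) p₀)) ; (suc zero) → sym (trans (ix-⨟ e I (suc zero)) (cong (ix I) p₁)) ; (suc (suc zero)) → sym (trans (ix-⨟ e I (suc (suc zero))) (cong (ix I) p₂)) }))) (D-bad (e ⨟ I) (bad e))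

  Dv : Vec (Fin (suc m)) 3 → ℚ
  Dv c = D (λ i → ix I (lookup c i))

  Dv≤ : ∀ c → Dv c ≤ - ρ + (1ℚ + ρ) * ⟦ not (distinct c) ⟧
  Dv≤ (a ∷ b ∷ c ∷ []) = go (distinct (a ∷ b ∷ c ∷ [])) refl
    where
    t : ∀ ρ → - ρ + (1ℚ + ρ) * 0ℚ ≡ - ρ
    t = solve-∀ ℛ
    f : ∀ ρ → - ρ + (1ℚ + ρ) * 1ℚ ≡ 1ℚ
    f = solve-∀ ℛ
    go : ∀ b' → distinct (a ∷ b ∷ c ∷ []) ≡ b' → Dt a b c ≤ - ρ + (1ℚ + ρ) * ⟦ not b' ⟧
    go true dq = ≤-trans (Dt-distinct a b c (apart zero (suc zero) (λ ())) (apart zero (suc (suc zero)) (λ ())) (apart (suc zero) (suc (suc zero)) (λ ()))) (≤-reflexive (sym (t ρ)))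
      where
      apart : ∀ i i' → i ≢ i' → lookup (a ∷ b ∷ c ∷ []) i ≢ lookup (a ∷ b ∷ c ∷ []) i'
      apart i i' ne e = ne (distinct-injective (a ∷ b ∷ c ∷ []) dq i i' e)
    go false _ = ≤-trans (D≤1 (tri a b c)) (≤-reflexive (sym (f ρ)))

  s : ℚ
  s = (ν 3 * ν 3) * inv (ν (suc m))

  avgD : ∫ (Disc.𝔼 m 3) Dv ≤ - ρ + (1ℚ + ρ) * s
  avgD = ≤-trans (∫≤ (Disc.𝔼 m 3) Dv≤) (≤-trans (≤-reflexive (trans (∫+ (Disc.𝔼 m 3) (λ _ → - ρ) (λ c → (1ℚ + ρ) * ⟦ not (distinct c) ⟧)) (cong₂ _+_ (mean-const (Disc.𝔼 m 3) (Disc.𝔼-mean m 3) (- ρ)) (∫* (Disc.𝔼 m 3) (1ℚ + ρ) (λ c → ⟦ not (distinct c) ⟧))))) (+-mono-≤ (≤-refl { - ρ}) (*-monoʳ (1ℚ + ρ) (0≤1 ⊕ ρ≥0) (indistinct≤ m 3))))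

  -- Every cell has measure at least `γ`, so the factor `γ` brings the averaged density into [0, 1].
  t : V → ℚ
  t v = γ * ∫ (avg m) (λ c → φ (ix I c) v)

  t≥0 : ∀ v → 0ℚ ≤ t v
  t≥0 v = <⇒≤ γ>0 ⊗ ∫≥0 (avg m) (λ c → φ≥0 (ix I c) v)

  t≤1 : ∀ v → t v ≤ 1ℚ
  t≤1 v = ≤-trans (≤-reflexive (sym (∫* (avg m) γ (λ c → φ (ix I c) v)))) (mean-≤ (avg m) (avg-mean m) {λ c → γ * φ (ix I c) v} (λ c → one (ix I c)))
    where
    l : ∀ g x i → g * (x * i) ≡ (g * i) * x
    l = solve-∀ ℛ
    one : ∀ c → γ * φ c v ≤ 1ℚ
    one c = ≤-trans (≤-reflexive (l γ (χ c v) (iq c))) (≤-trans (*≤ (γ * iq c) (χ c v) (<⇒≤ γ>0 ⊗ <⇒≤ (iq>0 c)) (⟦⟧≤1 (same c v))) (≤-trans (*-monoˡ {γ} {q c} (iq c) (<⇒≤ (iq>0 c)) (γ≤q c)) (≤-reflexive (inv-r (q c) (q>0 c)))))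

  Γ : ℚ
  Γ = γ * (γ * (γ * 1ℚ))

  a : Vec V 3 → ℚ
  a z = prodF 3 (λ i → t (lookup z i)) * cz z

  -- Multilinearity: a product of three averages over cells is the average over all triples of
  -- cells.
  total : ∫ (𝔼 3) a ≡ Γ * ∫ (Disc.𝔼 m 3) Dv
  total = trans (∫≡ (𝔼 3) at) (trans (∫* (𝔼 3) Γ (λ z → ∫ (Disc.𝔼 m 3) (λ c → A (λ i → ix I (lookup c i)) z * cz z))) (cong (Γ *_) (linVec-swap (avg m) (avg-swap m) 3 (𝔼 3) (λ z c → A (λ i → ix I (lookup c i)) z * cz z))))
    where
    at : ∀ z → a z ≡ Γ * ∫ (Disc.𝔼 m 3) (λ c → A (λ i → ix I (lookup c i)) z * cz z)
    at z = trans (cong (_* cz z) (trans (prodF-* 3 (λ _ → γ) (λ i → ∫ (avg m) (λ c → φ (ix I c) (lookup z i)))) (cong (Γ *_) (sym (prod-∫ (avg m) 3 (λ i c → φ (ix I c) (lookup z i))))))) (trans (*-assoc Γ (∫ (Disc.𝔼 m 3) (λ c → A (λ i → ix I (lookup c i)) z)) (cz z)) (cong (Γ *_) (sym (∫*ʳ (Disc.𝔼 m 3) (cz z) (λ c → A (λ i → ix I (lookup c i)) z)))))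

  a≥-1 : ∀ z → - 1ℚ ≤ a z
  a≥-1 z = ≤-by (l T₃ ⟦ edge H (toSet z) ⟧ dns) ((prodF≥0 3 (λ i → t≥0 (lookup z i)) ⊗ (⟦⟧≥0 (edge H (toSet z)) ⊕ Δ {dns} {1ℚ} d≤1)) ⊕ Δ {T₃} {1ℚ} (prodF-mono 3 {λ i → t (lookup z i)} {λ _ → 1ℚ} (λ i → t≥0 (lookup z i)) (λ i → t≤1 (lookup z i))))
    where
    T₃ = prodF 3 (λ i → t (lookup z i))
    l : ∀ T h d → T * (h - d) - (- 1ℚ) ≡ T * (h + (1ℚ - d)) + (1ℚ - T)
    l = solve-∀ ℛ

  contradiction : (1ℚ + ρ) * s ≤ ρ * half → fact 3 * μ + (ν 3 * ν 3) * inv (ν (suc n)) < Γ * (ρ * half) → ⊥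
  contradiction s-small μ-small = contra μ-small (≤-by (l (fact 3 * μ) ((ν 3 * ν 3) * inv (ν (suc n))) Yd (∫ (𝔼 3) a) Γ (∫ (Disc.𝔼 m 3) Dv) ρ ((1ℚ + ρ) * s) total) (((Δ { - (fact 3 * μ)} {Yd} (Weighted.weighted 3 n H dns μ dense t t≥0 t≤1) ⊕ Δ {Yd - (ν 3 * ν 3) * inv (ν (suc n))} {∫ (𝔼 3) a} (indistinct-slack n 3 a a≥-1)) ⊕ (Γ≥0 ⊗ Δ {∫ (Disc.𝔼 m 3) Dv} { - ρ + (1ℚ + ρ) * s} avgD)) ⊕ (Γ≥0 ⊗ Δ {(1ℚ + ρ) * s} {ρ * half} s-small)))
    where
    Yd = ∫ (𝔼 3) (λ z → ⟦ distinct z ⟧ * a z)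
    Γ≥0 : 0ℚ ≤ Γ
    Γ≥0 = <⇒≤ γ>0 ⊗ (<⇒≤ γ>0 ⊗ (<⇒≤ γ>0 ⊗ 0≤1))
    l₀ : ∀ m i Y T G D ρ S → (m + i) - G * (ρ * half) ≡ (((Y - (- m)) + (T - (Y - i))) + (G * ((- ρ + S) - D))) + (G * (ρ * half - S)) + (G * D - T)
    l₀ = solve-∀ ℛ
    l₁ : ∀ x y → x + (y - y) ≡ x
    l₁ = solve-∀ ℛ
    l : ∀ m i Y T G D ρ S → T ≡ G * D → (m + i) - G * (ρ * half) ≡ (((Y - (- m)) + (T - (Y - i))) + (G * ((- ρ + S) - D))) + (G * (ρ * half - S))
    l m i Y T G D ρ S refl = trans (l₀ m i Y T G D ρ S) (l₁ ((((Y - (- m)) + (T - (Y - i))) + (G * ((- ρ + S) - D))) + (G * (ρ * half - S))) (G * D))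

small-frac : ∀ a ε → 0ℚ ≤ a → 0ℚ < ε → Σ[ N ∈ ℕ ] (∀ n → N ℕ.≤ n → a * inv (ν (suc n)) ≤ ε)
small-frac a ε a≥0 ε>0 = go (archimedean (a * inv ε))
  where
  go : Σ[ N ∈ ℕ ] a * inv ε ≤ ν N → Σ[ N ∈ ℕ ] (∀ n → N ℕ.≤ n → a * inv (ν (suc n)) ≤ ε)
  go (N , p) = N , λ n q → *-cancel-pos (ν (suc n)) (ν-pos n) (≤-trans (≤-reflexive (trans (cancel-inv (ν (suc n)) a (ν-pos n)) (sym (cancel-inv ε a ε>0)))) (≤-trans (*-monoʳ ε (<⇒≤ ε>0) (≤-trans p (≤-trans (ν-mono q) (ν≤ n)))) (≤-reflexive (*-comm ε (ν (suc n))))))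

CellDense : (r M M₁ : ℕ) (dns ρ γ : ℚ) (n : ℕ) → KGraph (suc (suc r)) (suc n) → Set₁
CellDense r M M₁ dns ρ γ n H = ∀ {C : Set} (PC : Finite C) (col : Vec (Fin (suc n)) r → C) (x* : Vec (Fin (suc n)) M₁) → γ ≤ ∫ (Disc.𝔼 n M₁) (λ x → ⟦ sameCell PC col x* x ⟧) → DN (Σ[ J ∈ M ⊑ M₁ ] (∀ (e : suc (suc r) ⊑ M) → (dns - ρ) * ∫ (Disc.𝔼 n M₁) (λ x → ⟦ sameCell PC col x* x ⟧) ≤ ∫ (Disc.𝔼 n M₁) (λ x → ⟦ sameCell PC col x* x ∧ edge H (toSet (select (e ⨟ J) x)) ⟧)))

-- The order of the quantifiers matters: `M₁` is an input of the regularity argument, which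
-- determines `γ`, and `μ` may then depend on both.
cell-dense : ∀ r → 1 ℕ.≤ r → ∀ M dns ρ → 0ℚ ≤ dns → dns ≤ 1ℚ → 0ℚ < ρ → Σ[ M₁ ∈ ℕ ] (∀ γ → 0ℚ < γ → Σ[ μ ∈ ℚ ] (0ℚ < μ × Σ[ n₀ ∈ ℕ ] (∀ n → n₀ ℕ.≤ n → (H : KGraph (suc (suc r)) (suc n)) → Dense r dns μ H → CellDense r M M₁ dns ρ γ n H)))
cell-dense (suc zero) _ M dns ρ d≥0 d≤1 ρ>0 = ramseyℕ 3 M (suc m) , main
  where
  0≤ρ = <⇒≤ ρ>0
  nine≥0 : 0ℚ ≤ ν 3 * ν 3
  nine≥0 = ν≥0 3 ⊗ ν≥0 3
  -- `m` is so large that index triples with a repetition cost at most ρ/2 in the average `avgD`.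
  mm = small-frac ((1ℚ + ρ) * (ν 3 * ν 3)) (ρ * half) ((0≤1 ⊕ 0≤ρ) ⊗ nine≥0) (*-pos ρ>0 0<half)
  m : ℕ
  m = proj₁ mm
  m-small : (1ℚ + ρ) * ((ν 3 * ν 3) * inv (ν (suc m))) ≤ ρ * half
  m-small = ≤-trans (≤-reflexive (sym (*-assoc (1ℚ + ρ) (ν 3 * ν 3) (inv (ν (suc m)))))) (proj₂ mm m ℕₚ.≤-refl)
  main : ∀ γ → 0ℚ < γ → Σ[ μ ∈ ℚ ] (0ℚ < μ × Σ[ n₀ ∈ ℕ ] (∀ n → n₀ ℕ.≤ n → (H : KGraph 3 (suc n)) → Dense 1 dns μ H → CellDense 1 M (ramseyℕ 3 M (suc m)) dns ρ γ n H))
  main γ γ>0 = μ₀ , *-pos Bq>0 (inv-pos (fact 3) (fact-pos 3)) , proj₁ nn , found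
    where
    B : ℚ
    -- The contradiction requires errors below `B`: a quarter of it is granted to `μ` and a quarter
    -- to tuples with repeated vertices.
    B = (γ * (γ * (γ * 1ℚ))) * (ρ * half)
    B>0 : 0ℚ < B
    B>0 = *-pos (*-pos γ>0 (*-pos γ>0 (*-pos γ>0 0<1))) (*-pos ρ>0 0<half)
    Bq>0 : 0ℚ < B * quarter
    Bq>0 = *-pos B>0 0<quarter
    μ₀ : ℚ
    μ₀ = (B * quarter) * inv (fact 3)
    nn = small-frac (ν 3 * ν 3) (B * quarter) nine≥0 Bq>0
    l : ∀ B → B - (B * quarter + B * quarter) ≡ B * half
    l = solve-∀ ℛ
    found : ∀ n → proj₁ nn ℕ.≤ n → (H : KGraph 3 (suc n)) → Dense 1 dns μ₀ H → CellDense 1 M (ramseyℕ 3 M (suc m)) dns ρ γ n H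
    found n n≥ H dense PC col x* big = ramseyDN 3 M (suc m) (λ e → (dns - ρ) * ∫ (Disc.𝔼 n (ramseyℕ 3 M (suc m))) (λ x → ⟦ sameCell PC col x* x ⟧) ≤ ∫ (Disc.𝔼 n (ramseyℕ 3 M (suc m))) (λ x → ⟦ sameCell PC col x* x ∧ edge H (toSet (select e x)) ⟧)) >>= λ where
      (inj₁ good) → pure good
      (inj₂ (I , bad)) → λ _ → Polar.contradiction n (ramseyℕ 3 M (suc m)) m PC col x* I H dns μ₀ ρ γ d≥0 d≤1 0≤ρ γ>0 dense big (λ e → <⇒≤ (ℚₚ.≰⇒> (bad e))) m-small
        (≤-<-trans (+-mono-≤ (≤-reflexive (cancel-inv (fact 3) (B * quarter) (fact-pos 3))) (proj₂ nn n n≥)) (<-by (l B) (*-pos B>0 0<half)))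
cell-dense (suc (suc r')) _ M dns ρ d≥0 d≤1 ρ>0 = M , main
  where
  r k : ℕ
  r = suc (suc r')
  k = suc (suc r)
  κ : ℚ
  κ = prodF k (λ _ → inv (ν k))
  κ>0 : 0ℚ < κ
  κ>0 = pos k
    where
    pos : ∀ m → 0ℚ < prodF m (λ _ → inv (ν k))
    pos zero = 0<1
    pos (suc m) = *-pos (inv-pos (ν k) (ν-pos (suc r))) (pos m)
  main : ∀ γ → 0ℚ < γ → Σ[ μ ∈ ℚ ] (0ℚ < μ × Σ[ n₀ ∈ ℕ ] (∀ n → n₀ ℕ.≤ n → (H : KGraph k (suc n)) → Dense r dns μ H → CellDense r M M dns ρ γ n H))
  main γ γ>0 = κ * B , *-pos κ>0 B>0 , proj₁ nn , λ n n≥ H dense PC col x* big → pure (idT , λ e → cell-dense₄ r n M (s≤s (s≤s z≤n)) PC col x* (e ⨟ idT) H dns (κ * B) ρ γ d≤1 (<⇒≤ ρ>0) dense (≤-trans (+-mono-≤ (≤-reflexive (trans (*-assoc κ B (inv κ)) (cancel-inv κ B κ>0))) (proj₂ nn n n≥)) (≤-reflexive (l (ρ * γ)))) big)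
    where
    B : ℚ
    B = (ρ * γ) * half
    B>0 : 0ℚ < B
    B>0 = *-pos (*-pos ρ>0 γ>0) 0<half
    nn = small-frac (ν k * ν k) B (ν≥0 k ⊗ ν≥0 k) B>0
    l : ∀ x → x * half + x * half ≡ x
    l = solve-∀ ℛ

-- Thinnings as subsets of an ordered vertex set, and images of sets.

─⊥ : ∀ {n} (S : Subset n) → Data.Fin.Subset._─_ S (Vec.replicate n false) ≡ S
─⊥ [] = refl
─⊥ (b ∷ S) = cong (b ∷_) (─⊥ S)

∖-update : ∀ {n} (S : Subset n) v → S ∖ v ≡ S Vec.[ v ]≔ false
∖-update (b ∷ S) zero = cong (false ∷_) (─⊥ S)
∖-update (b ∷ S) (suc v) = cong (b ∷_) (∖-update S v)

∈-∖⁺ : ∀ {n} (S : Subset n) v w → w ∈ˢ S → w ≢ v → w ∈ˢ S ∖ v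
∈-∖⁺ S v w p q = trans (cong (λ U → lookup U w) (∖-update S v)) (trans (Vecₚ.lookup∘update′ q S false) p)

∈-∖⁻ : ∀ {n} (S : Subset n) v w → w ∈ˢ S ∖ v → w ∈ˢ S × w ≢ v
∈-∖⁻ S v w p = go (w Finₚ.≟ v)
  where
  p' : w ∈ˢ (S Vec.[ v ]≔ false)
  p' = trans (cong (λ U → lookup U w) (sym (∖-update S v))) p
  go : Dec (w ≡ v) → w ∈ˢ S × w ≢ v
  go (yes refl) = case trans (sym (Vecₚ.lookup∘update v S false)) p' of λ ()
  go (no q) = trans (sym (Vecₚ.lookup∘update′ q S false)) p' , q

∈-∩⁻ : ∀ {n} (S U : Subset n) v → v ∈ˢ S ∩ U → v ∈ˢ S × v ∈ˢ U
∈-∩⁻ S U v p = ∧-true (trans (sym (Vecₚ.lookup-zipWith _∧_ v S U)) p)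

∈-∩⁺ : ∀ {n} (S U : Subset n) v → v ∈ˢ S → v ∈ˢ U → v ∈ˢ S ∩ U
∈-∩⁺ S U v p q = trans (Vecₚ.lookup-zipWith _∧_ v S U) (∧-intro p q)

∈-∪⁻ : ∀ {n} (S U : Subset n) v → v ∈ˢ S ∪ U → (v ∈ˢ S) ⊎ (v ∈ˢ U)
∈-∪⁻ S U v p = ∨-elim (lookup S v) (lookup U v) (trans (sym (Vecₚ.lookup-zipWith _∨_ v S U)) p)

∈-∪⁺ˡ : ∀ {n} (S U : Subset n) v → v ∈ˢ S → v ∈ˢ S ∪ U
∈-∪⁺ˡ S U v p = trans (Vecₚ.lookup-zipWith _∨_ v S U) (∨-introˡ (lookup U v) p)

∈-∪⁺ʳ : ∀ {n} (S U : Subset n) v → v ∈ˢ U → v ∈ˢ S ∪ U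
∈-∪⁺ʳ S U v p = trans (Vecₚ.lookup-zipWith _∨_ v S U) (∨-introʳ (lookup S v) p)

∈-tabulate⁺ : ∀ {n} (g : Fin n → Bool) v → g v ≡ true → v ∈ˢ tabulate g
∈-tabulate⁺ g v p = trans (lookup∘tabulate g v) p

∈-tabulate⁻ : ∀ {n} (g : Fin n → Bool) v → v ∈ˢ tabulate g → g v ≡ true
∈-tabulate⁻ g v p = trans (sym (lookup∘tabulate g v)) p

ix-mono : ∀ {j m} (e : j ⊑ m) t t' → toℕ t ℕ.< toℕ t' → toℕ (ix e t) ℕ.< toℕ (ix e t')
ix-mono (skip e) t t' p = s≤s (ix-mono e t t' p)
ix-mono (keep e) zero (suc t') p = s≤s z≤n
ix-mono (keep e) (suc t) (suc t') (s≤s p) = s≤s (ix-mono e t t' p)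

ix-reflects : ∀ {j m} (e : j ⊑ m) t t' → toℕ (ix e t) ℕ.< toℕ (ix e t') → toℕ t ℕ.< toℕ t'
ix-reflects (skip e) t t' (s≤s p) = ix-reflects e t t' p
ix-reflects (keep e) zero (suc t') p = s≤s z≤n
ix-reflects (keep e) (suc t) (suc t') (s≤s p) = s≤s (ix-reflects e t t' p)

d-avoids : ∀ {j} (ℓ : Fin (suc j)) t → ix (d ℓ) t ≢ ℓ
d-avoids {suc j} (suc ℓ) (suc t) p = d-avoids ℓ t (Finₚ.suc-injective p)

d-covers : ∀ {j} (ℓ t : Fin (suc j)) → t ≢ ℓ → Σ[ t' ∈ Fin j ] ix (d ℓ) t' ≡ t
d-covers zero zero p = ⊥-elim (p refl)
d-covers zero (suc t) p = t , cong suc (ix-id t)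
d-covers {suc j} (suc ℓ) zero p = zero , refl
d-covers {suc j} (suc ℓ) (suc t) p = let t' , q = d-covers ℓ t (p ∘ cong suc) in suc t' , cong suc q

<ᵇ-intro : ∀ {a b} → a ℕ.< b → (a ℕ.<ᵇ b) ≡ true
<ᵇ-intro p = T⇒≡ (ℕₚ.<⇒<ᵇ p)

<ᵇ-elim : ∀ a b → (a ℕ.<ᵇ b) ≡ true → a ℕ.< b
<ᵇ-elim a b p = ℕₚ.<ᵇ⇒< a b (≡⇒T p)

module Ordered {f : ℕ} (σ : Permutation′ f) where
  vx : ∀ {j} → j ⊑ f → Fin j → Fin f
  vx e t = σ ⟨$⟩ˡ (ix e t)

  es : ∀ {j} → j ⊑ f → Subset f
  es e = toSet (tabulate (vx e))

  σ-vx : ∀ {j} (e : j ⊑ f) t → σ ⟨$⟩ʳ vx e t ≡ ix e t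
  σ-vx e t = inverseʳ σ

  vx-injective : ∀ {j} (e : j ⊑ f) t t' → vx e t ≡ vx e t' → t ≡ t'
  vx-injective e t t' p = ix-injective e t t' (trans (sym (σ-vx e t)) (trans (cong (σ ⟨$⟩ʳ_) p) (σ-vx e t')))

  ∈-es⁺ : ∀ {j} (e : j ⊑ f) t → vx e t ∈ˢ es e
  ∈-es⁺ e t = subst (_∈ˢ es e) (lookup∘tabulate (vx e) t) (∈-toSet⁺ (tabulate (vx e)) t)

  ∈-es⁻ : ∀ {j} (e : j ⊑ f) v → v ∈ˢ es e → Σ[ t ∈ Fin j ] vx e t ≡ v
  ∈-es⁻ e v p = let t , q = ∈-toSet⁻ (tabulate (vx e)) v p in t , trans (sym (lookup∘tabulate (vx e) t)) q

  card-es : ∀ {j} (e : j ⊑ f) → ∣ es e ∣ ≡ j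
  card-es e = card-toSet (tabulate (vx e)) (distinct-tabulate (vx e) (vx-injective e))

  es-remove : ∀ {j} (e : suc j ⊑ f) ℓ → es e ∖ vx e ℓ ≡ es (d ℓ ⨟ e)
  es-remove e ℓ = set-ext
    (λ v p → let q , ne = ∈-∖⁻ (es e) (vx e ℓ) v p ; t , r = ∈-es⁻ e v q ; t' , s = d-covers ℓ t (λ t≡ℓ → ne (trans (sym r) (cong (vx e) t≡ℓ))) in
      subst (_∈ˢ es (d ℓ ⨟ e)) (trans (at t') (trans (cong (vx e) s) r)) (∈-es⁺ (d ℓ ⨟ e) t'))
    (λ v p → let t , q = ∈-es⁻ (d ℓ ⨟ e) v p ; r = trans (sym (at t)) q in
      ∈-∖⁺ (es e) (vx e ℓ) v (subst (_∈ˢ es e) r (∈-es⁺ e (ix (d ℓ) t))) (λ v≡ → d-avoids ℓ t (vx-injective e (ix (d ℓ) t) ℓ (trans r v≡))))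
    where
    at : ∀ t → vx (d ℓ ⨟ e) t ≡ vx e (ix (d ℓ) t)
    at t = cong (σ ⟨$⟩ˡ_) (ix-⨟ (d ℓ) e t)

  -- The members before the one at position `ℓ` are those at the first `ℓ` positions. This
  -- translates ranks, as used in `Vanishing` and `LType`, into the indices of the face maps `d`.
  rank-es : ∀ {j} (e : j ⊑ f) ℓ → rank σ (es e) (vx e ℓ) ≡ toℕ ℓ
  rank-es {j} e ℓ = trans (cong ∣_∣ below≡) (card-toSet (tabulate below) (distinct-tabulate below (λ s s' p → Finₚ.toℕ-injective (trans (sym (Finₚ.toℕ-inject s)) (trans (cong toℕ (vx-injective e (Fin.inject s) (Fin.inject s') p)) (Finₚ.toℕ-inject s'))))))
    where
    below : Fin (toℕ ℓ) → Fin f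
    below s = vx e (Fin.inject s)
    before : Fin f → Bool
    before u = toℕ (σ ⟨$⟩ʳ u) ℕ.<ᵇ toℕ (σ ⟨$⟩ʳ vx e ℓ)
    below≡ : es e ∩ tabulate before ≡ toSet (tabulate below)
    below≡ = set-ext
      (λ v p → let p₁ , p₂ = ∈-∩⁻ (es e) (tabulate before) v p ; t , q = ∈-es⁻ e v p₁
                   lt = subst₂ ℕ._<_ (cong toℕ (trans (cong (σ ⟨$⟩ʳ_) (sym q)) (σ-vx e t))) (cong toℕ (σ-vx e ℓ)) (<ᵇ-elim _ _ (∈-tabulate⁻ before v p₂))
                   t<ℓ = ix-reflects e t ℓ lt
                   s = Fin.fromℕ< t<ℓ
               in subst (_∈ˢ toSet (tabulate below)) (trans (lookup∘tabulate below s) (trans (cong (vx e) (Finₚ.toℕ-injective (trans (Finₚ.toℕ-inject s) (Finₚ.toℕ-fromℕ< t<ℓ)))) q)) (∈-toSet⁺ (tabulate below) s))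
      (λ v p → let s , q = ∈-toSet⁻ (tabulate below) v p ; r = trans (sym (lookup∘tabulate below s)) q in
        subst (_∈ˢ (es e ∩ tabulate before)) r (∈-∩⁺ (es e) (tabulate before) (below s) (∈-es⁺ e (Fin.inject s)) (∈-tabulate⁺ before (below s) (<ᵇ-intro (subst₂ ℕ._<_ (cong toℕ (sym (σ-vx e (Fin.inject s)))) (cong toℕ (sym (σ-vx e ℓ))) (ix-mono e (Fin.inject s) ℓ (subst (ℕ._< toℕ ℓ) (sym (Finₚ.toℕ-inject s)) (Finₚ.toℕ<n s))))))))

  thinning-of : ∀ {j} (S : Subset f) → ∣ S ∣ ≡ j → Σ[ e ∈ j ⊑ f ] es e ≡ S
  thinning-of {j} S c = go (enumerate S c)
    where
    go : Σ[ e ∈ j ⊑ f ] toSet (positions e) ≡ S → Σ[ e ∈ j ⊑ f ] es e ≡ S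
    go (e₀ , e₀≡) = go' (enumerate A (card-toSet (tabulate g) (distinct-tabulate g (λ t t' p → ix-injective e₀ t t' (trans (sym (inverseˡ σ)) (trans (cong (σ ⟨$⟩ˡ_) p) (inverseˡ σ)))))))
      where
      g : Fin j → Fin f
      g t = σ ⟨$⟩ʳ ix e₀ t
      A : Subset f
      A = toSet (tabulate g)
      go' : Σ[ e ∈ j ⊑ f ] toSet (positions e) ≡ A → Σ[ e ∈ j ⊑ f ] es e ≡ S
      go' (e , e≡) = e , trans (toSet-≡ (tabulate (vx e)) (positions e₀)
          (λ t → let s , q = ∈-toSet⁻ (tabulate g) (ix e t) (subst (ix e t ∈ˢ_) e≡ (subst (_∈ˢ toSet (positions e)) (lookup-positions e t) (∈-toSet⁺ (positions e) t))) in s , trans (lookup-positions e₀ s) (trans (sym (inverseˡ σ)) (trans (cong (σ ⟨$⟩ˡ_) (trans (sym (lookup∘tabulate g s)) q)) (sym (lookup∘tabulate (vx e) t)))))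
          (λ s → let t , q = ∈-toSet⁻ (positions e) (g s) (subst (g s ∈ˢ_) (sym e≡) (subst (_∈ˢ A) (lookup∘tabulate g s) (∈-toSet⁺ (tabulate g) s))) in t , trans (lookup∘tabulate (vx e) t) (trans (cong (σ ⟨$⟩ˡ_) (trans (sym (lookup-positions e t)) q)) (trans (inverseˡ σ) (sym (lookup-positions e₀ s))))))
        e₀≡

any-elim : ∀ {A : Set} (p : A → Bool) l → BoolL.any p l ≡ true → Σ[ a ∈ A ] p a ≡ true
any-elim p (a ∷ l) h = [ (λ q → a , q) , any-elim p l ]′ (∨-elim (p a) (BoolL.any p l) h)

any-intro : ∀ {A : Set} (p : A → Bool) l {a} → a ∈ l → p a ≡ true → BoolL.any p l ≡ true
any-intro p (a ∷ l) (here refl) h = ∨-introˡ (BoolL.any p l) h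
any-intro p (b ∷ l) (there m) h = ∨-introʳ (p b) (any-intro p l m h)

∈-image⁻ : ∀ {f n} (φ : Fin f → Fin n) S w → w ∈ˢ image φ S → Σ[ u ∈ Fin f ] (u ∈ˢ S × φ u ≡ w)
∈-image⁻ {f} φ S w p = let u , q = any-elim _ (List.allFin f) (∈-tabulate⁻ _ w p) in u , ∧ˡ (lookup S u) _ q , dec (φ u Finₚ.≟ w) (∧ʳ (lookup S u) _ q)
  where
  dec : ∀ {P : Set} (x : Dec P) → ⌊ x ⌋ ≡ true → P
  dec (yes p) _ = p

∈-image⁺ : ∀ {f n} (φ : Fin f → Fin n) S u → u ∈ˢ S → φ u ∈ˢ image φ S
∈-image⁺ {f} φ S u p = ∈-tabulate⁺ _ (φ u) (any-intro (λ v → lookup S v ∧ ⌊ φ v Finₚ.≟ φ u ⌋) (List.allFin f) (∈-allFin u) (∧-intro p (dec (φ u Finₚ.≟ φ u) refl)))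
  where
  dec : ∀ {P : Set} (x : Dec P) → P → ⌊ x ⌋ ≡ true
  dec (yes _) _ = refl
  dec (no n) p = ⊥-elim (n p)

-- From the partitions of (♠) to patterns, and from tuples to copies.

module FromSpade (sr f : ℕ) (F : KGraph (suc sr) f) (i j : Fin (suc sr)) (E₁ E₂ : Subset f → Bool) (σ : Permutation′ f) (part : Partition (edge F) E₁ E₂) (van₁ : Vanishing (suc sr) E₁ σ) (van₂ : Vanishing (suc sr) E₂ σ)
  (cross : ∀ e₁ e₂ → T (E₁ e₁) → T (E₂ e₂) → ∣ e₁ ∩ e₂ ∣ ≡ sr → LType E₁ σ i (e₁ ∩ e₂) × LType E₂ σ j (e₁ ∩ e₂)) where
  open Ordered σ
  open Pattern sr f

  class-of : ∀ {E} (van : Vanishing (suc sr) E σ) (e : suc sr ⊑ f) ℓ → E (es e) ≡ true → toℕ (proj₁ van (es (d ℓ ⨟ e))) ≡ toℕ ℓ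
  class-of (c , h) e ℓ p = trans (cong (λ S → toℕ (c S)) (sym (es-remove e ℓ))) (trans (h (es e) (≡⇒T p) (vx e ℓ) (∈-es⁺ e ℓ)) (rank-es e ℓ))

  -- Being of type `ℓ` means that some edge places `S` in class `ℓ`; since `S` has only one class,
  -- the type determines it.
  type-class : ∀ {E} (van : Vanishing (suc sr) E σ) → (∀ S → E S ≡ true → ∣ S ∣ ≡ suc sr) → ∀ S → ∣ S ∣ ≡ sr → ∀ (ℓ : Fin (suc sr)) → LType E σ ℓ S → toℕ (proj₁ van S) ≡ toℕ ℓ
  type-class (c , h) size S cS ℓ (v , Ev , rk) = trans (cong (λ U → toℕ (c U)) (sym remove)) (trans (h (S ∪ ⁅ v ⁆) Ev v (∈-∪⁺ʳ S ⁅ v ⁆ v (∈-single⁺ v))) rk)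
    where
    v∉S : ¬ (v ∈ˢ S)
    v∉S p = ℕₚ.1+n≢n (trans (sym (size (S ∪ ⁅ v ⁆) (T⇒≡ Ev))) (trans (cong ∣_∣ (set-ext {S = S ∪ ⁅ v ⁆} {S} (λ w q → [ id , (λ r → subst (_∈ˢ S) (sym (∈-single⁻ w v r)) p) ]′ (∈-∪⁻ S ⁅ v ⁆ w q)) (λ w → ∈-∪⁺ˡ S ⁅ v ⁆ w))) cS))
    remove : (S ∪ ⁅ v ⁆) ∖ v ≡ S
    remove = set-ext (λ w q → let q₁ , ne = ∈-∖⁻ (S ∪ ⁅ v ⁆) v w q in [ id , (λ r → ⊥-elim (ne (∈-single⁻ w v r))) ]′ (∈-∪⁻ S ⁅ v ⁆ w q₁)) (λ w q → ∈-∖⁺ (S ∪ ⁅ v ⁆) v w (∈-∪⁺ˡ S ⁅ v ⁆ w q) (λ w≡v → v∉S (subst (_∈ˢ S) w≡v q)))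

  E₁⊆ : ∀ S → E₁ S ≡ true → ∣ S ∣ ≡ suc sr
  E₁⊆ S p = uniform F S (≡⇒T (trans (proj₁ (part S)) (∨-introˡ (E₂ S) p)))

  E₂⊆ : ∀ S → E₂ S ≡ true → ∣ S ∣ ≡ suc sr
  E₂⊆ S p = uniform F S (≡⇒T (trans (proj₁ (part S)) (∨-introʳ (E₁ S) p)))

  other : ∀ S → edge F S ≡ true → E₁ S ≡ false → E₂ S ≡ true
  other S p q = trans (cong (_∨ E₂ S) (sym q)) (trans (sym (proj₁ (part S))) p)

  -- The common facet is the whole intersection of the two edges, for otherwise they would coincide
  -- and lie on both sides of the partition. Then (♠) gives its types, and the classes force the
  -- roles.
  mixed : ∀ e e' ℓ ℓ' → E₁ (es e) ≡ true → E₂ (es e') ≡ true → d ℓ ⨟ e ≡ d ℓ' ⨟ e' → ℓ ≡ i × ℓ' ≡ j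
  mixed e e' ℓ ℓ' p p' q = Finₚ.toℕ-injective (trans (sym (class-of van₁ e ℓ p)) (type-class van₁ E₁⊆ S cS i (subst (LType E₁ σ i) meet (proj₁ types))))
                         , Finₚ.toℕ-injective (trans (sym (class-of van₂ e' ℓ' p')) (trans (cong (λ T → toℕ (proj₁ van₂ (es T))) (sym q)) (type-class van₂ E₂⊆ S cS j (subst (LType E₂ σ j) meet (proj₂ types)))))
    where
    S : Subset f
    S = es (d ℓ ⨟ e)
    cS : ∣ S ∣ ≡ sr
    cS = card-es (d ℓ ⨟ e)
    S⊆ : ∀ v → v ∈ˢ S → v ∈ˢ es e
    S⊆ v m = proj₁ (∈-∖⁻ (es e) (vx e ℓ) v (subst (v ∈ˢ_) (sym (es-remove e ℓ)) m))
    S≡' : S ≡ es e' ∖ vx e' ℓ'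
    S≡' = trans (cong es q) (sym (es-remove e' ℓ'))
    S⊆' : ∀ v → v ∈ˢ S → v ∈ˢ es e'
    S⊆' v m = proj₁ (∈-∖⁻ (es e') (vx e' ℓ') v (subst (v ∈ˢ_) S≡' m))
    apart : vx e ℓ ≢ vx e' ℓ'
    apart same = proj₂ (part (es e)) (≡⇒T p , ≡⇒T (subst (λ U → E₂ U ≡ true) (sym e≡e') p'))
      where
      e≡e' : es e ≡ es e'
      e≡e' = set-ext
        (λ v m → case v Finₚ.≟ vx e ℓ of λ { (yes r) → subst (_∈ˢ es e') (sym (trans r same)) (∈-es⁺ e' ℓ') ; (no r) → S⊆' v (subst (v ∈ˢ_) (es-remove e ℓ) (∈-∖⁺ (es e) (vx e ℓ) v m r)) })
        (λ v m → case v Finₚ.≟ vx e' ℓ' of λ { (yes r) → subst (_∈ˢ es e) (sym (trans r (sym same))) (∈-es⁺ e ℓ) ; (no r) → S⊆ v (subst (v ∈ˢ_) (sym S≡') (∈-∖⁺ (es e') (vx e' ℓ') v m r)) })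
    meet : es e ∩ es e' ≡ S
    meet = set-ext
      (λ v m → let m₁ , m₂ = ∈-∩⁻ (es e) (es e') v m in case v Finₚ.≟ vx e ℓ of λ
        { (no r) → subst (v ∈ˢ_) (es-remove e ℓ) (∈-∖⁺ (es e) (vx e ℓ) v m₁ r)
        ; (yes r) → subst (v ∈ˢ_) (sym S≡') (∈-∖⁺ (es e') (vx e' ℓ') v m₂ (λ r' → apart (trans (sym r) r'))) })
      (λ v m → ∈-∩⁺ (es e) (es e') v (S⊆ v m) (S⊆' v m))
    types : LType E₁ σ i (es e ∩ es e') × LType E₂ σ j (es e ∩ es e')
    types = cross (es e) (es e') (≡⇒T p) (≡⇒T p') (trans (cong ∣_∣ meet) cS)

  pattern-of : FPat i j
  FPat.inE pattern-of e = edge F (es e)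
  FPat.side pattern-of e = E₁ (es e)
  FPat.consistent pattern-of e e' p p' ℓ ℓ' q = go (E₁ (es e)) (E₁ (es e')) refl refl
    where
    same : ∀ {E} (van : Vanishing (suc sr) E σ) → E (es e) ≡ true → E (es e') ≡ true → ℓ ≡ ℓ'
    same van r r' = Finₚ.toℕ-injective (trans (sym (class-of van e ℓ r)) (trans (cong (λ T → toℕ (proj₁ van (es T))) q) (class-of van e' ℓ' r')))
    go : ∀ b b' → E₁ (es e) ≡ b → E₁ (es e') ≡ b' → (b ≡ b' × ℓ ≡ ℓ') ⊎ ((b ≡ true × b' ≡ false × ℓ ≡ i × ℓ' ≡ j) ⊎ (b ≡ false × b' ≡ true × ℓ ≡ j × ℓ' ≡ i))
    go true true r r' = inj₁ (refl , same van₁ r r')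
    go false false r r' = inj₁ (refl , same van₂ (other (es e) p r) (other (es e') p' r'))
    go true false r r' = let x , y = mixed e e' ℓ ℓ' r (other (es e') p' r') q in inj₂ (inj₁ (refl , refl , x , y))
    go false true r r' = let x , y = mixed e' e ℓ' ℓ r' (other (es e) p r) (sym q) in inj₂ (inj₂ (refl , refl , y , x))

  -- Vertex `v` goes to the entry of `y` at the position of `v` in `σ`; injectivity is the
  -- distinctness of the entries.
  contains : ∀ {n} (H : KGraph (suc sr) n) (y : Vec (Fin n) f) → distinct y ≡ true → (∀ e → edge F (es e) ≡ true → edge H (toSet (select e y)) ≡ true) → Contains F H
  contains H y dy hom = φ , (λ {u} {v} p → trans (sym (inverseˡ σ)) (trans (cong (σ ⟨$⟩ˡ_) (distinct-injective y dy (σ ⟨$⟩ʳ u) (σ ⟨$⟩ʳ v) p)) (inverseˡ σ))) , λ S p → go S p (thinning-of S (uniform F S p))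
    where
    φ : Fin f → Fin _
    φ v = lookup y (σ ⟨$⟩ʳ v)
    go : ∀ S → T (edge F S) → Σ[ e ∈ suc sr ⊑ f ] es e ≡ S → T (edge H (image φ S))
    go _ p (e , refl) = ≡⇒T (subst (λ U → edge H U ≡ true) (set-ext
      (λ w q → let t , r = ∈-toSet⁻ (select e y) w q in subst (_∈ˢ image φ (es e)) (trans (at t) r) (∈-image⁺ φ (es e) (vx e t) (∈-es⁺ e t)))
      (λ w q → let u , m , r = ∈-image⁻ φ (es e) w q ; t , s = ∈-es⁻ e u m in subst (_∈ˢ toSet (select e y)) (trans (sym (at t)) (trans (cong φ s) r)) (∈-toSet⁺ (select e y) t)))
      (hom e (T⇒≡ p)))
      where
      at : ∀ t → φ (vx e t) ≡ lookup (select e y) t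
      at t = trans (cong (lookup y) (σ-vx e t)) (sym (lookup-select e y t))

-- Box norms.

square-mean : ∀ {A : Set} (L : Lin A) → Mean L → ∀ (f : A → ℚ) → ∫ L f * ∫ L f ≤ ∫ L (λ a → f a * f a)
square-mean L mean f = ≤-by (sym eq) (∫≥0 L (λ a → sq≥0 (f a - m)))
  where
  m = ∫ L f
  l : ∀ x m → (x - m) * (x - m) ≡ (x * x + (- (m + m)) * x) + m * m
  l = solve-∀ ℛ
  l' : ∀ s m → (s + (- (m + m)) * m) + m * m ≡ s - m * m
  l' = solve-∀ ℛ
  eq : ∫ L (λ a → (f a - m) * (f a - m)) ≡ ∫ L (λ a → f a * f a) - m * m
  eq = trans (∫≡ L (λ a → l (f a) m)) (trans (∫+ L (λ a → f a * f a + (- (m + m)) * f a) (λ _ → m * m)) (trans (cong₂ _+_ (trans (∫+ L (λ a → f a * f a) (λ a → (- (m + m)) * f a)) (cong (∫ L (λ a → f a * f a) +_) (∫* L (- (m + m)) f))) (mean-const L mean (m * m))) (l' (∫ L (λ a → f a * f a)) m)))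

-- The power with exponent 2^K, by repeated squaring.
pow2 : ℕ → ℚ → ℚ
pow2 zero a = a
pow2 (suc K) a = pow2 K (a * a)

pow2-mono : ∀ K {a b} → 0ℚ ≤ a → a ≤ b → pow2 K a ≤ pow2 K b
pow2-mono zero p q = q
pow2-mono (suc K) {a} {b} p q = pow2-mono K {a * a} {b * b} (p ⊗ p) (*-mono {a} {b} {a} {b} p (≤-trans p q) q q)

pow2-pos : ∀ K {a} → 0ℚ < a → 0ℚ < pow2 K a
pow2-pos zero p = p
pow2-pos (suc K) p = pow2-pos K (*-pos p p)

pow2≥0 : ∀ K {a} → 0ℚ ≤ a → 0ℚ ≤ pow2 K a
pow2≥0 zero p = p
pow2≥0 (suc K) p = pow2≥0 K (p ⊗ p)

jensen : ∀ {A : Set} (L : Lin A) → Mean L → ∀ K (f : A → ℚ) → pow2 K (∫ L f) ≤ ∫ L (λ a → pow2 K (f a))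
jensen L mean zero f = ≤-refl
jensen L mean (suc K) f = ≤-trans (pow2-mono K {∫ L f * ∫ L f} {∫ L (λ a → f a * f a)} (sq≥0 (∫ L f)) (square-mean L mean f)) (jensen L mean K (λ a → f a * f a))

pow2-abs : ∀ K {a ε s} → 0ℚ < ε → pow2 (suc K) a ≤ s → s < pow2 (suc K) ε → Abs a ε
pow2-abs K {a} {ε} {s} ε>0 p q = [ (λ lt → contra q (≤-trans (pow2-mono (suc K) {ε} {a} (<⇒≤ ε>0) (<⇒≤ lt)) p)) , id ]′ (<-or-≤ ε a)
  , [ (λ lt → contra q (≤-trans (pow2-mono (suc K) {ε} { - a} (<⇒≤ ε>0) (≤-trans (≤-reflexive (n ε)) (neg-antimono-≤ (<⇒≤ lt)))) (≤-trans (≤-reflexive (cong (pow2 K) (sq a))) p))) , id ]′ (<-or-≤ a (- ε))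
  where
  n : ∀ e → e ≡ - (- e)
  n = solve-∀ ℛ
  sq : ∀ a → (- a) * (- a) ≡ a * a
  sq = solve-∀ ℛ

abs-* : ∀ {a b} → Abs a 1ℚ → Abs b 1ℚ → Abs (a * b) 1ℚ
abs-* {a} {b} (p , p') (q , q') = ≤-by (h₁ a b) (<⇒≤ 0<half ⊗ ((Δ {a} {1ℚ} p ⊗ Δ { - 1ℚ} {b} q') ⊕ (Δ { - 1ℚ} {a} p' ⊗ Δ {b} {1ℚ} q))) , ≤-by (h₂ a b) (<⇒≤ 0<half ⊗ ((Δ {a} {1ℚ} p ⊗ Δ {b} {1ℚ} q) ⊕ (Δ { - 1ℚ} {a} p' ⊗ Δ { - 1ℚ} {b} q')))
  where
  h₁ : ∀ a b → 1ℚ - a * b ≡ half * ((1ℚ - a) * (b - (- 1ℚ)) + (a - (- 1ℚ)) * (1ℚ - b))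
  h₁ = solve-∀ ℛ
  h₂ : ∀ a b → a * b - (- 1ℚ) ≡ half * ((1ℚ - a) * (1ℚ - b) + (a - (- 1ℚ)) * (b - (- 1ℚ)))
  h₂ = solve-∀ ℛ

module BoxNorm (n : ℕ) where
  open Disc n

  -- The 2^K-th power of the box norm: the mean of the product of `f` over all corners of a random
  -- box.
  Box : ∀ K → (Vec V K → ℚ) → ℚ
  Box zero f = f []
  Box (suc K) f = ∫ (avg n) (λ v → ∫ (avg n) (λ v' → Box K (λ x → f (v ∷ x) * f (v' ∷ x))))

  Indep : ∀ {K} → (Fin K → Vec V K → ℚ) → Set
  Indep U = ∀ t z z' → (∀ i → i ≢ t → lookup z i ≡ lookup z' i) → U t z ≡ U t z'

  Range : ∀ {K} → (Fin K → Vec V K → ℚ) → Set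
  Range U = ∀ t z → (0ℚ ≤ U t z) × (U t z ≤ 1ℚ)

  -- The Gowers-Cauchy-Schwarz inequality. `U zero` ignores the first coordinate, so one use of
  -- Cauchy-Schwarz removes it and doubles that coordinate. Jensen moves the remaining power inside
  -- the average over `v` and `v'`, where the induction applies.
  box-cs : ∀ K (f : Vec V K → ℚ) (U : Fin K → Vec V K → ℚ) → Indep U → Range U → pow2 K (∫ (𝔼 K) (λ z → f z * prodF K (λ t → U t z))) ≤ Box K f
  box-cs zero f U ind rng = ≤-reflexive (*-identityʳ (f []))
  box-cs (suc K) f U ind rng = ≤-trans (pow2-mono K {X * X} {Y} (sq≥0 X) X²≤Y)
      (≤-trans (jensen (avg n) (avg-mean n) K (λ v → ∫ (avg n) (λ v' → A v v')))
      (∫≤ (avg n) {λ v → pow2 K (∫ (avg n) (λ v' → A v v'))} {λ v → ∫ (avg n) (λ v' → Box K (λ x → f (v ∷ x) * f (v' ∷ x)))} (λ v → ≤-trans (jensen (avg n) (avg-mean n) K (λ v' → A v v'))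
        (∫≤ (avg n) {λ v' → pow2 K (A v v')} {λ v' → Box K (λ x → f (v ∷ x) * f (v' ∷ x))} (λ v' → box-cs K (λ x → f (v ∷ x) * f (v' ∷ x)) (U' v v') (ind' v v') (rng' v v'))))))
    where
    U' : V → V → Fin K → Vec V K → ℚ
    U' v v' t x = U (suc t) (v ∷ x) * U (suc t) (v' ∷ x)
    off : ∀ v t {x y : Vec V K} → (∀ i → i ≢ t → lookup x i ≡ lookup y i) → ∀ i → i ≢ suc t → lookup (v ∷ x) i ≡ lookup (v ∷ y) i
    off v t p zero _ = refl
    off v t p (suc i) ne = p i (ne ∘ cong suc)
    ind' : ∀ v v' → Indep (U' v v')
    ind' v v' t x y p = cong₂ _*_ (ind (suc t) (v ∷ x) (v ∷ y) (off v t p)) (ind (suc t) (v' ∷ x) (v' ∷ y) (off v' t p))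
    rng' : ∀ v v' → Range (U' v v')
    rng' v v' t x = (proj₁ (rng (suc t) (v ∷ x)) ⊗ proj₁ (rng (suc t) (v' ∷ x))) , *-mono {U (suc t) (v ∷ x)} {1ℚ} {U (suc t) (v' ∷ x)} {1ℚ} (proj₁ (rng (suc t) (v ∷ x))) 0≤1 (proj₂ (rng (suc t) (v ∷ x))) (proj₂ (rng (suc t) (v' ∷ x)))
    A : V → V → ℚ
    A v v' = ∫ (𝔼 K) (λ x → (f (v ∷ x) * f (v' ∷ x)) * prodF K (λ t → U' v v' t x))
    X Y : ℚ
    X = ∫ (𝔼 (suc K)) (λ z → f z * prodF (suc K) (λ t → U t z))
    Y = ∫ (avg n) (λ v → ∫ (avg n) (λ v' → A v v'))
    u₀ : Vec V K → ℚ
    u₀ x = U zero (zero ∷ x)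
    P : V → Vec V K → ℚ
    P v x = prodF K (λ t → U (suc t) (v ∷ x))
    g : V → Vec V K → ℚ
    g v x = f (v ∷ x) * P v x
    B : Vec V K → ℚ
    B x = ∫ (avg n) (λ v → g v x)
    X≡ : X ≡ ∫ (𝔼 K) (λ x → u₀ x * B x)
    X≡ = trans (∫≡ (avg n) (λ v → ∫≡ (𝔼 K) (λ x → trans (cong (λ u → f (v ∷ x) * (u * P v x)) (ind zero (v ∷ x) (zero ∷ x) (λ { zero ne → ⊥-elim (ne refl) ; (suc i) _ → refl }))) (l (f (v ∷ x)) (u₀ x) (P v x))))) (trans (linVec-swap (avg n) (avg-swap n) K (avg n) (λ v x → u₀ x * g v x)) (∫≡ (𝔼 K) (λ x → ∫* (avg n) (u₀ x) (λ v → g v x))))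
      where l : ∀ f u p → f * (u * p) ≡ u * (f * p)
            l = solve-∀ ℛ
    B² : ∀ x → B x * B x ≡ ∫ (avg n) (λ v → ∫ (avg n) (λ v' → g v x * g v' x))
    B² x = sym (trans (∫≡ (avg n) (λ v → ∫* (avg n) (g v x) (λ v' → g v' x))) (∫*ʳ (avg n) (B x) (λ v → g v x)))
    drop : ∀ x → (u₀ x * B x) * (u₀ x * B x) ≤ B x * B x
    drop x = ≤-trans (≤-reflexive (l (u₀ x) (B x))) (*≤ (B x * B x) (u₀ x * u₀ x) (sq≥0 (B x)) (*-mono {u₀ x} {1ℚ} {u₀ x} {1ℚ} (proj₁ (rng zero (zero ∷ x))) 0≤1 (proj₂ (rng zero (zero ∷ x))) (proj₂ (rng zero (zero ∷ x)))))
      where l : ∀ u b → (u * b) * (u * b) ≡ (b * b) * (u * u)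
            l = solve-∀ ℛ
    X²≤Y : X * X ≤ Y
    X²≤Y = ≤-trans (≤-reflexive (cong₂ _*_ X≡ X≡)) (≤-trans (square-mean (𝔼 K) (𝔼-mean K) (λ x → u₀ x * B x)) (≤-trans (∫≤ (𝔼 K) {λ x → (u₀ x * B x) * (u₀ x * B x)} {λ x → B x * B x} drop) (≤-reflexive
      (trans (∫≡ (𝔼 K) B²) (trans (avg-swap n (𝔼 K) (λ x v → ∫ (avg n) (λ v' → g v x * g v' x))) (∫≡ (avg n) (λ v → trans (avg-swap n (𝔼 K) (λ x v' → g v x * g v' x)) (∫≡ (avg n) (λ v' → ∫≡ (𝔼 K) (λ x → trans (l (f (v ∷ x)) (P v x) (f (v' ∷ x)) (P v' x)) (cong ((f (v ∷ x) * f (v' ∷ x)) *_) (sym (prodF-* K (λ t → U (suc t) (v ∷ x)) (λ t → U (suc t) (v' ∷ x)))))))))))))))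
      where l : ∀ f p f' p' → (f * p) * (f' * p') ≡ (f * f') * (p * p')
            l = solve-∀ ℛ

  box≥0 : ∀ K (f : Vec V (suc K) → ℚ) → 0ℚ ≤ Box (suc K) f
  box≥0 K f = ≤-trans (pow2≥0 K (sq≥0 (∫ (𝔼 (suc K)) (λ z → f z * prodF (suc K) (λ _ → 1ℚ))))) (box-cs (suc K) f (λ _ _ → 1ℚ) (λ _ _ _ _ → refl) (λ _ _ → 0≤1 , ≤-refl))

  -- Each factor of a test ignores one coordinate, so `box-cs` shows that the box norm dominates the
  -- cut norm.
  box-cutreg : ∀ R (f : Vec V (suc R) → ℚ) ε s → 0ℚ < ε → Box (suc R) f ≤ s → s < pow2 (suc R) ε → CutReg R f ε
  box-cutreg R f ε s ε>0 p q w = subst (λ a → Abs a ε) (∫≡ (𝔼 (suc R)) (λ z → cong (f z *_) (sym (⟦allF⟧ (suc R) (λ t → w t (select (d t) z)))))) (pow2-abs R ε>0 (≤-trans (box-cs (suc R) f U ind (λ t z → ⟦⟧≥0 (w t (select (d t) z)) , ⟦⟧≤1 (w t (select (d t) z)))) p) q)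
    where
    U : Fin (suc R) → Vec V (suc R) → ℚ
    U t z = ⟦ w t (select (d t) z) ⟧
    ind : Indep U
    ind t z z' h = cong (λ y → ⟦ w t y ⟧) (lookup-ext (λ i → trans (lookup-select (d t) z i) (trans (h (ix (d t) i) (d-avoids t i)) (sym (lookup-select (d t) z' i)))))

  cp : ∀ K → (Vec V K → ℚ) → Vec V K → Vec V K → ℚ
  cp zero f [] [] = f []
  cp (suc K) f (v ∷ x) (v' ∷ x') = cp K (λ y → f (v ∷ y) * f (v' ∷ y)) x x'

  -- The product over all corners except `x`; splitting this corner off isolates one random colour.
  cr : ∀ K → (Vec V K → ℚ) → Vec V K → Vec V K → ℚ
  cr zero f [] [] = 1ℚ
  cr (suc K) f (v ∷ x) (v' ∷ x') = f (v' ∷ x) * cr K (λ y → f (v ∷ y) * f (v' ∷ y)) x x'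

  box-cp : ∀ K f → Box K f ≡ ∫ (𝔼 K) (λ x → ∫ (𝔼 K) (λ x' → cp K f x x'))
  box-cp zero f = refl
  box-cp (suc K) f = ∫≡ (avg n) (λ v → trans (∫≡ (avg n) (λ v' → box-cp K (λ x → f (v ∷ x) * f (v' ∷ x)))) (linVec-swap (avg n) (avg-swap n) K (avg n) (λ v' x → ∫ (𝔼 K) (λ x' → cp K (λ y → f (v ∷ y) * f (v' ∷ y)) x x'))))

  cp-split : ∀ K f x x' → cp K f x x' ≡ f x * cr K f x x'
  cp-split zero f [] [] = sym (*-identityʳ (f []))
  cp-split (suc K) f (v ∷ x) (v' ∷ x') = trans (cp-split K (λ y → f (v ∷ y) * f (v' ∷ y)) x x') (*-assoc (f (v ∷ x)) (f (v' ∷ x)) _)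

  -- Every corner other than `x` takes at least one coordinate from `x'`, so only such arguments of
  -- `f` matter.
  cr-cong : ∀ K f f' x x' → (∀ y → Σ[ i ∈ Fin K ] lookup y i ≡ lookup x' i → f y ≡ f' y) → cr K f x x' ≡ cr K f' x x'
  cr-cong zero f f' [] [] p = refl
  cr-cong (suc K) f f' (v ∷ x) (v' ∷ x') p = cong₂ _*_ (p (v' ∷ x) (zero , refl)) (cr-cong K (λ y → f (v ∷ y) * f (v' ∷ y)) (λ y → f' (v ∷ y) * f' (v' ∷ y)) x x' (λ y (i , e) → cong₂ _*_ (p (v ∷ y) (suc i , e)) (p (v' ∷ y) (zero , refl))))

  cp-abs : ∀ K f x x' → (∀ y → Abs (f y) 1ℚ) → Abs (cp K f x x') 1ℚ
  cp-abs zero f [] [] p = p []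
  cp-abs (suc K) f (v ∷ x) (v' ∷ x') p = cp-abs K (λ y → f (v ∷ y) * f (v' ∷ y)) x x' (λ y → abs-* (p (v ∷ y)) (p (v' ∷ y)))

  private
    i₀ : ℚ
    i₀ = inv (ν (suc n))

  member≤ : ∀ {K} (x : Vec V K) → ∫ (avg n) (λ v → ⟦ not (notIn v x) ⟧) ≤ ν K * i₀
  member≤ [] = ≤-reflexive (trans (∫0 (avg n)) (sym (*-zeroˡ i₀)))
  member≤ {suc K} (b ∷ x) = ≤-trans (∫≤ (avg n) {λ v → ⟦ not (notIn v (b ∷ x)) ⟧} {λ v → ⟦ eqFin b v ⟧ + ⟦ not (notIn v x) ⟧} (λ v → subst (λ c → ⟦ not (notIn v (b ∷ x)) ⟧ ≤ ⟦ c ⟧ + ⟦ not (notIn v x) ⟧) (trans (not-not (eqFin v b)) (==-sym (finiteFin (suc n)) v b)) (⟦not∧⟧ (not (eqFin v b)) (notIn v x)))) (≤-trans (≤-reflexive (∫+ (avg n) (λ v → ⟦ eqFin b v ⟧) (λ v → ⟦ not (notIn v x) ⟧))) (≤-trans (+-mono-≤ (≤-reflexive (avg-eq n b)) (member≤ x)) (≤-reflexive (l (ν K) i₀))))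
    where l : ∀ m i → i + m * i ≡ (1ℚ + m) * i
          l = solve-∀ ℛ

  disj : ∀ {K m} → Vec V K → Vec V m → Bool
  disj {m = m} x x' = allF m (λ i → notIn (lookup x' i) x)

  meet≤ : ∀ {K} (x : Vec V K) m → ∫ (𝔼 m) (λ x' → ⟦ not (disj x x') ⟧) ≤ ν m * (ν K * i₀)
  meet≤ {K} x zero = ≤-reflexive (sym (*-zeroˡ (ν K * i₀)))
  meet≤ {K} x (suc m) = ≤-trans (∫≤ (avg n) {λ v → ∫ (𝔼 m) (λ x' → ⟦ not (disj x (v ∷ x')) ⟧)} {λ v → ⟦ not (notIn v x) ⟧ + W} (λ v → ≤-trans (∫≤ (𝔼 m) {λ x' → ⟦ not (disj x (v ∷ x')) ⟧} {λ x' → ⟦ not (notIn v x) ⟧ + ⟦ not (disj x x') ⟧} (λ x' → ⟦not∧⟧ (notIn v x) (disj x x'))) (≤-reflexive (trans (∫+ (𝔼 m) (λ _ → ⟦ not (notIn v x) ⟧) (λ x' → ⟦ not (disj x x') ⟧)) (cong (_+ W) (mean-const (𝔼 m) (𝔼-mean m) ⟦ not (notIn v x) ⟧))))))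
      (≤-trans (≤-reflexive (trans (∫+ (avg n) (λ v → ⟦ not (notIn v x) ⟧) (λ _ → W)) (cong (∫ (avg n) (λ v → ⟦ not (notIn v x) ⟧) +_) (mean-const (avg n) (avg-mean n) W)))) (≤-trans (+-mono-≤ (member≤ x) (meet≤ x m)) (≤-reflexive (l (ν m) (ν K * i₀)))))
    where
    W = ∫ (𝔼 m) (λ x' → ⟦ not (disj x x') ⟧)
    l : ∀ m i → i + m * i ≡ (1ℚ + m) * i
    l = solve-∀ ℛ

  -- For a random colouring of the sets, the corner x of a box meets the others only in other sets, so a box has mean zero unless x and x' intersect.
  module Colour (kk : ℕ) (inc : ∀ {K} → Vec V K → Bool) where
    Col : Set
    Col = Tree (Fin (suc kk)) (suc n)

    b : ℚ
    b = inv (ν (suc kk))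

    open Random (suc n) (λ _ → avg kk) (λ _ → avg-mean kk) (λ _ → avg-swap kk)

    θ : Fin (suc kk) → Fin (suc kk) → ℚ
    θ ℓ c = ⟦ eqFin ℓ c ⟧ - b

    F : ∀ {K} → Fin (suc kk) → Col → Vec V K → ℚ
    F ℓ χ y = ⟦ inc y ⟧ * θ ℓ (get χ (toSet y))

    ∫θ : ∀ ℓ → ∫ (avg kk) (θ ℓ) ≡ 0ℚ
    ∫θ ℓ = trans (∫- (avg kk) (λ c → ⟦ eqFin ℓ c ⟧) (λ _ → b)) (trans (cong₂ _-_ (avg-eq kk ℓ) (mean-const (avg kk) (avg-mean kk) b)) (+-inverseʳ b))

    F-abs : ∀ {K} ℓ χ (y : Vec V K) → Abs (F ℓ χ y) 1ℚ
    F-abs ℓ χ y = abs-* {⟦ inc y ⟧} {θ ℓ (get χ (toSet y))} (⟦⟧≤1 (inc y) , ≤-trans (neg-antimono-≤ 0≤1) (⟦⟧≥0 (inc y))) (≤-by (l₁ e b) (Δ {e} {1ℚ} (⟦⟧≤1 (eqFin ℓ (get χ (toSet y)))) ⊕ <⇒≤ b>0) , ≤-by (l₂ e b) (⟦⟧≥0 (eqFin ℓ (get χ (toSet y))) ⊕ Δ {b} {1ℚ} (inv≤1 (ν (suc kk)) (1≤ν kk))))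
      where
      e = ⟦ eqFin ℓ (get χ (toSet y)) ⟧
      b>0 : 0ℚ < b
      b>0 = inv-pos (ν (suc kk)) (ν-pos kk)
      l₁ : ∀ e b → 1ℚ - (e - b) ≡ (1ℚ - e) + b
      l₁ = solve-∀ ℛ
      l₂ : ∀ e b → (e - b) - (- 1ℚ) ≡ e + (1ℚ - b)
      l₂ = solve-∀ ℛ

    mean-zero : ∀ K ℓ (x x' : Vec V K) → disj x x' ≡ true → ∫ ℙ (λ χ → cp K (F ℓ χ) x x') ≡ 0ℚ
    mean-zero K ℓ x x' h = trans (∫≡ ℙ (λ χ → trans (cp-split K (F ℓ χ) x x') (l ⟦ inc x ⟧ (θ ℓ (get χ (toSet x))) (cr K (F ℓ χ) x x')))) (trans (factor (toSet x) (θ ℓ) Ψ indep) (trans (cong (_* ∫ ℙ Ψ) (∫θ ℓ)) (*-zeroˡ (∫ ℙ Ψ))))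
      where
      l : ∀ i t c → (i * t) * c ≡ t * (i * c)
      l = solve-∀ ℛ
      Ψ : Col → ℚ
      Ψ χ = ⟦ inc x ⟧ * cr K (F ℓ χ) x x'
      indep : ∀ χ c → Ψ (set χ (toSet x) c) ≡ Ψ χ
      indep χ c = cong (⟦ inc x ⟧ *_) (cr-cong K (F ℓ (set χ (toSet x) c)) (F ℓ χ) x x' (λ y (i , e) → cong (λ a → ⟦ inc y ⟧ * θ ℓ a) (get-set-other χ (toSet x) (toSet y) c (λ same →
        let i' , e' = ∈-toSet⁻ x (lookup x' i) (subst (lookup x' i ∈ˢ_) (sym same) (subst (_∈ˢ toSet y) e (∈-toSet⁺ y i))) in notIn-elim x (allF-elim K (λ i → notIn (lookup x' i) x) h i) i' e'))))

    -- Only pairs in which `x` meets `x'` contribute, each at most 1, and they are rare by `meet≤`.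
    mean-box : ∀ K ℓ → ∫ ℙ (λ χ → Box K (F ℓ χ)) ≤ ν K * (ν K * i₀)
    mean-box K ℓ = ≤-trans (≤-reflexive (trans (∫≡ ℙ (λ χ → box-cp K (F ℓ χ))) (trans (linVec-swap (avg n) (avg-swap n) K ℙ (λ χ x → ∫ (𝔼 K) (λ x' → cp K (F ℓ χ) x x'))) (∫≡ (𝔼 K) (λ x → linVec-swap (avg n) (avg-swap n) K ℙ (λ χ x' → cp K (F ℓ χ) x x'))))))
        (mean-≤ (𝔼 K) (𝔼-mean K) {λ x → ∫ (𝔼 K) (λ x' → ∫ ℙ (λ χ → cp K (F ℓ χ) x x'))} (λ x → ≤-trans (∫≤ (𝔼 K) {λ x' → ∫ ℙ (λ χ → cp K (F ℓ χ) x x')} {λ x' → ⟦ not (disj x x') ⟧} (λ x' → at x x' (disj x x') refl)) (meet≤ x K)))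
      where
      at : ∀ x x' c → disj x x' ≡ c → ∫ ℙ (λ χ → cp K (F ℓ χ) x x') ≤ ⟦ not c ⟧
      at x x' true h = ≤-reflexive (mean-zero K ℓ x x' h)
      at x x' false _ = mean-≤ ℙ ℙ-mean {λ χ → cp K (F ℓ χ) x x'} (λ χ → proj₁ (cp-abs K (F ℓ χ) x x' (F-abs ℓ χ)))

    sumFin-≥ : ∀ m (g : Fin m → ℚ) → (∀ i → 0ℚ ≤ g i) → ∀ i → g i ≤ ∫ (sumFin m) g
    sumFin-≥ (suc m) g p zero = ≤-trans (≤-reflexive (sym (+-identityʳ (g zero)))) (+-mono-≤ (≤-refl {g zero}) (∫≥0 (sumFin m) (p ∘ suc)))
    sumFin-≥ (suc m) g p (suc i) = ≤-trans (sumFin-≥ m (g ∘ suc) (p ∘ suc) i) (≤-trans (≤-reflexive (sym (+-identityˡ _))) (+-mono-≤ (p zero) (≤-refl {∫ (sumFin m) (g ∘ suc)})))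

    -- One colouring has to work for all colours: the first-moment bound is applied to the sum of
    -- the norms, and since they are non-negative each is at most the sum.
    good-colouring : ∀ R → Σ[ χ ∈ Col ] (∀ ℓ → Box (suc R) (F ℓ χ) ≤ ν (suc kk) * (ν (suc R) * (ν (suc R) * i₀)))
    good-colouring R = go (linTree-low (suc n) (λ _ → avg kk) (λ _ → avg-low kk) total)
      where
      B : ℚ
      B = ν (suc R) * (ν (suc R) * i₀)
      total : Col → ℚ
      total χ = ∫ (sumFin (suc kk)) (λ ℓ → Box (suc R) (F ℓ χ))
      total≤ : ∫ ℙ total ≤ ν (suc kk) * B
      total≤ = ≤-trans (≤-reflexive (sumFin-swap (suc kk) ℙ (λ χ ℓ → Box (suc R) (F ℓ χ)))) (≤-trans (∫≤ (sumFin (suc kk)) {λ ℓ → ∫ ℙ (λ χ → Box (suc R) (F ℓ χ))} {λ _ → B} (mean-box (suc R))) (≤-reflexive (trans (∫const (sumFin (suc kk)) B) (trans (cong (B *_) (sumFin-1 (suc kk))) (*-comm B (ν (suc kk)))))))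
      go : Σ[ χ ∈ Col ] total χ ≤ ∫ ℙ total → Σ[ χ ∈ Col ] (∀ ℓ → Box (suc R) (F ℓ χ) ≤ ν (suc kk) * B)
      go (χ , p) = χ , λ ℓ → ≤-trans (sumFin-≥ (suc kk) (λ ℓ → Box (suc R) (F ℓ χ)) (λ ℓ → box≥0 R (F ℓ χ)) ℓ) (≤-trans p total≤)

-- The random construction.

increasing-thin : ∀ {n k} (g : Fin k → Fin n) → (∀ t t' → toℕ t ℕ.< toℕ t' → toℕ (g t) ℕ.< toℕ (g t')) → Σ[ e ∈ k ⊑ n ] (∀ t → ix e t ≡ g t)
increasing-thin {zero} {zero} g p = done , λ ()
increasing-thin {zero} {suc k} g p = case g zero of λ ()
increasing-thin {suc n} {zero} g p = none , λ ()
increasing-thin {suc n} {suc k} g p = go (g zero) refl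
  where
  pr : (w : Fin (suc n)) → 0 ℕ.< toℕ w → Σ[ w' ∈ Fin n ] w ≡ suc w'
  pr (suc w) _ = w , refl
  lower : ∀ {j} (h : Fin j → Fin (suc n)) → (∀ t t' → toℕ t ℕ.< toℕ t' → toℕ (h t) ℕ.< toℕ (h t')) → (∀ t → 0 ℕ.< toℕ (h t)) → Σ[ e ∈ j ⊑ n ] (∀ t → suc (ix e t) ≡ h t)
  lower h q pos = let e , r = increasing-thin (λ t → proj₁ (pr (h t) (pos t))) (λ t t' lt → ℕₚ.≤-pred (subst₂ ℕ._<_ (cong toℕ (proj₂ (pr (h t) (pos t)))) (cong toℕ (proj₂ (pr (h t') (pos t')))) (q t t' lt))) in e , λ t → trans (cong suc (r t)) (sym (proj₂ (pr (h t) (pos t))))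
  go : ∀ w → g zero ≡ w → Σ[ e ∈ suc k ⊑ suc n ] (∀ t → ix e t ≡ g t)
  go zero q = let e , r = lower (g ∘ suc) (λ t t' lt → p (suc t) (suc t') (s≤s lt)) (λ t → ℕₚ.≤-<-trans z≤n (p zero (suc t) (s≤s z≤n))) in keep e , λ { zero → sym q ; (suc t) → r t }
  go (suc w) q = let e , r = lower g p (λ { zero → subst (λ v → 0 ℕ.< toℕ v) (sym q) (s≤s z≤n) ; (suc t) → ℕₚ.≤-<-trans z≤n (p zero (suc t) (s≤s z≤n)) }) in skip e , r

d-injective : ∀ {j} (ℓ ℓ' : Fin (suc j)) → d ℓ ≡ d ℓ' → ℓ ≡ ℓ'
d-injective ℓ ℓ' p with ℓ Finₚ.≟ ℓ'
... | yes q = q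
... | no q = let t , r = d-covers ℓ' ℓ q in ⊥-elim (d-avoids ℓ t (trans (cong (λ e → ix e t) p) r))

positions-select : ∀ {j m n} (e : j ⊑ m) (I : m ⊑ n) → positions (e ⨟ I) ≡ select e (positions I)
positions-select e I = lookup-ext (λ t → trans (lookup-positions (e ⨟ I) t) (trans (ix-⨟ e I t) (trans (sym (lookup-positions I (ix e t))) (sym (lookup-select e (positions I) t)))))

inK-tuples : ∀ {n} k j (G : Subset n → Bool) (z : Vec (Fin n) k) → distinct z ≡ true → inK k j G (toSet z) ≡ allL (λ τ → G (toSet (select τ z))) (thins j k)
inK-tuples k j G z dz = bool-ext
  (λ h → allL-intro _ (thins j k) (λ {τ} _ → inK-elim k j G (toSet z) h (toSet (select τ z)) (toSet-select⊆ τ z) (card-toSet (select τ z) (distinct-select τ z dz))))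
  (λ h → inK-intro k j G (toSet z) (card-toSet z dz) (λ U sub c → let τ , e = sub-select z U dz sub c in subst (λ U → G U ≡ true) e (allL-elim (λ τ → G (toSet (select τ z))) (thins j k) h (thins-complete τ))))

idP : ∀ {n} → Permutation′ n
idP = Data.Fin.Permutation.id

module Lower (r n : ℕ) where
  open Disc n
  open BoxNorm n

  R K k : ℕ
  R = suc r
  K = suc R
  k = suc K

  lt : Vec V 2 → Bool
  lt y = toℕ (lookup y zero) ℕ.<ᵇ toℕ (lookup y (suc zero))

  -- Monotonicity as a conjunction of tests on pairs of coordinates, the form that admissibility
  -- requires.
  inc : ∀ {m} → Vec V m → Bool
  inc {m} y = allL (λ T → lt (select T y)) (thins 2 m)

  lt-elim : ∀ {m} (T : 2 ⊑ m) (y : Vec V m) → lt (select T y) ≡ true → toℕ (lookup y (ix T zero)) ℕ.< toℕ (lookup y (ix T (suc zero)))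
  lt-elim T y h = subst₂ (λ a b → toℕ a ℕ.< toℕ b) (lookup-select T y zero) (lookup-select T y (suc zero)) (<ᵇ-elim _ _ h)

  lt-intro : ∀ {m} (T : 2 ⊑ m) (y : Vec V m) → toℕ (lookup y (ix T zero)) ℕ.< toℕ (lookup y (ix T (suc zero))) → lt (select T y) ≡ true
  lt-intro T y h = <ᵇ-intro (subst₂ (λ a b → toℕ a ℕ.< toℕ b) (sym (lookup-select T y zero)) (sym (lookup-select T y (suc zero))) h)

  inc-elim : ∀ {m} (y : Vec V m) → inc y ≡ true → ∀ t t' → toℕ t ℕ.< toℕ t' → toℕ (lookup y t) ℕ.< toℕ (lookup y t')
  inc-elim {m} y h t t' p = go (thin₂ t t' p)
    where
    go : Σ[ e ∈ 2 ⊑ m ] (ix e zero ≡ t × ix e (suc zero) ≡ t') → toℕ (lookup y t) ℕ.< toℕ (lookup y t')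
    go (e , refl , refl) = lt-elim e y (allL-elim (λ T → lt (select T y)) (thins 2 m) h (thins-complete e))

  inc-intro : ∀ {m} (y : Vec V m) → (∀ t t' → toℕ t ℕ.< toℕ t' → toℕ (lookup y t) ℕ.< toℕ (lookup y t')) → inc y ≡ true
  inc-intro {m} y p = allL-intro _ (thins 2 m) (λ {T} _ → lt-intro T y (p (ix T zero) (ix T (suc zero)) (ix-mono T zero (suc zero) (s≤s z≤n))))

  inc-select : ∀ {j m} (e : j ⊑ m) (y : Vec V m) → inc y ≡ true → inc (select e y) ≡ true
  inc-select e y h = inc-intro (select e y) (λ t t' p → subst₂ (λ a b → toℕ a ℕ.< toℕ b) (sym (lookup-select e y t)) (sym (lookup-select e y t')) (inc-elim y h (ix e t) (ix e t') (ix-mono e t t' p)))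

  inc-positions : ∀ {m} (e : m ⊑ suc n) → inc (positions e) ≡ true
  inc-positions e = inc-intro (positions e) (λ t t' p → subst₂ (λ a b → toℕ a ℕ.< toℕ b) (sym (lookup-positions e t)) (sym (lookup-positions e t')) (ix-mono e t t' p))

  inc-thin : ∀ {m} (z : Vec V m) → inc z ≡ true → Σ[ e ∈ m ⊑ suc n ] positions e ≡ z
  inc-thin z h = let e , p = increasing-thin (lookup z) (inc-elim z h) in e , lookup-ext (λ t → trans (lookup-positions e t) (p t))

  inc-distinct : ∀ {m} (z : Vec V m) → inc z ≡ true → distinct z ≡ true
  inc-distinct z h = let e , p = inc-thin z h in subst (λ z → distinct z ≡ true) p (positions-distinct e)

  open Colour K inc using (Col; b; θ; F; good-colouring)
  open Ordered {suc n} idP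

  module Graph (χ : Col) where
    ok : Subset (suc n) → Fin (suc n) → Bool
    ok S v = not (lookup S v) ∨ (toℕ (get χ (S ∖ v)) ℕ.≡ᵇ rank idP S v)

    H : KGraph k (suc n)
    edge H S = (∣ S ∣ ℕ.≡ᵇ k) ∧ allF (suc n) (ok S)
    uniform H S p = ℕₚ.≡ᵇ⇒≡ ∣ S ∣ k (≡⇒T (∧ˡ (∣ S ∣ ℕ.≡ᵇ k) (allF (suc n) (ok S)) (T⇒≡ p)))

    edge-colour : ∀ S v → edge H S ≡ true → v ∈ˢ S → toℕ (get χ (S ∖ v)) ≡ rank idP S v
    edge-colour S v p q = go (lookup S v) q (allF-elim (suc n) (ok S) (∧ʳ (∣ S ∣ ℕ.≡ᵇ k) (allF (suc n) (ok S)) p) v)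
      where
      go : ∀ c → c ≡ true → not c ∨ (toℕ (get χ (S ∖ v)) ℕ.≡ᵇ rank idP S v) ≡ true → toℕ (get χ (S ∖ v)) ≡ rank idP S v
      go true _ h = ℕₚ.≡ᵇ⇒≡ (toℕ (get χ (S ∖ v))) (rank idP S v) (≡⇒T h)

    A : Fin k → Vec V k → Bool
    A ℓ z = eqFin ℓ (get χ (toSet (select (d ℓ) z)))

    edge-es : ∀ (e : k ⊑ suc n) → edge H (es e) ≡ allF k (λ ℓ → eqFin ℓ (get χ (es (d ℓ ⨟ e))))
    edge-es e = bool-ext
      (λ h → allF-intro k (λ ℓ → eqFin ℓ (get χ (es (d ℓ ⨟ e)))) (λ ℓ → subst (λ c → eqFin ℓ c ≡ true) (Finₚ.toℕ-injective (sym (trans (cong (λ S → toℕ (get χ S)) (sym (es-remove e ℓ))) (trans (edge-colour (es e) (vx e ℓ) h (∈-es⁺ e ℓ)) (rank-es e ℓ))))) (==-refl (finiteFin k) ℓ)))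
      (λ h → ∧-intro (T⇒≡ (ℕₚ.≡⇒≡ᵇ ∣ es e ∣ k (card-es e))) (allF-intro (suc n) (ok (es e)) (λ v → go h v (lookup (es e) v) refl)))
      where
      go : allF k (λ ℓ → eqFin ℓ (get χ (es (d ℓ ⨟ e)))) ≡ true → ∀ v c → lookup (es e) v ≡ c → not c ∨ (toℕ (get χ (es e ∖ v)) ℕ.≡ᵇ rank idP (es e) v) ≡ true
      go h v false _ = refl
      go h v true q = go' (∈-es⁻ e v q)
        where
        go' : Σ[ t ∈ Fin k ] vx e t ≡ v → (toℕ (get χ (es e ∖ v)) ℕ.≡ᵇ rank idP (es e) v) ≡ true
        go' (ℓ , refl) = T⇒≡ (ℕₚ.≡⇒≡ᵇ (toℕ (get χ (es e ∖ vx e ℓ))) (rank idP (es e) (vx e ℓ)) (trans (cong (λ S → toℕ (get χ S)) (es-remove e ℓ)) (trans (cong toℕ (sym (eqFin⇒≡ ℓ (get χ (es (d ℓ ⨟ e))) (allF-elim k (λ ℓ → eqFin ℓ (get χ (es (d ℓ ⨟ e)))) h ℓ)))) (sym (rank-es e ℓ)))))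

    edge-tuple : ∀ z → inc z ≡ true → edge H (toSet z) ≡ allF k (λ ℓ → A ℓ z)
    edge-tuple z h = go (inc-thin z h)
      where
      go : Σ[ e ∈ k ⊑ suc n ] positions e ≡ z → edge H (toSet z) ≡ allF k (λ ℓ → A ℓ z)
      go (e , refl) = trans (edge-es e) (bool-ext (λ p → allF-intro k (λ ℓ → A ℓ (positions e)) (λ ℓ → trans (sym (at ℓ)) (allF-elim k (λ ℓ → eqFin ℓ (get χ (es (d ℓ ⨟ e)))) p ℓ))) (λ p → allF-intro k (λ ℓ → eqFin ℓ (get χ (es (d ℓ ⨟ e)))) (λ ℓ → trans (at ℓ) (allF-elim k (λ ℓ → A ℓ (positions e)) p ℓ))))
        where
        at : ∀ ℓ → eqFin ℓ (get χ (es (d ℓ ⨟ e))) ≡ A ℓ (positions e)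
        at ℓ = cong (λ y → eqFin ℓ (get χ (toSet y))) (positions-select (d ℓ) e)

    module Dens (G : Subset (suc n) → Bool) (ε : ℚ) (ε≥0 : 0ℚ ≤ ε) (reg : ∀ ℓ → CutReg R (F ℓ χ) ε) where
      -- The order of the facet `d ℓ` is split off because `F ℓ` contains it already. For k = 3 this
      -- facet is itself a pair, and its order is not a test on fewer coordinates.
      Splits : (Vec V k → Bool) → Fin k → Set
      Splits X ℓ = Σ[ X' ∈ (Vec V k → Bool) ] (Adm (d ℓ) X' × (∀ z → X z ≡ inc (select (d ℓ) z) ∧ X' z))
      b>0 : 0ℚ < b
      b>0 = inv-pos (ν k) (ν-pos K)
      b≤1 : b ≤ 1ℚ
      b≤1 = inv≤1 (ν k) (1≤ν K)
      GG : Vec V k → Bool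
      GG z = allL (λ τ → G (toSet (select τ z))) (thins R k)
      X₀ : Vec V k → Bool
      X₀ z = inc z ∧ GG z
      ltb : ∀ ℓ (T : 2 ⊑ k) → (Σ[ δ ∈ K ⊑ 2 ] d ℓ ≡ δ ⨟ T) ⊎ (Σ[ τ ∈ R ⊑ K ] Cov (d ℓ) T τ) → Vec V k → Bool
      ltb ℓ T (inj₁ _) z = true
      ltb ℓ T (inj₂ _) z = lt (select T z)
      adm-ltb : ∀ ℓ T s → Adm (d ℓ) (ltb ℓ T s)
      adm-ltb ℓ T (inj₁ _) = adm-true (d ℓ)
      adm-ltb ℓ T (inj₂ (τ , c)) = adm-dep c lt
      ordered₂ : ∀ (a b : Fin 2) → toℕ a ℕ.< toℕ b → (a ≡ zero) × (b ≡ suc zero)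
      ordered₂ zero (suc zero) p = refl , refl
      ordered₂ (suc zero) (suc zero) (s≤s ())
      good-base : ∀ ℓ → Splits X₀ ℓ
      good-base ℓ = X' , adm-∧ (d ℓ) LT GG (adm-all (d ℓ) (λ T → ltb ℓ T (cov-diff (d ℓ) T)) (thins 2 k) (λ {T} _ → adm-ltb ℓ T (cov-diff (d ℓ) T))) (adm-all (d ℓ) (λ τ z → G (toSet (select τ z))) (thins R k) (λ {τ} _ → adm-dep (proj₂ (cov-small (d ℓ) τ ℕₚ.≤-refl (ℕₚ.n≤1+n R))) (λ y → G (toSet y)))) , eq
        where
        LT X' : Vec V k → Bool
        LT z = allL (λ T → ltb ℓ T (cov-diff (d ℓ) T) z) (thins 2 k)
        X' z = LT z ∧ GG z
        down : ∀ T s z → lt (select T z) ≡ true → ltb ℓ T s z ≡ true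
        down T (inj₁ _) z p = refl
        down T (inj₂ _) z p = p
        up : ∀ T s z → inc (select (d ℓ) z) ≡ true → ltb ℓ T s z ≡ true → lt (select T z) ≡ true
        up T (inj₂ _) z h p = p
        up T (inj₁ (δ , q)) z h p = lt-intro T z (subst₂ (λ a b → toℕ a ℕ.< toℕ b) (at zero (proj₁ o)) (at (suc zero) (proj₂ o)) (inc-elim (select (d ℓ) z) h zero (suc zero) (s≤s z≤n)))
          where
          o = ordered₂ (ix δ zero) (ix δ (suc zero)) (ix-mono δ zero (suc zero) (s≤s z≤n))
          at : ∀ t {c} → ix δ t ≡ c → lookup (select (d ℓ) z) t ≡ lookup z (ix T c)
          at t refl = trans (lookup-select (d ℓ) z t) (cong (lookup z) (trans (cong (λ e → ix e t) q) (ix-⨟ δ T t)))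
        eq : ∀ z → X₀ z ≡ inc (select (d ℓ) z) ∧ X' z
        eq z = bool-ext
          (λ h → let hi = ∧ˡ (inc z) (GG z) h in ∧-intro (inc-select (d ℓ) z hi) (∧-intro (allL-intro _ (thins 2 k) (λ {T} _ → down T (cov-diff (d ℓ) T) z (allL-elim (λ T → lt (select T z)) (thins 2 k) hi (thins-complete T)))) (∧ʳ (inc z) (GG z) h)))
          (λ h → let hx = ∧ʳ (inc (select (d ℓ) z)) (X' z) h in ∧-intro (allL-intro _ (thins 2 k) (λ {T} _ → up T (cov-diff (d ℓ) T) z (∧ˡ (inc (select (d ℓ) z)) (X' z) h) (allL-elim _ (thins 2 k) (∧ˡ (LT z) (GG z) hx) (thins-complete T)))) (∧ʳ (LT z) (GG z) hx))
      good-∧ : ∀ X ℓ ℓ' → ℓ ≢ ℓ' → Splits X ℓ' → Splits (λ z → X z ∧ A ℓ z) ℓ'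
      good-∧ X ℓ ℓ' ne (X' , adm , eq) = (λ z → X' z ∧ A ℓ z) , adm-∧ (d ℓ') X' (A ℓ) adm (admA (cov-diff (d ℓ') (d ℓ))) , λ z → trans (cong (_∧ A ℓ z) (eq z)) (Boolₚ.∧-assoc (inc (select (d ℓ') z)) (X' z) (A ℓ z))
        where
        admA : (Σ[ δ ∈ K ⊑ K ] d ℓ' ≡ δ ⨟ d ℓ) ⊎ (Σ[ τ ∈ R ⊑ K ] Cov (d ℓ') (d ℓ) τ) → Adm (d ℓ') (A ℓ)
        admA (inj₁ (δ , q)) = ⊥-elim (ne (sym (d-injective ℓ' ℓ (trans q (trans (cong (_⨟ d ℓ) (id-unique δ)) (⨟-idˡ (d ℓ)))))))
        admA (inj₂ (τ , c)) = adm-dep c (λ y → eqFin ℓ (get χ (toSet y)))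
      one : ∀ X ℓ → Splits X ℓ → - ε ≤ ∫ (𝔼 k) (λ z → ⟦ X z ⟧ * (⟦ A ℓ z ⟧ - b))
      one X ℓ (X' , adm , eq) = ≤-trans (proj₂ (cut-lift {F = F ℓ χ} {ε = ε} {X = X'} (d ℓ) (reg ℓ) adm)) (≤-reflexive (∫≡ (𝔼 k) (λ z → sym (trans (cong (λ c → ⟦ c ⟧ * (⟦ A ℓ z ⟧ - b)) (eq z)) (trans (cong (_* (⟦ A ℓ z ⟧ - b)) (⟦∧⟧ (inc (select (d ℓ) z)) (X' z))) (l ⟦ inc (select (d ℓ) z) ⟧ ⟦ X' z ⟧ (⟦ A ℓ z ⟧ - b)))))))
        where l : ∀ i x t → (i * x) * t ≡ (i * t) * x
              l = solve-∀ ℛ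
      -- Telescoping: one face condition at a time is replaced by its probability `b`. The
      -- conditions on the other faces are tests for the current one, so each replacement costs at
      -- most `ε`.
      tele : ∀ l → Unique l → ∀ X → (∀ {ℓ} → ℓ ∈ l → Splits X ℓ) → - (ν (length l) * ε) ≤ ∫ (𝔼 k) (λ z → ⟦ X z ⟧ * (⟦ allL (λ ℓ → A ℓ z) l ⟧ - b ^ℚ length l))
      tele [] _ X _ = ≤-reflexive (trans (l ε) (sym (trans (∫≡ (𝔼 k) (λ z → l' ⟦ X z ⟧)) (∫0 (𝔼 k)))))
        where
        l : ∀ e → - (0ℚ * e) ≡ 0ℚ
        l = solve-∀ ℛ
        l' : ∀ x → x * (1ℚ - 1ℚ) ≡ 0ℚ
        l' = solve-∀ ℛ
      tele (ℓ ∷ l) (ne ∷ u) X good = ≤-trans (≤-by (l₂ I₁ I₂ (ν m) ε B) ((Δ { - (ν m * ε)} {I₁} (tele l u (λ z → X z ∧ A ℓ z) (λ {ℓ'} p → good-∧ X ℓ ℓ' (All.lookup ne p) (good (there p)))) ⊕ (B≥0 ⊗ Δ { - ε} {I₂} (one X ℓ (good (here refl))))) ⊕ (Δ {B} {1ℚ} B≤1 ⊗ ε≥0)))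
          (≤-reflexive (sym (trans (∫≡ (𝔼 k) (λ z → split z)) (trans (∫+ (𝔼 k) (λ z → ⟦ X z ∧ A ℓ z ⟧ * (⟦ allL (λ ℓ → A ℓ z) l ⟧ - B)) (λ z → B * (⟦ X z ⟧ * (⟦ A ℓ z ⟧ - b)))) (cong (I₁ +_) (∫* (𝔼 k) B (λ z → ⟦ X z ⟧ * (⟦ A ℓ z ⟧ - b))))))))
        where
        m = length l
        B = b ^ℚ m
        B≥0 : 0ℚ ≤ B
        B≥0 = ^ℚ≥0 m (<⇒≤ b>0)
        B≤1 : B ≤ 1ℚ
        B≤1 = ^ℚ≤1 m (<⇒≤ b>0) b≤1
        I₁ I₂ : ℚ
        I₁ = ∫ (𝔼 k) (λ z → ⟦ X z ∧ A ℓ z ⟧ * (⟦ allL (λ ℓ → A ℓ z) l ⟧ - B))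
        I₂ = ∫ (𝔼 k) (λ z → ⟦ X z ⟧ * (⟦ A ℓ z ⟧ - b))
        l₂ : ∀ I J m e B → (I + B * J) - (- ((1ℚ + m) * e)) ≡ ((I - (- (m * e))) + B * (J - (- e))) + (1ℚ - B) * e
        l₂ = solve-∀ ℛ
        l₁ : ∀ x a c b B → x * (a * c - b * B) ≡ (x * a) * (c - B) + B * (x * (a - b))
        l₁ = solve-∀ ℛ
        split : ∀ z → ⟦ X z ⟧ * (⟦ A ℓ z ∧ allL (λ ℓ → A ℓ z) l ⟧ - b * B) ≡ ⟦ X z ∧ A ℓ z ⟧ * (⟦ allL (λ ℓ → A ℓ z) l ⟧ - B) + B * (⟦ X z ⟧ * (⟦ A ℓ z ⟧ - b))
        split z = trans (cong (λ c → ⟦ X z ⟧ * (c - b * B)) (⟦∧⟧ (A ℓ z) (allL (λ ℓ → A ℓ z) l))) (trans (l₁ ⟦ X z ⟧ ⟦ A ℓ z ⟧ ⟦ allL (λ ℓ → A ℓ z) l ⟧ b B) (cong (λ c → c * (⟦ allL (λ ℓ → A ℓ z) l ⟧ - B) + B * (⟦ X z ⟧ * (⟦ A ℓ z ⟧ - b))) (sym (⟦∧⟧ (X z) (A ℓ z)))))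
      α : ℚ
      α = b ^ℚ k
      mean-surplus : - (ν k * ε) ≤ ∫ (𝔼 k) (λ z → ⟦ X₀ z ⟧ * (⟦ allF k (λ ℓ → A ℓ z) ⟧ - α))
      mean-surplus = subst (λ m → - (ν m * ε) ≤ ∫ (𝔼 k) (λ z → ⟦ X₀ z ⟧ * (⟦ allF k (λ ℓ → A ℓ z) ⟧ - b ^ℚ m))) (Listₚ.length-tabulate {n = k} id) (≤-trans (tele (List.allFin k) (Uniqueₚ.allFin⁺ k) X₀ (λ {ℓ} _ → good-base ℓ)) (≤-reflexive (∫≡ (𝔼 k) (λ z → cong (λ c → ⟦ X₀ z ⟧ * (⟦ c ⟧ - b ^ℚ length (List.allFin k))) (bool-ext (λ h → allF-intro k _ (λ ℓ → allL-elim (λ ℓ → A ℓ z) (List.allFin k) h (∈-allFin ℓ))) (λ h → allL-intro _ (List.allFin k) (λ {ℓ} _ → allF-elim k (λ ℓ → A ℓ z) h ℓ)))))))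
      Z : Vec V k → Bool
      Z z = inc z ∧ inK k R G (toSet z)
      -- A set has exactly one increasing enumeration, so no factorial appears.
      to-tuples : ∀ (φ : Subset (suc n) → ℚ) → ∫ (∑S (suc n)) (λ S → ⟦ inK k R G S ⟧ * φ S) ≡ ν (suc n) ^ℚ k * ∫ (𝔼 k) (λ z → ⟦ Z z ⟧ * φ (toSet z))
      to-tuples φ = trans (sym (sum-by (finiteTuple (suc n) k) (finiteS (suc n)) (∑S-swap (suc n)) Z toSet (inK k R G) φ (λ z p → ∧ʳ (inc z) (inK k R G (toSet z)) p) bwd inj)) (sum-avg n k (λ z → ⟦ Z z ⟧ * φ (toSet z)))
        where
        bwd : ∀ S → inK k R G S ≡ true → Σ[ z ∈ Vec V k ] (Z z ≡ true × toSet z ≡ S)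
        bwd S p = let e , q = enumerate S (inK-card k R G S p) in positions e , ∧-intro (inc-positions e) (trans (cong (inK k R G) q) p) , q
        inj : ∀ z z' → Z z ≡ true → Z z' ≡ true → toSet z ≡ toSet z' → z ≡ z'
        inj z z' p p' = go (inc-thin z (∧ˡ (inc z) _ p)) (inc-thin z' (∧ˡ (inc z') _ p'))
          where
          go : Σ[ e ∈ k ⊑ suc n ] positions e ≡ z → Σ[ e ∈ k ⊑ suc n ] positions e ≡ z' → toSet z ≡ toSet z' → z ≡ z'
          go (e , refl) (e' , refl) q = cong positions (thin-range e e' (range e e' q) (range e' e (sym q)))
            where
            range : ∀ (e e' : k ⊑ suc n) → toSet (positions e) ≡ toSet (positions e') → ∀ i → Σ[ j ∈ Fin k ] ix e' j ≡ ix e i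
            range e e' q i = let j , s = ∈-toSet⁻ (positions e') (lookup (positions e) i) (subst (lookup (positions e) i ∈ˢ_) q (∈-toSet⁺ (positions e) i)) in j , trans (sym (lookup-positions e' j)) (trans s (lookup-positions e i))
      surplus≥ : ∀ m → ν k * ε ≤ m → - (m * ν (suc n) ^ℚ k) ≤ ∫ (∑S (suc n)) (λ S → ⟦ inK k R G S ⟧ * (⟦ edge H S ⟧ - α))
      surplus≥ m p = ≤-trans (≤-by (l (ν (suc n) ^ℚ k) m (ν k * ε) E) (^ℚ≥0 k (ν≥0 (suc n)) ⊗ (Δ {ν k * ε} {m} p ⊕ Δ { - (ν k * ε)} {E} mean-surplus))) (≤-reflexive (sym (trans (to-tuples (λ S → ⟦ edge H S ⟧ - α)) (cong (ν (suc n) ^ℚ k *_) (∫≡ (𝔼 k) (λ z → at z (inc z) refl))))))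
        where
        E = ∫ (𝔼 k) (λ z → ⟦ X₀ z ⟧ * (⟦ allF k (λ ℓ → A ℓ z) ⟧ - α))
        l : ∀ N m e E → N * E - (- (m * N)) ≡ N * ((m - e) + (E - (- e)))
        l = solve-∀ ℛ
        at : ∀ z c → inc z ≡ c → ⟦ c ∧ inK k R G (toSet z) ⟧ * (⟦ edge H (toSet z) ⟧ - α) ≡ ⟦ c ∧ GG z ⟧ * (⟦ allF k (λ ℓ → A ℓ z) ⟧ - α)
        at z false q = trans (*-zeroˡ (⟦ edge H (toSet z) ⟧ - α)) (sym (*-zeroˡ (⟦ allF k (λ ℓ → A ℓ z) ⟧ - α)))
        at z true q = cong₂ (λ x y → ⟦ x ⟧ * (⟦ y ⟧ - α)) (inK-tuples k R G z (inc-distinct z q)) (edge-tuple z q)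

card-image : ∀ {f n} (φ : Fin f → Fin n) → (∀ u v → φ u ≡ φ v → u ≡ v) → ∀ S → ∣ image φ S ∣ ≡ ∣ S ∣
card-image φ inj S = go (enumerate S refl)
  where
  go : Σ[ e ∈ ∣ S ∣ ⊑ _ ] toSet (positions e) ≡ S → ∣ image φ S ∣ ≡ ∣ S ∣
  go (e , p) = trans (cong ∣_∣ same) (card-toSet (tabulate g) (distinct-tabulate g (λ t t' q → ix-injective e t t' (inj (ix e t) (ix e t') q))))
    where
    g : Fin ∣ S ∣ → Fin _
    g t = φ (ix e t)
    same : image φ S ≡ toSet (tabulate g)
    same = set-ext
      (λ w q → let u , m , r = ∈-image⁻ φ S w q ; t , s = ∈-toSet⁻ (positions e) u (subst (u ∈ˢ_) (sym p) m) in subst (_∈ˢ toSet (tabulate g)) (trans (lookup∘tabulate g t) (trans (cong φ (trans (sym (lookup-positions e t)) s)) r)) (∈-toSet⁺ (tabulate g) t))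
      (λ w q → let t , r = ∈-toSet⁻ (tabulate g) w q in subst (_∈ˢ image φ S) (trans (sym (lookup∘tabulate g t)) r) (∈-image⁺ φ S (ix e t) (subst (ix e t ∈ˢ_) p (subst (_∈ˢ toSet (positions e)) (lookup-positions e t) (∈-toSet⁺ (positions e) t)))))

-- Sorting the image of an embedding orders the vertices of its source; this `σ` is the candidate
-- for a vanishing ordering.
sort-by : ∀ {f n} (φ : Fin f → Fin n) → (∀ u v → φ u ≡ φ v → u ≡ v) → Σ[ σ ∈ Permutation′ f ] Σ[ e ∈ f ⊑ n ] (∀ v → ix e (σ ⟨$⟩ʳ v) ≡ φ v)
sort-by {f} {n} φ inj = go (enumerate S (card-toSet (tabulate φ) (distinct-tabulate φ inj)))
  where
  S : Subset n
  S = toSet (tabulate φ)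
  go : Σ[ e ∈ f ⊑ n ] toSet (positions e) ≡ S → Σ[ σ ∈ Permutation′ f ] Σ[ e ∈ f ⊑ n ] (∀ v → ix e (σ ⟨$⟩ʳ v) ≡ φ v)
  go (e , p) = permutation s t (λ y → ix-injective e (s (t y)) y (trans (s-at (t y)) (t-at y))) (λ x → inj (t (s x)) x (trans (t-at (s x)) (s-at x))) , e , s-at
    where
    s∈ : ∀ v → Σ[ i ∈ Fin f ] lookup (positions e) i ≡ φ v
    s∈ v = ∈-toSet⁻ (positions e) (φ v) (subst (φ v ∈ˢ_) (sym p) (subst (_∈ˢ S) (lookup∘tabulate φ v) (∈-toSet⁺ (tabulate φ) v)))
    s t : Fin f → Fin f
    s v = proj₁ (s∈ v)
    s-at : ∀ v → ix e (s v) ≡ φ v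
    s-at v = trans (sym (lookup-positions e (s v))) (proj₂ (s∈ v))
    t∈ : ∀ i → Σ[ u ∈ Fin f ] lookup (tabulate φ) u ≡ ix e i
    t∈ i = ∈-toSet⁻ (tabulate φ) (ix e i) (subst (ix e i ∈ˢ_) p (subst (_∈ˢ toSet (positions e)) (lookup-positions e i) (∈-toSet⁺ (positions e) i)))
    t i = proj₁ (t∈ i)
    t-at : ∀ i → φ (t i) ≡ ix e i
    t-at i = trans (sym (lookup∘tabulate φ (t i))) (proj₂ (t∈ i))

image-∖ : ∀ {f n} (φ : Fin f → Fin n) → (∀ u v → φ u ≡ φ v → u ≡ v) → ∀ S v → image φ (S ∖ v) ≡ image φ S ∖ φ v
image-∖ φ inj S v = set-ext
  (λ w p → let u , m , q = ∈-image⁻ φ (S ∖ v) w p ; m' , ne = ∈-∖⁻ S v u m in subst (_∈ˢ (image φ S ∖ φ v)) q (∈-∖⁺ (image φ S) (φ v) (φ u) (∈-image⁺ φ S u m') (λ r → ne (inj u v r))))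
  (λ w p → let m , ne = ∈-∖⁻ (image φ S) (φ v) w p ; u , m' , q = ∈-image⁻ φ S w m in subst (_∈ˢ image φ (S ∖ v)) q (∈-image⁺ φ (S ∖ v) u (∈-∖⁺ S v u m' (λ u≡v → ne (trans (sym q) (cong φ u≡v))))))

-- Pulling the colouring back along a copy of F, in the order induced by the copy, would give a vanishing ordering.
graph-free : ∀ r n χ {f} (F : KGraph (Lower.k r n) f) → Club F → Free F (Lower.Graph.H r n χ)
graph-free r n χ {f} F club (φ , inj , hom) = go (sort-by φ inj')
  where
  open Lower r n
  open Graph χ
  inj' : ∀ u v → φ u ≡ φ v → u ≡ v
  inj' u v = inj
  go : Σ[ σ ∈ Permutation′ f ] Σ[ e ∈ f ⊑ suc n ] (∀ v → ix e (σ ⟨$⟩ʳ v) ≡ φ v) → ⊥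
  go (σ , e , σ-at) = club (σ , (λ S → get χ (image φ S)) , van)
    where
    ranks : ∀ S v → rank idP (image φ S) (φ v) ≡ rank σ S v
    ranks S v = trans (cong ∣_∣ same) (card-image φ inj' (S ∩ tabulate before))
      where
      before : Fin f → Bool
      before u = toℕ (σ ⟨$⟩ʳ u) ℕ.<ᵇ toℕ (σ ⟨$⟩ʳ v)
      below : Fin (suc n) → Bool
      below w = toℕ w ℕ.<ᵇ toℕ (φ v)
      same : image φ S ∩ tabulate below ≡ image φ (S ∩ tabulate before)
      same = set-ext
        (λ w p → let p₁ , p₂ = ∈-∩⁻ (image φ S) (tabulate below) w p ; u , m , q = ∈-image⁻ φ S w p₁ in
          subst (_∈ˢ image φ (S ∩ tabulate before)) q (∈-image⁺ φ (S ∩ tabulate before) u (∈-∩⁺ S (tabulate before) u m (∈-tabulate⁺ before u (<ᵇ-intro (ix-reflects e (σ ⟨$⟩ʳ u) (σ ⟨$⟩ʳ v) (subst₂ (λ a b → toℕ a ℕ.< toℕ b) (trans (sym q) (sym (σ-at u))) (sym (σ-at v)) (<ᵇ-elim _ _ (∈-tabulate⁻ below w p₂)))))))))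
        (λ w p → let u , m , q = ∈-image⁻ φ (S ∩ tabulate before) w p ; m₁ , m₂ = ∈-∩⁻ S (tabulate before) u m in
          subst (_∈ˢ (image φ S ∩ tabulate below)) q (∈-∩⁺ (image φ S) (tabulate below) (φ u) (∈-image⁺ φ S u m₁) (∈-tabulate⁺ below (φ u) (<ᵇ-intro (subst₂ (λ a b → toℕ a ℕ.< toℕ b) (σ-at u) (σ-at v) (ix-mono e (σ ⟨$⟩ʳ u) (σ ⟨$⟩ʳ v) (<ᵇ-elim _ _ (∈-tabulate⁻ before u m₂))))))))
    van : ∀ S → T (edge F S) → ∀ v → lookup S v ≡ true → toℕ (get χ (image φ (S ∖ v))) ≡ rank σ S v
    van S p v m = trans (cong (λ U → toℕ (get χ U)) (image-∖ φ inj' S v)) (trans (edge-colour (image φ S) (φ v) (T⇒≡ (hom S p)) (∈-image⁺ φ S v m)) (ranks S v))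

-- The value k^(-k), its attainment, and the conclusion.

reciprocal : ∀ N .{{_ : ℕ.NonZero N}} → (ℤ.+ 1 ℚ./ N) * ν N ≡ 1ℚ
reciprocal (suc N) = trans (cong ((ℤ.+ 1 ℚ./ suc N) *_) (sym (ℕtoℚ≡ν (suc N)))) (ℚₚ.toℚᵘ-injective (ℚᵘₚ.≃-trans (ℚₚ.toℚᵘ-homo-* (ℤ.+ 1 ℚ./ suc N) (ℕtoℚ (suc N))) (ℚᵘₚ.≃-trans (ℚᵘₚ.*-cong (ℚₚ.toℚᵘ-fromℚᵘ (ℚᵘ.mkℚᵘ (ℤ.+ 1) N)) (ℚₚ.toℚᵘ-fromℚᵘ (ℚᵘ.mkℚᵘ (ℤ.+ suc N) 0))) (ℚᵘ.*≡* (trans (ℤₚ.*-identityʳ _) (trans (ℤₚ.*-identityˡ (ℤ.+ suc N)) (sym (trans (ℤₚ.*-identityˡ _) (cong ℤ.+_ (ℕₚ.*-identityʳ (suc N)))))))))))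

1^ℚ : ∀ n → 1ℚ ^ℚ n ≡ 1ℚ
1^ℚ zero = refl
1^ℚ (suc n) = trans (*-identityˡ _) (1^ℚ n)

invPow-* : ∀ m → invPow (suc m) * ν (suc m) ^ℚ suc m ≡ 1ℚ
invPow-* m = trans (cong (invPow (suc m) *_) (sym (ν-^ (suc m) (suc m)))) (reciprocal (suc m ℕ.^ suc m) {{ℕₚ.m^n≢0 (suc m) (suc m)}})

invPow≡ : ∀ m → invPow (suc m) ≡ inv (ν (suc m)) ^ℚ suc m
invPow≡ m = trans (sym (*-identityʳ I)) (trans (cong (I *_) (sym NB)) (trans (sym (*-assoc I N B)) (trans (cong (_* B) (invPow-* m)) (*-identityˡ B))))
  where
  I = invPow (suc m)
  N = ν (suc m) ^ℚ suc m
  B = inv (ν (suc m)) ^ℚ suc m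
  NB : N * B ≡ 1ℚ
  NB = trans (sym (*-^ℚ (ν (suc m)) (inv (ν (suc m))) (suc m))) (trans (cong (_^ℚ suc m) (inv-r (ν (suc m)) (ν-pos m))) (1^ℚ (suc m)))

invPow-achievable : ∀ r {f} (F : KGraph (suc (suc (suc r))) f) → Club F → Achievable (suc r) F (invPow (suc (suc (suc r))))
invPow-achievable r F club μ₀ μ>0 n₀ = suc n , ℕₚ.m≤n⇒m≤1+n (ℕₚ.m≤m+n n₀ N) , G.H , graph-free r n χ F club , λ G → surplus⇒dense R (invPow k) μ₀ G.H G (subst (λ a → - (μ₀ * ν (suc n) ^ℚ k) ≤ ∫ (∑S (suc n)) (λ S → ⟦ inK k R G S ⟧ * (⟦ edge G.H S ⟧ - a))) (sym (invPow≡ K)) (G.Dens.surplus≥ G ε (<⇒≤ ε>0) reg μ₀ (≤-reflexive (cancel-inv (ν k) μ₀ (ν-pos K)))))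
  where
  R K k : ℕ
  R = suc r
  K = suc R
  k = suc K
  ε : ℚ
  -- Each of the `k` faces may lose `ε`, and the total allowed is `μ₀`.
  ε = μ₀ * inv (ν k)
  ε>0 : 0ℚ < ε
  ε>0 = *-pos μ>0 (inv-pos (ν k) (ν-pos K))
  Q : ℚ
  Q = pow2 K ε
  Q>0 : 0ℚ < Q
  Q>0 = pow2-pos K ε>0
  nn = small-frac (ν k * (ν K * ν K)) (Q * half) (ν≥0 k ⊗ (ν≥0 K ⊗ ν≥0 K)) (*-pos Q>0 0<half)
  N n : ℕ
  N = proj₁ nn
  -- `n₀` meets the requirement on the order, and `N` makes the expected box norms small; the host
  -- has one vertex more.
  n = n₀ ℕ.+ N
  module C = BoxNorm.Colour n K (Lower.inc r n)
  found = C.good-colouring R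
  χ = proj₁ found
  module G = Lower.Graph r n χ
  s : ℚ
  s = ν k * (ν K * (ν K * inv (ν (suc n))))
  s< : s < Q
  s< = ≤-<-trans (≤-trans (≤-reflexive (l (ν k) (ν K) (inv (ν (suc n))))) (proj₂ nn n (ℕₚ.m≤n+m N n₀))) (<-by (l' Q) (*-pos Q>0 0<half))
    where
    l : ∀ k K i → k * (K * (K * i)) ≡ (k * (K * K)) * i
    l = solve-∀ ℛ
    l' : ∀ Q → Q - Q * half ≡ Q * half
    l' = solve-∀ ℛ
  reg : ∀ ℓ → Disc.CutReg n R (C.F ℓ χ) ε
  reg ℓ = BoxNorm.box-cutreg n R (C.F ℓ χ) ε s ε>0 (proj₂ found ℓ) s<

invPow≥0 : ∀ m → 0ℚ ≤ invPow (suc m)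
invPow≥0 m = subst (0ℚ ≤_) (sym (invPow≡ m)) (^ℚ≥0 (suc m) (<⇒≤ (inv-pos (ν (suc m)) (ν-pos m))))

invPow≤1 : ∀ m → invPow (suc m) ≤ 1ℚ
invPow≤1 m = subst (_≤ 1ℚ) (sym (invPow≡ m)) (^ℚ≤1 (suc m) (<⇒≤ (inv-pos (ν (suc m)) (ν-pos m))) (inv≤1 (ν (suc m)) (1≤ν m)))

achievable⇒≤ : ∀ r f (F : KGraph (suc (suc (suc r))) f) → Spade F → ∀ dns → 0ℚ ≤ dns → dns ≤ 1ℚ → Achievable (suc r) F dns → dns ≤ invPow (suc (suc (suc r)))
achievable⇒≤ r f F spade dns d≥0 d≤1 ach = [ (λ lt → ⊥-elim (absurd lt)) , id ]′ (<-or-≤ I dns)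
  where
  k : ℕ
  k = suc (suc (suc r))
  I : ℚ
  I = invPow k
  module S (i j : Fin k) (i<j : i Fin.< j) = FromSpade (suc (suc r)) f F i j (proj₁ (spade i j i<j)) (proj₁ (proj₂ (spade i j i<j))) (proj₁ (proj₂ (proj₂ (spade i j i<j)))) (proj₁ (proj₂ (proj₂ (proj₂ (spade i j i<j))))) (proj₁ (proj₂ (proj₂ (proj₂ (proj₂ (spade i j i<j)))))) (proj₁ (proj₂ (proj₂ (proj₂ (proj₂ (proj₂ (spade i j i<j))))))) (proj₂ (proj₂ (proj₂ (proj₂ (proj₂ (proj₂ (spade i j i<j)))))))
  absurd : I < dns → ⊥
  absurd lt = copy (ach μ₀ μ>0 (suc (n₁ ℕ.+ n₂)))
    where
    c : ℚ
    -- Strictly between k^(-k) and the density: the excess over k^(-k) drives the reduced theorem,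
    -- and the distance to `dns` pays for regularity.
    c = (dns + I) * half
    c≥0 : 0ℚ ≤ c
    c≥0 = (d≥0 ⊕ invPow≥0 (suc (suc r))) ⊗ <⇒≤ 0<half
    c<d : c < dns
    c<d = <-by (l dns I) (*-pos (Δ< lt) 0<half)
      where l : ∀ d i → d - (d + i) * half ≡ (d - i) * half
            l = solve-∀ ℛ
    I<c : I < c
    I<c = <-by (l dns I) (*-pos (Δ< lt) 0<half)
      where l : ∀ d i → (d + i) * half - i ≡ (d - i) * half
            l = solve-∀ ℛ
    N : ℚ
    N = ν k ^ℚ k
    c-big : 1ℚ < c * N
    c-big = <-by (trans (cong (λ x → c * N - x) (sym (invPow-* (suc (suc r))))) (l c I N)) (*-pos (Δ< I<c) (^ℚ-pos k (ν-pos (suc (suc r)))))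
      where l : ∀ c i n → c * n - i * n ≡ (c - i) * n
            l = solve-∀ ℛ
    module U = Upper (suc r) f S.pattern-of dns c c≥0 c<d d≤1 c-big
    -- The constants are fixed in the order `M`, `M₁`, then the cell size `γ₀` from regularity, and
    -- last the `μ₀` at which achievability is applied.
    cd = cell-dense (suc r) (s≤s z≤n) U.M dns U.ρ d≥0 d≤1 U.ρ>0
    M₁ : ℕ
    M₁ = proj₁ cd
    module W = U.WithM₁ M₁
    cdγ = proj₂ cd W.γ₀ (proj₁ (proj₂ W.γ₀s))
    μ₀ : ℚ
    μ₀ = proj₁ cdγ
    μ>0 : 0ℚ < μ₀
    μ>0 = proj₁ (proj₂ cdγ)
    n₁ n₂ : ℕ
    n₁ = proj₁ (proj₂ (proj₂ cdγ))
    few = small-frac (ν M₁ * ν M₁) W.z₀ (ν≥0 M₁ ⊗ ν≥0 M₁) (proj₁ (proj₂ W.z₀s))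
    n₂ = proj₁ few
    copy : Σ[ n ∈ ℕ ] (suc (n₁ ℕ.+ n₂) ℕ.≤ n × Σ[ H ∈ KGraph k n ] (Free F H × Dense (suc r) dns μ₀ H)) → ⊥
    copy (suc n , s≤s n≥ , H , free-H , dense) = W.upper n (λ z → edge H (toSet z)) (proj₂ (proj₂ (proj₂ cdγ)) n (ℕₚ.≤-trans (ℕₚ.m≤m+n n₁ n₂) n≥) H dense) (proj₂ few n (ℕₚ.≤-trans (ℕₚ.m≤n+m n₂ n₁) n≥)) (λ (i , j , i<j , y , dy , hom) → free-H (S.contains i j i<j H y dy hom))

theorem1p14 : (k f : ℕ) → 3 ℕ.≤ k → (F : KGraph k f) →
  Club F → Spade F → IsPi (k ℕ.∸ 2) F (invPow k)
theorem1p14 (suc (suc (suc r))) f (s≤s (s≤s (s≤s z≤n))) F club spade = achievable⇒≤ r f F spade , λ β β<α → invPow (suc (suc (suc r))) , invPow≥0 (suc (suc r)) , invPow≤1 (suc (suc r)) , invPow-achievable r F club , β<α
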